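{- Let $\mathrm{Discrete}$, $\mathrm{Amenable}$, $\mathrm{Compact}$, $\mathrm{Godsil}$, $\mathrm{Tinhofer}$, $\mathrm{Refinable}$ denote the classes of (vertex-colored) graphs defined in the context. Then $$\mathrm{Discrete}\subsetneq\mathrm{Amenable}\subsetneq\mathrm{Compact}\subsetneq\mathrm{Godsil}\subsetneq\mathrm{Tinhofer}\subsetneq\mathrm{Refinable},$$ i.e. each class is contained in the next and all inclusions are strict.
   Context: Graphs are finite simple undirected vertex-colored graphs ($c:V(G)\to\{1,\dots,k\}$; uncolored means constant coloring); isomorphisms and automorphisms preserve colors. Color refinement (CR): $C^0(u)=c(u)$, $C^{i+1}(u)=(C^i(u),\{\!\{C^i(a): a\in N(u)\}\!\})$; colors are formal objects comparable across graphs. The partitions into color classes stabilize to the stable partition $\mathcal{P}_G$. - Discrete: $\mathcal{P}_G$ consists of singletons. - Amenable: every $H$ with $\{\!\{C^i(u):u\in V(G)\}\!\}=\{\!\{C^i(v):v\in V(H)\}\!\}$ for all $i$ is isomorphic to $G$. - Compact: with $A$ the adjacency matrix, every extreme point of the polytope of doubly stochastic matrices $X$ with $AX=XA$ and $X[u,v]=0$ for $c(u)\neq c(v)$ is a permutation matrix. - A partition of $V(G)$ is equitable if every cell is monochromatic, every cell induces a regular graph, and for any two cells $X,Y$ every vertex of $X$ has the same number of neighbors in $Y$. For a subgroup $\Gamma$ of $\mathrm{Aut}(G)$ the partition into $\Gamma$-orbits is an orbit partition. Godsil: every equitable partition of $G$ is an orbit partition of some subgroup of $\mathrm{Aut}(G)$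 (orbit partitions are always equitable). - Tinhofer's algorithm on input $(G,H)$: (1) run CR on the disjoint union $G+H$ until the coloring of $V(G)\cup V(H)$ stabilizes; (2) if the multisets of colors in $G$ and $H$ differ, output "non-isomorphic"; otherwise (a) if all color classes are singletons in $G$ and $H$, output "isomorphic" if the map sending each $u\in V(G)$ to the vertex of $H$ of the same color is an isomorphism and "non-isomorphic" otherwise; (b) else pick a color class with at least two vertices in each of $G$ and $H$, choose any $u\in V(G)$ and $v\in V(H)$ in it, give $u$ and $v$ the same new color, and go to (1). Tinhofer: for every graph $H$ and all choices made in step (b), the algorithm answers correctly whether $G\cong H$. - Refinable: $\mathcal{P}_G$ equals the orbit partition of $\mathrm{Aut}(G)$.
   Formalization: In the definition of compact graphs, the doubly stochastic matrices and the convex combinations that test extremality have rational instead of real entries; as the polytope is given by rational constraints, its extreme points are the same. -}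

module Defs where

open import Data.Nat using (ℕ; zero; suc; _+_; _*_; _≡ᵇ_)
open import Data.Bool using (Bool; true; false; if_then_else_; _∧_)
open import Data.Fin using (Fin; zero; suc)
open import Data.Fin.Properties using (_≟_)
open import Data.Maybe using (Maybe; just; nothing; maybe)
open import Data.List using (List; []; _∷_; length)
open import Data.Product using (Σ; ∃; ∃-syntax; _×_; _,_; proj₁; proj₂)
open import Data.Sum using (_⊎_; inj₁; inj₂)
open import Data.Rational using (ℚ; 0ℚ; 1ℚ; _≤_; _<_) renaming (_+_ to _+q_; _*_ to _*q_; _-_ to _-q_)
open import Relation.Nullary using (¬_; does)
open import Relation.Binary.PropositionalEquality using (_≡_; _≢_)
open import Function.Definitions using (Bijective)
open import Function using (_∘_; id)
open import Level using (_⊔_)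

-- Finite simple undirected vertex-coloured graphs on vertex set Fin n.
-- Colours are natural numbers (an uncoloured graph has constant colouring).

record Graph : Set where
  field
    n     : ℕ
    adj   : Fin n → Fin n → Bool
    symm  : ∀ u v → adj u v ≡ adj v u
    loopless : ∀ u → adj u u ≡ false
    col   : Fin n → ℕ
open Graph public

IsBij : {A B : Set} → (A → B) → Set
IsBij f = Bijective _≡_ _≡_ f

IsIsoMap : (G H : Graph) → (Fin (n G) → Fin (n H)) → Set
IsIsoMap G H f =
  IsBij f × (∀ u v → adj H (f u) (f v) ≡ adj G u v) × (∀ u → col H (f u) ≡ col G u)

_≅_ : Graph → Graph → Set
G ≅ H = Σ (Fin (n G) → Fin (n H)) (IsIsoMap G H)

IsAut : (G : Graph) → (Fin (n G) → Fin (n G)) → Set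
IsAut G σ = IsIsoMap G G σ

-- Colour refinement.  CRSame i G u H v  means  C^i(u) = C^i(v)  where u is
-- a vertex of G and v a vertex of H (CR colours are compared across graphs;
-- the CR colour of a vertex in a disjoint union equals its colour in its own
-- component).  Equality of the multisets of neighbour colours is expressed
-- by a bijection between the neighbourhoods matching colours.

Nbr : (G : Graph) → Fin (n G) → Set
Nbr G u = Σ (Fin (n G)) λ a → adj G u a ≡ true

CRSame : ℕ → (G : Graph) → Fin (n G) → (H : Graph) → Fin (n H) → Set
CRSame zero    G u H v = col G u ≡ col H v
CRSame (suc i) G u H v =
  CRSame i G u H v ×
  Σ (Nbr G u → Nbr H v) λ f → IsBij f × (∀ a → CRSame i G (proj₁ a) H (proj₁ (f a)))

SameMultiset : ℕ → Graph → Graph → Set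
SameMultiset i G H =
  Σ (Fin (n G) → Fin (n H)) λ f → IsBij f × (∀ u → CRSame i G u H (f u))

StableSame : (G : Graph) → Fin (n G) → (H : Graph) → Fin (n H) → Set
StableSame G u H v = ∀ i → CRSame i G u H v

Discrete : Graph → Set
Discrete G = ∀ u v → StableSame G u G v → u ≡ v

Amenable : Graph → Set
Amenable G = (H : Graph) → (∀ i → SameMultiset i G H) → G ≅ H

Refinable : Graph → Set
Refinable G = ∀ u v →
  (StableSame G u G v → Σ (Fin (n G) → Fin (n G)) λ σ → IsAut G σ × σ u ≡ v) ×
  ((Σ (Fin (n G) → Fin (n G)) λ σ → IsAut G σ × σ u ≡ v) → StableSame G u G v)

-- Equitable partitions and Godsil graphs.
-- A partition of V(G) is given by a labelling p : Fin n → ℕ (cells = fibres).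

countFin : (m : ℕ) → (Fin m → Bool) → ℕ
countFin zero    P = 0
countFin (suc m) P = (if P zero then 1 else 0) + countFin m (P ∘ suc)

nbrsIn : (G : Graph) → (Fin (n G) → ℕ) → Fin (n G) → ℕ → ℕ
nbrsIn G p u y = countFin (n G) (λ a → adj G u a ∧ (p a ≡ᵇ y))

-- monochromatic cells; every vertex of a cell X has the same number of
-- neighbours in every cell Y (the case X = Y is regularity of G[X]).
Equitable : (G : Graph) → (Fin (n G) → ℕ) → Set
Equitable G p =
  (∀ u v → p u ≡ p v → col G u ≡ col G v) ×
  (∀ u v → p u ≡ p v → ∀ y → nbrsIn G p u y ≡ nbrsIn G p v y)

IsAutSubgroup : (G : Graph) → ((Fin (n G) → Fin (n G)) → Set) → Set
IsAutSubgroup G Γ =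
  (∀ σ → Γ σ → IsAut G σ) ×
  Γ id ×
  (∀ σ τ → Γ σ → Γ τ → Γ (σ ∘ τ)) ×
  (∀ σ → Γ σ → Σ (Fin (n G) → Fin (n G)) λ τ → Γ τ × (∀ x → τ (σ x) ≡ x) × (∀ x → σ (τ x) ≡ x))

IsOrbitPartitionOf : (G : Graph) → ((Fin (n G) → Fin (n G)) → Set) → (Fin (n G) → ℕ) → Set
IsOrbitPartitionOf G Γ p = ∀ u v →
  (p u ≡ p v → Σ (Fin (n G) → Fin (n G)) λ σ → Γ σ × σ u ≡ v) ×
  ((Σ (Fin (n G) → Fin (n G)) λ σ → Γ σ × σ u ≡ v) → p u ≡ p v)

Godsil : Graph → Set₁
Godsil G = ∀ p → Equitable G p →
  Σ ((Fin (n G) → Fin (n G)) → Set) λ Γ → IsAutSubgroup G Γ × IsOrbitPartitionOf G Γ p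

Matrix : ℕ → Set
Matrix m = Fin m → Fin m → ℚ

sumℚ : (m : ℕ) → (Fin m → ℚ) → ℚ
sumℚ zero    f = 0ℚ
sumℚ (suc m) f = f zero +q sumℚ m (f ∘ suc)

adjMatrix : (G : Graph) → Matrix (n G)
adjMatrix G u v = if adj G u v then 1ℚ else 0ℚ

InPolytope : (G : Graph) → Matrix (n G) → Set
InPolytope G X =
  (∀ u v → 0ℚ ≤ X u v) ×
  (∀ u → sumℚ (n G) (λ v → X u v) ≡ 1ℚ) ×
  (∀ v → sumℚ (n G) (λ u → X u v) ≡ 1ℚ) ×
  (∀ u v → sumℚ (n G) (λ w → adjMatrix G u w *q X w v) ≡ sumℚ (n G) (λ w → X u w *q adjMatrix G w v)) ×
  (∀ u v → col G u ≢ col G v → X u v ≡ 0ℚ)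

IsExtremePoint : (G : Graph) → Matrix (n G) → Set
IsExtremePoint G X =
  InPolytope G X ×
  (∀ Y Z t → InPolytope G Y → InPolytope G Z → 0ℚ < t → t < 1ℚ →
     (∀ u v → X u v ≡ (t *q Y u v) +q ((1ℚ -q t) *q Z u v)) →
     ∀ u v → Y u v ≡ Z u v)

IsPermutationMatrix : (m : ℕ) → Matrix m → Set
IsPermutationMatrix m X =
  Σ (Fin m → Fin m) λ π → IsBij π ×
    (∀ u v → X u v ≡ (if does (π u ≟ v) then 1ℚ else 0ℚ))

Compact : Graph → Set
Compact G = ∀ X → IsExtremePoint G X → IsPermutationMatrix (n G) X

-- Tinhofer's algorithm.
-- A state is the list of individualised pairs (u , v), most recent first.
-- The j-th individualised pair (j = position counted from the start) gets
-- the new colour 2j+1; all other vertices keep c(x) encoded as 2c(x)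
-- (so new colours are distinct from each other and from old ones).
-- Running CR from this colouring yields the same stable partition of G+H
-- as recolouring the previously stable colouring.

Pairs : Graph → Graph → Set
Pairs G H = List (Fin (n G) × Fin (n H))

indexL : {G H : Graph} → Pairs G H → Fin (n G) → Maybe ℕ
indexL {G} {H} []             x = nothing
indexL {G} {H} ((u , _) ∷ s) x = if does (u ≟ x) then just (length s) else indexL {G} {H} s x

indexR : {G H : Graph} → Pairs G H → Fin (n H) → Maybe ℕ
indexR {G} {H} []             x = nothing
indexR {G} {H} ((_ , v) ∷ s) x = if does (v ≟ x) then just (length s) else indexR {G} {H} s x

recolour : (G : Graph) → (Fin (n G) → Maybe ℕ) → Graph
recolour G ind = record G { col = λ x → maybe (λ j → suc (2 * j)) (2 * col G x) (ind x) }

leftG : (G H : Graph) → Pairs G H → Graph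
leftG G H s = recolour G (indexL {G} {H} s)

rightG : (G H : Graph) → Pairs G H → Graph
rightG G H s = recolour H (indexR {G} {H} s)

data Answer : Set where
  isomorphic nonIsomorphic : Answer

data TinhoferRun (G H : Graph) (s : Pairs G H) : Answer → Set where
  differ :
    ¬ (∀ i → SameMultiset i (leftG G H s) (rightG G H s)) →
    TinhoferRun G H s nonIsomorphic
  discreteYes :
    (∀ i → SameMultiset i (leftG G H s) (rightG G H s)) →
    (∀ u u' → StableSame (leftG G H s) u (leftG G H s) u' → u ≡ u') →
    (∀ v v' → StableSame (rightG G H s) v (rightG G H s) v' → v ≡ v') →
    (f : Fin (n G) → Fin (n H)) →
    (∀ u → StableSame (leftG G H s) u (rightG G H s) (f u)) →
    IsIsoMap G H f →
    TinhoferRun G H s isomorphic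
  discreteNo :
    (∀ i → SameMultiset i (leftG G H s) (rightG G H s)) →
    (∀ u u' → StableSame (leftG G H s) u (leftG G H s) u' → u ≡ u') →
    (∀ v v' → StableSame (rightG G H s) v (rightG G H s) v' → v ≡ v') →
    (f : Fin (n G) → Fin (n H)) →
    (∀ u → StableSame (leftG G H s) u (rightG G H s) (f u)) →
    ¬ IsIsoMap G H f →
    TinhoferRun G H s nonIsomorphic
  individualise :
    (∀ i → SameMultiset i (leftG G H s) (rightG G H s)) →
    (u : Fin (n G)) (v : Fin (n H)) →
    StableSame (leftG G H s) u (rightG G H s) v →
    (∃[ u' ] (u' ≢ u × StableSame (leftG G H s) u (leftG G H s) u')) →
    (∃[ v' ] (v' ≢ v × StableSame (rightG G H s) v (rightG G H s) v')) →
    ∀ {a} → TinhoferRun G H ((u , v) ∷ s) a →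
    TinhoferRun G H s a

Tinhofer : Graph → Set
Tinhofer G = (H : Graph) → (a : Answer) → TinhoferRun G H [] a →
  (a ≡ isomorphic → G ≅ H) × (G ≅ H → a ≡ isomorphic)

_⊆_ : ∀ {ℓ₁ ℓ₂} → (Graph → Set ℓ₁) → (Graph → Set ℓ₂) → Set (ℓ₁ ⊔ ℓ₂)
P ⊆ Q = ∀ G → P G → Q G

_⊊_ : ∀ {ℓ₁ ℓ₂} → (Graph → Set ℓ₁) → (Graph → Set ℓ₂) → Set (ℓ₁ ⊔ ℓ₂)
P ⊊ Q = (P ⊆ Q) × (∃[ G ] (Q G × ¬ P G))

{-# OPTIONS --safe #-}
module Submission where

-- Discrete ⊆ Amenable: the bijections realising SameMultiset eventually match stable colours, and for a discrete
-- graph such a matching preserves edges. Amenable ⊆ Compact: the matrices X of the polytope respect the stable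
-- partition, and an extreme point whose support contains an automorphism σ equals σ, for otherwise X could be moved
-- along X - σ in both directions. So it suffices to find an automorphism in the support of every X. Amenability says
-- that all graphs with the same degrees between stable cells are isomorphic; edge switching then shows that, up to
-- complementing inside or between cells, cells are edgeless, perfect matchings or pentagons, and different cells
-- are linked by functions, in which case G may be replaced by a canonical graph, where Hall's theorem
-- provides the automorphism cell by cell. Compact ⊆ Godsil: start from the matrix averaging over the cells of an
-- equitable partition and descend to an extreme point that is nonzero at a given position (u , v) of a cell.
-- Godsil ⊆ Tinhofer: the stable partition of G with individualised vertices is equitable, so the choices made in the
-- algorithm are interchangeable by automorphisms. Tinhofer ⊆ Refinable: run the algorithm on (G , G), individualising
-- u and v first. Existence statements are proved up to double negation, and removed by finite search.

open import Defs
open import Data.Nat as ℕ using (ℕ; zero; suc; _+_; _*_; _∸_; _≤_; _<_; z≤n; s≤s; _≡ᵇ_)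
import Data.Nat.Properties as ℕₚ
open import Data.Bool using (Bool; true; false; if_then_else_; _∧_; _∨_; not)
import Data.Bool.Properties as 𝔹ₚ
open import Data.Fin using (Fin; zero; suc; toℕ; fromℕ<; combine; remQuot)
import Data.Fin.Properties as Fₚ
open import Data.Fin.Properties using (_≟_; any?; all?)
open import Data.Product using (Σ; ∃; ∃₂; _×_; _,_; proj₁; proj₂)
open import Data.Sum using (_⊎_; inj₁; inj₂; [_,_]′)
open import Data.Empty using (⊥; ⊥-elim)
open import Data.Rational as ℚ using (ℚ; 0ℚ; 1ℚ)
import Data.Rational.Properties as ℚₚ
open import Relation.Nullary using (¬_; Dec; yes; no; does)
open import Relation.Nullary.Decidable using (map′; _×-dec_; _→-dec_; ¬?; ¬¬-excluded-middle; dec-true; dec-false; _⊎-dec_; from-yes)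
open import Relation.Binary.PropositionalEquality
open import Function using (_∘_; id; case_of_)
open import Relation.Binary.Definitions using (tri<; tri≈; tri>)
import Data.Nat.DivMod as DM
open import Data.Nat.Divisibility using (divides)
import Data.Integer
open import Data.Rational.Solver using (module +-*-Solver)
open import Data.Maybe using (Maybe; just; nothing; maybe; is-nothing)
open import Data.Maybe.Properties using (just-injective; ≡-dec)
open import Data.List using ([]; _∷_; length)
open import Data.Fin.Patterns using (0F; 1F; 2F; 3F; 4F; 5F; 6F; 7F; 8F; 9F)

-- Counting and finite search

-- The hard inclusion is that of amenable graphs in compact ones. Hall's theorem yields only a
-- permutation inside the support of a matrix, and nothing makes it an automorphism. On the
-- canonical graph, however, commuting with the adjacency matrix becomes a relation between diagonal
-- blocks: cells linked by a bijection carry equal blocks, and along a function from `c` to `z` the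
-- block of `z` is the quotient of the block of `c` by the fibres. A permutation chosen for `z`
-- therefore lifts to `c`, provided that no second constraint acts on `c`. Competing constraints,
-- like all other unwanted structure, are excluded in one way: two graphs with the same degrees
-- between cells are compared, and an isomorphism between them is refuted. The usual tool is a set
-- of vertices, defined invariantly, which one switch makes strictly smaller. Stable equality
-- quantifies over all rounds and extremality over all matrices, so neither is decided here. The
-- final goals, such as the existence of a suitable map between finite sets, are decidable.

∧-true : ∀ {a b} → a ∧ b ≡ true → a ≡ true × b ≡ true
∧-true {true} {true} _ = refl , refl

∧-intro : ∀ {a b} → a ≡ true → b ≡ true → a ∧ b ≡ true
∧-intro refl refl = refl

∧-falseʳ : ∀ a {b} → b ≡ false → a ∧ b ≡ false
∧-falseʳ a refl = 𝔹ₚ.∧-zeroʳ a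

bool-ext : ∀ {a b} → (a ≡ true → b ≡ true) → (b ≡ true → a ≡ true) → a ≡ b
bool-ext {false} {false} f g = refl
bool-ext {false} {true}  f g = g refl
bool-ext {true}  {false} f g = sym (f refl)
bool-ext {true}  {true}  f g = refl

true≢false : ∀ {b} → b ≡ true → b ≡ false → ⊥
true≢false refl ()

not-true : ∀ {b} → ¬ b ≡ true → b ≡ false
not-true {false} _ = refl
not-true {true}  h = ⊥-elim (h refl)

bool-cases : ∀ b → b ≡ true ⊎ b ≡ false
bool-cases true  = inj₁ refl
bool-cases false = inj₂ refl

does-true : ∀ {A : Set} (d : Dec A) → does d ≡ true → A
does-true (yes a) _ = a

does-false : ∀ {A : Set} (d : Dec A) → does d ≡ false → ¬ A
does-false (no ¬a) _ = ¬a

does-cong : ∀ {A B : Set} (d : Dec A) (e : Dec B) → (A → B) → (B → A) → does d ≡ does e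
does-cong d e f g = bool-ext (λ h → dec-true e (f (does-true d h))) (λ h → dec-true d (g (does-true e h)))

≡ᵇ-refl : ∀ y → (y ≡ᵇ y) ≡ true
≡ᵇ-refl zero    = refl
≡ᵇ-refl (suc y) = ≡ᵇ-refl y

≡ᵇ-true : ∀ x y → (x ≡ᵇ y) ≡ true → x ≡ y
≡ᵇ-true zero    zero    _ = refl
≡ᵇ-true (suc x) (suc y) h = cong suc (≡ᵇ-true x y h)

≡ᵇ-false : ∀ x y → x ≢ y → (x ≡ᵇ y) ≡ false
≡ᵇ-false x y ne = not-true (λ h → ne (≡ᵇ-true x y h))

dne : {A : Set} → Dec A → ¬ ¬ A → A
dne (yes a) _ = a
dne (no ¬a) h = ⊥-elim (h ¬a)

-- The double-negation shift holds because the index set is finite. It allows finitely many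
-- undecided propositions to be assumed decided while a contradiction is derived.
¬¬-Π : ∀ {n} {P : Fin n → Set} → (∀ i → ¬ ¬ P i) → ¬ ¬ (∀ i → P i)
¬¬-Π {zero}  h k = k (λ ())
¬¬-Π {suc n} h k = h zero λ p₀ → ¬¬-Π (λ i → h (suc i)) λ ps →
  k (λ { zero → p₀ ; (suc i) → ps i })

mkBij : {A B : Set} {f : A → B} (g : B → A) → (∀ x → g (f x) ≡ x) → (∀ y → f (g y) ≡ y) → IsBij f
mkBij {f = f} g gf fg = (λ {x} {y} e → trans (sym (gf x)) (trans (cong g e) (gf y)))
                      , λ y → g y , λ { refl → fg y }

module _ {A B : Set} {f : A → B} (b : IsBij f) where

  inv : B → A
  inv y = proj₁ (proj₂ b y)

  f∘inv : ∀ y → f (inv y) ≡ y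
  f∘inv y = proj₂ (proj₂ b y) refl

  inv∘f : ∀ x → inv (f x) ≡ x
  inv∘f x = proj₁ b (f∘inv (f x))

  inv-bij : IsBij inv
  inv-bij = mkBij f f∘inv inv∘f

∘-bij : {A B C : Set} {f : A → B} {g : B → C} → IsBij g → IsBij f → IsBij (g ∘ f)
∘-bij {f = f} {g} bg bf = mkBij (inv bf ∘ inv bg)
  (λ x → trans (cong (inv bf) (inv∘f bg (f x))) (inv∘f bf x))
  (λ y → trans (cong g (f∘inv bf (inv bg y))) (f∘inv bg y))

id-bij : {A : Set} → IsBij (id {A = A})
id-bij = mkBij id (λ _ → refl) (λ _ → refl)

bij-≗ : {A B : Set} {f g : A → B} → (∀ x → f x ≡ g x) → IsBij f → IsBij g
bij-≗ {f = f} h b = mkBij (inv b) (λ x → trans (cong (inv b) (sym (h x))) (inv∘f b x))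
                               (λ y → trans (sym (h (inv b y))) (f∘inv b y))

Sub : ∀ {m} → (Fin m → Bool) → Set
Sub {m} P = Σ (Fin m) λ a → P a ≡ true

sub-≡ : ∀ {m} {P : Fin m → Bool} {x y : Sub P} → proj₁ x ≡ proj₁ y → x ≡ y
sub-≡ {x = a , p} {.a , h} refl = cong (a ,_) (uip p h)
  where uip : ∀ {b c : Bool} (p q : b ≡ c) → p ≡ q
        uip refl refl = refl

record Enum {m} (P : Fin m → Bool) (k : ℕ) : Set where
  field
    to      : Sub P → Fin k
    from    : Fin k → Sub P
    from∘to : ∀ x → from (to x) ≡ x
    to∘from : ∀ i → to (from i) ≡ i
open Enum public

enum : ∀ {m} (P : Fin m → Bool) → Enum P (countFin m P)
enum {zero} P = record { to = λ { (() , _) } ; from = λ () ; from∘to = λ { (() , _) } ; to∘from = λ () }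
enum {suc m} P = go (P zero) refl
  where
  e = enum (P ∘ suc)
  go : ∀ b → P zero ≡ b → Enum P ((if b then 1 else 0) + countFin m (P ∘ suc))
  go true eq = record
    { to = λ { (zero , _) → zero ; (suc a , h) → suc (to e (a , h)) }
    ; from = λ { zero → zero , eq ; (suc k) → suc (proj₁ (from e k)) , proj₂ (from e k) }
    ; from∘to = λ { (zero , h) → sub-≡ refl ; (suc a , h) → sub-≡ (cong (suc ∘ proj₁) (from∘to e (a , h))) }
    ; to∘from = λ { zero → refl ; (suc k) → cong suc (to∘from e k) } }
  go false eq = record
    { to = λ { (zero , h) → ⊥-elim (true≢false h eq) ; (suc a , h) → to e (a , h) }
    ; from = λ k → suc (proj₁ (from e k)) , proj₂ (from e k)
    ; from∘to = λ { (zero , h) → ⊥-elim (true≢false h eq) ; (suc a , h) → sub-≡ (cong (suc ∘ proj₁) (from∘to e (a , h))) }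
    ; to∘from = λ k → to∘from e k }

module _ {m k} {P : Fin m → Bool} {Q : Fin k → Bool} where

  count-inj : (f : Sub P → Sub Q) → (∀ {x y} → f x ≡ f y → x ≡ y) → countFin m P ≤ countFin k Q
  count-inj f inj = Fₚ.injective⇒≤ {f = λ i → to (enum Q) (f (from (enum P) i))} λ {i} {j} e →
    trans (sym (to∘from (enum P) i)) (trans (cong (to (enum P)) (inj (trans (sym (from∘to (enum Q) _))
      (trans (cong (from (enum Q)) e) (from∘to (enum Q) _))))) (to∘from (enum P) j))

  bij-of-count : countFin m P ≡ countFin k Q → Σ (Sub P → Sub Q) IsBij
  bij-of-count e = f , mkBij g gf fg
    where
    f : Sub P → Sub Q
    f x = from (enum Q) (subst Fin e (to (enum P) x))
    g : Sub Q → Sub P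
    g y = from (enum P) (subst Fin (sym e) (to (enum Q) y))
    gf : ∀ x → g (f x) ≡ x
    gf x rewrite to∘from (enum Q) (subst Fin e (to (enum P) x))
               | subst-sym-subst {P = Fin} e {to (enum P) x} = from∘to (enum P) x
    fg : ∀ y → f (g y) ≡ y
    fg y rewrite to∘from (enum P) (subst Fin (sym e) (to (enum Q) y))
               | subst-subst-sym {P = Fin} e {to (enum Q) y} = from∘to (enum Q) y

count-bij : ∀ {m k} {P : Fin m → Bool} {Q : Fin k → Bool} {f : Sub P → Sub Q} → IsBij f → countFin m P ≡ countFin k Q
count-bij b = ℕₚ.≤-antisym (count-inj _ (proj₁ b)) (count-inj _ (proj₁ (inv-bij b)))

count-cong : ∀ {m} {P Q : Fin m → Bool} → (∀ a → P a ≡ Q a) → countFin m P ≡ countFin m Q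
count-cong {zero}  h = refl
count-cong {suc m} h = cong₂ (λ b c → (if b then 1 else 0) + c) (h zero) (count-cong (h ∘ suc))

count-∘ : ∀ {m k} {φ : Fin m → Fin k} → IsBij φ → (P : Fin k → Bool) → countFin m (P ∘ φ) ≡ countFin k P
count-∘ {φ = φ} b P = count-bij {f = λ { (a , h) → φ a , h }}
  (mkBij (λ { (c , h) → inv b c , trans (cong P (f∘inv b c)) h })
         (λ { (a , h) → sub-≡ (inv∘f b a) }) (λ { (c , h) → sub-≡ (f∘inv b c) }))

count-⊆ : ∀ {m} {P Q : Fin m → Bool} → (∀ a → P a ≡ true → Q a ≡ true) → countFin m P ≤ countFin m Q
count-⊆ h = count-inj (λ { (a , p) → a , h a p }) (λ e → sub-≡ (cong proj₁ e))

count-⊂ : ∀ {m} {P Q : Fin m → Bool} → (∀ a → P a ≡ true → Q a ≡ true) →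
  ∀ a → Q a ≡ true → P a ≡ false → countFin m P < countFin m Q
count-⊂ {P = P} h zero q p rewrite q | p = s≤s (count-⊆ (h ∘ suc))
count-⊂ {P = P} {Q} h (suc a) q p with P zero | Q zero | h zero
... | true  | true  | _ = s≤s (count-⊂ (h ∘ suc) a q p)
... | true  | false | k = ⊥-elim (true≢false (k refl) refl)
... | false | true  | _ = s≤s (ℕₚ.<⇒≤ (count-⊂ (h ∘ suc) a q p))
... | false | false | _ = count-⊂ (h ∘ suc) a q p

count-false : ∀ {m} {P : Fin m → Bool} → (∀ a → P a ≡ false) → countFin m P ≡ 0
count-false {zero}  h = refl
count-false {suc m} h rewrite h zero = count-false (h ∘ suc)

count-pos : ∀ {m} {P : Fin m → Bool} a → P a ≡ true → 1 ≤ countFin m P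
count-pos zero h rewrite h = s≤s z≤n
count-pos {P = P} (suc a) h = ℕₚ.≤-trans (count-pos a h) (ℕₚ.m≤n+m _ (if P zero then 1 else 0))

count-witness : ∀ {m} (P : Fin m → Bool) → 1 ≤ countFin m P → Sub P
count-witness P h = from (enum P) (fromℕ< h)

count-exchange : ∀ {m} {P Q : Fin m → Bool} → countFin m P ≡ countFin m Q →
  ∀ a → P a ≡ true → Q a ≡ false → ∃ λ b → Q b ≡ true × P b ≡ false
count-exchange {P = P} {Q} e a p q with any? (λ b → (Q b 𝔹ₚ.≟ true) ×-dec (P b 𝔹ₚ.≟ false))
... | yes r = r
... | no ¬r = ⊥-elim (ℕₚ.<-irrefl (sym e) (count-⊂ (λ b qb → 𝔹ₚ.¬-not {y = false} (λ pb → ¬r (b , qb , pb))) a p q))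

count-⊆-eq : ∀ {m} {P Q : Fin m → Bool} → (∀ a → P a ≡ true → Q a ≡ true) → countFin m P ≡ countFin m Q →
  ∀ a → Q a ≡ true → P a ≡ true
count-⊆-eq {P = P} h e a q with P a in p
... | true  = refl
... | false = ⊥-elim (ℕₚ.<-irrefl e (count-⊂ h a q p))

count-∨-∧ : ∀ {m} (P Q : Fin m → Bool) →
  countFin m (λ a → P a ∨ Q a) + countFin m (λ a → P a ∧ Q a) ≡ countFin m P + countFin m Q
count-∨-∧ {zero} P Q = refl
count-∨-∧ {suc m} P Q with P zero | Q zero | count-∨-∧ (P ∘ suc) (Q ∘ suc)
... | true  | true  | ih = cong suc (trans (ℕₚ.+-suc _ _) (trans (cong suc ih) (sym (ℕₚ.+-suc _ _))))
... | true  | false | ih = cong suc ih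
... | false | true  | ih = trans (cong suc ih) (sym (ℕₚ.+-suc _ _))
... | false | false | ih = ih

-- `v` lies in both `P` and `Q`, so their union is too small to cover `R`. This is how sparsity
-- enters the switching arguments.
count-avoid : ∀ {m} (P Q R : Fin m → Bool) → countFin m P + countFin m Q ≤ countFin m R →
  ∀ v → P v ≡ true → Q v ≡ true → ∃ λ z → R z ≡ true × P z ≡ false × Q z ≡ false
count-avoid {m} P Q R le v p q with any? (λ z → (R z 𝔹ₚ.≟ true) ×-dec ((P z 𝔹ₚ.≟ false) ×-dec (Q z 𝔹ₚ.≟ false)))
... | yes r = r
... | no ¬r = ⊥-elim (ℕₚ.<-irrefl refl (begin-strict
    countFin m R ≤⟨ count-⊆ cover ⟩
    countFin m (λ a → P a ∨ Q a) <⟨ ℕₚ.m<m+n _ (count-pos v (∧-intro p q)) ⟩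
    countFin m (λ a → P a ∨ Q a) + countFin m (λ a → P a ∧ Q a) ≡⟨ count-∨-∧ P Q ⟩
    countFin m P + countFin m Q ≤⟨ le ⟩
    countFin m R ∎))
  where
  open ℕₚ.≤-Reasoning
  cover : ∀ z → R z ≡ true → P z ∨ Q z ≡ true
  cover z r with P z in pz | Q z in qz
  ... | true  | _    = refl
  ... | false | true = refl
  ... | false | false = ⊥-elim (¬r (z , r , pz , qz))

count-two : ∀ {m} {P : Fin m → Bool} → 2 ≤ countFin m P → ∀ a → ∃ λ b → b ≢ a × P b ≡ true
count-two {m} {P} le a with any? (λ b → ¬? (b ≟ a) ×-dec (P b 𝔹ₚ.≟ true))
... | yes r = r
... | no ¬r = ⊥-elim (ℕₚ.<⇒≱ le (Fₚ.injective⇒≤ {f = λ (_ : Fin (countFin m P)) → zero {0}} λ {i} {j} _ →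
    trans (sym (to∘from (enum P) i)) (trans (cong (to (enum P)) (sub-≡ (trans (only i) (sym (only j))))) (to∘from (enum P) j))))
  where
  only : ∀ i → proj₁ (from (enum P) i) ≡ a
  only i with proj₁ (from (enum P) i) ≟ a
  ... | yes e = e
  ... | no ne = ⊥-elim (¬r (_ , ne , proj₂ (from (enum P) i)))

-- Glues one bijection per label. Equal counts for every label, the numeric form used by `nbrsIn`,
-- become a label-preserving bijection, the form used by `CRSame`; `count-label` goes back.
labelled-bij : ∀ {m k} {P : Fin m → Bool} {P′ : Fin k → Bool} (q : Fin m → ℕ) (q′ : Fin k → ℕ) →
  (∀ y → countFin m (λ a → P a ∧ (q a ≡ᵇ y)) ≡ countFin k (λ a → P′ a ∧ (q′ a ≡ᵇ y))) →
  Σ (Sub P → Sub P′) λ f → IsBij f × (∀ x → q′ (proj₁ (f x)) ≡ q (proj₁ x))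
labelled-bij {m} {k} {P} {P′} q q′ h =
    f , mkBij g (λ x → sub-≡ (gf (proj₁ x) (proj₂ x)))
                (λ y → sub-≡ (fg (proj₁ y) (proj₂ y))) , fq
  where
  C : ℕ → Fin m → Bool
  C y a = P a ∧ (q a ≡ᵇ y)
  C′ : ℕ → Fin k → Bool
  C′ y a = P′ a ∧ (q′ a ≡ᵇ y)
  F : ∀ y → Sub (C y) → Sub (C′ y)
  F y = proj₁ (bij-of-count (h y))
  Fb : ∀ y → IsBij (F y)
  Fb y = proj₂ (bij-of-count (h y))
  inC : ∀ {a} → P a ≡ true → C (q a) a ≡ true
  inC {a} p = ∧-intro p (≡ᵇ-refl (q a))
  inC′ : ∀ {a} → P′ a ≡ true → C′ (q′ a) a ≡ true
  inC′ {a} p = ∧-intro p (≡ᵇ-refl (q′ a))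
  f : Sub P → Sub P′
  f (a , p) = proj₁ (F (q a) (a , inC p)) , proj₁ (∧-true (proj₂ (F (q a) (a , inC p))))
  g : Sub P′ → Sub P
  g (a , p) = proj₁ (inv (Fb (q′ a)) (a , inC′ p)) , proj₁ (∧-true (proj₂ (inv (Fb (q′ a)) (a , inC′ p))))
  fq : ∀ x → q′ (proj₁ (f x)) ≡ q (proj₁ x)
  fq (a , p) = ≡ᵇ-true _ _ (proj₂ (∧-true {P′ _} (proj₂ (F (q a) (a , inC p)))))
  gq : ∀ x → q (proj₁ (g x)) ≡ q′ (proj₁ x)
  gq (a , p) = ≡ᵇ-true _ _ (proj₂ (∧-true {P _} (proj₂ (inv (Fb (q′ a)) (a , inC′ p)))))
  fAt : ∀ x y (c : C y (proj₁ x) ≡ true) → q (proj₁ x) ≡ y → proj₁ (f x) ≡ proj₁ (F y (proj₁ x , c))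
  fAt (a , p) .(q a) c refl = cong (λ z → proj₁ (F (q a) z)) (sub-≡ refl)
  gAt : ∀ x y (c : C′ y (proj₁ x) ≡ true) → q′ (proj₁ x) ≡ y → proj₁ (g x) ≡ proj₁ (inv (Fb y) (proj₁ x , c))
  gAt (a , p) .(q′ a) c refl = cong (λ z → proj₁ (inv (Fb (q′ a)) z)) (sub-≡ refl)
  gf : ∀ a (p : P a ≡ true) → proj₁ (g (f (a , p))) ≡ a
  gf a p = trans (gAt (f (a , p)) (q a) (proj₂ (F (q a) (a , inC p))) (fq (a , p)))
    (cong proj₁ (inv∘f (Fb (q a)) (a , inC p)))
  fg : ∀ a (p : P′ a ≡ true) → proj₁ (f (g (a , p))) ≡ a
  fg a p = trans (fAt (g (a , p)) (q′ a) (proj₂ (inv (Fb (q′ a)) (a , inC′ p))) (gq (a , p)))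
    (cong proj₁ (f∘inv (Fb (q′ a)) (a , inC′ p)))

count-label : ∀ {m k} {P : Fin m → Bool} {P′ : Fin k → Bool} (C : Fin m → Bool) (C′ : Fin k → Bool)
  {f : Sub P → Sub P′} → IsBij f → (∀ x → C′ (proj₁ (f x)) ≡ C (proj₁ x)) →
  countFin m (λ a → P a ∧ C a) ≡ countFin k (λ a → P′ a ∧ C′ a)
count-label {P = P} {P′} C C′ {f} b h = count-bij {f = F}
    (mkBij G (λ { (a , p) → sub-≡ (trans (cong (proj₁ ∘ inv b) (sub-≡ refl)) (cong proj₁ (inv∘f b (a , proj₁ (∧-true p))))) })
             (λ { (a , p) → sub-≡ (trans (cong (proj₁ ∘ f) (sub-≡ refl)) (cong proj₁ (f∘inv b (a , proj₁ (∧-true p))))) }))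
  where
  F : Sub (λ a → P a ∧ C a) → Sub (λ a → P′ a ∧ C′ a)
  F (a , p) = proj₁ (f (a , proj₁ (∧-true p))) ,
    ∧-intro (proj₂ (f (a , proj₁ (∧-true p)))) (trans (h _) (proj₂ (∧-true {P a} p)))
  G : Sub (λ a → P′ a ∧ C′ a) → Sub (λ a → P a ∧ C a)
  G (a , p) = proj₁ (inv b (a , proj₁ (∧-true p))) , ∧-intro (proj₂ (inv b (a , proj₁ (∧-true p))))
    (trans (sym (h _)) (trans (cong (C′ ∘ proj₁) (f∘inv b (a , proj₁ (∧-true p)))) (proj₂ (∧-true {P′ a} p))))

consF : ∀ {m} {A : Set} → A → (Fin m → A) → Fin (suc m) → A
consF a f zero    = a
consF a f (suc i) = f i

-- Functions are enumerated only up to pointwise equality, hence the hypothesis that `P` respects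
-- it.
anyFun? : ∀ {m k} {P : (Fin m → Fin k) → Set} → (∀ {f g} → (∀ x → f x ≡ g x) → P f → P g) →
  (∀ f → Dec (P f)) → Dec (∃ P)
anyFun? {zero} resp P? = map′ (λ p → _ , p) (λ { (f , p) → resp (λ ()) p }) (P? (λ ()))
anyFun? {suc m} resp P? = map′ (λ { (a , f , p) → consF a f , p })
    (λ { (f , p) → f zero , f ∘ suc , resp (λ { zero → refl ; (suc i) → refl }) p })
    (any? λ a → anyFun? (λ h → resp (λ { zero → refl ; (suc i) → h i })) (λ f → P? (consF a f)))

bij? : ∀ {m k} (f : Fin m → Fin k) → Dec (IsBij f)
bij? f = map′ (λ { (i , s) → (λ {x} {y} → i x y) , λ y → proj₁ (s y) , λ { refl → proj₂ (s y) } })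
              (λ { (i , s) → (λ x y → i) , λ y → proj₁ (s y) , proj₂ (s y) refl })
  (all? (λ x → all? λ y → (f x ≟ f y) →-dec (x ≟ y)) ×-dec all? (λ y → any? λ x → f x ≟ y))

isIso? : ∀ G H f → Dec (IsIsoMap G H f)
isIso? G H f = bij? f ×-dec (all? (λ u → all? λ v → adj H (f u) (f v) 𝔹ₚ.≟ adj G u v)
  ×-dec all? (λ u → col H (f u) ℕ.≟ col G u))

isIso-≗ : ∀ G H {f g} → (∀ x → f x ≡ g x) → IsIsoMap G H f → IsIsoMap G H g
isIso-≗ G H h (b , a , c) = bij-≗ h b
  , (λ u v → trans (cong₂ (adj H) (sym (h u)) (sym (h v))) (a u v))
  , (λ u → trans (cong (col H) (sym (h u))) (c u))

≅? : ∀ G H → Dec (G ≅ H)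
≅? G H = anyFun? (isIso-≗ G H) (isIso? G H)

-- The search stops at `d` and returns it untested. If `d` satisfies `P`, the result is the least
-- such index, so two members of one class find the same representative.
first : ∀ {n} → (Fin n → Bool) → Fin n → Fin n
first P zero    = zero
first P (suc d) = if P zero then zero else suc (first (P ∘ suc) d)

first-true : ∀ {n} (P : Fin n → Bool) d → P d ≡ true → P (first P d) ≡ true
first-true P zero h = h
first-true P (suc d) h with P zero in eq
... | true  = eq
... | false = first-true (P ∘ suc) d h

first-unique : ∀ {n} (P Q : Fin n → Bool) d e → (∀ a → P a ≡ Q a) → P d ≡ true → Q e ≡ true → first P d ≡ first Q e
first-unique P Q zero zero h p q = refl
first-unique P Q zero (suc e) h p q rewrite trans (sym (h zero)) p = refl
first-unique P Q (suc d) zero h p q rewrite trans (h zero) q = refl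
first-unique P Q (suc d) (suc e) h p q rewrite h zero with Q zero
... | true  = refl
... | false = cong suc (first-unique (P ∘ suc) (Q ∘ suc) d e (h ∘ suc) p q)

record Reps {n} (R : Fin n → Fin n → Set) : Set where
  field
    rep       : Fin n → Fin n
    rep-rel   : ∀ u → R u (rep u)
    rep-cong  : ∀ {u v} → R u v → rep u ≡ rep v

reps : ∀ {n} {R : Fin n → Fin n → Set} → (∀ u → R u u) → (∀ {u v} → R u v → R v u) →
  (∀ {u v w} → R u v → R v w → R u w) → (∀ u v → Dec (R u v)) → Reps R
reps {R = R} rr rs rt R? = record
  { rep = λ u → first (λ v → does (R? u v)) u
  ; rep-rel = λ u → does-true (R? u _) (first-true (λ v → does (R? u v)) u (dec-true (R? u u) (rr u)))
  ; rep-cong = λ {u} {v} r → first-unique _ _ u v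
      (λ a → does-cong (R? u a) (R? v a) (rt (rs r)) (rt r)) (dec-true (R? u u) (rr u)) (dec-true (R? v v) (rr v)) }

injective⇒bij : ∀ {n} {f : Fin n → Fin n} → (∀ {x y} → f x ≡ f y → x ≡ y) → IsBij f
injective⇒bij {n} {f} inj = inj , λ y → let (x , e) = find y in x , λ { refl → e }
  where
  P : Fin n → Bool
  P y = does (any? (λ x → f x ≟ y))
  all≤ : countFin n (λ _ → true) ≤ countFin n P
  all≤ = count-inj (λ { (x , _) → f x , dec-true (any? (λ x′ → f x′ ≟ f x)) (x , refl) })
                   (λ e → sub-≡ (inj (cong proj₁ e)))
  find : ∀ y → ∃ λ x → f x ≡ y
  find y with any? (λ x → f x ≟ y) in eq
  ... | yes r = r
  ... | no ¬r = ⊥-elim (ℕₚ.<⇒≱ (count-⊂ (λ _ _ → refl) y refl (cong does eq)) all≤)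

count-outside : ∀ {m} (P R : Fin m → Bool) → countFin m P < countFin m R → ∃ λ z → R z ≡ true × P z ≡ false
count-outside P R lt with any? (λ z → (R z 𝔹ₚ.≟ true) ×-dec (P z 𝔹ₚ.≟ false))
... | yes r = r
... | no ¬r = ⊥-elim (ℕₚ.<⇒≱ lt (count-⊆ λ z r → 𝔹ₚ.¬-not {y = false} (λ f → ¬r (z , r , f))))

separates : ∀ {A : Set} (f : A → Bool) {a b} → f a ≡ true → f b ≡ false → a ≢ b
separates f t e refl = true≢false t e

count-single : ∀ {m} (x : Fin m) → countFin m (λ s → does (s ≟ x)) ≡ 1
count-single {suc m} zero    = cong suc (count-false {m} (λ _ → refl))
count-single {suc m} (suc x) = count-single x

count-split : ∀ {m} (P Q : Fin m → Bool) → countFin m P ≡ countFin m (λ a → P a ∧ Q a) + countFin m (λ a → P a ∧ not (Q a))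
count-split {zero}  P Q = refl
count-split {suc m} P Q with P zero | Q zero | count-split (P ∘ suc) (Q ∘ suc)
... | true  | true  | ih = cong suc ih
... | true  | false | ih = trans (cong suc ih) (sym (ℕₚ.+-suc _ _))
... | false | _     | ih = ih

count≥2 : ∀ {m} {P : Fin m → Bool} {a b} → a ≢ b → P a ≡ true → P b ≡ true → 2 ≤ countFin m P
count≥2 {m} {P} {a} {b} ne pa pb = ℕₚ.≤-trans (s≤s (count-pos {P = λ s → does (s ≟ a)} a (dec-true (a ≟ a) refl)))
  (count-⊂ (λ s h → trans (cong P (does-true (s ≟ a) h)) pa) b pb (dec-false (b ≟ a) (ne ∘ sym)))

count-three : ∀ {m} {P : Fin m → Bool} → 3 ≤ countFin m P → ∀ a b → ∃ λ s → s ≢ a × s ≢ b × P s ≡ true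
count-three {m} {P} le a b with any? (λ s → ¬? (s ≟ a) ×-dec (¬? (s ≟ b) ×-dec (P s 𝔹ₚ.≟ true)))
... | yes r = r
... | no ¬r = ⊥-elim (ℕₚ.<⇒≱ le (begin
    countFin m P ≤⟨ count-⊆ cover ⟩
    countFin m (λ s → does (s ≟ a) ∨ does (s ≟ b)) ≤⟨ ℕₚ.m≤m+n _ _ ⟩
    countFin m (λ s → does (s ≟ a) ∨ does (s ≟ b)) + countFin m (λ s → does (s ≟ a) ∧ does (s ≟ b))
      ≡⟨ count-∨-∧ (λ s → does (s ≟ a)) (λ s → does (s ≟ b)) ⟩
    countFin m (λ s → does (s ≟ a)) + countFin m (λ s → does (s ≟ b)) ≡⟨ cong₂ _+_ (count-single a) (count-single b) ⟩
    2 ∎))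
  where
  open ℕₚ.≤-Reasoning
  cover : ∀ s → P s ≡ true → does (s ≟ a) ∨ does (s ≟ b) ≡ true
  cover s h with s ≟ a
  ... | yes _ = refl
  ... | no na with s ≟ b
  ...   | yes _ = refl
  ...   | no nb = ⊥-elim (¬r (s , na , nb , h))

∨-true : ∀ {a b} → a ∨ b ≡ true → a ≡ true ⊎ b ≡ true
∨-true {true}  _ = inj₁ refl
∨-true {false} h = inj₂ h

∨-introˡ : ∀ {a} b → a ≡ true → a ∨ b ≡ true
∨-introˡ _ refl = refl

∨-introʳ : ∀ a {b} → b ≡ true → a ∨ b ≡ true
∨-introʳ a refl = 𝔹ₚ.∨-zeroʳ a

∨-false : ∀ {a b} → a ∨ b ≡ false → a ≡ false × b ≡ false
∨-false {false} {false} _ = refl , refl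

not-false : ∀ {b} → not b ≡ true → b ≡ false
not-false {false} _ = refl

-- Edge switching

Adj : ℕ → Set
Adj n = Fin n → Fin n → Bool

record Simple {n} (B : Adj n) : Set where
  field
    sy : ∀ u v → B u v ≡ B v u
    ir : ∀ u → B u u ≡ false

  adj≢ : ∀ {u v} → B u v ≡ true → u ≢ v
  adj≢ h refl = true≢false h (ir _)

open Simple public

swp : ∀ {n} → Fin n → Fin n → Fin n → Fin n
swp b d x = if does (x ≟ b) then d else if does (x ≟ d) then b else x

swp-left : ∀ {n} (b d : Fin n) → swp b d b ≡ d
swp-left b d rewrite dec-true (b ≟ b) refl = refl

swp-right : ∀ {n} (b d : Fin n) → swp b d d ≡ b
swp-right b d with d ≟ b
... | yes refl = refl
... | no _ rewrite dec-true (d ≟ d) refl = refl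

swp-other : ∀ {n} {b d x : Fin n} → x ≢ b → x ≢ d → swp b d x ≡ x
swp-other {b = b} {d} {x} nb nd rewrite dec-false (x ≟ b) nb | dec-false (x ≟ d) nd = refl

swp-invol : ∀ {n} (b d x : Fin n) → swp b d (swp b d x) ≡ x
swp-invol b d x with x ≟ b
... | yes refl = swp-right b d
... | no nb with x ≟ d
...   | yes refl = swp-left b d
...   | no nd = swp-other nb nd

swp-bij : ∀ {n} (b d : Fin n) → IsBij (swp b d)
swp-bij b d = mkBij (swp b d) (swp-invol b d) (swp-invol b d)

Pair : ∀ {n} → (x y u v : Fin n) → Set
Pair x y u v = (u ≡ x × v ≡ y) ⊎ (u ≡ y × v ≡ x)

pair? : ∀ {n} (x y u v : Fin n) → Dec (Pair x y u v)
pair? x y u v = ((u ≟ x) ×-dec (v ≟ y)) ⊎-dec ((u ≟ y) ×-dec (v ≟ x))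

pair-sym : ∀ {n} {x y u v : Fin n} → Pair x y u v → Pair x y v u
pair-sym (inj₁ (a , b)) = inj₂ (b , a)
pair-sym (inj₂ (a , b)) = inj₁ (b , a)

pair-flip : ∀ {n} {x y u v : Fin n} → Pair x y u v → Pair y x u v
pair-flip (inj₁ h) = inj₂ h
pair-flip (inj₂ h) = inj₁ h

Pairs₂ : ∀ {n} → (x y z w u v : Fin n) → Set
Pairs₂ x y z w u v = Pair x y u v ⊎ Pair z w u v

pairs? : ∀ {n} (x y z w u v : Fin n) → Dec (Pairs₂ x y z w u v)
pairs? x y z w u v = pair? x y u v ⊎-dec pair? z w u v

iter : {A : Set} → (A → A) → ℕ → A → A
iter f zero    x = x
iter f (suc k) x = f (iter f k x)

iter-cycle : ∀ {n} {φ : Fin n → Fin n} → IsBij φ → ∀ u → ∃ λ k → iter φ (suc k) u ≡ u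
iter-cycle {n} {φ} b u =
  let (i , j , i<j , e) = Fₚ.pigeonhole (ℕₚ.n<1+n n) (λ (i : Fin (suc n)) → iter φ (toℕ i) u)
  in go (toℕ i) (toℕ j) i<j e
  where
  go : ∀ i j → i < j → iter φ i u ≡ iter φ j u → ∃ λ k → iter φ (suc k) u ≡ u
  go zero    (suc j) _ e       = j , sym e
  go (suc i) (suc j) (s≤s l) e = go i j l (proj₁ b e)

collect : ∀ {m} {A : Fin m → Set} {C : Set} → (∀ i → A i ⊎ C) → (∀ i → A i) ⊎ C
collect {zero}  h = inj₁ (λ ())
collect {suc m} h with h zero | collect (h ∘ suc)
... | inj₂ c | _      = inj₂ c
... | inj₁ _ | inj₂ c = inj₂ c
... | inj₁ a | inj₁ f = inj₁ λ { zero → a ; (suc i) → f i }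

-- Repeated improvement: the set of bad pairs shrinks until every bad pair is stuck.
improve : ∀ {n} (St : Adj n → Set) (Bad : Adj n → Adj n) (Stuck : Adj n → Fin n → Fin n → Set) →
  (∀ B → St B → ∀ x y → Bad B x y ≡ true → Stuck B x y ⊎
     (∃ λ B₁ → St B₁ × (∀ x′ y′ → Bad B₁ x′ y′ ≡ true → Bad B x′ y′ ≡ true) × Bad B₁ x y ≡ false)) →
  ∀ B → St B → ∃ λ B₁ → St B₁ × (∀ x y → Bad B₁ x y ≡ true → Stuck B₁ x y)
improve {n} St Bad Stuck step B₀ st₀ = go (μ B₀) B₀ st₀ ℕₚ.≤-refl
  where
  badAt : Adj n → Fin (n * n) → Bool
  badAt B k = Bad B (proj₁ (remQuot {n} n k)) (proj₂ (remQuot {n} n k))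
  μ : Adj n → ℕ
  μ B = countFin (n * n) (badAt B)
  badAt-combine : ∀ B x y → badAt B (combine x y) ≡ Bad B x y
  badAt-combine B x y = cong (λ q → Bad B (proj₁ q) (proj₂ q)) (Fₚ.remQuot-combine {n} {n} x y)
  Better : Adj n → Set
  Better B = ∃ λ B₁ → St B₁ × μ B₁ < μ B
  try : ∀ B → St B → ∀ x y → (Bad B x y ≡ true → Stuck B x y) ⊎ Better B
  try B st x y with Bad B x y in e
  ... | false = inj₁ (λ ())
  ... | true with step B st x y e
  ...   | inj₁ s = inj₁ (λ _ → s)
  ...   | inj₂ (B₁ , st₁ , sub , f) = inj₂ (B₁ , st₁ , count-⊂ (λ k → sub _ _) (combine x y)
            (trans (badAt-combine B x y) e) (trans (badAt-combine B₁ x y) f))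
  go : ∀ k B → St B → μ B ≤ k → ∃ λ B₁ → St B₁ × (∀ x y → Bad B₁ x y ≡ true → Stuck B₁ x y)
  go k B st le with collect (λ x → collect (try B st x))
  ... | inj₁ done = B , st , done
  go zero B st le | inj₂ (B₁ , st₁ , lt) = ⊥-elim (ℕₚ.n≮0 (ℕₚ.<-≤-trans lt le))
  go (suc k) B st le | inj₂ (B₁ , st₁ , lt) = go k B₁ st₁ (ℕₚ.≤-pred (ℕₚ.<-≤-trans lt le))

-- A cell is a fibre of `p`, named by an element of `Fin n`. When `p` chooses representatives, a
-- name with `p c ≡ c` is a vertex of its own cell, and for an equitable `B` the number `deg B c c′`
-- is the common degree from one cell to another.
module Cells {n : ℕ} (p : Fin n → Fin n) where

  inCell : Fin n → Fin n → Bool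
  inCell c v = does (p v ≟ c)

  inCell-true : ∀ {c v} → p v ≡ c → inCell c v ≡ true
  inCell-true {c} {v} = dec-true (p v ≟ c)

  inCell-elim : ∀ {c v} → inCell c v ≡ true → p v ≡ c
  inCell-elim {c} {v} = does-true (p v ≟ c)

  size : Fin n → ℕ
  size c = countFin n (inCell c)

  nbr : Adj n → Fin n → Fin n → Fin n → Bool
  nbr B u c v = B u v ∧ inCell c v

  deg : Adj n → Fin n → Fin n → ℕ
  deg B u c = countFin n (nbr B u c)

  nbr-intro : ∀ B {u c v} → B u v ≡ true → p v ≡ c → nbr B u c v ≡ true
  nbr-intro B e h = ∧-intro e (inCell-true h)

  nbr-elim : ∀ B {u c v} → nbr B u c v ≡ true → B u v ≡ true × p v ≡ c
  nbr-elim B {u} {c} {v} h = proj₁ (∧-true h) , inCell-elim (proj₂ (∧-true {B u v} h))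

  nbr-false : ∀ B {u c v} → nbr B u c v ≡ false → p v ≡ c → B u v ≡ false
  nbr-false B h e = not-true (λ b → true≢false (nbr-intro B b e) h)

  nbr-non : ∀ B {u c v} → B u v ≡ false → nbr B u c v ≡ false
  nbr-non B h rewrite h = refl

  Equit : Adj n → Set
  Equit B = ∀ {u v} c → p u ≡ p v → deg B u c ≡ deg B v c

  Real : Adj n → Adj n → Set
  Real B B′ = ∀ u c → deg B′ u c ≡ deg B u c

  CellIso : Adj n → Adj n → (Fin n → Fin n) → Set
  CellIso B B′ φ = IsBij φ × (∀ u → p (φ u) ≡ p u) × (∀ u v → B′ (φ u) (φ v) ≡ B u v)

  -- All that is kept of amenability: a graph with the same degrees into the stable cells cannot be
  -- told apart by refinement.
  Rigid : Adj n → Set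
  Rigid B = ∀ B′ → Simple B′ → Real B B′ → ∃ (CellIso B B′)

  real-trans : ∀ {B B₁ B₂} → Real B B₁ → Real B₁ B₂ → Real B B₂
  real-trans r s u c = trans (s u c) (r u c)

  real-sym : ∀ {B B₁} → Real B B₁ → Real B₁ B
  real-sym r u c = sym (r u c)

  equit-real : ∀ {B B₁} → Equit B → Real B B₁ → Equit B₁
  equit-real e r c h = trans (r _ c) (trans (e c h) (sym (r _ c)))

  cellIso-trans : ∀ {B B₁ B₂ φ ψ} → CellIso B B₁ φ → CellIso B₁ B₂ ψ → CellIso B B₂ (ψ ∘ φ)
  cellIso-trans (b , c , a) (b′ , c′ , a′) = ∘-bij b′ b , (λ u → trans (c′ _) (c u)) , (λ u v → trans (a′ _ _) (a u v))

  cellIso-sym : ∀ {B B₁ φ} → (i : CellIso B B₁ φ) → CellIso B₁ B (inv (proj₁ i))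
  cellIso-sym {B₁ = B₁} (b , c , a) = inv-bij b , (λ u → trans (sym (c _)) (cong p (f∘inv b u)))
    , (λ u v → trans (sym (a _ _)) (cong₂ B₁ (f∘inv b u) (f∘inv b v)))

  rigid-real : ∀ {B B₁} → Rigid B → Simple B₁ → Real B B₁ → Rigid B₁
  rigid-real rg s r B′ s′ r′ =
    let (φ , i) = rg _ s r
        (ψ , j) = rg B′ s′ (real-trans r r′)
    in _ , cellIso-trans {B₂ = B′} (cellIso-sym i) j

  -- A set attached invariantly to a graph cannot shrink properly along an isomorphism.
  no-shrink : ∀ {B B′} → ∃ (CellIso B B′) → (D : Adj n → Fin n → Set) →
    (∀ φ → CellIso B B′ φ → ∀ x → D B x → D B′ (φ x)) → (∀ x → D B′ x → D B x) →
    ∀ u → D B u → D B′ u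
  no-shrink {B} {B′} (φ , i) D invar sub u du =
    let (k , e) = iter-cycle (proj₁ i) u in subst (D B′) e (go k)
    where
    go : ∀ k → D B′ (iter φ (suc k) u)
    go zero    = invar φ i u du
    go (suc k) = invar φ i _ (sub _ (go k))

  exchange : ∀ {B} → Equit B → ∀ {x y v c} → p x ≡ p y → p v ≡ c → B x v ≡ true → B y v ≡ false →
    ∃ λ w → p w ≡ c × B y w ≡ true × B x w ≡ false
  exchange {B} eq {x} {y} {v} {c} h hv t f =
    let (w , q , r) = count-exchange (eq c h) v (nbr-intro B t hv) (nbr-non B f)
        (q₁ , q₂) = nbr-elim B q
    in w , q₂ , q₁ , nbr-false B r q₂

  -- An alternating 4-cycle whose opposite corners lie in the same cell. Exchanging its edges with
  -- its non-edges gives each corner a new neighbour in the cell where it loses one, so no degree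
  -- into a cell changes.
  record Alternating (B : Adj n) (a b c d : Fin n) : Set where
    field
      ab : B a b ≡ true
      cd : B c d ≡ true
      ad : B a d ≡ false
      cb : B c b ≡ false
      a≢d : a ≢ d
      b≢c : b ≢ c
      pac : p a ≡ p c
      pbd : p b ≡ p d

  switch : Adj n → (a b c d : Fin n) → Adj n
  switch B a b c d u v =
    if does (pairs? a b c d u v) then false else if does (pairs? a d c b u v) then true else B u v

  record Switched (B : Adj n) (a b c d : Fin n) (B′ : Adj n) : Set where
    field
      simple : Simple B′
      real   : Real B B′
      rem    : ∀ {u v} → Pairs₂ a b c d u v → B′ u v ≡ false
      add    : ∀ {u v} → Pairs₂ a d c b u v → B′ u v ≡ true
      old    : ∀ {u v} → B′ u v ≡ true → B u v ≡ true ⊎ Pairs₂ a d c b u v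
      kept   : ∀ {u v} → B u v ≡ true → B′ u v ≡ true ⊎ Pairs₂ a b c d u v
      off    : ∀ {u v} → u ≢ a → u ≢ b → u ≢ c → u ≢ d → B′ u v ≡ B u v

    offʳ : Simple B → ∀ {u v} → v ≢ a → v ≢ b → v ≢ c → v ≢ d → B′ u v ≡ B u v
    offʳ s h₁ h₂ h₃ h₄ = trans (sy simple _ _) (trans (off h₁ h₂ h₃ h₄) (sy s _ _))

  module _ {B : Adj n} (s : Simple B) where

    private
      sw-rem : ∀ {a b c d u v} → Pairs₂ a b c d u v → switch B a b c d u v ≡ false
      sw-rem {a} {b} {c} {d} {u} {v} h rewrite dec-true (pairs? a b c d u v) h = refl

      sw-add : ∀ {a b c d u v} → ¬ Pairs₂ a b c d u v → Pairs₂ a d c b u v → switch B a b c d u v ≡ true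
      sw-add {a} {b} {c} {d} {u} {v} h k
        rewrite dec-false (pairs? a b c d u v) h | dec-true (pairs? a d c b u v) k = refl

      sw-keep : ∀ {a b c d u v} → ¬ Pairs₂ a b c d u v → ¬ Pairs₂ a d c b u v → switch B a b c d u v ≡ B u v
      sw-keep {a} {b} {c} {d} {u} {v} h k
        rewrite dec-false (pairs? a b c d u v) h | dec-false (pairs? a d c b u v) k = refl

      rot : ∀ {a b c d} → Alternating B a b c d → Alternating B c d a b
      rot A = record { ab = cd ; cd = ab ; ad = cb ; cb = ad ; a≢d = b≢c ∘ sym ; b≢c = a≢d ∘ sym ; pac = sym pac ; pbd = sym pbd }
        where open Alternating A

      mir : ∀ {a b c d} → Alternating B a b c d → Alternating B b a d c
      mir A = record { ab = trans (sy s _ _) ab ; cd = trans (sy s _ _) cd ; ad = trans (sy s _ _) cb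
                     ; cb = trans (sy s _ _) ad ; a≢d = b≢c ; b≢c = a≢d ; pac = pbd ; pbd = pac }
        where open Alternating A

      sw-cong : ∀ {a b c d a′ b′ c′ d′} u v →
        (Pairs₂ a b c d u v → Pairs₂ a′ b′ c′ d′ u v) → (Pairs₂ a′ b′ c′ d′ u v → Pairs₂ a b c d u v) →
        (Pairs₂ a d c b u v → Pairs₂ a′ d′ c′ b′ u v) → (Pairs₂ a′ d′ c′ b′ u v → Pairs₂ a d c b u v) →
        switch B a b c d u v ≡ switch B a′ b′ c′ d′ u v
      sw-cong {a} {b} {c} {d} {a′} {b′} {c′} {d′} u v f g h k
        rewrite does-cong (pairs? a b c d u v) (pairs? a′ b′ c′ d′ u v) f g
              | does-cong (pairs? a d c b u v) (pairs? a′ d′ c′ b′ u v) h k = refl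

      ⊎-swap : ∀ {X Y : Set} → X ⊎ Y → Y ⊎ X
      ⊎-swap (inj₁ x) = inj₂ x
      ⊎-swap (inj₂ y) = inj₁ y

      flip₂ : ∀ {x y z w u v} → Pairs₂ {n} x y z w u v → Pairs₂ y x w z u v
      flip₂ (inj₁ h) = inj₁ (pair-flip h)
      flip₂ (inj₂ h) = inj₂ (pair-flip h)

      flipSwap : ∀ {x y z w u v} → Pairs₂ {n} x y z w u v → Pairs₂ w z y x u v
      flipSwap = ⊎-swap ∘ flip₂

      sw-rot : ∀ {a b c d} u v → switch B a b c d u v ≡ switch B c d a b u v
      sw-rot u v = sw-cong u v ⊎-swap ⊎-swap ⊎-swap ⊎-swap

      sw-mir : ∀ {a b c d} u v → switch B a b c d u v ≡ switch B b a d c u v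
      sw-mir u v = sw-cong u v flip₂ flip₂ flipSwap flipSwap

      -- In the row of `a` the switch only transposes the entries at `b` and `d`, two vertices of
      -- one cell, which is why the degrees of `a` survive. The other corners follow by the
      -- symmetries `rot` and `mir` of the cycle.
      row : ∀ {a b c d} → Alternating B a b c d → ∀ v → switch B a b c d a v ≡ B a (swp b d v)
      row {a} {b} {c} {d} A v = go (v ≟ b) (v ≟ d)
        where
        open Alternating A
        a≢b = adj≢ s ab
        a≢c : a ≢ c
        a≢c refl = true≢false ab cb
        norem : v ≢ b → ¬ Pairs₂ a b c d a v
        norem h (inj₁ (inj₁ (_ , e))) = h e
        norem h (inj₁ (inj₂ (e , _))) = a≢b e
        norem h (inj₂ (inj₁ (e , _))) = a≢c e
        norem h (inj₂ (inj₂ (e , _))) = a≢d e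
        noadd : v ≢ d → ¬ Pairs₂ a d c b a v
        noadd h (inj₁ (inj₁ (_ , e))) = h e
        noadd h (inj₁ (inj₂ (e , _))) = a≢d e
        noadd h (inj₂ (inj₁ (e , _))) = a≢c e
        noadd h (inj₂ (inj₂ (e , _))) = a≢b e
        go : Dec (v ≡ b) → Dec (v ≡ d) → switch B a b c d a v ≡ B a (swp b d v)
        go (yes refl) _ = trans (sw-rem {a} {b} {c} {d} (inj₁ (inj₁ (refl , refl)))) (sym (trans (cong (B a) (swp-left b d)) ad))
        go (no h) (yes refl) = trans (sw-add (norem h) (inj₁ (inj₁ (refl , refl)))) (sym (trans (cong (B a) (swp-right b v)) ab))
        go (no h) (no k) = trans (sw-keep (norem h) (noadd k)) (cong (B a) (sym (swp-other h k)))

      p-swp : ∀ {b d} → p b ≡ p d → ∀ v → p (swp b d v) ≡ p v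
      p-swp {b} {d} e v with v ≟ b
      ... | yes refl = sym e
      ... | no _ with v ≟ d
      ...   | yes refl = e
      ...   | no _ = refl

      row-deg : ∀ {a b c d} → Alternating B a b c d → ∀ k → deg (switch B a b c d) a k ≡ deg B a k
      row-deg {a} {b} {c} {d} A k = trans (count-cong λ v → cong₂ _∧_ (row A v)
          (cong (λ z → does (z ≟ k)) (sym (p-swp (Alternating.pbd A) v))))
        (count-∘ (swp-bij b d) (nbr B a k))

      sw-off : ∀ {a b c d u v} → u ≢ a → u ≢ b → u ≢ c → u ≢ d → switch B a b c d u v ≡ B u v
      sw-off {a} {b} {c} {d} {u} {v} ha hb hc hd = sw-keep
        (λ { (inj₁ (inj₁ (e , _))) → ha e ; (inj₁ (inj₂ (e , _))) → hb e
           ; (inj₂ (inj₁ (e , _))) → hc e ; (inj₂ (inj₂ (e , _))) → hd e })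
        (λ { (inj₁ (inj₁ (e , _))) → ha e ; (inj₁ (inj₂ (e , _))) → hd e
           ; (inj₂ (inj₁ (e , _))) → hc e ; (inj₂ (inj₂ (e , _))) → hb e })

    switched : ∀ {a b c d} → Alternating B a b c d → ∃ (Switched B a b c d)
    switched {a} {b} {c} {d} A = B′ , record
      { simple = record { sy = λ u v → sw-sym u v ; ir = sw-ir }
      ; real = real′ ; rem = sw-rem ; add = λ h → sw-add (disj h) h
      ; old = old′ ; kept = kept′ ; off = sw-off }
      where
      open Alternating A
      B′ = switch B a b c d
      sym₂ : ∀ {x y z w u v} → Pairs₂ {n} x y z w u v → Pairs₂ x y z w v u
      sym₂ (inj₁ h) = inj₁ (pair-sym h)
      sym₂ (inj₂ h) = inj₂ (pair-sym h)
      sw-sym : ∀ u v → B′ u v ≡ B′ v u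
      sw-sym u v rewrite does-cong (pairs? a b c d u v) (pairs? a b c d v u) sym₂ sym₂
                       | does-cong (pairs? a d c b u v) (pairs? a d c b v u) sym₂ sym₂
                       | sy s u v = refl
      noloop : ∀ {x y u} → x ≢ y → ¬ Pair {n} x y u u
      noloop h (inj₁ (refl , e)) = h e
      noloop h (inj₂ (refl , e)) = h (sym e)
      sw-ir : ∀ u → B′ u u ≡ false
      sw-ir u = trans (sw-keep
        (λ { (inj₁ h) → noloop (adj≢ s ab) h ; (inj₂ h) → noloop (adj≢ s cd) h })
        (λ { (inj₁ h) → noloop a≢d h ; (inj₂ h) → noloop (b≢c ∘ sym) h })) (ir s u)
      non : ∀ {u v} → Pairs₂ a d c b u v → B u v ≡ false
      non (inj₁ (inj₁ (refl , refl))) = ad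
      non (inj₁ (inj₂ (refl , refl))) = trans (sy s _ _) ad
      non (inj₂ (inj₁ (refl , refl))) = cb
      non (inj₂ (inj₂ (refl , refl))) = trans (sy s _ _) cb
      edge : ∀ {u v} → Pairs₂ a b c d u v → B u v ≡ true
      edge (inj₁ (inj₁ (refl , refl))) = ab
      edge (inj₁ (inj₂ (refl , refl))) = trans (sy s _ _) ab
      edge (inj₂ (inj₁ (refl , refl))) = cd
      edge (inj₂ (inj₂ (refl , refl))) = trans (sy s _ _) cd
      disj : ∀ {u v} → Pairs₂ a d c b u v → ¬ Pairs₂ a b c d u v
      disj h k = true≢false (edge k) (non h)
      old′ : ∀ {u v} → B′ u v ≡ true → B u v ≡ true ⊎ Pairs₂ a d c b u v
      old′ {u} {v} h with pairs? a b c d u v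
      ... | yes q = ⊥-elim (true≢false h (sw-rem q))
      ... | no nq with pairs? a d c b u v
      ...   | yes q = inj₂ q
      ...   | no nr = inj₁ (trans (sym (sw-keep nq nr)) h)
      kept′ : ∀ {u v} → B u v ≡ true → B′ u v ≡ true ⊎ Pairs₂ a b c d u v
      kept′ {u} {v} h with pairs? a b c d u v
      ... | yes q = inj₂ q
      ... | no nq with pairs? a d c b u v
      ...   | yes q = inj₁ (sw-add nq q)
      ...   | no nr = inj₁ (trans (sw-keep nq nr) h)
      real′ : Real B B′
      real′ u k = go (u ≟ a) (u ≟ c) (u ≟ b) (u ≟ d)
        where
        go : Dec (u ≡ a) → Dec (u ≡ c) → Dec (u ≡ b) → Dec (u ≡ d) → deg B′ u k ≡ deg B u k
        go (yes refl) _ _ _ = row-deg A k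
        go _ (yes refl) _ _ = trans (count-cong λ v → cong (_∧ inCell k v) (sw-rot c v)) (row-deg (rot A) k)
        go _ _ (yes refl) _ = trans (count-cong λ v → cong (_∧ inCell k v) (sw-mir b v)) (row-deg (mir A) k)
        go _ _ _ (yes refl) = trans (count-cong λ v → cong (_∧ inCell k v) (trans (sw-mir d v) (sw-rot d v))) (row-deg (rot (mir A)) k)
        go (no ha) (no hc) (no hb) (no hd) = count-cong λ v → cong (_∧ inCell k v) (sw-off ha hb hc hd)

-- A sparse biregular pair of cells with both degrees at least two has non-isomorphic realisations:
-- one can be switched into one containing a complete bipartite component, and destroying that
-- component by one more switch strictly decreases the set of vertices in such components.
module BiregularPair {n : ℕ} (p : Fin n → Fin n)
  {B₀ : Adj n} (s₀ : Simple B₀) (eq₀ : Cells.Equit p B₀) (rg₀ : Cells.Rigid p B₀)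
  {c c′ : Fin n} (c≢c′ : c ≢ c′) {u v₀ : Fin n} (pu : p u ≡ c) (pv₀ : p v₀ ≡ c′) (uv₀ : B₀ u v₀ ≡ true)
  (s≥2 : 2 ≤ Cells.deg p B₀ u c′) (t≥2 : 2 ≤ Cells.deg p B₀ v₀ c)
  (s-sparse : 2 * Cells.deg p B₀ u c′ ≤ Cells.size p c′) (t-sparse : 2 * Cells.deg p B₀ v₀ c ≤ Cells.size p c) where
  open Cells p

  private
    cells≢ : ∀ {x v} → p x ≡ c → p v ≡ c′ → x ≢ v
    cells≢ px pv refl = c≢c′ (trans (sym px) pv)

    -- The neighbours of `u` in `c′` and of `v₀` in `c` are frozen, so the two sets to be joined
    -- completely stay the same while edges are switched.
    St : Adj n → Set
    St B = Simple B × Real B₀ B × (∀ v → p v ≡ c′ → B u v ≡ B₀ u v) × (∀ x → p x ≡ c → B x v₀ ≡ B₀ x v₀)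

    Bad : Adj n → Adj n
    Bad B x v = (inCell c x ∧ inCell c′ v) ∧ ((B₀ x v₀ ∧ B₀ u v) ∧ not (B x v))

    bad-elim : ∀ B x v → Bad B x v ≡ true → p x ≡ c × p v ≡ c′ × B₀ x v₀ ≡ true × B₀ u v ≡ true × B x v ≡ false
    bad-elim B x v h =
      let (h₁ , h₂) = ∧-true h ; (h₃ , h₄) = ∧-true h₁ ; (h₅ , h₆) = ∧-true h₂ ; (h₇ , h₈) = ∧-true h₅
      in inCell-elim h₃ , inCell-elim h₄ , h₇ , h₈ , not-false h₆

    bad-intro : ∀ B x v → p x ≡ c → p v ≡ c′ → B₀ x v₀ ≡ true → B₀ u v ≡ true → B x v ≡ false → Bad B x v ≡ true
    bad-intro B x v h₁ h₂ h₃ h₄ h₅ =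
      ∧-intro (∧-intro (inCell-true h₁) (inCell-true h₂)) (∧-intro (∧-intro h₃ h₄) (cong not h₅))

    Out : Fin n → Fin n → Set
    Out x v = B₀ x v₀ ≡ false ⊎ B₀ u v ≡ false

    -- A switch creates a bad pair only by removing an edge between N(v₀) and N(u); the two
    -- conditions `Out` exclude this for both removed edges.
    keep : ∀ {B a b e d} → St B → Alternating B a b e d → p a ≡ c → p b ≡ c′ → a ≢ u → e ≢ u → b ≢ v₀ → d ≢ v₀ →
      Out a b → Out e d →
      ∃ λ B₁ → Switched B a b e d B₁ × St B₁ × (∀ x y → Bad B₁ x y ≡ true → Bad B x y ≡ true)
    keep {B} {a} {b} {e} {d} (s , r , hu , hv) A pa pb au eu bv dv o₁ o₂ =
      let (B₁ , S) = switched s A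
          open Switched S
      in B₁ , S
       , (simple , real-trans r real
         , (λ v pv → trans (off (au ∘ sym) (cells≢ pu pb) (eu ∘ sym) (cells≢ pu pd)) (hu v pv))
         , (λ x px → trans (offʳ s (cells≢ pa pv₀ ∘ sym) (bv ∘ sym) (cells≢ pe pv₀ ∘ sym) (dv ∘ sym)) (hv x px)))
       , λ x y h →
         let (h₁ , h₂ , h₃ , h₄ , h₅) = bad-elim B₁ x y h
         in bad-intro B x y h₁ h₂ h₃ h₄ (not-true λ xy → case kept xy of λ
            { (inj₁ k) → true≢false k h₅
            ; (inj₂ (inj₁ (inj₁ (refl , refl)))) → out o₁ h₃ h₄
            ; (inj₂ (inj₁ (inj₂ (refl , refl)))) → cells≢ h₁ pb refl
            ; (inj₂ (inj₂ (inj₁ (refl , refl)))) → out o₂ h₃ h₄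
            ; (inj₂ (inj₂ (inj₂ (refl , refl)))) → cells≢ h₁ pd refl })
      where
      open Alternating A
      pe : p e ≡ c
      pe = trans (sym pac) pa
      pd : p d ≡ c′
      pd = trans (sym pbd) pb
      out : ∀ {x v} → Out x v → B₀ x v₀ ≡ true → B₀ u v ≡ true → ⊥
      out (inj₁ f) t _ = true≢false t f
      out (inj₂ f) _ t = true≢false t f

    Better : Adj n → Fin n → Fin n → Set
    Better B x v = ∃ λ B₁ → St B₁ × (∀ x′ v′ → Bad B₁ x′ v′ ≡ true → Bad B x′ v′ ≡ true) × Bad B₁ x v ≡ false

    finish : ∀ {B x y x′ v} → St B → p x ≡ c → p v ≡ c′ → p x′ ≡ c → p y ≡ c′ →
      B x y ≡ true → B x′ v ≡ true → B x v ≡ false → B x′ y ≡ false →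
      B₀ u v ≡ true → B₀ x v₀ ≡ true → B₀ u y ≡ false → B₀ x′ v₀ ≡ false → Better B x v
    finish {B} {x} {y} {x′} {v} st@(s , r , hu , hv) px pv px′ py xy x′v xv x′y uv xv₀ uy x′v₀ =
      let (B₁ , S , st₁ , sub) = keep st A px py
             (λ { refl → true≢false (trans (hu _ pv) uv) xv }) (λ { refl → true≢false uv₀ x′v₀ })
             (λ { refl → true≢false uv₀ uy }) (λ { refl → true≢false (trans (hv _ px) xv₀) xv })
             (inj₂ uy) (inj₁ x′v₀)
      in B₁ , st₁ , sub , not-true (λ h → let (_ , _ , _ , _ , f) = bad-elim B₁ x v h in
           true≢false (Switched.add S (inj₁ (inj₁ (refl , refl)))) f)
      where
      A : Alternating B x y x′ v
      A = record { ab = xy ; cd = x′v ; ad = xv ; cb = x′y ; a≢d = cells≢ px pv ; b≢c = cells≢ px′ py ∘ sym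
                 ; pac = trans px (sym px′) ; pbd = trans py (sym pv) }

    step : ∀ B → St B → ∀ x v → Bad B x v ≡ true → ⊥ ⊎ Better B x v
    step B st@(s , r , hu , hv) x v bad
      with bad-elim B x v bad
    ... | px , pv , xv₀ , uv , xv
      -- `v₀` is adjacent to `x` and `v` is not, so `v` has a neighbour `x′` outside N(v₀); likewise
      -- `x` has a neighbour `y` outside N(u). If `x′` and `y` are not adjacent, one switch joins
      -- `x` and `v`.
      with exchange (equit-real eq₀ r) (trans pv₀ (sym pv)) px (trans (sy s _ _) (trans (hv x px) xv₀)) (trans (sy s _ _) xv)
         | exchange (equit-real eq₀ r) (trans pu (sym px)) pv (trans (hu v pv) uv) xv
    ... | x′ , px′ , vx′ , v₀x′ | y , py , xy , uy′
      with B x′ y in x′y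
    ... | false = inj₂ (finish st px pv px′ py xy (trans (sy s _ _) vx′) xv x′y uv xv₀ (trans (sym (hu y py)) uy′)
                    (trans (sym (hv x′ px′)) (trans (sy s _ _) v₀x′)))
    ... | true
      -- `v` is a common neighbour of `u` and `x′`, and by sparsity the sum of their degrees is at
      -- most the size of `c′`. Hence some `y₂` is adjacent to neither and can replace `y`.
      with count-avoid (nbr B u c′) (nbr B x′ c′) (inCell c′)
          (ℕₚ.≤-trans (ℕₚ.≤-reflexive (trans (cong₂ _+_ (r u c′) (trans (equit-real eq₀ r c′ (trans px′ (sym pu))) (r u c′)))
             (cong (deg B₀ u c′ +_) (sym (ℕₚ.+-identityʳ _))))) s-sparse)
          v (nbr-intro B (trans (hu v pv) uv) pv) (nbr-intro B (trans (sy s _ _) vx′) pv)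
    ... | y₂ , cy₂ , ny₂ , my₂ = inj₂ (go (inCell-elim cy₂) (B x y₂) refl)
      where
      uy : B₀ u y ≡ false
      uy = trans (sym (hu y py)) uy′
      x′v₀ : B₀ x′ v₀ ≡ false
      x′v₀ = trans (sym (hv x′ px′)) (trans (sy s _ _) v₀x′)
      x′v = trans (sy s _ _) vx′
      go : p y₂ ≡ c′ → ∀ b → B x y₂ ≡ b → Better B x v
      go py₂ b e = go₂ b e
        where
        uy₂ : B₀ u y₂ ≡ false
        uy₂ = trans (sym (hu y₂ py₂)) (nbr-false B ny₂ py₂)
        x′y₂ : B x′ y₂ ≡ false
        x′y₂ = nbr-false B my₂ py₂
        go₂ : ∀ b → B x y₂ ≡ b → Better B x v
        go₂ true xy₂ = finish st px pv px′ py₂ xy₂ x′v xv x′y₂ uv xv₀ uy₂ x′v₀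
        go₂ false xy₂
          -- If `x` misses `y₂` as well, a preliminary switch with an auxiliary `x″` moves an edge
          -- of `x` from `y` to `y₂`.
          with exchange (equit-real eq₀ r) (trans py (sym py₂)) px (trans (sy s _ _) xy) (trans (sy s _ _) xy₂)
        ... | x″ , px″ , y₂x″ , yx″
          with keep st (record { ab = xy ; cd = trans (sy s _ _) y₂x″ ; ad = xy₂ ; cb = trans (sy s _ _) yx″
                         ; a≢d = cells≢ px py₂ ; b≢c = cells≢ px″ py ∘ sym ; pac = trans px (sym px″) ; pbd = trans py (sym py₂) })
                px py (separates (λ z → B z v) (trans (hu _ pv) uv) xv ∘ sym)
                (separates (λ z → B z y₂) (trans (sy s _ _) y₂x″) (trans (hu _ py₂) uy₂))
                (separates (B₀ u) uv₀ uy ∘ sym) (separates (B₀ u) uv₀ uy₂ ∘ sym) (inj₂ uy) (inj₂ uy₂)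
        ... | B₁ , S , st₁ , sub
          with finish st₁ px pv px′ py₂ (Switched.add S (inj₁ (inj₁ (refl , refl))))
                 (trans (sameV x′) x′v) (trans (sameV x) xv)
                 (trans (Switched.off S (separates (λ z → B₀ z v₀) xv₀ x′v₀ ∘ sym) (cells≢ px′ py)
                          (separates (B y) (trans (sy s _ _) x′y) yx″) (cells≢ px′ py₂)) x′y₂) uv xv₀ uy₂ x′v₀
          where
          sameV : ∀ z → B₁ z v ≡ B z v
          sameV z = Switched.offʳ S s (cells≢ px pv ∘ sym) (separates (B x) xy xv ∘ sym) (cells≢ px″ pv ∘ sym) (separates (B₀ u) uv uy₂)
        ... | B₂ , st₂ , sub₂ , f = B₂ , st₂ , (λ a b q → sub a b (sub₂ a b q)) , f

    -- Completeness between N(v₀) and N(u), together with equal degrees, makes these two sets a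
    -- component of the bipartite graph between the cells: `rowS` and `colT` say that no edge leaves
    -- it.
    module Complete (B : Adj n) (st : St B) (full : ∀ x v → p x ≡ c → p v ≡ c′ → B x v₀ ≡ true → B u v ≡ true → B x v ≡ true) where
      s = proj₁ st
      r = proj₁ (proj₂ st)
      hu = proj₁ (proj₂ (proj₂ st))
      hv = proj₂ (proj₂ (proj₂ st))
      eqB = equit-real eq₀ r
      uv₀′ : B u v₀ ≡ true
      uv₀′ = trans (hu v₀ pv₀) uv₀

      rowS : ∀ x y → p x ≡ c → p y ≡ c′ → B x v₀ ≡ true → B x y ≡ true → B u y ≡ true
      rowS x y px py xv₀ xy = proj₁ (nbr-elim B (count-⊆-eq {P = nbr B u c′} {nbr B x c′}
        (λ a h → let (h₁ , h₂) = nbr-elim B h in nbr-intro B (full x a px h₂ xv₀ h₁) h₂)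
        (eqB c′ (trans pu (sym px))) y (nbr-intro B xy py)))

      colT : ∀ x y → p x ≡ c → p y ≡ c′ → B u y ≡ true → B x y ≡ true → B x v₀ ≡ true
      colT x y px py uy xy = trans (sy s _ _) (proj₁ (nbr-elim B (count-⊆-eq {P = nbr B v₀ c} {nbr B y c}
        (λ a h → let (h₁ , h₂) = nbr-elim B h in
           nbr-intro B (trans (sy s _ _) (full a y h₂ py (trans (sy s _ _) h₁) uy)) h₂)
        (eqB c (trans pv₀ (sym py))) x (nbr-intro B (trans (sy s _ _) xy) px))))

      2*-< : ∀ {t m} → 2 ≤ t → 2 * t ≤ m → t < m
      2*-< {t} h k = ℕₚ.≤-trans (ℕₚ.m<m+n t (ℕₚ.≤-trans (s≤s z≤n) h)) (ℕₚ.≤-trans (ℕₚ.+-monoʳ-≤ t (ℕₚ.m≤m+n t 0)) k)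

      module Switch {x y v₁ x₁} (px : p x ≡ c) (xv₀ : B x v₀ ≡ false) (py : p y ≡ c′) (xy : B x y ≡ true)
        (pv₁ : p v₁ ≡ c′) (v₁≢v₀ : v₁ ≢ v₀) (uv₁ : B u v₁ ≡ true)
        (px₁ : p x₁ ≡ c) (x₁≢u : x₁ ≢ u) (x₁v₀ : B x₁ v₀ ≡ true) where
        uy : B u y ≡ false
        uy = not-true λ h → true≢false (colT x y px py h xy) xv₀
        u≢x : u ≢ x
        u≢x = separates (λ z → B z v₀) uv₀′ xv₀
        x₁≢x : x₁ ≢ x
        x₁≢x = separates (λ z → B z v₀) x₁v₀ xv₀

        -- `x` lies in a complete bipartite component, expressed locally: every path of three edges
        -- from `x` closes to a 4-cycle.
        D : Adj n → Fin n → Set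
        D E x = p x ≡ c × (∀ y x′ y′ → p y ≡ c′ → p x′ ≡ c → p y′ ≡ c′ → E x y ≡ true → E x′ y ≡ true → E x′ y′ ≡ true → E x y′ ≡ true)

        D-invariant : ∀ {E E′} φ → CellIso E E′ φ → ∀ x → D E x → D E′ (φ x)
        D-invariant {E} {E′} φ (b , pφ , aφ) x (px , h) = trans (pφ x) px , λ y x′ y′ py px′ py′ h₁ h₂ h₃ →
          trans (cong (E′ (φ x)) (sym (f∘inv b y′))) (trans (aφ _ _) (h (inv b y) (inv b x′) (inv b y′)
            (trans (pi y) py) (trans (pi x′) px′) (trans (pi y′) py′)
            (trans (sym (aφ _ _)) (trans (cong (E′ (φ x)) (f∘inv b y)) h₁))
            (trans (sym (aφ _ _)) (trans (cong₂ E′ (f∘inv b x′) (f∘inv b y)) h₂))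
            (trans (sym (aφ _ _)) (trans (cong₂ E′ (f∘inv b x′) (f∘inv b y′)) h₃))))
          where
          pi : ∀ z → p (inv b z) ≡ p z
          pi z = trans (sym (pφ _)) (cong p (f∘inv b z))

        Du : D B u
        Du = pu , λ y x′ y′ py px′ py′ h₁ h₂ h₃ → rowS x′ y′ px′ py′ (colT x′ y px′ py h₁ h₂) h₃

        A : Alternating B u v₀ x y
        A = record { ab = uv₀′ ; cd = xy ; ad = uy ; cb = xv₀ ; a≢d = cells≢ pu py ; b≢c = cells≢ px pv₀ ∘ sym
                   ; pac = trans pu (sym px) ; pbd = trans pv₀ (sym py) }

        B₂ = proj₁ (switched s A)
        open Switched (proj₂ (switched s A))

        kept′ : ∀ {a b} → p a ≡ c → p b ≡ c′ → a ≢ x → (a ≢ u ⊎ b ≢ v₀) → B a b ≡ true → B₂ a b ≡ true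
        kept′ {a} {b} pa pb ax aub h with kept h
        ... | inj₁ k = k
        ... | inj₂ (inj₁ (inj₁ (e , e′))) = ⊥-elim ([ (λ q → q e) , (λ q → q e′) ]′ aub)
        ... | inj₂ (inj₁ (inj₂ (e , _))) = ⊥-elim (cells≢ pa pv₀ e)
        ... | inj₂ (inj₂ (inj₁ (e , _))) = ⊥-elim (ax e)
        ... | inj₂ (inj₂ (inj₂ (e , _))) = ⊥-elim (cells≢ pa py e)

        old′ : ∀ {a b} → p a ≡ c → p b ≡ c′ → (a ≢ u ⊎ b ≢ y) → (a ≢ x ⊎ b ≢ v₀) → B₂ a b ≡ true → B a b ≡ true
        old′ {a} {b} pa pb h₁ h₂ h with old h
        ... | inj₁ k = k
        ... | inj₂ (inj₁ (inj₁ (e , e′))) = ⊥-elim ([ (λ q → q e) , (λ q → q e′) ]′ h₁)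
        ... | inj₂ (inj₁ (inj₂ (e , _))) = ⊥-elim (cells≢ pa py e)
        ... | inj₂ (inj₂ (inj₁ (e , e′))) = ⊥-elim ([ (λ q → q e) , (λ q → q e′) ]′ h₂)
        ... | inj₂ (inj₂ (inj₂ (e , _))) = ⊥-elim (cells≢ pa pv₀ e)

        x₁v₁₂ : B₂ x₁ v₁ ≡ true
        x₁v₁₂ = kept′ px₁ pv₁ x₁≢x (inj₁ x₁≢u) (full x₁ v₁ px₁ pv₁ x₁v₀ uv₁)
        x₁v₀₂ : B₂ x₁ v₀ ≡ true
        x₁v₀₂ = kept′ px₁ pv₀ x₁≢x (inj₁ x₁≢u) x₁v₀
        uv₁₂ : B₂ u v₁ ≡ true
        uv₁₂ = kept′ pu pv₁ u≢x (inj₂ v₁≢v₀) uv₁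

        ¬Du : ¬ D B₂ u
        ¬Du (_ , h) = true≢false (h v₁ x₁ v₀ pv₁ px₁ pv₀ uv₁₂ x₁v₁₂ x₁v₀₂) (rem (inj₁ (inj₁ (refl , refl))))

        ¬Dx : ¬ D B₂ x
        ¬Dx (_ , h) = true≢false (colT x v₁ px pv₁ uv₁ (old′ px pv₁ (inj₁ (u≢x ∘ sym)) (inj₂ v₁≢v₀)
          (h v₀ x₁ v₁ pv₀ px₁ pv₁ (add (inj₂ (inj₁ (refl , refl)))) x₁v₀₂ x₁v₁₂))) xv₀

        -- A path of `B` may use a removed edge. If this is `u v₀`, completeness closes the path. If
        -- it is `x y`, membership of `z` in the new set would tie `x` or `y` to the component of
        -- `u`, against `rowS` and `colT`.
        sub : ∀ z → D B₂ z → D B z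
        sub z Dz@(pz , h) = pz , go
          where
          z≢u : z ≢ u
          z≢u refl = ¬Du Dz
          z≢x : z ≢ x
          z≢x e = ¬Dx (subst (D B₂) e Dz)
          go : ∀ y₁ x′ y₂ → p y₁ ≡ c′ → p x′ ≡ c → p y₂ ≡ c′ → B z y₁ ≡ true → B x′ y₁ ≡ true → B x′ y₂ ≡ true → B z y₂ ≡ true
          go y₁ x′ y₂ py₁ px′ py₂ h₁ h₂ h₃ with kept h₂ | kept h₃
          ... | inj₁ k₂ | inj₁ k₃ = old′ pz py₂ (inj₁ z≢u) (inj₁ z≢x) (h y₁ x′ y₂ py₁ px′ py₂ (kept′ pz py₁ z≢x (inj₁ z≢u) h₁) k₂ k₃)
          ... | inj₂ (inj₁ (inj₁ (refl , refl))) | _ = full z y₂ pz py₂ h₁ h₃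
          ... | inj₂ (inj₁ (inj₂ (e , _))) | _ = ⊥-elim (cells≢ px′ pv₀ e)
          ... | inj₂ (inj₂ (inj₂ (e , _))) | _ = ⊥-elim (cells≢ px′ py e)
          ... | inj₂ (inj₂ (inj₁ (e , e′))) | _ = ⊥-elim (true≢false (rowS z y pz py zv₀ zy) uy)
            where
            zy : B z y ≡ true
            zy = subst (λ k → B z k ≡ true) e′ h₁
            zv₀ : B z v₀ ≡ true
            zv₀ = colT z v₁ pz pv₁ uv₁ (old′ pz pv₁ (inj₁ z≢u) (inj₁ z≢x)
              (h y u v₁ py pu pv₁ (kept′ pz py z≢x (inj₁ z≢u) zy) (add (inj₁ (inj₁ (refl , refl)))) uv₁₂))
          ... | inj₁ k₂ | inj₂ (inj₁ (inj₁ (refl , refl))) = colT z y₁ pz py₁ h₂ h₁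
          ... | inj₁ k₂ | inj₂ (inj₁ (inj₂ (e , _))) = ⊥-elim (cells≢ px′ pv₀ e)
          ... | inj₁ k₂ | inj₂ (inj₂ (inj₂ (e , _))) = ⊥-elim (cells≢ px′ py e)
          ... | inj₁ k₂ | inj₂ (inj₂ (inj₁ (e , e′))) = ⊥-elim (true≢false
              (colT x y₁ px py₁ (rowS z y₁ pz py₁ zv₀ h₁) (subst (λ k → B k y₁ ≡ true) e h₂)) xv₀)
            where
            zv₀ : B z v₀ ≡ true
            zv₀ = old′ pz pv₀ (inj₁ z≢u) (inj₁ z≢x) (h y₁ x v₀ py₁ px pv₀ (kept′ pz py₁ z≢x (inj₁ z≢u) h₁)
              (subst (λ k → B₂ k y₁ ≡ true) e k₂) (add (inj₂ (inj₁ (refl , refl)))))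

        absurd : ⊥
        absurd = ¬Du (no-shrink (rigid-real rg₀ s r B₂ simple real) D (λ φ i → D-invariant φ i) sub u Du)

      absurd : ⊥
      absurd
        with count-outside (nbr B v₀ c) (inCell c) (2*-< (subst (2 ≤_) (sym (r v₀ c)) t≥2) (subst (λ k → 2 * k ≤ size c) (sym (r v₀ c)) t-sparse))
           | count-two {P = nbr B u c′} (subst (2 ≤_) (sym (r u c′)) s≥2) v₀
           | count-two {P = nbr B v₀ c} (subst (2 ≤_) (sym (r v₀ c)) t≥2) u
      ... | x , cx , nx | v₁ , v₁≢v₀ , nv₁ | x₁ , x₁≢u , nx₁
        with count-witness (nbr B x c′) (ℕₚ.≤-trans (s≤s z≤n)
               (subst (2 ≤_) (trans (sym (r u c′)) (eqB c′ (trans pu (sym (inCell-elim cx))))) s≥2))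
      ... | y , ny
        with nbr-elim B nv₁ | nbr-elim B nx₁ | nbr-elim B ny
      ... | uv₁ , pv₁ | v₀x₁ , px₁ | xy , py =
        Switch.absurd (inCell-elim cx) (trans (sy s _ _) (nbr-false B nx (inCell-elim cx))) py xy pv₁ v₁≢v₀ uv₁ px₁ x₁≢u (trans (sy s _ _) v₀x₁)

  biregular-absurd : ⊥
  biregular-absurd =
    -- No bad pair is ever stuck, so the improvement ends with none left.
    let (B , st , done) = improve St Bad (λ _ _ _ → ⊥) step B₀ (s₀ , (λ _ _ → refl) , (λ _ _ → refl) , (λ _ _ → refl))
        (_ , _ , hu , hv) = st
    in Complete.absurd B st λ x v px pv xv₀ uv → 𝔹ₚ.¬-not {y = false} λ f →
         done x v (bad-intro B x v px pv (trans (sym (hv x px)) xv₀) (trans (sym (hu v pv)) uv) f)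

-- A sparse cell of degree at least two is a 5-cycle: otherwise one can switch towards a clique
-- component, which a further switch destroys, or (when the size is 2d + 1) towards a graph
-- that cannot be isomorphic to its complement.
module RegularCell {n : ℕ} (p : Fin n → Fin n)
  {B₀ : Adj n} (s₀ : Simple B₀) (eq₀ : Cells.Equit p B₀) (rg₀ : Cells.Rigid p B₀)
  {c u : Fin n} (pu : p u ≡ c) where
  open Cells p

  private
    d = deg B₀ u c

    -- Inside one cell `x` and `z` may be neighbours of each other. Transposing them before the
    -- neighbourhoods are compared cancels that edge, so the vertex obtained is not `x`.
    exchange-closed : ∀ {B} → Simple B → Equit B → ∀ {x z v} → p x ≡ c → p z ≡ c → p v ≡ c → v ≢ x → v ≢ z →
      B x v ≡ true → B z v ≡ false → ∃ λ t → p t ≡ c × B z t ≡ true × t ≢ x × B x t ≡ false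
    exchange-closed {B} s eq {x} {z} {v} px pz pv vx vz t f
      with count-exchange {P = λ k → nbr B x c (swp x z k)} {Q = nbr B z c}
            (trans (count-∘ (swp-bij x z) (nbr B x c)) (eq c (trans px (sym pz))))
            v (trans (cong (nbr B x c) (swp-other vx vz)) (nbr-intro B t pv)) (nbr-non B f)
    ... | w , q , r with nbr-elim B q
    ... | zw , pw = w , pw , zw , w≢x , trans (cong (B x) (sym (swp-other w≢x (adj≢ s zw ∘ sym)))) xw
      where
      w≢x : w ≢ x
      w≢x refl = true≢false (trans (sy s _ _) zw) (nbr-false B (trans (cong (nbr B w c) (sym (swp-left w z))) r) pz)
      xw : B x (swp x z w) ≡ false
      xw = nbr-false B r (trans (cong p (swp-other w≢x (adj≢ s zw ∘ sym))) pw)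

    -- Only the neighbourhood of `u` inside its cell is frozen; the aim is to turn it into a clique.
    St : Adj n → Set
    St B = Simple B × Real B₀ B × (∀ v → p v ≡ c → B u v ≡ B₀ u v)

    Bad : Adj n → Adj n
    Bad B v w = (inCell c v ∧ inCell c w) ∧ ((B₀ u v ∧ B₀ u w) ∧ (not (does (v ≟ w)) ∧ not (B v w)))

    BadP : Adj n → Fin n → Fin n → Set
    BadP B v w = p v ≡ c × p w ≡ c × B₀ u v ≡ true × B₀ u w ≡ true × v ≢ w × B v w ≡ false

    bad-elim : ∀ B v w → Bad B v w ≡ true → BadP B v w
    bad-elim B v w h with ∧-true h
    ... | h₁ , h₂ with ∧-true h₁ | ∧-true h₂
    ... | h₃ , h₄ | h₅ , h₆ with ∧-true h₅ | ∧-true h₆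
    ... | h₇ , h₈ | h₉ , h₀ = inCell-elim h₃ , inCell-elim h₄ , h₇ , h₈ , does-false (v ≟ w) (not-false h₉) , not-false h₀

    bad-intro : ∀ B v w → BadP B v w → Bad B v w ≡ true
    bad-intro B v w (h₁ , h₂ , h₃ , h₄ , h₅ , h₆) = ∧-intro (∧-intro (inCell-true h₁) (inCell-true h₂))
      (∧-intro (∧-intro h₃ h₄) (∧-intro (cong not (dec-false (v ≟ w) h₅)) (cong not h₆)))

    Better : Adj n → Fin n → Fin n → Set
    Better B v w = ∃ λ B₁ → St B₁ × (∀ x′ v′ → Bad B₁ x′ v′ ≡ true → Bad B x′ v′ ≡ true) × Bad B₁ v w ≡ false

    Out : Fin n → Fin n → Set
    Out x v = B₀ u x ≡ false ⊎ B₀ u v ≡ false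

    keep : ∀ {B a b e k} → St B → Alternating B a b e k → p a ≡ c → p b ≡ c → u ≢ a → u ≢ b → u ≢ e → u ≢ k →
      Out a b → Out e k →
      ∃ λ B₁ → Switched B a b e k B₁ × St B₁ × (∀ x y → Bad B₁ x y ≡ true → Bad B x y ≡ true)
    keep {B} {a} {b} {e} {k} (s , r , hu) A pa pb ua ub ue uk o₁ o₂ with switched s A
    ... | B₁ , S = B₁ , S , (simple , real-trans r real , λ v pv → trans (off ua ub ue uk) (hu v pv))
        , λ x y h → let (h₁ , h₂ , h₃ , h₄ , h₅ , h₆) = bad-elim B₁ x y h in
            bad-intro B x y (h₁ , h₂ , h₃ , h₄ , h₅ , not-true λ xy → case kept xy of λ
            { (inj₁ q) → true≢false q h₆
            ; (inj₂ (inj₁ (inj₁ (refl , refl)))) → out o₁ h₃ h₄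
            ; (inj₂ (inj₁ (inj₂ (refl , refl)))) → out o₁ h₄ h₃
            ; (inj₂ (inj₂ (inj₁ (refl , refl)))) → out o₂ h₃ h₄
            ; (inj₂ (inj₂ (inj₂ (refl , refl)))) → out o₂ h₄ h₃ })
      where
      open Switched S
      out : ∀ {x v} → Out x v → B₀ u x ≡ true → B₀ u v ≡ true → ⊥
      out (inj₁ f) t _ = true≢false t f
      out (inj₂ f) _ t = true≢false t f

    Far : Adj n → Fin n → Set
    Far B y = p y ≡ c × y ≢ u × B u y ≡ false

    finish : ∀ {B v w y z} → St B → BadP B v w → Far B y → Far B z → z ≢ y →
      B v z ≡ true → B w y ≡ true → B y z ≡ false → Better B v w
    finish {B} {v} {w} {y} {z} st@(s , r , hu) (pv , pw , uv , uw , v≢w , vw) (py , yu , uy) (pz , zu , uz) zy vz wy yz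
      with keep st (record { ab = vz ; cd = trans (sy s _ _) wy ; ad = vw ; cb = yz ; a≢d = v≢w ; b≢c = zy
                           ; pac = trans pv (sym py) ; pbd = trans pz (sym pw) })
             pv pz (adj≢ s₀ uv) (zu ∘ sym) (yu ∘ sym) (adj≢ s₀ uw)
             (inj₂ (trans (sym (hu _ pz)) uz)) (inj₁ (trans (sym (hu _ py)) uy))
    ... | B₁ , S , st₁ , sub = B₁ , st₁ , sub , not-true λ h → let (_ , _ , _ , _ , _ , f) = bad-elim B₁ v w h in
            true≢false (Switched.add S (inj₁ (inj₁ (refl , refl)))) f

    far≢ : ∀ {B v y} → St B → B₀ u v ≡ true → Far B y → v ≢ y
    far≢ {B} (s , r , hu) uv (py , _ , uy) refl = true≢false uv (trans (sym (hu _ py)) uy)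

    -- The case where `v` misses `z`: the edges `v x` and `z t` are first replaced by `v z` and
    -- `x t`. The inequalities show that the data needed by `finish` survive this switch.
    module Prepare {B v w y z x t} (st : St B) (bad : BadP B v w) (fy : Far B y) (fz : Far B z)
      (zy : z ≢ y) (wy : B w y ≡ true) (yz : B y z ≡ false) (vz : B v z ≡ false)
      (fx : Far B x) (vx : B v x ≡ true) (pt : p t ≡ c) (zt : B z t ≡ true) (t≢x : t ≢ x) (xt : B x t ≡ false) where
      s = proj₁ st
      hu = proj₂ (proj₂ st)
      pv = proj₁ bad
      pw = proj₁ (proj₂ bad)
      uv = proj₁ (proj₂ (proj₂ bad))
      uw = proj₁ (proj₂ (proj₂ (proj₂ bad)))
      v≢w = proj₁ (proj₂ (proj₂ (proj₂ (proj₂ bad))))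
      vw = proj₂ (proj₂ (proj₂ (proj₂ (proj₂ bad))))
      w≢x : w ≢ x
      w≢x = far≢ st uw fx
      w≢z : w ≢ z
      w≢z = far≢ st uw fz
      z≢x : z ≢ x
      z≢x = separates (B v) vx vz ∘ sym
      u≢t : u ≢ t
      u≢t e = true≢false (trans (sy s _ _) (subst (λ k → B z k ≡ true) (sym e) zt)) (proj₂ (proj₂ fz))
      A : Alternating B v x t z
      A = record { ab = vx ; cd = trans (sy s _ _) zt ; ad = vz ; cb = trans (sy s _ _) xt ; a≢d = far≢ st uv fz
                 ; b≢c = t≢x ∘ sym ; pac = trans pv (sym pt) ; pbd = trans (proj₁ fx) (sym (proj₁ fz)) }

      module _ {B₁} (S : Switched B v x t z B₁) (st₁ : St B₁) (sub : ∀ x y → Bad B₁ x y ≡ true → Bad B x y ≡ true) where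
        open Switched S
        far₁ : ∀ {k} → Far B k → Far B₁ k
        far₁ (pk , k≢u , uk) = pk , k≢u , trans (proj₂ (proj₂ st₁) _ pk) (trans (sym (hu _ pk)) uk)
        vw₁ : B₁ v w ≡ false
        vw₁ = not-true λ h → case old h of λ
          { (inj₁ q) → true≢false q vw
          ; (inj₂ (inj₁ (inj₁ (_ , e)))) → w≢z e
          ; (inj₂ (inj₁ (inj₂ (e , _)))) → far≢ st uv fz e
          ; (inj₂ (inj₂ (inj₁ (_ , e)))) → w≢x e
          ; (inj₂ (inj₂ (inj₂ (e , _)))) → adj≢ s vx e }
        wy₁ : B₁ w y ≡ true
        wy₁ = case kept wy of λ
          { (inj₁ q) → q
          ; (inj₂ (inj₁ (inj₁ (e , _)))) → ⊥-elim (v≢w (sym e))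
          ; (inj₂ (inj₁ (inj₂ (e , _)))) → ⊥-elim (w≢x e)
          ; (inj₂ (inj₂ (inj₁ (_ , e)))) → ⊥-elim (zy (sym e))
          ; (inj₂ (inj₂ (inj₂ (e , _)))) → ⊥-elim (w≢z e) }
        yz₁ : B₁ y z ≡ false
        yz₁ = not-true λ h → case old h of λ
          { (inj₁ q) → true≢false q yz
          ; (inj₂ (inj₁ (inj₁ (e , _)))) → far≢ st uv fy (sym e)
          ; (inj₂ (inj₁ (inj₂ (e , _)))) → zy (sym e)
          ; (inj₂ (inj₂ (inj₁ (_ , e)))) → z≢x e
          ; (inj₂ (inj₂ (inj₂ (_ , e)))) → adj≢ s zt e }
        finish₁ : Better B₁ v w
        finish₁ = finish st₁ (pv , pw , uv , uw , v≢w , vw₁) (far₁ fy) (far₁ fz) zy (add (inj₁ (inj₁ (refl , refl)))) wy₁ yz₁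
        result : Better B v w
        result = proj₁ finish₁ , proj₁ (proj₂ finish₁) , (λ a b q → sub a b (proj₁ (proj₂ (proj₂ finish₁)) a b q))
               , proj₂ (proj₂ (proj₂ finish₁))

      better : Better B v w
      better = let (B₁ , S , st₁ , sub) = keep st A pv (proj₁ fx) (adj≢ s₀ uv) (proj₁ (proj₂ fx) ∘ sym) u≢t (proj₁ (proj₂ fz) ∘ sym)
                      (inj₂ (trans (sym (hu _ (proj₁ fx))) (proj₂ (proj₂ fx)))) (inj₂ (trans (sym (hu _ (proj₁ fz))) (proj₂ (proj₂ fz))))
               in result S st₁ sub

    better : ∀ {B v w y z} → St B → BadP B v w → Far B y → Far B z → z ≢ y → B w y ≡ true → B y z ≡ false → Better B v w
    better {B} {v} {w} {y} {z} st bad fy fz zy wy yz = go (B v z) refl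
      where
      s = proj₁ st
      eqB = equit-real eq₀ (proj₁ (proj₂ st))
      pv = proj₁ bad
      pw = proj₁ (proj₂ bad)
      uv = proj₁ (proj₂ (proj₂ bad))
      uw = proj₁ (proj₂ (proj₂ (proj₂ bad)))
      v≢w = proj₁ (proj₂ (proj₂ (proj₂ (proj₂ bad))))
      vw = proj₂ (proj₂ (proj₂ (proj₂ (proj₂ bad))))
      go : ∀ b → B v z ≡ b → Better B v w
      go true  vz = finish st bad fy fz zy vz wy yz
      go false vz =
        let (x , px , vx , x≢u , ux) = exchange-closed s eqB pu pv pw (adj≢ s₀ uw ∘ sym) (v≢w ∘ sym) (trans (proj₂ (proj₂ st) w pw) uw) vw
            (t , pt , zt , t≢x , xt) = exchange-closed s eqB px (proj₁ fz) pv (adj≢ s vx) (far≢ st uv fz) (trans (sy s _ _) vx) (trans (sy s _ _) vz)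
        in Prepare.better st bad fy fz zy wy yz vz (px , x≢u , ux) vx pt zt t≢x xt

    -- The obstruction to repairing the missing edge `v w`. Counting excludes it in cells with more
    -- than 2d + 1 vertices; with exactly 2d + 1 vertices, `Tight` exploits it.
    Stuck : Adj n → Fin n → Fin n → Set
    Stuck B v w = ∀ y z → Far B y → Far B z → z ≢ y → B w y ≡ true → B y z ≡ true

    far? : ∀ B y → Dec (Far B y)
    far? B y = (p y ≟ c) ×-dec (¬? (y ≟ u) ×-dec (B u y 𝔹ₚ.≟ false))

    step : ∀ B → St B → ∀ v w → Bad B v w ≡ true → Stuck B v w ⊎ Better B v w
    step B st v w bad = collect λ y → collect λ z → try y z
      where
      try : ∀ y z → (Far B y → Far B z → z ≢ y → B w y ≡ true → B y z ≡ true) ⊎ Better B v w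
      try y z with far? B y | far? B z | z ≟ y | B w y in wy | B y z in yz
      ... | no ¬f | _ | _ | _ | _ = inj₁ λ f → ⊥-elim (¬f f)
      ... | _ | no ¬f | _ | _ | _ = inj₁ λ _ f → ⊥-elim (¬f f)
      ... | _ | _ | yes e | _ | _ = inj₁ λ _ _ ne → ⊥-elim (ne e)
      ... | _ | _ | _ | false | _ = inj₁ λ _ _ _ ()
      ... | _ | _ | _ | _ | true = inj₁ λ _ _ _ _ → refl
      ... | yes fy | yes fz | no zy | true | false = inj₂ (better st (bad-elim B v w bad) fy fz zy wy yz)

    clo : Adj n → Fin n → Fin n → Bool
    clo B x k = nbr B x c k ∨ does (k ≟ x)

    count-clo : ∀ {B} → Simple B → ∀ x → countFin n (clo B x) ≡ suc (deg B x c)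
    count-clo {B} s x = begin
      countFin n (clo B x) ≡⟨ sym (ℕₚ.+-identityʳ _) ⟩
      countFin n (clo B x) + 0 ≡⟨ cong (countFin n (clo B x) +_) (sym (count-false disjoint)) ⟩
      countFin n (clo B x) + countFin n (λ k → nbr B x c k ∧ does (k ≟ x)) ≡⟨ count-∨-∧ (nbr B x c) (λ k → does (k ≟ x)) ⟩
      deg B x c + countFin n (λ k → does (k ≟ x)) ≡⟨ cong (deg B x c +_) (count-single x) ⟩
      deg B x c + 1 ≡⟨ ℕₚ.+-comm _ 1 ⟩
      suc (deg B x c) ∎
      where
      open ≡-Reasoning
      disjoint : ∀ k → nbr B x c k ∧ does (k ≟ x) ≡ false
      disjoint k = not-true λ h → let (h₁ , h₂) = ∧-true {nbr B x c k} h in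
        adj≢ s (proj₁ (nbr-elim B h₁)) (sym (does-true (k ≟ x) h₂))

    clo-false : ∀ {B x k} → clo B x k ≡ false → p k ≡ c → k ≢ x × B x k ≡ false
    clo-false {B} {x} {k} h pk with ∨-false {nbr B x c k} h
    ... | h₁ , h₂ = does-false (k ≟ x) h₂ , nbr-false B h₁ pk

    module Clique {B : Adj n} (st : St B) (d≥2 : 2 ≤ d) (d<m : suc d < size c)
      (clique : ∀ v w → p v ≡ c → p w ≡ c → B u v ≡ true → B u w ≡ true → v ≢ w → B v w ≡ true) where
      s = proj₁ st
      r = proj₁ (proj₂ st)
      eqB = equit-real eq₀ r
      degc : ∀ x → p x ≡ c → deg B x c ≡ d
      degc x px = trans (eqB c (trans px (sym pu))) (r u c)

      -- `v` is adjacent to `u` and to all of N(u) except itself, which uses up its `d` neighbours: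
      -- N(u) together with `u` is a component of the cell.
      closed : ∀ {v y} → p v ≡ c → p y ≡ c → B u v ≡ true → B v y ≡ true → y ≢ u → B u y ≡ true
      closed {v} {y} pv py uv vy y≢u = 𝔹ₚ.¬-not {y = false} λ uy →
        let (t , pt , ut , t≢v , vt) = exchange-closed s eqB pv pu py (adj≢ s vy ∘ sym) y≢u vy uy
        in true≢false (clique v t pv pt uv ut (t≢v ∘ sym)) vt

      -- One switch of `u v₀` and `x y` breaks the clique around `u`. The further neighbours `v₁`,
      -- `e` and `e′`, available because d ≥ 2, show that afterwards none of the four corners has a
      -- clique as neighbourhood, so `D` loses `u` and gains nothing.
      module Switch {x y v₀ v₁ e e′}
        (px : p x ≡ c) (py : p y ≡ c) (pv₀ : p v₀ ≡ c) (pv₁ : p v₁ ≡ c) (pe : p e ≡ c) (pe′ : p e′ ≡ c)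
        (x≢u : x ≢ u) (ux : B u x ≡ false) (xy : B x y ≡ true) (uv₀ : B u v₀ ≡ true) (uv₁ : B u v₁ ≡ true) (v₁≢v₀ : v₁ ≢ v₀)
        (xe : B x e ≡ true) (e≢y : e ≢ y) (ye′ : B y e′ ≡ true) (e′≢x : e′ ≢ x) where
        y≢u : y ≢ u
        y≢u refl = true≢false (trans (sy s _ _) xy) ux
        far : ∀ {k} → p k ≡ c → B x k ≡ true → B u k ≡ false
        far pk xk = not-true λ uk → true≢false (closed pk px uk (trans (sy s _ _) xk) x≢u) ux
        uy : B u y ≡ false
        uy = far py xy
        farY : ∀ {k} → p k ≡ c → B y k ≡ true → B u k ≡ false
        farY pk yk = not-true λ uk → true≢false (closed pk py uk (trans (sy s _ _) yk) y≢u) uy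
        non-x : ∀ {k} → p k ≡ c → B u k ≡ true → B x k ≡ false
        non-x pk uk = not-true λ xk → true≢false uk (far pk xk)
        non-y : ∀ {k} → p k ≡ c → B u k ≡ true → B y k ≡ false
        non-y pk uk = not-true λ yk → true≢false uk (farY pk yk)
        u≢v₀ = adj≢ s uv₀
        x≢v₀ : x ≢ v₀
        x≢v₀ = separates (B u) uv₀ ux ∘ sym
        y≢v₀ : y ≢ v₀
        y≢v₀ = separates (B u) uv₀ uy ∘ sym
        x≢v₁ : x ≢ v₁
        x≢v₁ = separates (B u) uv₁ ux ∘ sym
        y≢v₁ : y ≢ v₁
        y≢v₁ = separates (B u) uv₁ uy ∘ sym
        x≢y = adj≢ s xy
        A : Alternating B u v₀ x y
        A = record { ab = uv₀ ; cd = xy ; ad = uy ; cb = non-x pv₀ uv₀ ; a≢d = y≢u ∘ sym ; b≢c = x≢v₀ ∘ sym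
                   ; pac = trans pu (sym px) ; pbd = trans pv₀ (sym py) }

        D : Adj n → Fin n → Set
        D E x = p x ≡ c × ∀ y z → p y ≡ c → p z ≡ c → E x y ≡ true → E x z ≡ true → y ≢ z → E y z ≡ true

        D-invariant : ∀ {E E′} φ → CellIso E E′ φ → ∀ x → D E x → D E′ (φ x)
        D-invariant {E} {E′} φ (b , pφ , aφ) x (px , h) = trans (pφ x) px , λ y z py pz h₁ h₂ ne →
          trans (cong₂ E′ (sym (f∘inv b y)) (sym (f∘inv b z))) (trans (aφ _ _) (h _ _ (trans (pi y) py) (trans (pi z) pz)
            (trans (sym (aφ _ _)) (trans (cong (E′ (φ x)) (f∘inv b y)) h₁))
            (trans (sym (aφ _ _)) (trans (cong (E′ (φ x)) (f∘inv b z)) h₂))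
            (λ q → ne (proj₁ (inv-bij b) q))))
          where
          pi : ∀ z → p (inv b z) ≡ p z
          pi z = trans (sym (pφ _)) (cong p (f∘inv b z))

        module _ {B₂} (S : Switched B u v₀ x y B₂) where
          open Switched S

          kept′ : ∀ {a k} → B a k ≡ true → ¬ Pair u v₀ a k → ¬ Pair x y a k → B₂ a k ≡ true
          kept′ h n₁ n₂ with kept h
          ... | inj₁ q = q
          ... | inj₂ (inj₁ q) = ⊥-elim (n₁ q)
          ... | inj₂ (inj₂ q) = ⊥-elim (n₂ q)

          old′ : ∀ {a k} → B₂ a k ≡ true → ¬ Pair u y a k → ¬ Pair x v₀ a k → B a k ≡ true
          old′ h n₁ n₂ with old h
          ... | inj₁ q = q
          ... | inj₂ (inj₁ q) = ⊥-elim (n₁ q)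
          ... | inj₂ (inj₂ q) = ⊥-elim (n₂ q)

          noPair : ∀ {a b k l : Fin n} → (k ≢ a ⊎ l ≢ b) → (k ≢ b ⊎ l ≢ a) → ¬ Pair a b k l
          noPair h _ (inj₁ (e , f)) = [ (λ q → q e) , (λ q → q f) ]′ h
          noPair _ h (inj₂ (e , f)) = [ (λ q → q e) , (λ q → q f) ]′ h

          u≢v₁ = adj≢ s uv₁

          ¬Du : ¬ D B₂ u
          ¬Du (_ , h) = true≢false (old′
              (h v₁ y pv₁ py (kept′ uv₁ (noPair (inj₂ v₁≢v₀) (inj₁ u≢v₀)) (noPair (inj₁ (x≢u ∘ sym)) (inj₁ (y≢u ∘ sym))))
                (add (inj₁ (inj₁ (refl , refl)))) (y≢v₁ ∘ sym))
              (noPair (inj₁ (u≢v₁ ∘ sym)) (inj₁ (y≢v₁ ∘ sym))) (noPair (inj₁ (x≢v₁ ∘ sym)) (inj₁ v₁≢v₀)))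
            (trans (sy s _ _) (non-y pv₁ uv₁))

          ¬Dx : ¬ D B₂ x
          ¬Dx (_ , h) = true≢false (old′
              (h v₀ e pv₀ pe (add (inj₂ (inj₁ (refl , refl)))) (kept′ xe (noPair (inj₁ x≢u) (inj₁ x≢v₀)) (noPair (inj₂ e≢y) (inj₁ x≢y))) v₀≢e)
              (noPair (inj₁ (u≢v₀ ∘ sym)) (inj₁ (y≢v₀ ∘ sym))) (noPair (inj₁ (x≢v₀ ∘ sym)) (inj₂ (adj≢ s xe ∘ sym))))
            (not-true λ q → true≢false (closed pv₀ pe uv₀ q e≢u) (far pe xe))
            where
            v₀≢e : v₀ ≢ e
            v₀≢e = separates (B u) uv₀ (far pe xe)
            e≢u : e ≢ u
            e≢u = separates (B x) xe (trans (sy s _ _) ux)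

          ¬Dv₀ : ¬ D B₂ v₀
          ¬Dv₀ (_ , h) = true≢false (old′
              (h x v₁ px pv₁ (add (inj₂ (inj₂ (refl , refl)))) (kept′ (clique v₀ v₁ pv₀ pv₁ uv₀ uv₁ (v₁≢v₀ ∘ sym))
                 (noPair (inj₁ (u≢v₀ ∘ sym)) (inj₂ (u≢v₁ ∘ sym))) (noPair (inj₁ (x≢v₀ ∘ sym)) (inj₁ (y≢v₀ ∘ sym)))) x≢v₁)
              (noPair (inj₁ x≢u) (inj₁ x≢y)) (noPair (inj₂ v₁≢v₀) (inj₁ x≢v₀)))
            (non-x pv₁ uv₁)

          ¬Dy : ¬ D B₂ y
          ¬Dy (_ , h) = true≢false (old′
              (h u e′ pu pe′ (add (inj₁ (inj₂ (refl , refl)))) (kept′ ye′ (noPair (inj₁ y≢u) (inj₁ y≢v₀)) (noPair (inj₁ (x≢y ∘ sym)) (inj₂ e′≢x)))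
                 (separates (B y) ye′ (trans (sy s _ _) uy) ∘ sym))
              (noPair (inj₂ (adj≢ s ye′ ∘ sym)) (inj₁ (y≢u ∘ sym))) (noPair (inj₁ (x≢u ∘ sym)) (inj₁ u≢v₀)))
            (farY pe′ ye′)

          sub : ∀ z → D B₂ z → D B z
          sub z Dz@(pz , h) = pz , λ a b pa pb za zb a≢b →
            old′ (h a b pa pb (trans (offz a) za) (trans (offz b) zb) a≢b)
              (λ { (inj₁ (refl , refl)) → uyz za zb ; (inj₂ (refl , refl)) → uyz zb za })
              (λ { (inj₁ (refl , refl)) → xv₀z za zb ; (inj₂ (refl , refl)) → xv₀z zb za })
            where
            z≢u : z ≢ u
            z≢u refl = ¬Du Dz
            offz : ∀ k → B₂ z k ≡ B z k
            offz k = off z≢u (λ { refl → ¬Dv₀ Dz }) (λ { refl → ¬Dx Dz }) (λ { refl → ¬Dy Dz })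
            uyz : B z u ≡ true → B z y ≡ true → ⊥
            uyz h k = true≢false (trans (sy s _ _) k) (non-y pz (trans (sy s _ _) h))
            xv₀z : B z x ≡ true → B z v₀ ≡ true → ⊥
            xv₀z h k = true≢false (trans (sy s _ _) h) (non-x pz (closed pv₀ pz uv₀ (trans (sy s _ _) k) z≢u))

          contradictory : ⊥
          contradictory = ¬Du (no-shrink (rigid-real rg₀ s r B₂ simple real) D (λ φ i → D-invariant φ i) sub u
            (pu , λ a b pa pb h₁ h₂ → clique a b pa pb h₁ h₂))

        absurd : ⊥
        absurd = contradictory (proj₂ (switched s A))

      absurd : ⊥
      absurd
        with count-outside (clo B u) (inCell c) (subst (_< size c) (sym (trans (count-clo s u) (cong suc (degc u pu)))) d<m)
           | count-witness (nbr B u c) (subst (1 ≤_) (sym (degc u pu)) (ℕₚ.<⇒≤ d≥2))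
      ... | x , cx , nx | v₀ , nv₀
        with clo-false {B} nx (inCell-elim cx) | nbr-elim B nv₀
           | count-two {P = nbr B u c} (subst (2 ≤_) (sym (degc u pu)) d≥2) v₀
           | count-witness (nbr B x c) (subst (1 ≤_) (sym (degc x (inCell-elim cx))) (ℕₚ.<⇒≤ d≥2))
      ... | x≢u , ux | uv₀ , pv₀ | v₁ , v₁≢v₀ , nv₁ | y , ny
        with nbr-elim B nv₁ | nbr-elim B ny
           | count-two {P = nbr B x c} (subst (2 ≤_) (sym (degc x (inCell-elim cx))) d≥2) y
           | count-two {P = nbr B y c} (subst (2 ≤_) (sym (degc y (proj₂ (nbr-elim B ny)))) d≥2) x
      ... | uv₁ , pv₁ | xy , py | e , e≢y , ne | e′ , e′≢x , ne′ =
        Switch.absurd (inCell-elim cx) py pv₀ pv₁ (proj₂ (nbr-elim B ne)) (proj₂ (nbr-elim B ne′)) x≢u ux xy uv₀ uv₁ v₁≢v₀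
          (proj₁ (nbr-elim B ne)) e≢y (proj₁ (nbr-elim B ne′)) e′≢x

    module Improved {B : Adj n} (st : St B) (stuck : ∀ v w → Bad B v w ≡ true → Stuck B v w) where
      s = proj₁ st
      r = proj₁ (proj₂ st)
      hu = proj₂ (proj₂ st)
      eqB = equit-real eq₀ r
      degc : ∀ x → p x ≡ c → deg B x c ≡ d
      degc x px = trans (eqB c (trans px (sym pu))) (r u c)
      bad : ∀ {v w} → p v ≡ c → p w ≡ c → B u v ≡ true → B u w ≡ true → v ≢ w → B v w ≡ false → Bad B v w ≡ true
      bad pv pw uv uw ne f = bad-intro B _ _ (pv , pw , trans (sym (hu _ pv)) uv , trans (sym (hu _ pw)) uw , ne , f)

      large-absurd : 2 ≤ d → 2 * suc d ≤ size c → ⊥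
      large-absurd d≥2 le = Clique.absurd st d≥2
          (ℕₚ.≤-trans (ℕₚ.m<m+n (suc d) {suc (d + 0)} (s≤s z≤n)) le) clique
        where
        clique : ∀ v w → p v ≡ c → p w ≡ c → B u v ≡ true → B u w ≡ true → v ≢ w → B v w ≡ true
        clique v w pv pw uv uw v≢w = 𝔹ₚ.¬-not {y = false} λ vw →
          let (y , py , wy , y≢u , uy) = exchange-closed s eqB pu pw pv (adj≢ s uv ∘ sym) v≢w uv (trans (sy s _ _) vw)
              (z , cz , nz , mz) = count-avoid (clo B u) (clo B y) (inCell c)
                 (ℕₚ.≤-trans (ℕₚ.≤-reflexive (trans (cong₂ _+_ (trans (count-clo s u) (cong suc (degc u pu)))
                     (trans (count-clo s y) (cong suc (degc y py)))) (cong (suc d +_) (sym (ℕₚ.+-identityʳ _))))) le)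
                 w (∨-introˡ (does (w ≟ u)) (nbr-intro B uw pw)) (∨-introˡ (does (w ≟ y)) (nbr-intro B (trans (sy s _ _) wy) pw))
              (z≢u , uz) = clo-false {B} nz (inCell-elim cz)
              (z≢y , yz) = clo-false {B} mz (inCell-elim cz)
          in true≢false (stuck v w (bad pv pw uv uw v≢w vw) y z (py , y≢u , uy) (inCell-elim cz , z≢u , uz) z≢y wy) yz

      -- Here `u` has `d` neighbours and a set `W` of `d` non-neighbours. It turns out that `W` is a
      -- clique and that every vertex lies in a triangle. Complementing the cell keeps the degree,
      -- as (2d + 1) - 1 - d = d, but makes the neighbours of `u` independent; so the complement
      -- cannot be isomorphic to `B`.
      module Tight (d≥3 : 3 ≤ d) (tight : size c ≡ suc (d + d)) where
        W : Fin n → Bool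
        W k = inCell c k ∧ not (clo B u k)

        W-elim : ∀ {k} → W k ≡ true → Far B k
        W-elim {k} h with ∧-true {inCell c k} h
        ... | h₁ , h₂ = let (a , b) = clo-false {B} (not-false h₂) (inCell-elim h₁) in inCell-elim h₁ , a , b

        W-intro : ∀ {k} → Far B k → W k ≡ true
        W-intro {k} (pk , k≢u , uk) = ∧-intro (inCell-true pk) (cong not (not-true λ h → case ∨-true {nbr B u c k} h of λ
          { (inj₁ q) → true≢false (proj₁ (nbr-elim B q)) uk ; (inj₂ q) → k≢u (does-true (k ≟ u) q) }))

        count-W : countFin n W ≡ d
        count-W = ℕₚ.+-cancelˡ-≡ (suc d) _ _ (trans (cong (_+ countFin n W)
            (sym (trans (count-cong in-clo) (trans (count-clo s u) (cong suc (degc u pu))))))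
          (trans (sym (count-split (inCell c) (clo B u))) tight))
          where
          in-clo : ∀ k → inCell c k ∧ clo B u k ≡ clo B u k
          in-clo k = bool-ext (λ h → proj₂ (∧-true {inCell c k} h)) (λ h → ∧-intro (in-c (∨-true {nbr B u c k} h)) h)
            where
            in-c : nbr B u c k ≡ true ⊎ does (k ≟ u) ≡ true → inCell c k ≡ true
            in-c (inj₁ q) = inCell-true (proj₂ (nbr-elim B q))
            in-c (inj₂ q) = inCell-true (trans (cong p (does-true (k ≟ u) q)) pu)

        count-clo-c : ∀ {y} → p y ≡ c → countFin n (clo B y) ≡ suc d
        count-clo-c py = trans (count-clo s _) (cong suc (degc _ py))

        clo-cell : ∀ {y k} → p y ≡ c → clo B y k ≡ true → p k ≡ c
        clo-cell {y} {k} py h with ∨-true {nbr B y c k} h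
        ... | inj₁ q = proj₂ (nbr-elim B q)
        ... | inj₂ q = trans (cong p (does-true (k ≟ y) q)) py

        -- The closed neighbourhood of `y` has d + 1 vertices and does not fit into `W`.
        near : ∀ y → Far B y → ∃ λ w → p w ≡ c × B u w ≡ true × B y w ≡ true
        near y (py , y≢u , uy) with any? (λ w → (p w ≟ c) ×-dec ((B u w 𝔹ₚ.≟ true) ×-dec (B y w 𝔹ₚ.≟ true)))
        ... | yes q = q
        ... | no ¬q = ⊥-elim (ℕₚ.<-irrefl refl (ℕₚ.≤-trans (ℕₚ.≤-reflexive (sym (count-clo-c py)))
               (ℕₚ.≤-trans (count-⊆ sub) (ℕₚ.≤-reflexive count-W))))
          where
          sub : ∀ k → clo B y k ≡ true → W k ≡ true
          sub k h with ∨-true {nbr B y c k} h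
          ... | inj₂ q = subst (λ z → W z ≡ true) (sym (does-true (k ≟ y) q)) (W-intro (py , y≢u , uy))
          ... | inj₁ q with nbr-elim B q
          ... | yk , pk = W-intro (pk , separates (B y) yk (trans (sy s _ _) uy) , not-true λ uk → ¬q (k , pk , uk , yk))

        -- `y` has a neighbour `w` in N(u). As `w` is adjacent to `y`, which `u` is not, some `t` in
        -- N(u) is missed by `w`, and the missing edge `t w` is stuck.
        W-clique : ∀ {y z} → Far B y → Far B z → z ≢ y → B y z ≡ true
        W-clique {y} {z} fy@(py , y≢u , uy) fz zy =
          let (w , pw , uw , yw) = near y fy
              (t , pt , ut , t≢w , wt) = exchange-closed s eqB pw pu py (adj≢ s yw) y≢u (trans (sy s _ _) yw) uy
          in stuck t w (bad pt pw ut uw t≢w (trans (sy s _ _) wt)) y z fy fz zy (trans (sy s _ _) yw)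

        -- The clique `W` takes d - 1 of the neighbours of `y`, which leaves a single one in N(u).
        near-unique : ∀ {y w w′} → Far B y → p w ≡ c → p w′ ≡ c → B u w ≡ true → B u w′ ≡ true → B y w ≡ true → B y w′ ≡ true → w ≡ w′
        near-unique {y} {w} {w′} fy@(py , y≢u , uy) pw pw′ uw uw′ yw yw′ with w ≟ w′
        ... | yes e = e
        ... | no ne = ⊥-elim (ℕₚ.<-irrefl refl (begin-strict
            suc d <⟨ ℕₚ.n<1+n _ ⟩
            2 + d ≤⟨ ℕₚ.+-mono-≤ (count≥2 {P = λ k → clo B y k ∧ not (W k)} ne (inside pw uw yw) (inside pw′ uw′ yw′)) (ℕₚ.≤-reflexive (sym count-W)) ⟩
            countFin n (λ k → clo B y k ∧ not (W k)) + countFin n W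
              ≤⟨ ℕₚ.+-monoʳ-≤ _ (count-⊆ λ k h → ∧-intro (W⊆ k h) h) ⟩
            countFin n (λ k → clo B y k ∧ not (W k)) + countFin n (λ k → clo B y k ∧ W k) ≡⟨ ℕₚ.+-comm (countFin n (λ k → clo B y k ∧ not (W k))) _ ⟩
            countFin n (λ k → clo B y k ∧ W k) + countFin n (λ k → clo B y k ∧ not (W k)) ≡⟨ sym (count-split (clo B y) W) ⟩
            countFin n (clo B y) ≡⟨ count-clo-c py ⟩
            suc d ∎))
          where
          open ℕₚ.≤-Reasoning
          inside : ∀ {k} → p k ≡ c → B u k ≡ true → B y k ≡ true → clo B y k ∧ not (W k) ≡ true
          inside {k} pk uk yk = ∧-intro (∨-introˡ (does (k ≟ y)) (nbr-intro B yk pk))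
            (cong not (not-true λ h → true≢false uk (proj₂ (proj₂ (W-elim h)))))
          W⊆ : ∀ k → W k ≡ true → clo B y k ≡ true
          W⊆ k h with k ≟ y
          ... | yes _ = ∨-introʳ (nbr B y c k) refl
          ... | no ne′ = ∨-introˡ false (nbr-intro B (W-clique fy (W-elim h) ne′) (proj₁ (W-elim h)))

        Edge : Fin n → Set
        Edge x = ∃₂ λ a b → p a ≡ c × p b ≡ c × B x a ≡ true × B x b ≡ true × B a b ≡ true

        two-others : ∀ x → p x ≡ c → ∀ w → ∃₂ λ a b → a ≢ w × b ≢ w × b ≢ a × p a ≡ c × p b ≡ c × B x a ≡ true × B x b ≡ true
        two-others x px w
          with count-three {P = nbr B x c} (subst (3 ≤_) (sym (degc x px)) d≥3) w w
        ... | a , a≢w , _ , na with count-three {P = nbr B x c} (subst (3 ≤_) (sym (degc x px)) d≥3) w a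
        ... | b , b≢w , b≢a , nb = a , b , a≢w , b≢w , b≢a , proj₂ (nbr-elim B na) , proj₂ (nbr-elim B nb) , proj₁ (nbr-elim B na) , proj₁ (nbr-elim B nb)

        edge-N : ∀ x → p x ≡ c → B u x ≡ true → Edge x
        edge-N x px ux with any? (λ k → (p k ≟ c) ×-dec ((B u k 𝔹ₚ.≟ true) ×-dec (B x k 𝔹ₚ.≟ true)))
        ... | yes (k , pk , uk , xk) = u , k , pu , pk , trans (sy s _ _) ux , xk , uk
        ... | no ¬q with two-others x px u
        ... | a , b , a≢u , b≢u , b≢a , pa , pb , xa , xb = a , b , pa , pb , xa , xb ,
              W-clique (pa , a≢u , not-true λ h → ¬q (a , pa , h , xa)) (pb , b≢u , not-true λ h → ¬q (b , pb , h , xb)) b≢a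

        edge-W : ∀ x → Far B x → Edge x
        edge-W x fx@(px , x≢u , ux) with near x fx
        ... | w , pw , uw , xw with two-others x px w
        ... | a , b , a≢w , b≢w , b≢a , pa , pb , xa , xb = a , b , pa , pb , xa , xb ,
              W-clique (far pa xa a≢w) (far pb xb b≢w) b≢a
          where
          far : ∀ {k} → p k ≡ c → B x k ≡ true → k ≢ w → Far B k
          far pk xk k≢w = pk , separates (B x) xk (trans (sy s _ _) ux) , not-true λ uk → k≢w (near-unique fx pk pw uk uw xk xw)

        edge-u : Edge u
        edge-u with any? (λ a → any? (λ b → (p a ≟ c) ×-dec ((p b ≟ c) ×-dec ((B u a 𝔹ₚ.≟ true) ×-dec ((B u b 𝔹ₚ.≟ true) ×-dec (B a b 𝔹ₚ.≟ true))))))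
        ... | yes q = q
        ... | no ¬q with two-others u pu u
        -- If N(u) were independent, N(v) and N(w) would lie in `W` together with `u` and, by
        -- `near-unique`, meet only in `u`. Then 2d ≤ (d + 1) + 1, against d ≥ 3.
        ... | v , w , _ , _ , w≢v , pv , pw , uv , uw = ⊥-elim (ℕₚ.<⇒≱ d≥3 (ℕₚ.+-cancelʳ-≤ d d 2 (begin
            d + d ≡⟨ sym (cong₂ _+_ (degc v pv) (degc w pw)) ⟩
            deg B v c + deg B w c ≡⟨ sym (count-∨-∧ (nbr B v c) (nbr B w c)) ⟩
            countFin n (λ k → nbr B v c k ∨ nbr B w c k) + countFin n (λ k → nbr B v c k ∧ nbr B w c k)
              ≤⟨ ℕₚ.+-mono-≤ (count-⊆ {Q = λ k → W k ∨ does (k ≟ u)} λ k h → [ in-W pv uv k , in-W pw uw k ]′ (∨-true {nbr B v c k} h))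
                             (count-⊆ {Q = λ k → does (k ≟ u)} common) ⟩
            countFin n (λ k → W k ∨ does (k ≟ u)) + countFin n (λ k → does (k ≟ u))
              ≤⟨ ℕₚ.+-mono-≤ (ℕₚ.≤-trans (ℕₚ.m≤m+n _ _) (ℕₚ.≤-reflexive (trans (count-∨-∧ W (λ k → does (k ≟ u))) (cong₂ _+_ count-W (count-single u)))))
                             (ℕₚ.≤-reflexive (count-single u)) ⟩
            (d + 1) + 1 ≡⟨ trans (ℕₚ.+-assoc d 1 1) (ℕₚ.+-comm d 2) ⟩
            2 + d ∎)))
          where
          open ℕₚ.≤-Reasoning
          far : ∀ {a} → p a ≡ c → B u a ≡ true → ∀ {k} → p k ≡ c → B a k ≡ true → k ≢ u → Far B k
          far {a} pa ua {k} pk ak ne = pk , ne , not-true λ uk → ¬q (a , k , pa , pk , ua , uk , ak)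
          in-W : ∀ {a} → p a ≡ c → B u a ≡ true → ∀ k → nbr B a c k ≡ true → W k ∨ does (k ≟ u) ≡ true
          in-W {a} pa ua k h = go (k ≟ u)
            where
            go : Dec (k ≡ u) → W k ∨ does (k ≟ u) ≡ true
            go (yes e) = ∨-introʳ (W k) (dec-true (k ≟ u) e)
            go (no ne) = ∨-introˡ (does (k ≟ u)) (W-intro (far pa ua (proj₂ (nbr-elim B h)) (proj₁ (nbr-elim B h)) ne))
          common : ∀ k → nbr B v c k ∧ nbr B w c k ≡ true → does (k ≟ u) ≡ true
          common k h with k ≟ u | ∧-true {nbr B v c k} h
          ... | yes _ | _ = refl
          ... | no ne | h₁ , h₂ with nbr-elim B h₁ | nbr-elim B h₂
          ... | vk , pk | wk , _ = ⊥-elim (w≢v (near-unique (far pv uv pk vk ne) pw pv uw uv (trans (sy s _ _) wk) (trans (sy s _ _) vk)))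

        edge : ∀ x → p x ≡ c → Edge x
        edge x px with x ≟ u | B u x in ux
        ... | yes refl | _ = edge-u
        ... | no _ | true = edge-N x px ux
        ... | no x≢u | false = edge-W x (px , x≢u , ux)

        inside? : ∀ a b → Dec (p a ≡ c × p b ≡ c × a ≢ b)
        inside? a b = (p a ≟ c) ×-dec ((p b ≟ c) ×-dec ¬? (a ≟ b))

        co : Adj n
        co a b = if does (inside? a b) then not (B a b) else B a b

        co-in : ∀ {a b} → p a ≡ c → p b ≡ c → a ≢ b → co a b ≡ not (B a b)
        co-in {a} {b} pa pb ne rewrite dec-true (inside? a b) (pa , pb , ne) = refl

        co-out : ∀ {a b} → ¬ (p a ≡ c × p b ≡ c × a ≢ b) → co a b ≡ B a b
        co-out {a} {b} h rewrite dec-false (inside? a b) h = refl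

        co-simple : Simple co
        co-simple = record { sy = sym′ ; ir = λ a → trans (co-out {a} {a} (λ (_ , _ , ne) → ne refl)) (ir s a) }
          where
          sym′ : ∀ a b → co a b ≡ co b a
          sym′ a b = go (inside? a b)
            where
            go : Dec (p a ≡ c × p b ≡ c × a ≢ b) → co a b ≡ co b a
            go (yes (pa , pb , ne)) = trans (co-in pa pb ne) (trans (cong not (sy s a b)) (sym (co-in pb pa (ne ∘ sym))))
            go (no h) = trans (co-out h) (trans (sy s a b) (sym (co-out (λ (pb , pa , ne) → h (pa , pb , ne ∘ sym)))))

        co-real : Real B co
        co-real a k = go (p a ≟ c) (k ≟ c)
          where
          go : Dec (p a ≡ c) → Dec (k ≡ c) → deg co a k ≡ deg B a k
          go (no h) _ = count-cong {P = nbr co a k} {nbr B a k} λ b → cong (_∧ inCell k b) (co-out {a} {b} (λ (q , _) → h q))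
          go (yes pa) (no h) = count-cong {P = nbr co a k} {nbr B a k} λ b → bool-ext
              (λ q → let (q₁ , q₂) = nbr-elim co {a} {k} {b} q in nbr-intro B {a} {k} {b} (trans (sym (co-out {a} {b} (λ (_ , pb , _) → h (trans (sym q₂) pb)))) q₁) q₂)
              (λ q → let (q₁ , q₂) = nbr-elim B {a} {k} {b} q in nbr-intro co {a} {k} {b} (trans (co-out {a} {b} (λ (_ , pb , _) → h (trans (sym q₂) pb))) q₁) q₂)
          go (yes pa) (yes refl) = trans (count-cong {P = nbr co a c} eq) (trans count-rest (sym (degc a pa)))
            where
            eq : ∀ b → nbr co a c b ≡ inCell c b ∧ not (clo B a b)
            eq b = bool-ext
              (λ q → let (q₁ , q₂) = nbr-elim co {a} {c} {b} q in ∧-intro (inCell-true q₂) (cong not (not-true λ h → [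
                  (λ h₁ → true≢false q₁ (trans (co-in pa q₂ (adj≢ co-simple q₁)) (cong not (proj₁ (nbr-elim B h₁)))))
                , (λ h₂ → adj≢ co-simple q₁ (sym (does-true (b ≟ a) h₂))) ]′ (∨-true {nbr B a c b} h))))
              (λ q → let (q₁ , q₂) = ∧-true {inCell c b} q ; pb = inCell-elim q₁ ; (ne , f) = clo-false {B} (not-false q₂) pb
                     in nbr-intro co {a} {c} {b} (trans (co-in pa pb (ne ∘ sym)) (cong not f)) pb)
            count-rest : countFin n (λ b → inCell c b ∧ not (clo B a b)) ≡ d
            count-rest = ℕₚ.+-cancelˡ-≡ (suc d) _ _ (trans (cong (_+ countFin n (λ b → inCell c b ∧ not (clo B a b)))
                (sym (trans (count-cong λ k → bool-ext (λ h → proj₂ (∧-true {inCell c k} h)) (λ h → ∧-intro (inCell-true (clo-cell pa h)) h)) (count-clo-c pa))))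
              (trans (sym (count-split (inCell c) (clo B a))) tight))

        tight-absurd : ⊥
        tight-absurd with rigid-real rg₀ s r co co-simple co-real
        ... | φ , b , pφ , aφ with edge (φ u) (trans (pφ u) pu)
        ... | x , y , px , py , ux , uy , xy = true≢false (subst₂ (λ k l → B k l ≡ true) (sym ex) (sym ey) xy) nonadj
          where
          x₀ = inv b x
          y₀ = inv b y
          ex : φ x₀ ≡ x
          ex = f∘inv b x
          ey : φ y₀ ≡ y
          ey = f∘inv b y
          px₀ : p x₀ ≡ c
          px₀ = trans (sym (pφ _)) (trans (cong p ex) px)
          py₀ : p y₀ ≡ c
          py₀ = trans (sym (pφ _)) (trans (cong p ey) py)
          far : ∀ z → p z ≡ c → B (φ u) (φ z) ≡ true → Far B z
          far z pz h = pz , (λ { refl → true≢false h (ir s _) })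
            , trans (sym (aφ u z)) (trans (co-in (trans (pφ u) pu) (trans (pφ z) pz) (adj≢ s h)) (cong not h))
          x₀≢y₀ : y₀ ≢ x₀
          x₀≢y₀ e = adj≢ s xy (trans (sym ex) (trans (cong φ (sym e)) ey))
          x₀y₀ : B x₀ y₀ ≡ true
          x₀y₀ = W-clique (far x₀ px₀ (trans (cong (B (φ u)) ex) ux)) (far y₀ py₀ (trans (cong (B (φ u)) ey) uy)) x₀≢y₀
          nonadj : B (φ x₀) (φ y₀) ≡ false
          nonadj = not-false (trans (sym (co-in (trans (pφ _) px₀) (trans (pφ _) py₀) (λ e → x₀≢y₀ (sym (proj₁ b e)))))
            (trans (aφ x₀ y₀) x₀y₀))

  sparse-cell : suc (2 * d) ≤ size c → d ≤ 1 ⊎ (d ≡ 2 × size c ≡ 5)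
  sparse-cell sparse with improve St Bad Stuck step B₀ (s₀ , (λ _ _ → refl) , (λ _ _ → refl))
  ... | B , st , stuck with ℕₚ.<-cmp d 2
  ... | tri< lt _ _ = inj₁ (ℕₚ.≤-pred lt)
  ... | tri≈ _ e _ with ℕₚ.m≤n⇒m<n∨m≡n sparse
  ...   | inj₂ q = inj₂ (e , trans (sym q) (cong (λ k → suc (2 * k)) e))
  ...   | inj₁ lt = ⊥-elim (Improved.large-absurd st stuck (ℕₚ.≤-reflexive (sym e)) (ℕₚ.≤-trans (ℕₚ.≤-reflexive (ℕₚ.*-suc 2 d)) lt))
  sparse-cell sparse | B , st , stuck | tri> _ _ gt with ℕₚ.m≤n⇒m<n∨m≡n sparse
  ...   | inj₂ q = ⊥-elim (Improved.Tight.tight-absurd st stuck gt (trans (sym q) (cong (λ k → suc (d + k)) (ℕₚ.+-identityʳ d))))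
  ...   | inj₁ lt = ⊥-elim (Improved.large-absurd st stuck (ℕₚ.<⇒≤ gt) (ℕₚ.≤-trans (ℕₚ.≤-reflexive (ℕₚ.*-suc 2 d)) lt))

-- Canonical graphs

countℕ : ℕ → (ℕ → Bool) → ℕ
countℕ m R = countFin m (R ∘ toℕ)

countℕ-cong : ∀ m {R S : ℕ → Bool} → (∀ i → i < m → R i ≡ S i) → countℕ m R ≡ countℕ m S
countℕ-cong m h = count-cong (λ a → h (toℕ a) (Fₚ.toℕ<n a))

countℕ-false : ∀ m {R : ℕ → Bool} → (∀ i → i < m → R i ≡ false) → countℕ m R ≡ 0
countℕ-false m h = count-false (λ a → h (toℕ a) (Fₚ.toℕ<n a))

countℕ-true : ∀ m {R : ℕ → Bool} → (∀ i → i < m → R i ≡ true) → countℕ m R ≡ m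
countℕ-true zero    h = refl
countℕ-true (suc m) {R} h rewrite h 0 (s≤s z≤n) = cong suc (countℕ-true m (λ i l → h (suc i) (s≤s l)))

countℕ-+ : ∀ a b (R : ℕ → Bool) → countℕ (a + b) R ≡ countℕ a R + countℕ b (λ i → R (a + i))
countℕ-+ zero    b R = refl
countℕ-+ (suc a) b R = trans (cong ((if R 0 then 1 else 0) +_) (countℕ-+ a b (R ∘ suc)))
  (sym (ℕₚ.+-assoc (if R 0 then 1 else 0) _ _))

countℕ-≡ : ∀ m j → j < m → countℕ m (_≡ᵇ j) ≡ 1
countℕ-≡ (suc m) zero    _       = cong suc (countℕ-false m (λ _ _ → refl))
countℕ-≡ (suc m) (suc j) (s≤s l) = countℕ-≡ m j l

≡ᵇ-sym : ∀ i j → (i ≡ᵇ j) ≡ (j ≡ᵇ i)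
≡ᵇ-sym zero zero = refl
≡ᵇ-sym zero (suc j) = refl
≡ᵇ-sym (suc i) zero = refl
≡ᵇ-sym (suc i) (suc j) = ≡ᵇ-sym i j

-- Division by zero gives the junk value 0.
div mod : ℕ → ℕ → ℕ
div i zero    = 0
div i (suc t) = i DM./ suc t
mod i zero    = 0
mod i (suc t) = i DM.% suc t

div-small : ∀ {i t} → i < t → div i t ≡ 0
div-small {t = suc t} l = DM.m<n⇒m/n≡0 l

div-zero : ∀ {i t} → 1 ≤ t → div i t ≡ 0 → i < t
div-zero {t = suc t} _ e = DM.m/n≡0⇒m<n e

div-+ : ∀ t i → 1 ≤ t → div (t + i) t ≡ suc (div i t)
div-+ (suc t) i _ = trans (DM.+-distrib-/-∣ˡ i (divides 1 (sym (ℕₚ.*-identityˡ _)))) (cong (_+ i DM./ suc t) (DM.n/n≡1 (suc t)))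

div-block : ∀ j t r → r < t → div (j * t + r) t ≡ j
div-block zero    t r l = div-small l
div-block (suc j) t r l = trans (cong (λ z → div z t) (ℕₚ.+-assoc t (j * t) r))
  (trans (div-+ t _ (ℕₚ.≤-trans (s≤s z≤n) l)) (cong suc (div-block j t r l)))

div-< : ∀ {i} k t → i < k * t → div i t < k
div-< {i} k zero l = ⊥-elim (ℕₚ.n≮0 (subst (i <_) (ℕₚ.*-zeroʳ k) l))
div-< k (suc t) l = DM.m<n*o⇒m/o<n l

countℕ-div : ∀ k t j → j < k → countℕ (k * t) (λ i → div i t ≡ᵇ j) ≡ t
countℕ-div k zero j l = cong (λ z → countℕ z (λ i → div i 0 ≡ᵇ j)) (ℕₚ.*-zeroʳ k)
countℕ-div (suc k) (suc t) zero _ = trans (countℕ-+ (suc t) (k * suc t) (λ i → div i (suc t) ≡ᵇ 0))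
  (trans (cong₂ _+_ (countℕ-true (suc t) (λ i l → cong (_≡ᵇ 0) (div-small {i} l)))
                    (countℕ-false (k * suc t) (λ i l → cong (_≡ᵇ 0) (div-+ (suc t) i (s≤s z≤n)))))
         (ℕₚ.+-identityʳ _))
countℕ-div (suc k) (suc t) (suc j) (s≤s l) = trans (countℕ-+ (suc t) (k * suc t) (λ i → div i (suc t) ≡ᵇ suc j))
  (cong₂ _+_ (countℕ-false (suc t) (λ i l → cong (_≡ᵇ suc j) (div-small {i} l)))
             (trans (countℕ-cong (k * suc t) (λ i _ → cong (_≡ᵇ suc j) (div-+ (suc t) i (s≤s z≤n)))) (countℕ-div k (suc t) j l)))

mod-small : ∀ {i k} → i < k → mod i k ≡ i
mod-small {k = suc k} l = DM.m<n⇒m%n≡m l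

mod-< : ∀ {k} i → 1 ≤ k → mod i k < k
mod-< {suc k} i _ = DM.m%n<n i (suc k)

mod-+ : ∀ k i → mod (k + i) k ≡ mod i k
mod-+ zero i = refl
mod-+ (suc k) i = trans (cong (DM._% suc k) (ℕₚ.+-comm (suc k) i)) (DM.[m+n]%n≡m%n i (suc k))

countℕ-mod : ∀ k t j → j < k → countℕ (t * k) (λ i → mod i k ≡ᵇ j) ≡ t
countℕ-mod k zero j l = refl
countℕ-mod k (suc t) j l = trans (countℕ-+ k (t * k) (λ i → mod i k ≡ᵇ j))
  (cong₂ _+_ (trans (countℕ-cong k (λ i l → cong (_≡ᵇ j) (mod-small l))) (countℕ-≡ k j l))
             (trans (countℕ-cong (t * k) (λ i _ → cong (_≡ᵇ j) (mod-+ k i))) (countℕ-mod k t j l)))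

mod-suc-≢ : ∀ {k} a → 2 ≤ k → mod (suc a) k ≢ mod a k
mod-suc-≢ {suc zero} a (s≤s ())
mod-suc-≢ {suc (suc k)} a _ e with ℕₚ.m≤n⇒m<n∨m≡n (DM.m%n<n a (suc (suc k)))
... | inj₁ l = ℕₚ.1+n≢n (trans (sym (DM.m<n⇒m%n≡m l)) (trans (sym (DM.%-distribˡ-+ 1 a (suc (suc k)))) e))
... | inj₂ q = ℕₚ.0≢1+n (ℕₚ.suc-injective (trans (cong suc (trans (sym (trans (DM.%-congˡ {o = suc (suc k)} q) (DM.n%n≡0 (suc (suc k)))))
      (trans (sym (DM.%-distribˡ-+ 1 a (suc (suc k)))) e))) q))

-- Canonical graphs on one cell: empty, matching of the pairs {2k, 2k+1}, pentagon.
pentagon : ℕ → ℕ → Bool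
pentagon i j = (mod (suc i) 5 ≡ᵇ j) ∨ (mod (suc j) 5 ≡ᵇ i)

block : ℕ → ℕ → ℕ → Bool
block 0 i j = false
block 1 i j = not (i ≡ᵇ j) ∧ (div i 2 ≡ᵇ div j 2)
block _ i j = pentagon i j

block-sym : ∀ d i j → block d i j ≡ block d j i
block-sym 0 i j = refl
block-sym 1 i j = cong₂ _∧_ (cong not (≡ᵇ-sym i j)) (≡ᵇ-sym (div i 2) (div j 2))
block-sym (suc (suc _)) i j = 𝔹ₚ.∨-comm (mod (suc i) 5 ≡ᵇ j) _

block-irr : ∀ d i → block d i i ≡ false
block-irr 0 i = refl
block-irr 1 i rewrite ≡ᵇ-refl i = refl
block-irr (suc (suc _)) i = cong₂ _∨_ f f
  where
  f : (mod (suc i) 5 ≡ᵇ i) ≡ false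
  f with i ℕ.<? 5
  ... | yes l = ≡ᵇ-false _ i (λ e → mod-suc-≢ {5} i (s≤s (s≤s z≤n)) (trans e (sym (mod-small l))))
  ... | no ge = ≡ᵇ-false _ i (λ e → ge (subst (_< 5) e (mod-< {5} (suc i) (s≤s z≤n))))

countℕ-pentagon : ∀ i → i < 5 → countℕ 5 (pentagon i) ≡ 2
countℕ-pentagon 0 _ = refl
countℕ-pentagon 1 _ = refl
countℕ-pentagon 2 _ = refl
countℕ-pentagon 3 _ = refl
countℕ-pentagon 4 _ = refl
countℕ-pentagon (suc (suc (suc (suc (suc i))))) (s≤s (s≤s (s≤s (s≤s (s≤s ())))))

countℕ-matching : ∀ k i → i < k * 2 → countℕ (k * 2) (block 1 i) ≡ 1
countℕ-matching k i l = ℕₚ.suc-injective (begin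
  suc (countℕ m (block 1 i)) ≡⟨ cong (_+ countℕ m (block 1 i)) (sym (countℕ-≡ m i l)) ⟩
  countℕ m (_≡ᵇ i) + countℕ m (block 1 i)
    ≡⟨ cong₂ _+_ (countℕ-cong m same) (countℕ-cong m (λ j _ → diff j)) ⟩
  countℕ m (λ j → R j ∧ (j ≡ᵇ i)) + countℕ m (λ j → R j ∧ not (j ≡ᵇ i)) ≡⟨ sym (count-split {m} (R ∘ toℕ) ((_≡ᵇ i) ∘ toℕ)) ⟩
  countℕ m R ≡⟨ countℕ-div k 2 (div i 2) (div-< k 2 l) ⟩
  2 ∎)
  where
  open ≡-Reasoning
  m = k * 2
  R : ℕ → Bool
  R j = div j 2 ≡ᵇ div i 2
  same : ∀ j → j < m → (j ≡ᵇ i) ≡ R j ∧ (j ≡ᵇ i)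
  same j _ = bool-ext (λ h → ∧-intro (subst (λ z → (div z 2 ≡ᵇ div i 2) ≡ true) (sym (≡ᵇ-true j i h)) (≡ᵇ-refl (div i 2))) h)
                      (λ h → proj₂ (∧-true {R j} h))
  diff : ∀ j → block 1 i j ≡ R j ∧ not (j ≡ᵇ i)
  diff j = trans (cong₂ (λ a b → not a ∧ b) (≡ᵇ-sym i j) (≡ᵇ-sym (div i 2) (div j 2))) (𝔹ₚ.∧-comm (not (j ≡ᵇ i)) (R j))

-- A link between two cells with degrees a and b: the identity for a = b = 1, otherwise the graph of a function.
link : ℕ → ℕ → (ℕ → ℕ) → (ℕ → ℕ) → ℕ → ℕ → Bool
link 1 1 f g i j = i ≡ᵇ j
link 1 (suc (suc _)) f g i j = f i ≡ᵇ j
link (suc (suc _)) 1 f g i j = g j ≡ᵇ i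
link _ _ f g i j = false

link-sym : ∀ a b f g i j → link a b f g i j ≡ link b a g f j i
link-sym 0 0 f g i j = refl
link-sym 0 1 f g i j = refl
link-sym 0 (suc (suc b)) f g i j = refl
link-sym 1 0 f g i j = refl
link-sym 1 1 f g i j = ≡ᵇ-sym i j
link-sym 1 (suc (suc b)) f g i j = refl
link-sym (suc (suc a)) 0 f g i j = refl
link-sym (suc (suc a)) 1 f g i j = refl
link-sym (suc (suc a)) (suc (suc b)) f g i j = refl

module Standard {n : ℕ} (p : Fin n → Fin n) (p-idem : ∀ v → p (p v) ≡ p v)
  {B : Adj n} (sB : Simple B) (eqB : Cells.Equit p B)
  (double : ∀ {c c′} → p c ≡ c → p c′ ≡ c′ → Cells.size p c * Cells.deg p B c c′ ≡ Cells.size p c′ * Cells.deg p B c′ c)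
  (parity : ∀ {c} → p c ≡ c → Cells.deg p B c c ≡ 1 → ∃ λ k → Cells.size p c ≡ k * 2)
  (cell-type : ∀ {c} → p c ≡ c → Cells.deg p B c c ≤ 1 ⊎ (Cells.deg p B c c ≡ 2 × Cells.size p c ≡ 5))
  (pair-type : ∀ {c c′} → p c ≡ c → p c′ ≡ c′ → c ≢ c′ → Cells.deg p B c c′ ≤ 1 ⊎ Cells.deg p B c′ c ≤ 1)
  (sparse : ∀ {c c′} → p c ≡ c → p c′ ≡ c′ → c ≢ c′ → 2 * Cells.deg p B c c′ ≤ Cells.size p c′)
  (sparse-cell : ∀ {c} → p c ≡ c → suc (2 * Cells.deg p B c c) ≤ Cells.size p c) where
  open Cells p

  D : Fin n → Fin n → ℕ
  D = deg B

  idx : Fin n → ℕ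
  idx v = toℕ (to (enum (inCell (p v))) (v , inCell-true refl))

  idx-< : ∀ v → idx v < size (p v)
  idx-< v = Fₚ.toℕ<n (to (enum (inCell (p v))) (v , inCell-true refl))

  -- The inverse of `idx` on a cell; out of range it returns the name `c` as a default.
  at : Fin n → ℕ → Fin n
  at c i with i ℕ.<? size c
  ... | yes l = proj₁ (from (enum (inCell c)) (fromℕ< l))
  ... | no _  = c

  at-≡ : ∀ c i (l : i < size c) → at c i ≡ proj₁ (from (enum (inCell c)) (fromℕ< l))
  at-≡ c i l with i ℕ.<? size c
  ... | yes l′ = cong (λ z → proj₁ (from (enum (inCell c)) z)) (Fₚ.fromℕ<-cong i i refl l′ l)
  ... | no h = ⊥-elim (h l)

  at-cell : ∀ {c i} → i < size c → p (at c i) ≡ c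
  at-cell {c} {i} l = trans (cong p (at-≡ c i l)) (inCell-elim (proj₂ (from (enum (inCell c)) (fromℕ< l))))

  idx-at : ∀ {c i} → i < size c → idx (at c i) ≡ i
  idx-at {c} {i} l = go (at c i) (at-≡ c i l) (at-cell l)
    where
    go : ∀ v → v ≡ proj₁ (from (enum (inCell c)) (fromℕ< l)) → p v ≡ c → idx v ≡ i
    go v e refl = trans (cong (λ z → toℕ (to (enum (inCell (p v))) z)) (sub-≡ e))
      (trans (cong toℕ (to∘from (enum (inCell (p v))) (fromℕ< l))) (Fₚ.toℕ-fromℕ< l))

  at-idx : ∀ v → at (p v) (idx v) ≡ v
  at-idx v = trans (at-≡ (p v) (idx v) (idx-< v)) (trans (cong (λ z → proj₁ (from (enum (inCell (p v))) z))
    (Fₚ.fromℕ<-toℕ (to (enum (inCell (p v))) (v , inCell-true refl)) (idx-< v))) (cong proj₁ (from∘to (enum (inCell (p v))) (v , inCell-true refl))))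

  idx-inj : ∀ {u v} → p u ≡ p v → idx u ≡ idx v → u ≡ v
  idx-inj {u} {v} h e = trans (sym (at-idx u)) (trans (cong₂ at h e) (at-idx v))

  count-idx : ∀ c (R : ℕ → Bool) → countFin n (λ v → R (idx v) ∧ inCell c v) ≡ countℕ (size c) R
  count-idx c R = count-bij {f = f} (mkBij g gf fg)
    where
    E = enum (inCell c)
    toE : ∀ v (h : p v ≡ c) → idx v ≡ toℕ (to E (v , inCell-true h))
    toE v refl = refl
    f : Sub (λ v → R (idx v) ∧ inCell c v) → Sub (λ (a : Fin (size c)) → R (toℕ a))
    f (v , h) = to E (v , proj₂ (∧-true {R (idx v)} h))
      , trans (cong R (trans (cong (λ z → toℕ (to E z)) (sub-≡ refl)) (sym (toE v (inCell-elim (proj₂ (∧-true {R (idx v)} h))))))) (proj₁ (∧-true h))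
    g : Sub (λ (a : Fin (size c)) → R (toℕ a)) → Sub (λ v → R (idx v) ∧ inCell c v)
    g (a , h) = proj₁ (from E a) , ∧-intro (trans (cong R (trans (toE _ (inCell-elim (proj₂ (from E a))))
        (trans (cong (λ z → toℕ (to E z)) (sub-≡ refl)) (cong toℕ (to∘from E a))))) h) (proj₂ (from E a))
    gf : ∀ x → g (f x) ≡ x
    gf (v , h) = sub-≡ (cong proj₁ (from∘to E (v , proj₂ (∧-true {R (idx v)} h))))
    fg : ∀ y → f (g y) ≡ y
    fg (a , h) = sub-≡ (trans (cong (to E) (sub-≡ refl)) (to∘from E a))

  size-pos : ∀ {c} → p c ≡ c → 1 ≤ size c
  size-pos {c} h = count-pos c (inCell-true h)

  D-zero : ∀ {c c′} → p c ≡ c → p c′ ≡ c′ → D c c′ ≡ 0 → D c′ c ≡ 0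
  D-zero {c} {c′} h h′ e = ℕₚ.m*n≡0⇒m≡0 (D c′ c) (size c′) {{ℕ.>-nonZero (size-pos h′)}}
    (trans (ℕₚ.*-comm (D c′ c) _) (trans (sym (double h h′)) (trans (cong (size c *_) e) (ℕₚ.*-zeroʳ (size c)))))

  -- c → z is a proper link: every vertex of c has one neighbour in z, every vertex of z has several in c.
  Proper : Fin n → Fin n → Set
  Proper c z = (p c ≡ c × p z ≡ z × c ≢ z) × D c z ≡ 1 × 2 ≤ D z c

  Eq : Fin n → Fin n → Set
  Eq c c′ = (p c ≡ c × p c′ ≡ c′ × c ≢ c′) × D c c′ ≡ 1 × D c′ c ≡ 1

  eq-size : ∀ {c c′} → Eq c c′ → size c ≡ size c′
  eq-size {c} {c′} ((h , h′ , _) , a , b) = trans (sym (ℕₚ.*-identityʳ _)) (trans (cong (size c *_) (sym a))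
    (trans (double h h′) (trans (cong (size c′ *_) b) (ℕₚ.*-identityʳ _))))

  proper-size : ∀ {c z} → Proper c z → size c ≡ size z * D z c
  proper-size {c} {z} ((h , h′ , _) , a , b) = trans (sym (ℕₚ.*-identityʳ _)) (trans (cong (size c *_) (sym a)) (double h h′))

  proper-2≤ : ∀ {c z} → Proper c z → 2 ≤ size z
  proper-2≤ ((h , h′ , ne) , a , _) = subst (λ k → 2 * k ≤ size _) a (sparse h h′ ne)

  -- The functions on proper links are left open, because rigidity is exploited by comparing two
  -- different choices.
  record Maps (F : Fin n → Fin n → ℕ → ℕ) : Set where
    field
      map-<     : ∀ {c z} → Proper c z → ∀ i → i < size c → F c z i < size z
      map-fibre : ∀ {c z} → Proper c z → ∀ j → j < size z → countℕ (size c) (λ i → F c z i ≡ᵇ j) ≡ D z c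

  std : (Fin n → Fin n → ℕ → ℕ) → Adj n
  std F u v = if does (p u ≟ p v) then block (D (p u) (p u)) (idx u) (idx v)
              else link (D (p u) (p v)) (D (p v) (p u)) (F (p u) (p v)) (F (p v) (p u)) (idx u) (idx v)

  module _ (F : Fin n → Fin n → ℕ → ℕ) where

    std-same : ∀ {u v c} → p u ≡ c → p v ≡ c → std F u v ≡ block (D c c) (idx u) (idx v)
    std-same {u} {v} refl h rewrite dec-true (p u ≟ p v) (sym h) = refl

    std-diff : ∀ {u v c c′} → p u ≡ c → p v ≡ c′ → c ≢ c′ → std F u v ≡ link (D c c′) (D c′ c) (F c c′) (F c′ c) (idx u) (idx v)
    std-diff {u} {v} refl refl ne rewrite dec-false (p u ≟ p v) ne = refl

    std-simple : Simple (std F)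
    std-simple = record { sy = λ u v → go u v (p u ≟ p v) ; ir = λ u → trans (std-same refl refl) (block-irr (D (p u) (p u)) (idx u)) }
      where
      go : ∀ u v → Dec (p u ≡ p v) → std F u v ≡ std F v u
      go u v (yes h) = trans (std-same refl (sym h)) (trans (block-sym (D (p u) (p u)) (idx u) (idx v)) (sym (std-same (sym h) refl)))
      go u v (no h) = trans (std-diff refl refl h) (trans (link-sym (D (p u) (p v)) _ _ _ (idx u) (idx v)) (sym (std-diff refl refl (h ∘ sym))))

    std-eq : ∀ {u v c c′} → Eq c c′ → p u ≡ c → p v ≡ c′ → std F u v ≡ (idx u ≡ᵇ idx v)
    std-eq {u} {v} {c} {c′} ((_ , _ , ne) , a , b) h h′ = trans (std-diff h h′ ne)
      (cong₂ (λ x y → link x y (F c c′) (F c′ c) (idx u) (idx v)) a b)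

    std-proper : ∀ {u v c z} → Proper c z → p u ≡ c → p v ≡ z → std F u v ≡ (F c z (idx u) ≡ᵇ idx v)
    std-proper {u} {v} {c} {z} ((_ , _ , ne) , a , b) h h′ = trans (std-diff h h′ ne) (go (D c z) (D z c) a b)
      where
      go : ∀ x y → x ≡ 1 → 2 ≤ y → link x y (F c z) (F z c) (idx u) (idx v) ≡ (F c z (idx u) ≡ᵇ idx v)
      go .1 (suc (suc y)) refl _ = refl
      go .1 (suc zero) refl (s≤s ())

    std-none : ∀ {u v c z} → p c ≡ c → p z ≡ z → c ≢ z → D c z ≡ 0 → p u ≡ c → p v ≡ z → std F u v ≡ false
    std-none {u} {v} {c} {z} pc pz ne e h h′ = trans (std-diff h h′ ne)
      (cong₂ (λ x y → link x y (F c z) (F z c) (idx u) (idx v)) e (D-zero pc pz e))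

  data LinkType (c z : Fin n) : Set where
    none     : D c z ≡ 0 → LinkType c z
    equal    : Eq c z → LinkType c z
    proper   : Proper c z → LinkType c z
    proper⁻¹ : Proper z c → LinkType c z

  linkType : ∀ {c z} → p c ≡ c → p z ≡ z → c ≢ z → LinkType c z
  linkType {c} {z} pc pz ne = go (D c z) (D z c) refl refl (pair-type pc pz ne)
    where
    go : ∀ a b → D c z ≡ a → D z c ≡ b → D c z ≤ 1 ⊎ D z c ≤ 1 → LinkType c z
    go 0 b e f _ = none e
    go 1 0 e f _ = ⊥-elim (ℕₚ.0≢1+n (trans (sym (D-zero pz pc f)) e))
    go 1 1 e f _ = equal ((pc , pz , ne) , e , f)
    go 1 (suc (suc b)) e f _ = proper ((pc , pz , ne) , e , subst (2 ≤_) (sym f) (s≤s (s≤s z≤n)))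
    go (suc (suc a)) 0 e f _ = ⊥-elim (ℕₚ.0≢1+n (trans (sym (D-zero pz pc f)) e))
    go (suc (suc a)) 1 e f _ = proper⁻¹ ((pz , pc , ne ∘ sym) , f , subst (2 ≤_) (sym e) (s≤s (s≤s z≤n)))
    go (suc (suc a)) (suc (suc b)) e f h = ⊥-elim ([ (λ l → ℕₚ.<⇒≱ (subst (1 <_) (sym e) (s≤s (s≤s z≤n))) l)
                                                   , (λ l → ℕₚ.<⇒≱ (subst (1 <_) (sym f) (s≤s (s≤s z≤n))) l) ]′ h)

  -- The degrees depend only on the sizes of the fibres. Thus every choice of functions gives a
  -- realisation, and rigidity makes all these graphs isomorphic.
  std-real : ∀ {F} → Maps F → Real B (std F)
  std-real {F} M u c = go (p c ≟ c) (p u ≟ c)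
    where
    open Maps M
    pu = p-idem u
    degB : deg B u c ≡ D (p u) c
    degB = eqB c (sym (p-idem u))
    via : ∀ (R : ℕ → Bool) → (∀ v → p v ≡ c → std F u v ≡ R (idx v)) → deg (std F) u c ≡ countℕ (size c) R
    via R h = trans (count-cong {P = nbr (std F) u c} λ v → bool-ext
        (λ q → let (q₁ , q₂) = nbr-elim (std F) {u} q in ∧-intro (trans (sym (h v q₂)) q₁) (inCell-true q₂))
        (λ q → let (q₁ , q₂) = ∧-true {R (idx v)} q in nbr-intro (std F) {u} (trans (h v (inCell-elim q₂)) q₁) (inCell-elim q₂)))
      (count-idx c R)
    empty : p c ≢ c → ∀ (E : Adj n) → deg E u c ≡ 0
    empty h E = count-false λ v → not-true λ q → let (_ , q₂) = nbr-elim E {u} q in h (trans (cong p (sym q₂)) (trans (p-idem v) q₂))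
    cell : ∀ c → p c ≡ c → ∀ i → i < size c → countℕ (size c) (block (D c c) i) ≡ D c c
    cell c pc i l = case cell-type pc of λ
      { (inj₂ (d≡2 , s≡5)) → trans (cong₂ (λ x y → countℕ x (block y i)) s≡5 d≡2) (trans (countℕ-pentagon i (subst (i <_) s≡5 l)) (sym d≡2))
      ; (inj₁ le) → small (D c c) refl le }
      where
      small : ∀ x → D c c ≡ x → D c c ≤ 1 → countℕ (size c) (block (D c c) i) ≡ D c c
      small 0 e _ = trans (cong (λ y → countℕ (size c) (block y i)) e) (trans (countℕ-false (size c) (λ _ _ → refl)) (sym e))
      small 1 e _ with parity pc e
      ... | k , q = trans (cong₂ (λ x y → countℕ x (block y i)) q e) (trans (countℕ-matching k i (subst (i <_) q l)) (sym e))
      small (suc (suc x)) e le = ⊥-elim (ℕₚ.<⇒≱ (subst (1 <_) (sym e) (s≤s (s≤s z≤n))) le)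
    go : Dec (p c ≡ c) → Dec (p u ≡ c) → deg (std F) u c ≡ deg B u c
    go (no h) _ = trans (empty h (std F)) (sym (empty h B))
    go (yes pc) (yes h) = trans (via (block (D c c) (idx u)) (λ v hv → std-same F h hv))
      (trans (cell c pc (idx u) (subst (λ z → idx u < size z) h (idx-< u))) (trans (cong (λ z → D z c) (sym h)) (sym degB)))
    go (yes pc) (no h) with linkType pu pc h
    ... | none e = trans (via (λ _ → false) (λ v hv → std-none F pu pc h e refl hv))
          (trans (countℕ-false (size c) (λ _ _ → refl)) (trans (sym e) (sym degB)))
    ... | equal E@(_ , e , _) = trans (via (λ j → j ≡ᵇ idx u) (λ v hv → trans (std-eq F E refl hv) (≡ᵇ-sym (idx u) (idx v))))
          (trans (countℕ-≡ (size c) (idx u) (subst (idx u <_) (eq-size E) (idx-< u))) (trans (sym e) (sym degB)))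
    ... | proper P@(_ , e , _) = trans (via (λ j → j ≡ᵇ F (p u) c (idx u)) (λ v hv → trans (std-proper F P refl hv) (≡ᵇ-sym _ (idx v))))
          (trans (countℕ-≡ (size c) _ (map-< P (idx u) (idx-< u))) (trans (sym e) (sym degB)))
    ... | proper⁻¹ P = trans (via (λ j → F c (p u) j ≡ᵇ idx u) (λ v hv → trans (sy (std-simple F) u v) (std-proper F P hv refl)))
          (trans (map-fibre P (idx u) (idx-< u)) (sym degB))

  F₀ : Fin n → Fin n → ℕ → ℕ
  F₀ c z i = div i (D z c)

  F₀-maps : Maps F₀
  F₀-maps = record
    { map-< = λ {c} {z} P i l → div-< (size z) (D z c) (subst (i <_) (proper-size P) l)
    ; map-fibre = λ {c} {z} P j l → trans (cong (λ k → countℕ k (λ i → div i (D z c) ≡ᵇ j)) (proper-size P)) (countℕ-div (size z) (D z c) j l) }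

  G₀ : Adj n
  G₀ = std F₀

  -- The fibres of the quotient map are intervals of indices. Replacing it on one link by the
  -- remainder map keeps the fibre sizes but separates consecutive indices. `Clash` shows that no
  -- isomorphism can achieve this if the same indices carry further structure.
  module Twist (rg : Rigid G₀) {c₁ w : Fin n} (P₁ : Proper c₁ w) where

    F₁ : Fin n → Fin n → ℕ → ℕ
    F₁ c z i = if does (c ≟ c₁) ∧ does (z ≟ w) then mod i (size w) else div i (D z c)

    F₁-twisted : ∀ i → F₁ c₁ w i ≡ mod i (size w)
    F₁-twisted i rewrite dec-true (c₁ ≟ c₁) refl | dec-true (w ≟ w) refl = refl

    F₁-other : ∀ {c z} → ¬ (c ≡ c₁ × z ≡ w) → ∀ i → F₁ c z i ≡ div i (D z c)
    F₁-other {c} {z} h i with c ≟ c₁ | z ≟ w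
    ... | yes e | yes f = ⊥-elim (h (e , f))
    ... | yes _ | no _ = refl
    ... | no _ | yes _ = refl
    ... | no _ | no _ = refl

    F₁-maps : Maps F₁
    F₁-maps = record { map-< = lt ; map-fibre = fibre }
      where
      lt : ∀ {c z} → Proper c z → ∀ i → i < size c → F₁ c z i < size z
      lt {c} {z} P i l with c ≟ c₁ | z ≟ w
      ... | yes refl | yes refl = mod-< i (ℕₚ.≤-trans (s≤s z≤n) (proper-2≤ P))
      ... | yes _ | no _ = Maps.map-< F₀-maps P i l
      ... | no _ | _ = Maps.map-< F₀-maps P i l
      fibre : ∀ {c z} → Proper c z → ∀ j → j < size z → countℕ (size c) (λ i → F₁ c z i ≡ᵇ j) ≡ D z c
      fibre {c} {z} P j l with c ≟ c₁ | z ≟ w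
      ... | yes refl | yes refl = trans (cong (λ k → countℕ k (λ i → mod i (size z) ≡ᵇ j)) (trans (proper-size P) (ℕₚ.*-comm (size z) _)))
                                    (countℕ-mod (size z) (D z c) j l)
      ... | yes _ | no _ = Maps.map-fibre F₀-maps P j l
      ... | no _ | _ = Maps.map-fibre F₀-maps P j l

    G₁ = std F₁

    iso : ∃ (CellIso G₀ G₁)
    iso = rg G₁ (std-simple F₁) (real-trans (real-sym (std-real F₀-maps)) (std-real F₁-maps))

  data Conn (c : Fin n) : Fin n → Set where
    here : Conn c c
    step : ∀ {c′ c″} → Conn c c′ → Eq c′ c″ → Conn c c″

  conn-size : ∀ {c c′} → Conn c c′ → size c ≡ size c′
  conn-size here = refl
  conn-size (step k e) = trans (conn-size k) (eq-size e)

  module Clash (rg : Rigid G₀) {c₁ w : Fin n} (P₁ : Proper c₁ w) {c : Fin n} (k : Conn c c₁) where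
    open Twist rg P₁

    φ = proj₁ iso
    φ-bij = proj₁ (proj₂ iso)
    φ-cell = proj₁ (proj₂ (proj₂ iso))
    φ-adj = proj₂ (proj₂ (proj₂ iso))

    -- Identity links are untouched by the twist and force the images of vertices with equal indices
    -- to have equal indices.
    follow : ∀ {c c′ u v} → Conn c c′ → p u ≡ c → p v ≡ c′ → idx u ≡ idx v → idx (φ u) ≡ idx (φ v)
    follow here h h′ e = cong (idx ∘ φ) (idx-inj (trans h (sym h′)) e)
    follow {c} {c″} {u} {v} (step {c′} k E) h h′ e = trans (follow k h pv′ (sym i′)) (≡ᵇ-true _ _
        (trans (sym (std-eq F₁ E (trans (φ-cell v′) pv′) (trans (φ-cell v) h′))) (trans (φ-adj v′ v)
          (trans (std-eq F₀ E pv′ h′) (subst (λ z → (idx v′ ≡ᵇ z) ≡ true) (trans i′ e) (≡ᵇ-refl (idx v′)))))))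
      where
      l : idx u < size c′
      l = subst (idx u <_) (trans (cong size h) (conn-size k)) (idx-< u)
      v′ = at c′ (idx u)
      pv′ = at-cell l
      i′ : idx v′ ≡ idx u
      i′ = idx-at l

    -- Two vertices with small indices share a neighbour in w before the twist; consecutive ones do not afterwards.
    separated : ∀ {u u′} → p u ≡ c → p u′ ≡ c → idx u < D w c₁ → idx u′ < D w c₁ → suc (idx (φ u)) ≡ idx (φ u′) → ⊥
    separated {u} {u′} pu pu′ l l′ e = mod-suc-≢ (idx (φ u)) (proper-2≤ P₁)
        (trans (cong (λ z → mod z (size w)) e) (trans (sees pu′ l′) (sym (sees pu l))))
      where
      l₀ : 0 < size w
      l₀ = ℕₚ.≤-trans (s≤s z≤n) (proper-2≤ P₁)
      w₀ = at w 0
      sees : ∀ {u} → p u ≡ c → idx u < D w c₁ → mod (idx (φ u)) (size w) ≡ idx (φ w₀)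
      sees {u} pu l = trans (cong (λ z → mod z (size w)) (follow k pu px (sym (idx-at lx)))) (trans (sym (F₁-twisted (idx (φ x))))
          (≡ᵇ-true _ _ (trans (sym (std-proper F₁ P₁ (trans (φ-cell x) px) (trans (φ-cell w₀) (at-cell l₀)))) (trans (φ-adj x w₀)
            (trans (std-proper F₀ P₁ px (at-cell l₀)) (cong₂ _≡ᵇ_ (div-small (subst (_< D w c₁) (sym (idx-at lx)) l)) (idx-at l₀)))))))
        where
        lx : idx u < size c₁
        lx = subst (idx u <_) (trans (cong size pu) (conn-size k)) (idx-< u)
        x = at c₁ (idx u)
        px = at-cell lx

    -- The vertices with indices 0 and 1 are matched, so their images have the indices 2k and 2k + 1
    -- in some order. Both lie in one fibre of the link before the twist, which `separated` forbids.
    matching-absurd : p c ≡ c → D c c ≡ 1 → ⊥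
    matching-absurd pc d≡1 = go (idx (φ u)) (idx (φ u′)) refl refl (∧-true {not (idx (φ u) ≡ᵇ idx (φ u′))}
        (trans (cong (λ d → block d (idx (φ u)) (idx (φ u′))) (sym d≡1))
          (trans (sym (std-same F₁ (trans (φ-cell u) pu) (trans (φ-cell u′) pu′))) (trans (φ-adj u u′)
            (trans (std-same F₀ pu pu′) (trans (cong₂ (block (D c c)) (idx-at l₀) (idx-at l₁)) (cong (λ d → block d 0 1) d≡1)))))))
      where
      l₁ : 1 < size c
      l₁ = ℕₚ.≤-trans (s≤s (s≤s z≤n)) (subst (λ d → suc (2 * d) ≤ size c) d≡1 (sparse-cell pc))
      l₀ : 0 < size c
      l₀ = ℕₚ.≤-trans (s≤s z≤n) l₁
      u = at c 0
      u′ = at c 1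
      pu = at-cell l₀
      pu′ = at-cell l₁
      t≥2 = proj₂ (proj₂ P₁)
      lu : idx u < D w c₁
      lu = subst (_< D w c₁) (sym (idx-at l₀)) (ℕₚ.≤-trans (s≤s z≤n) t≥2)
      lu′ : idx u′ < D w c₁
      lu′ = subst (_< D w c₁) (sym (idx-at l₁)) t≥2
      near : ∀ i j → div i 2 ≡ div j 2 → i ≢ j → suc i ≡ j ⊎ suc j ≡ i
      near 0 0 e ne = ⊥-elim (ne refl)
      near 0 1 e ne = inj₁ refl
      near 1 0 e ne = inj₂ refl
      near 1 1 e ne = ⊥-elim (ne refl)
      near 0 (suc (suc j)) e ne = ⊥-elim (ℕₚ.0≢1+n (trans e (div-+ 2 j (s≤s z≤n))))
      near 1 (suc (suc j)) e ne = ⊥-elim (ℕₚ.0≢1+n (trans e (div-+ 2 j (s≤s z≤n))))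
      near (suc (suc i)) 0 e ne = ⊥-elim (ℕₚ.0≢1+n (trans (sym e) (div-+ 2 i (s≤s z≤n))))
      near (suc (suc i)) 1 e ne = ⊥-elim (ℕₚ.0≢1+n (trans (sym e) (div-+ 2 i (s≤s z≤n))))
      near (suc (suc i)) (suc (suc j)) e ne with near i j (ℕₚ.suc-injective (trans (sym (div-+ 2 i (s≤s z≤n))) (trans e (div-+ 2 j (s≤s z≤n))))) (λ q → ne (cong (2 +_) q))
      ... | inj₁ q = inj₁ (cong (2 +_) q)
      ... | inj₂ q = inj₂ (cong (2 +_) q)
      go : ∀ i j → idx (φ u) ≡ i → idx (φ u′) ≡ j → not (idx (φ u) ≡ᵇ idx (φ u′)) ≡ true × (div (idx (φ u)) 2 ≡ᵇ div (idx (φ u′)) 2) ≡ true → ⊥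
      go i j e f (h₁ , h₂) with near (idx (φ u)) (idx (φ u′)) (≡ᵇ-true _ _ h₂)
             (λ q → true≢false (trans (cong (idx (φ u) ≡ᵇ_) (sym q)) (≡ᵇ-refl (idx (φ u)))) (not-false h₁))
      ... | inj₁ q = separated pu pu′ lu lu′ q
      ... | inj₂ q = separated pu′ pu lu′ lu q

    -- A proper link writes the size as a product of two factors that are at least 2, and 5 is
    -- prime.
    pentagon-absurd : size c ≡ 5 → ⊥
    pentagon-absurd e = go (size w) (D w c₁) (proper-2≤ P₁) (proj₂ (proj₂ P₁)) (trans (sym e) (trans (conn-size k) (proper-size P₁)))
      where
      go : ∀ a b → 2 ≤ a → 2 ≤ b → 5 ≡ a * b → ⊥
      go 1 b (s≤s ()) _ q
      go a 1 _ (s≤s ()) q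
      go 2 2 _ _ ()
      go 2 (suc (suc (suc b))) _ _ q = ℕₚ.<⇒≢ (ℕₚ.≤-trans (s≤s (s≤s (s≤s (s≤s (s≤s (s≤s z≤n)))))) (ℕₚ.*-monoʳ-≤ 2 {3} {suc (suc (suc b))} (s≤s (s≤s (s≤s z≤n))))) q
      go (suc (suc (suc a))) (suc (suc b)) _ _ q = ℕₚ.<⇒≢ (ℕₚ.≤-trans (s≤s (s≤s (s≤s (s≤s (s≤s (s≤s z≤n)))))) (ℕₚ.*-mono-≤ {3} {suc (suc (suc a))} {2} {suc (suc b)} (s≤s (s≤s (s≤s z≤n))) (s≤s (s≤s z≤n)))) q

    -- The fibre over the vertex with index 0 in `z` goes to the fibre over its image, the interval
    -- of indices from `b * t` to `b * t + t - 1`. Two consecutive indices in it come from indices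
    -- below `t ≤ D w c₁`, hence from one fibre of the link before the twist.
    proper-absurd : ∀ {z} → Proper c z → D z c ≤ D w c₁ → ¬ (c ≡ c₁ × z ≡ w) → ⊥
    proper-absurd {z} P le ne = separated (proj₁ (pre y py iy)) (proj₁ (pre y′ py′ iy′)) (proj₂ (pre y py iy)) (proj₂ (pre y′ py′ iy′))
        (trans (cong (suc ∘ idx) (f∘inv φ-bij y)) (trans (cong suc (idx-at la)) (sym (trans (cong idx (f∘inv φ-bij y′)) (idx-at la′)))))
      where
      t = D z c
      t≥2 = proj₂ (proj₂ P)
      l₀ : 0 < size z
      l₀ = ℕₚ.≤-trans (s≤s z≤n) (proper-2≤ P)
      z₀ = at z 0
      pz₀ = at-cell l₀
      b = idx (φ z₀)
      b< : b < size z
      b< = subst (λ q → b < size q) (trans (φ-cell z₀) pz₀) (idx-< (φ z₀))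
      a = b * t
      a+1< : b * t + 1 < size c
      a+1< = ℕₚ.≤-trans (subst (_≤ suc b * t) (trans (ℕₚ.+-comm 2 (b * t)) (ℕₚ.+-suc (b * t) 1)) (ℕₚ.+-monoˡ-≤ (b * t) t≥2))
               (subst (suc b * t ≤_) (sym (proper-size P)) (ℕₚ.*-monoˡ-≤ t b<))
      la′ : suc a < size c
      la′ = subst (_< size c) (ℕₚ.+-comm a 1) a+1<
      la : a < size c
      la = ℕₚ.<-trans (ℕₚ.n<1+n a) la′
      y = at c a
      y′ = at c (suc a)
      py = at-cell la
      py′ = at-cell la′
      iy : div (idx y) t ≡ b
      iy = trans (cong (λ q → div q t) (trans (idx-at la) (sym (ℕₚ.+-identityʳ a)))) (div-block b t 0 (ℕₚ.≤-trans (s≤s z≤n) t≥2))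
      iy′ : div (idx y′) t ≡ b
      iy′ = trans (cong (λ q → div q t) (trans (idx-at la′) (ℕₚ.+-comm 1 a))) (div-block b t 1 t≥2)
      pre : ∀ y → p y ≡ c → div (idx y) t ≡ b → p (inv φ-bij y) ≡ c × idx (inv φ-bij y) < D w c₁
      pre y py e = pu , ℕₚ.≤-trans (div-zero (ℕₚ.≤-trans (s≤s z≤n) t≥2) (trans (≡ᵇ-true _ _ (trans (sym (std-proper F₀ P pu pz₀))
          (trans (sym (φ-adj u z₀)) (trans (cong (λ q → G₁ q (φ z₀)) (f∘inv φ-bij y)) (trans (std-proper F₁ P py (trans (φ-cell z₀) pz₀))
            (trans (cong (_≡ᵇ b) (trans (F₁-other ne (idx y)) e)) (≡ᵇ-refl b))))))) (idx-at l₀))) le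
        where
        u = inv φ-bij y
        pu : p u ≡ c
        pu = trans (sym (φ-cell u)) (trans (cong p (f∘inv φ-bij y)) py)

-- Rational sums and Hall's theorem

⟦_⟧ : Bool → ℚ
⟦ b ⟧ = if b then 1ℚ else 0ℚ

⟦⟧-nonneg : ∀ b → 0ℚ ℚ.≤ ⟦ b ⟧
⟦⟧-nonneg true  = ℚₚ.nonNegative⁻¹ 1ℚ
⟦⟧-nonneg false = ℚₚ.≤-refl

sum-cong : ∀ {m} {f g : Fin m → ℚ} → (∀ i → f i ≡ g i) → sumℚ m f ≡ sumℚ m g
sum-cong {zero}  h = refl
sum-cong {suc m} h = cong₂ ℚ._+_ (h zero) (sum-cong (h ∘ suc))

sum-zero : ∀ {m} {f : Fin m → ℚ} → (∀ i → f i ≡ 0ℚ) → sumℚ m f ≡ 0ℚ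
sum-zero {zero}  h = refl
sum-zero {suc m} h = trans (cong₂ ℚ._+_ (h zero) (sum-zero (h ∘ suc))) (ℚₚ.+-identityˡ 0ℚ)

+-interchange : ∀ a b c d → (a ℚ.+ b) ℚ.+ (c ℚ.+ d) ≡ (a ℚ.+ c) ℚ.+ (b ℚ.+ d)
+-interchange a b c d = trans (ℚₚ.+-assoc a b _) (trans (cong (a ℚ.+_) (trans (sym (ℚₚ.+-assoc b c d))
  (trans (cong (ℚ._+ d) (ℚₚ.+-comm b c)) (ℚₚ.+-assoc c b d)))) (sym (ℚₚ.+-assoc a c _)))

sum-+ : ∀ {m} (f g : Fin m → ℚ) → sumℚ m (λ i → f i ℚ.+ g i) ≡ sumℚ m f ℚ.+ sumℚ m g
sum-+ {zero}  f g = sym (ℚₚ.+-identityˡ 0ℚ)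
sum-+ {suc m} f g = trans (cong ((f zero ℚ.+ g zero) ℚ.+_) (sum-+ (f ∘ suc) (g ∘ suc)))
  (+-interchange (f zero) (g zero) (sumℚ m (f ∘ suc)) (sumℚ m (g ∘ suc)))

sum-*ˡ : ∀ {m} a (f : Fin m → ℚ) → sumℚ m (λ i → a ℚ.* f i) ≡ a ℚ.* sumℚ m f
sum-*ˡ {zero}  a f = sym (ℚₚ.*-zeroʳ a)
sum-*ˡ {suc m} a f = trans (cong (a ℚ.* f zero ℚ.+_) (sum-*ˡ a (f ∘ suc))) (sym (ℚₚ.*-distribˡ-+ a _ _))

sum-*ʳ : ∀ {m} a (f : Fin m → ℚ) → sumℚ m (λ i → f i ℚ.* a) ≡ sumℚ m f ℚ.* a
sum-*ʳ a f = trans (sum-cong (λ i → ℚₚ.*-comm (f i) a)) (trans (sum-*ˡ a f) (ℚₚ.*-comm a _))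

sum-comm : ∀ m k (f : Fin m → Fin k → ℚ) → sumℚ m (λ i → sumℚ k (f i)) ≡ sumℚ k (λ j → sumℚ m (λ i → f i j))
sum-comm zero    k f = sym (sum-zero {k} {λ _ → 0ℚ} (λ _ → refl))
sum-comm (suc m) k f = trans (cong (sumℚ k (f zero) ℚ.+_) (sum-comm m k (f ∘ suc))) (sym (sum-+ (f zero) _))

sum-≤ : ∀ {m} {f g : Fin m → ℚ} → (∀ i → f i ℚ.≤ g i) → sumℚ m f ℚ.≤ sumℚ m g
sum-≤ {zero}  h = ℚₚ.≤-refl
sum-≤ {suc m} h = ℚₚ.+-mono-≤ (h zero) (sum-≤ (h ∘ suc))

sum-nonneg : ∀ {m} {f : Fin m → ℚ} → (∀ i → 0ℚ ℚ.≤ f i) → 0ℚ ℚ.≤ sumℚ m f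
sum-nonneg {m} {f} h = subst (ℚ._≤ sumℚ m f) (sum-zero {m} (λ _ → refl)) (sum-≤ h)

nonneg-sum-zero : ∀ {m} {f : Fin m → ℚ} → (∀ i → 0ℚ ℚ.≤ f i) → sumℚ m f ≡ 0ℚ → ∀ i → f i ≡ 0ℚ
nonneg-sum-zero {suc m} {f} h e = λ { zero → ℚₚ.≤-antisym le₀ (h zero) ; (suc i) → nonneg-sum-zero (h ∘ suc) (ℚₚ.≤-antisym le₁ (sum-nonneg (h ∘ suc))) i }
  where
  le₀ : f zero ℚ.≤ 0ℚ
  le₀ = subst₂ ℚ._≤_ (ℚₚ.+-identityʳ _) e (ℚₚ.+-monoʳ-≤ (f zero) (sum-nonneg (h ∘ suc)))
  le₁ : sumℚ m (f ∘ suc) ℚ.≤ 0ℚ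
  le₁ = subst₂ ℚ._≤_ (ℚₚ.+-identityˡ _) e (ℚₚ.+-monoˡ-≤ (sumℚ m (f ∘ suc)) (h zero))

sum-single : ∀ {m} (f : Fin m → ℚ) a → (∀ i → i ≢ a → f i ≡ 0ℚ) → sumℚ m f ≡ f a
sum-single f zero    h = trans (cong (f zero ℚ.+_) (sum-zero (λ i → h (suc i) λ ()))) (ℚₚ.+-identityʳ _)
sum-single f (suc a) h = trans (cong₂ ℚ._+_ (h zero λ ()) (sum-single (f ∘ suc) a (λ i ne → h (suc i) (ne ∘ Fₚ.suc-injective))))
  (ℚₚ.+-identityˡ _)

*-nonneg : ∀ {x y} → 0ℚ ℚ.≤ x → 0ℚ ℚ.≤ y → 0ℚ ℚ.≤ x ℚ.* y
*-nonneg {x} {y} hx hy = subst (ℚ._≤ x ℚ.* y) (ℚₚ.*-zeroˡ y) (ℚₚ.*-monoʳ-≤-nonNeg y {{ℚ.nonNegative hy}} hx)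

sum-pick : ∀ {m} (f : Fin m → ℚ) a → sumℚ m (λ i → ⟦ does (i ≟ a) ⟧ ℚ.* f i) ≡ f a
sum-pick {m} f a = trans (sum-single (λ i → ⟦ does (i ≟ a) ⟧ ℚ.* f i) a
    (λ i ne → trans (cong (λ b → ⟦ b ⟧ ℚ.* f i) (dec-false (i ≟ a) ne)) (ℚₚ.*-zeroˡ (f i))))
  (trans (cong (λ b → ⟦ b ⟧ ℚ.* f a) (dec-true (a ≟ a) refl)) (ℚₚ.*-identityˡ (f a)))

-- `f` vanishes outside the image of `g`, so each `f v` is the sum over `j` of `f v` times the
-- indicator of `v ≡ g j`; the two sums are then exchanged.
sum-reindex : ∀ {n m} (g : Fin m → Fin n) (h : Fin n → Fin m) (f : Fin n → ℚ) → (∀ j → h (g j) ≡ j) →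
  (∀ v → f v ≢ 0ℚ → g (h v) ≡ v) → sumℚ n f ≡ sumℚ m (f ∘ g)
sum-reindex {n} {m} g h f hg gh = begin
  sumℚ n f ≡⟨ sum-cong expand ⟩
  sumℚ n (λ v → sumℚ m (λ j → ⟦ does (v ≟ g j) ⟧ ℚ.* f v)) ≡⟨ sum-comm n m (λ v j → ⟦ does (v ≟ g j) ⟧ ℚ.* f v) ⟩
  sumℚ m (λ j → sumℚ n (λ v → ⟦ does (v ≟ g j) ⟧ ℚ.* f v)) ≡⟨ sum-cong (λ j → sum-pick f (g j)) ⟩
  sumℚ m (f ∘ g) ∎
  where
  open ≡-Reasoning
  expand : ∀ v → f v ≡ sumℚ m (λ j → ⟦ does (v ≟ g j) ⟧ ℚ.* f v)
  expand v with f v ℚₚ.≟ 0ℚ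
  ... | yes e = trans e (sym (sum-zero (λ j → trans (cong (⟦ does (v ≟ g j) ⟧ ℚ.*_) e) (ℚₚ.*-zeroʳ ⟦ does (v ≟ g j) ⟧))))
  ... | no ne = sym (trans (sum-cong (λ j → cong (λ b → ⟦ b ⟧ ℚ.* f v) (does-cong (v ≟ g j) (j ≟ h v)
            (λ e → sym (trans (cong h e) (hg j))) (λ e → trans (sym (gh v ne)) (cong g (sym e)))))) (sum-pick (λ _ → f v) (h v)))

sum-perm : ∀ {n} {φ : Fin n → Fin n} → IsBij φ → (f : Fin n → ℚ) → sumℚ n (f ∘ φ) ≡ sumℚ n f
sum-perm {φ = φ} b f = sym (sum-reindex φ (inv b) f (inv∘f b) (λ v _ → f∘inv b v))

<⇒≱ℚ : ∀ {x y} → x ℚ.< y → ¬ y ℚ.≤ x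
<⇒≱ℚ l h = ℚₚ.<-irrefl refl (ℚₚ.<-≤-trans l h)

ι : ℕ → ℚ
ι zero    = 0ℚ
ι (suc k) = 1ℚ ℚ.+ ι k

sum-count : ∀ m (P : Fin m → Bool) → sumℚ m (λ i → ⟦ P i ⟧) ≡ ι (countFin m P)
sum-count zero P = refl
sum-count (suc m) P with P zero
... | true  = cong (1ℚ ℚ.+_) (sum-count m (P ∘ suc))
... | false = trans (ℚₚ.+-identityˡ _) (sum-count m (P ∘ suc))

0<1 : 0ℚ ℚ.< 1ℚ
0<1 = ℚₚ.positive⁻¹ 1ℚ

ι-<-suc : ∀ k → ι k ℚ.< ι (suc k)
ι-<-suc k = subst (ℚ._< 1ℚ ℚ.+ ι k) (ℚₚ.+-identityˡ (ι k)) (ℚₚ.+-monoˡ-< (ι k) 0<1)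

ι-< : ∀ {a b} → a < b → ι a ℚ.< ι b
ι-< {a} {suc b} (s≤s l) with ℕₚ.m≤n⇒m<n∨m≡n l
... | inj₁ l′ = ℚₚ.<-trans (ι-< l′) (ι-<-suc b)
... | inj₂ refl = ι-<-suc b

ι-cancel-≤ : ∀ {a b} → ι a ℚ.≤ ι b → a ≤ b
ι-cancel-≤ {a} {b} h with a ℕ.≤? b
... | yes l = l
... | no g = ⊥-elim (<⇒≱ℚ (ι-< (ℕₚ.≰⇒> g)) h)

ι-injective : ∀ {a b} → ι a ≡ ι b → a ≡ b
ι-injective e = ℕₚ.≤-antisym (ι-cancel-≤ (ℚₚ.≤-reflexive e)) (ι-cancel-≤ (ℚₚ.≤-reflexive (sym e)))

≢0⇒pos : ∀ {x} → 0ℚ ℚ.≤ x → x ≢ 0ℚ → 0ℚ ℚ.< x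
≢0⇒pos {x} h ne with ℚₚ.<-cmp 0ℚ x
... | tri< l _ _ = l
... | tri≈ _ e _ = ⊥-elim (ne (sym e))
... | tri> _ _ g = ⊥-elim (<⇒≱ℚ g h)

recip : ℚ → ℚ
recip x with x ℚₚ.≟ 0ℚ
... | yes _ = 0ℚ
... | no ne = (ℚ.1/ x) {{ℚ.≢-nonZero ne}}

*-recip : ∀ {x} → x ≢ 0ℚ → x ℚ.* recip x ≡ 1ℚ
*-recip {x} h with x ℚₚ.≟ 0ℚ
... | yes e = ⊥-elim (h e)
... | no ne = ℚₚ.*-inverseʳ x {{ℚ.≢-nonZero ne}}

recip-nonneg : ∀ {x} → 0ℚ ℚ.≤ x → 0ℚ ℚ.≤ recip x
recip-nonneg {x} h with ℚₚ.≤-total 0ℚ (recip x)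
... | inj₁ l = l
... | inj₂ g with x ℚₚ.≟ 0ℚ
...   | yes _ = ℚₚ.≤-refl
...   | no ne = ⊥-elim (<⇒≱ℚ 0<1 (subst₂ ℚ._≤_ (ℚₚ.*-inverseʳ x {{ℚ.≢-nonZero ne}}) (ℚₚ.*-zeroʳ x)
        (ℚₚ.*-monoˡ-≤-nonNeg x {{ℚ.nonNegative h}} g)))

record DoublyStochastic (m : ℕ) (X : Fin m → Fin m → ℚ) : Set where
  field
    nonneg : ∀ i j → 0ℚ ℚ.≤ X i j
    rows   : ∀ i → sumℚ m (X i) ≡ 1ℚ
    cols   : ∀ j → sumℚ m (λ i → X i j) ≡ 1ℚ

0≢1ℚ : 0ℚ ≢ 1ℚ
0≢1ℚ ()

-- The support of a doubly stochastic matrix contains a permutation: a map inside the support whose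
-- image is as large as possible is onto, by moving the missed column along alternating paths.
module Hall {m : ℕ} (E : Fin m → Fin m → Bool)
  (hall : ∀ (D R : Fin m → Bool) → (∀ i j → D j ≡ true → E i j ≡ true → R i ≡ true) → countFin m D ≤ countFin m R) where

  private
    Map = Fin m → Fin m

    Inside : Map → Set
    Inside f = ∀ i → E i (f i) ≡ true

    image : Map → Fin m → Bool
    image f j = does (any? (λ i → f i ≟ j))

    image-true : ∀ f i → image f (f i) ≡ true
    image-true f i = dec-true (any? (λ k → f k ≟ f i)) (i , refl)

    image-elim : ∀ f {j} → image f j ≡ true → ∃ λ i → f i ≡ j
    image-elim f {j} h = does-true (any? (λ i → f i ≟ j)) h

    Collides : Map → Fin m → Set
    Collides f i = ∃ λ i′ → i′ ≢ i × f i′ ≡ f i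

    collides? : ∀ f i → Dec (Collides f i)
    collides? f i = any? (λ i′ → ¬? (i′ ≟ i) ×-dec (f i′ ≟ f i))

    -- An alternating path from a missed column: row `i` is moved to `j`, which releases the column
    -- `f i`, and so on until the released column is also the value of another row.
    data Path (f : Map) : Fin m → Set where
      hit : ∀ {j} i → E i j ≡ true → Collides f i → Path f j
      via : ∀ {j} i → E i j ≡ true → Path f (f i) → Path f j

    len : ∀ {f j} → Path f j → ℕ
    len (hit _ _ _) = 0
    len (via _ _ π) = suc (len π)

    _[_≔_] : Map → Fin m → Fin m → Map
    (f [ i ≔ j ]) k = if does (k ≟ i) then j else f k

    upd-same : ∀ f i j → (f [ i ≔ j ]) i ≡ j
    upd-same f i j rewrite dec-true (i ≟ i) refl = refl

    upd-other : ∀ f {i k} j → k ≢ i → (f [ i ≔ j ]) k ≡ f k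
    upd-other f {i} {k} j ne rewrite dec-false (k ≟ i) ne = refl

    upd-inside : ∀ {f i j} → Inside f → E i j ≡ true → Inside (f [ i ≔ j ])
    upd-inside {f} {i} {j} h e k with k ≟ i
    ... | yes refl = e
    ... | no _ = h k

    Larger : Map → Set
    Larger f = ∃ λ f′ → Inside f′ × countFin m (image f) < countFin m (image f′)

    at-collision : ∀ {f i j} → Inside f → image f j ≡ false → E i j ≡ true → Collides f i → Larger f
    at-collision {f} {i} {j} h hole e (i′ , ne , q) = f [ i ≔ j ] , upd-inside h e ,
        count-⊂ keep j (subst (λ z → image (f [ i ≔ j ]) z ≡ true) (upd-same f i j) (image-true (f [ i ≔ j ]) i)) hole
      where
      keep : ∀ a → image f a ≡ true → image (f [ i ≔ j ]) a ≡ true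
      keep a t with image-elim f t
      ... | k , refl with k ≟ i
      ...   | no nk = subst (λ z → image (f [ i ≔ j ]) z ≡ true) (upd-other f j nk) (image-true (f [ i ≔ j ]) k)
      ...   | yes refl = subst (λ z → image (f [ i ≔ j ]) z ≡ true) (trans (upd-other f j ne) q) (image-true (f [ i ≔ j ]) i′)

    larger : ∀ k f j → Inside f → image f j ≡ false → (π : Path f j) → len π ≤ k → Larger f
    larger k f j h hole (hit i e c) _ = at-collision h hole e c
    larger (suc k) f j h hole (via i e π) (s≤s le) with collides? f i
    ... | yes c = at-collision h hole e c
    ... | no nc = let (f′ , h′ , lt) = go k π le ℕₚ.≤-refl in f′ , h′ , ℕₚ.≤-<-trans le₁ lt
      where
      f₁ = f [ i ≔ j ]
      h₁ = upd-inside h e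
      fi≢j : f i ≢ j
      fi≢j q = true≢false (subst (λ z → image f z ≡ true) q (image-true f i)) hole
      hole₁ : image f₁ (f i) ≡ false
      hole₁ = not-true λ t → let (x , q) = image-elim f₁ t in bad x q (x ≟ i)
        where
        bad : ∀ x → f₁ x ≡ f i → Dec (x ≡ i) → ⊥
        bad x q (yes refl) = fi≢j (sym (trans (sym (upd-same f i j)) q))
        bad x q (no ne) = nc (x , ne , trans (sym (upd-other f j ne)) q)
      le₁ : countFin m (image f) ≤ countFin m (image f₁)
      le₁ = ℕₚ.≤-trans (count-⊆ {Q = image f₁ ∘ swp (f i) j} sub) (ℕₚ.≤-reflexive (count-∘ (swp-bij (f i) j) (image f₁)))
        where
        sub : ∀ a → image f a ≡ true → image f₁ (swp (f i) j a) ≡ true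
        sub a t with image-elim f t
        ... | x , refl = case x ≟ i of λ
          { (yes refl) → subst (λ z → image f₁ z ≡ true) (trans (upd-same f i j) (sym (swp-left (f i) j))) (image-true f₁ i)
          ; (no ne) → subst (λ z → image f₁ z ≡ true) (trans (upd-other f j ne) (sym (swp-other
                (λ q → nc (x , ne , q)) (λ q → true≢false (subst (λ z → image f z ≡ true) q t) hole)))) (image-true f₁ x) }
      -- After row `i` has been reassigned, the remaining path is still valid unless it uses `i`
      -- again; in that case it contains a strictly shorter path from `f i`.
      avoid : ∀ {a} (π : Path f a) → (Σ (Path f₁ a) λ π′ → len π′ ≤ len π) ⊎ (Σ (Path f (f i)) λ π′ → len π′ < len π)
      avoid (hit i₂ e₂ (i′ , ne , q)) = case (i₂ ≟ i) , (i′ ≟ i) of λ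
        { (yes refl , _) → ⊥-elim (nc (i′ , ne , q))
        ; (_ , yes refl) → ⊥-elim (nc (i₂ , ne ∘ sym , sym q))
        ; (no n₂ , no n′) → inj₁ (hit i₂ e₂ (i′ , ne , trans (upd-other f j n′) (trans q (sym (upd-other f j n₂)))) , z≤n) }
      avoid (via i₂ e₂ π) with i₂ ≟ i | avoid π
      ... | yes refl | _ = inj₂ (π , ℕₚ.n<1+n _)
      ... | no _ | inj₂ (π′ , l) = inj₂ (π′ , ℕₚ.m<n⇒m<1+n l)
      ... | no n₂ | inj₁ (π′ , l) = inj₁ (via i₂ e₂ (proj₁ q) , s≤s (ℕₚ.≤-trans (ℕₚ.≤-reflexive (proj₂ q)) l))
        where
        q : Σ (Path f₁ (f₁ i₂)) λ π″ → len π″ ≡ len π′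
        q = moved (sym (upd-other f j n₂)) π′
          where
          moved : ∀ {a b} → a ≡ b → (π : Path f₁ a) → Σ (Path f₁ b) λ π″ → len π″ ≡ len π
          moved refl π = π , refl
      go : ∀ k₁ (π : Path f (f i)) → len π ≤ k₁ → k₁ ≤ k → Larger f₁
      go k₁ π l l′ with avoid π
      ... | inj₁ (π′ , l″) = larger k f₁ (f i) h₁ hole₁ π′ (ℕₚ.≤-trans l″ (ℕₚ.≤-trans l l′))
      go zero π l l′ | inj₂ (π′ , l″) = ⊥-elim (ℕₚ.n≮0 (ℕₚ.<-≤-trans l″ l))
      go (suc k₁) π l l′ | inj₂ (π′ , l″) = go k₁ π′ (ℕₚ.≤-pred (ℕₚ.≤-trans l″ l)) (ℕₚ.≤-trans (ℕₚ.n≤1+n k₁) l′)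

    data Reach (f : Map) (j₀ : Fin m) : Fin m → Set where
      start : Reach f j₀ j₀
      move  : ∀ {j} i → Reach f j₀ j → E i j ≡ true → Reach f j₀ (f i)

    path-from : ∀ {f j₀ j} → Reach f j₀ j → Path f j → Path f j₀
    path-from start π = π
    path-from (move i r e) π = path-from r (via i e π)

    -- Without a path, `f` maps the rows that meet the reachable columns injectively into these
    -- columns minus `j₀`, against Hall's condition. Reachability is only assumed decided, hence the
    -- double negation.
    path-exists : ∀ f j₀ → image f j₀ ≡ false → ¬ ¬ Path f j₀
    path-exists f j₀ hole np = ¬¬-Π (λ j → ¬¬-excluded-middle {A = Reach f j₀ j}) λ reach? →
      let D : Fin m → Bool
          D j = does (reach? j)
          R : Fin m → Bool
          R i = does (any? (λ j → (D j 𝔹ₚ.≟ true) ×-dec (E i j 𝔹ₚ.≟ true)))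
          R-elim : ∀ i → R i ≡ true → ∃ λ j → D j ≡ true × E i j ≡ true
          R-elim i = does-true (any? (λ j → (D j 𝔹ₚ.≟ true) ×-dec (E i j 𝔹ₚ.≟ true)))
          D′ : Fin m → Bool
          D′ j = D j ∧ not (does (j ≟ j₀))
          reached : ∀ i → R i ≡ true → D′ (f i) ≡ true
          reached i t = let (j , dj , e) = R-elim i t in ∧-intro (dec-true (reach? (f i)) (move i (does-true (reach? j) dj) e))
            (cong not (dec-false (f i ≟ j₀) (λ q → true≢false (subst (λ z → image f z ≡ true) q (image-true f i)) hole)))
          inj : ∀ {i i′} → R i ≡ true → f i ≡ f i′ → i ≡ i′
          inj {i} {i′} t q = case i′ ≟ i of λ
            { (yes e) → sym e
            ; (no ne) → let (j , dj , e) = R-elim i t in ⊥-elim (np (path-from (does-true (reach? j) dj) (hit i e (i′ , ne , sym q)))) }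
      in ℕₚ.<-irrefl refl (ℕₚ.<-≤-trans
           (count-⊂ {P = D′} {D} (λ j t → proj₁ (∧-true {D j} t)) j₀ (dec-true (reach? j₀) start)
             (trans (cong (λ b → D j₀ ∧ not b) (dec-true (j₀ ≟ j₀) refl)) (𝔹ₚ.∧-zeroʳ (D j₀))))
           (ℕₚ.≤-trans (hall D R (λ i j dj e → dec-true (any? (λ j → (D j 𝔹ₚ.≟ true) ×-dec (E i j 𝔹ₚ.≟ true))) (j , dj , e)))
             (count-inj {Q = D′} (λ { (i , t) → f i , reached i t }) (λ { {i , t} {i′ , t′} q → sub-≡ (inj t (cong proj₁ q)) }))))

    surjective : ∀ k f → Inside f → m ∸ countFin m (image f) ≤ k → ¬ ¬ (∃ λ f′ → Inside f′ × ∀ j → image f′ j ≡ true)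
    surjective k f h le ret with any? (λ j → image f j 𝔹ₚ.≟ false)
    ... | no none = ret (f , h , λ j → 𝔹ₚ.¬-not {y = false} (λ q → none (j , q)))
    ... | yes (j , hole) = path-exists f j hole λ π → let (f′ , h′ , lt) = larger (len π) f j h hole π ℕₚ.≤-refl in again k le f′ h′ lt
      where
      count≤ : ∀ P → countFin m P ≤ m
      count≤ P = subst (countFin m P ≤_) (countAll m) (count-⊆ {P = P} {Q = λ _ → true} (λ _ _ → refl))
        where
        countAll : ∀ m → countFin m (λ _ → true) ≡ m
        countAll zero = refl
        countAll (suc m) = cong suc (countAll m)
      again : ∀ k → m ∸ countFin m (image f) ≤ k → ∀ f′ → Inside f′ → countFin m (image f) < countFin m (image f′) → ⊥
      again k le f′ h′ lt with ℕₚ.<-≤-trans (ℕₚ.∸-monoʳ-< lt (count≤ (image f′))) le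
      again zero le f′ h′ lt | ()
      again (suc k) le f′ h′ lt | s≤s l = surjective k f′ h′ l ret

  matching : ¬ ¬ (∃ λ (σ : Fin m → Fin m) → IsBij σ × ∀ i → E i (σ i) ≡ true)
  matching ret = surjective m f₀ (λ i → proj₂ (nonempty i)) (ℕₚ.m∸n≤m m (countFin m (image f₀))) λ (f , h , s) →
      let g = λ j → proj₁ (image-elim f (s j))
          fg : ∀ j → f (g j) ≡ j
          fg j = proj₂ (image-elim f (s j))
          bg = injective⇒bij {f = g} (λ {x} {y} e → trans (sym (fg x)) (trans (cong f e) (fg y)))
      in ret (f , mkBij g (λ x → trans (cong g (cong f (sym (f∘inv bg x)))) (trans (cong g (fg (inv bg x))) (f∘inv bg x))) fg , h)
    where
    nonempty : ∀ i → ∃ λ j → E i j ≡ true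
    nonempty i with any? (λ j → E i j 𝔹ₚ.≟ true)
    ... | yes r = r
    ... | no none = ⊥-elim (ℕₚ.<-irrefl refl (ℕₚ.<-≤-trans
          (count-⊂ {P = λ k → not (does (k ≟ i))} {Q = λ _ → true} (λ _ _ → refl) i refl (cong not (dec-true (i ≟ i) refl)))
          (hall (λ _ → true) (λ k → not (does (k ≟ i))) (λ k j _ e → cong not (dec-false (k ≟ i) (λ { refl → none (j , e) }))))))
    f₀ : Fin m → Fin m
    f₀ i = proj₁ (nonempty i)

-- Hall's condition by weighing: the columns in `D` have total mass |D|, and all of it lies in the
-- rows of `R`, which have mass one each.
birkhoff-support : ∀ {m} {X : Fin m → Fin m → ℚ} → DoublyStochastic m X →
  ¬ ¬ (∃ λ (σ : Fin m → Fin m) → IsBij σ × ∀ i → X i (σ i) ≢ 0ℚ)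
birkhoff-support {m} {X} ds ret = Hall.matching E hall λ (σ , b , h) → ret (σ , b , λ i → does-false (X i (σ i) ℚₚ.≟ 0ℚ) (not-false (h i)))
  where
  open DoublyStochastic ds
  E : Fin m → Fin m → Bool
  E i j = not (does (X i j ℚₚ.≟ 0ℚ))
  hall : ∀ (D R : Fin m → Bool) → (∀ i j → D j ≡ true → E i j ≡ true → R i ≡ true) → countFin m D ≤ countFin m R
  hall D R h = ι-cancel-≤ (subst₂ ℚ._≤_ left (sum-count m R) (sum-≤ row))
    where
    row : ∀ i → sumℚ m (λ j → ⟦ D j ⟧ ℚ.* X i j) ℚ.≤ ⟦ R i ⟧
    row i with bool-cases (R i)
    ... | inj₁ t = subst (λ b → sumℚ m (λ j → ⟦ D j ⟧ ℚ.* X i j) ℚ.≤ ⟦ b ⟧) (sym t) (subst (sumℚ m (λ j → ⟦ D j ⟧ ℚ.* X i j) ℚ.≤_) (rows i) (sum-≤ le))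
      where
      le : ∀ j → ⟦ D j ⟧ ℚ.* X i j ℚ.≤ X i j
      le j with D j
      ... | true  = ℚₚ.≤-reflexive (ℚₚ.*-identityˡ _)
      ... | false = ℚₚ.≤-trans (ℚₚ.≤-reflexive (ℚₚ.*-zeroˡ (X i j))) (nonneg i j)
    ... | inj₂ f = subst (λ b → sumℚ m (λ j → ⟦ D j ⟧ ℚ.* X i j) ℚ.≤ ⟦ b ⟧) (sym f) (ℚₚ.≤-reflexive (sum-zero z))
      where
      z : ∀ j → ⟦ D j ⟧ ℚ.* X i j ≡ 0ℚ
      z j with D j in dj | X i j ℚₚ.≟ 0ℚ in q
      ... | false | _ = ℚₚ.*-zeroˡ (X i j)
      ... | true | yes e = trans (cong (1ℚ ℚ.*_) e) (ℚₚ.*-zeroʳ 1ℚ)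
      ... | true | no ne = ⊥-elim (true≢false (h i j dj (cong not (dec-false (X i j ℚₚ.≟ 0ℚ) ne))) f)
    left : sumℚ m (λ i → sumℚ m (λ j → ⟦ D j ⟧ ℚ.* X i j)) ≡ ι (countFin m D)
    left = trans (sum-comm m m (λ i j → ⟦ D j ⟧ ℚ.* X i j)) (trans (sum-cong (λ j → trans (sum-*ˡ ⟦ D j ⟧ (λ i → X i j)) (trans (cong (⟦ D j ⟧ ℚ.*_) (cols j)) (ℚₚ.*-identityʳ ⟦ D j ⟧))))
      (sum-count m D))

0<⇒≢0 : ∀ {x} → 0ℚ ℚ.< x → x ≢ 0ℚ
0<⇒≢0 l e = ℚₚ.<-irrefl (sym e) l

sub-pos : ∀ {x y} → x ℚ.< y → 0ℚ ℚ.< y ℚ.- x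
sub-pos {x} {y} l = subst (ℚ._< y ℚ.- x) (ℚₚ.+-inverseʳ x) (ℚₚ.+-monoˡ-< (ℚ.- x) l)

-- Permutations in the support of commuting matrices on index sets

Σℕ : ℕ → (ℕ → ℚ) → ℚ
Σℕ m f = sumℚ m (f ∘ toℕ)

Σℕ-cong : ∀ m {f g : ℕ → ℚ} → (∀ i → i < m → f i ≡ g i) → Σℕ m f ≡ Σℕ m g
Σℕ-cong m h = sum-cong (λ a → h (toℕ a) (Fₚ.toℕ<n a))

Σℕ-nonneg : ∀ m {f : ℕ → ℚ} → (∀ i → i < m → 0ℚ ℚ.≤ f i) → 0ℚ ℚ.≤ Σℕ m f
Σℕ-nonneg m h = sum-nonneg (λ a → h (toℕ a) (Fₚ.toℕ<n a))

Σℕ-pick : ∀ m (f : ℕ → ℚ) a → a < m → Σℕ m (λ k → ⟦ k ≡ᵇ a ⟧ ℚ.* f k) ≡ f a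
Σℕ-pick (suc m) f zero _ = trans (cong₂ ℚ._+_ (ℚₚ.*-identityˡ (f 0)) (sum-zero {m} (λ i → ℚₚ.*-zeroˡ (f (suc (toℕ i)))))) (ℚₚ.+-identityʳ _)
Σℕ-pick (suc m) f (suc a) (s≤s l) = trans (cong₂ ℚ._+_ (ℚₚ.*-zeroˡ (f 0)) (Σℕ-pick m (f ∘ suc) a l)) (ℚₚ.+-identityˡ _)

Σℕ-pairs : ∀ k (f : ℕ → ℚ) → Σℕ (k * 2) f ≡ Σℕ k (λ a → f (a * 2) ℚ.+ f (suc (a * 2)))
Σℕ-pairs zero f = refl
Σℕ-pairs (suc k) f = trans (sym (ℚₚ.+-assoc (f 0) (f 1) _)) (cong ((f 0 ℚ.+ f 1) ℚ.+_) (Σℕ-pairs k (λ x → f (suc (suc x)))))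

record Stochasticℕ (m : ℕ) (M : ℕ → ℕ → ℚ) : Set where
  field
    nonnegℕ : ∀ i j → i < m → j < m → 0ℚ ℚ.≤ M i j
    rowsℕ   : ∀ i → i < m → Σℕ m (M i) ≡ 1ℚ
    colsℕ   : ∀ j → j < m → Σℕ m (λ i → M i j) ≡ 1ℚ
open Stochasticℕ public

record Perm< (m : ℕ) (g : ℕ → ℕ) : Set where
  field
    bound : ∀ i → i < m → g i < m
    injℕ  : ∀ i j → i < m → j < m → g i ≡ g j → i ≡ j
open Perm< public

perm<-onto : ∀ {m g} → Perm< m g → ∀ j → j < m → ∃ λ i → i < m × g i ≡ j
perm<-onto {m} {g} P j l = toℕ a , Fₚ.toℕ<n a , trans (sym (Fₚ.toℕ-fromℕ< (bound P (toℕ a) (Fₚ.toℕ<n a)))) (trans (cong toℕ (f∘inv b (fromℕ< l))) (Fₚ.toℕ-fromℕ< l))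
  where
  f : Fin m → Fin m
  f a = fromℕ< (bound P (toℕ a) (Fₚ.toℕ<n a))
  b : IsBij f
  b = injective⇒bij λ {x} {y} e → Fₚ.toℕ-injective (injℕ P _ _ (Fₚ.toℕ<n x) (Fₚ.toℕ<n y)
        (trans (sym (Fₚ.toℕ-fromℕ< (bound P (toℕ x) (Fₚ.toℕ<n x)))) (trans (cong toℕ e) (Fₚ.toℕ-fromℕ< (bound P (toℕ y) (Fₚ.toℕ<n y))))))
  a = inv b (fromℕ< l)

SupportPerm : ℕ → (ℕ → ℕ → ℚ) → (ℕ → ℕ) → Set
SupportPerm m M g = Perm< m g × (∀ i → i < m → M i (g i) ≢ 0ℚ)

birkhoffℕ : ∀ {m M} → Stochasticℕ m M → ¬ ¬ ∃ (SupportPerm m M)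
birkhoffℕ {m} {M} S ret = birkhoff-support {m} {λ a b → M (toℕ a) (toℕ b)} (record
    { nonneg = λ a b → nonnegℕ S _ _ (Fₚ.toℕ<n a) (Fₚ.toℕ<n b) ; rows = λ a → rowsℕ S _ (Fₚ.toℕ<n a) ; cols = λ b → colsℕ S _ (Fₚ.toℕ<n b) })
  λ (σ , b , h) →
    let g : ℕ → ℕ
        g i = extend σ i
    in ret (g , record { bound = λ i l → subst (_< m) (sym (extend-≡ σ l)) (Fₚ.toℕ<n _)
                   ; injℕ = λ i j l l′ e → trans (sym (Fₚ.toℕ-fromℕ< l)) (trans (cong toℕ (proj₁ b (Fₚ.toℕ-injective
                        (trans (sym (extend-≡ σ l)) (trans e (extend-≡ σ l′)))))) (Fₚ.toℕ-fromℕ< l′)) }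
             , λ i l → subst₂ (λ x y → M x y ≢ 0ℚ) (Fₚ.toℕ-fromℕ< l) (sym (extend-≡ σ l)) (h (fromℕ< l)))
  where
  extend : (Fin m → Fin m) → ℕ → ℕ
  extend σ i with i ℕ.<? m
  ... | yes l = toℕ (σ (fromℕ< l))
  ... | no _  = i
  extend-≡ : ∀ σ {i} (l : i < m) → extend σ i ≡ toℕ (σ (fromℕ< l))
  extend-≡ σ {i} l with i ℕ.<? m
  ... | yes l′ = cong (toℕ ∘ σ) (Fₚ.fromℕ<-cong i i refl l′ l)
  ... | no h = ⊥-elim (h l)

-- `Z` is the quotient of `M` by blocks of `t` indices: the mass that a row or column of `M` puts on
-- a block depends only on the blocks. Keeping the blocks `(a , τ a)` and dividing each by
-- `Z a (τ a)` gives a doubly stochastic matrix, and any permutation in its support lies above `τ`.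
lift-perm : ∀ {m k t M Z τ} → m ≡ k * t → Stochasticℕ m M →
  (∀ i b → i < m → b < k → Σℕ m (λ j → M i j ℚ.* ⟦ div j t ≡ᵇ b ⟧) ≡ Z (div i t) b) →
  (∀ a j → a < k → j < m → Σℕ m (λ i → ⟦ div i t ≡ᵇ a ⟧ ℚ.* M i j) ≡ Z a (div j t)) →
  SupportPerm k Z τ → ¬ ¬ (∃ λ g → SupportPerm m M g × ∀ i → i < m → div (g i) t ≡ τ (div i t))
lift-perm {m} {k} {t} {M} {Z} {τ} m≡ S rowZ colZ (P , supp) ret = birkhoffℕ Y-stochastic λ (g , Pg , h) →
    ret (g , (Pg , λ i l e → h i l (trans (cong (λ z → ⟦ div (g i) t ≡ᵇ τ (div i t) ⟧ ℚ.* (r (div i t) ℚ.* z)) e)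
           (trans (cong (⟦ div (g i) t ≡ᵇ τ (div i t) ⟧ ℚ.*_) (ℚₚ.*-zeroʳ (r (div i t)))) (ℚₚ.*-zeroʳ ⟦ div (g i) t ≡ᵇ τ (div i t) ⟧))))
         , λ i l → inblock i (g i) (h i l))
  where
  r : ℕ → ℚ
  r a = recip (Z a (τ a))
  Y : ℕ → ℕ → ℚ
  Y i j = ⟦ div j t ≡ᵇ τ (div i t) ⟧ ℚ.* (r (div i t) ℚ.* M i j)
  q< : ∀ {i} → i < m → div i t < k
  q< {i} l = div-< k t (subst (i <_) m≡ l)
  inblock : ∀ i j → Y i j ≢ 0ℚ → div j t ≡ τ (div i t)
  inblock i j ne with bool-cases (div j t ≡ᵇ τ (div i t))
  ... | inj₁ e = ≡ᵇ-true _ _ e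
  ... | inj₂ f = ⊥-elim (ne (trans (cong (λ b → ⟦ b ⟧ ℚ.* (r (div i t) ℚ.* M i j)) f) (ℚₚ.*-zeroˡ (r (div i t) ℚ.* M i j))))
  r-nonneg : ∀ {i} → i < m → 0ℚ ℚ.≤ r (div i t)
  r-nonneg {i} l = recip-nonneg (subst (0ℚ ℚ.≤_) (rowZ i (τ (div i t)) l (bound P _ (q< l)))
    (Σℕ-nonneg m (λ j l′ → *-nonneg (nonnegℕ S i j l l′) (⟦⟧-nonneg (div j t ≡ᵇ τ (div i t))))))
  swap* : ∀ x y z → x ℚ.* (y ℚ.* z) ≡ y ℚ.* (z ℚ.* x)
  swap* x y z = trans (ℚₚ.*-comm x _) (ℚₚ.*-assoc y z x)
  swap*′ : ∀ x y z → x ℚ.* (y ℚ.* z) ≡ y ℚ.* (x ℚ.* z)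
  swap*′ x y z = trans (swap* x y z) (cong (y ℚ.*_) (ℚₚ.*-comm z x))
  Y-stochastic : Stochasticℕ m Y
  Y-stochastic = record
    { nonnegℕ = λ i j l l′ → *-nonneg (⟦⟧-nonneg (div j t ≡ᵇ τ (div i t))) (*-nonneg (r-nonneg l) (nonnegℕ S i j l l′))
    ; rowsℕ = λ i l → trans (Σℕ-cong m (λ j _ → swap* ⟦ div j t ≡ᵇ τ (div i t) ⟧ (r (div i t)) (M i j)))
        (trans (sum-*ˡ (r (div i t)) (λ (b : Fin m) → M i (toℕ b) ℚ.* ⟦ div (toℕ b) t ≡ᵇ τ (div i t) ⟧))
        (trans (cong (r (div i t) ℚ.*_) (rowZ i (τ (div i t)) l (bound P _ (q< l))))
        (trans (ℚₚ.*-comm (r (div i t)) _) (*-recip (supp _ (q< l))))))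
    ; colsℕ = λ j l → colSum j l (perm<-onto P (div j t) (q< l)) }
    where
    colSum : ∀ j → j < m → (∃ λ a → a < k × τ a ≡ div j t) → Σℕ m (λ i → Y i j) ≡ 1ℚ
    colSum j l (a , la , e) = trans (Σℕ-cong m term) (trans (sum-*ˡ (r a) (λ (b : Fin m) → ⟦ div (toℕ b) t ≡ᵇ a ⟧ ℚ.* M (toℕ b) j))
        (trans (cong (r a ℚ.*_) (trans (colZ a j la l) (cong (Z a) (sym e)))) (trans (ℚₚ.*-comm (r a) _) (*-recip (supp a la)))))
      where
      term : ∀ i → i < m → Y i j ≡ r a ℚ.* (⟦ div i t ≡ᵇ a ⟧ ℚ.* M i j)
      term i li = trans (cong (λ b → ⟦ b ⟧ ℚ.* (r (div i t) ℚ.* M i j)) same) (go (div i t) refl (bool-cases (div i t ≡ᵇ a)))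
        where
        same : (div j t ≡ᵇ τ (div i t)) ≡ (div i t ≡ᵇ a)
        same = bool-ext (λ h → subst (λ z → (div i t ≡ᵇ z) ≡ true) (injℕ P _ _ (q< li) la (trans (sym (≡ᵇ-true _ _ h)) (sym e))) (≡ᵇ-refl (div i t)))
                        (λ h → subst (λ z → (div j t ≡ᵇ τ z) ≡ true) (sym (≡ᵇ-true _ _ h)) (subst (λ z → (div j t ≡ᵇ z) ≡ true) (sym e) (≡ᵇ-refl (div j t))))
        go : ∀ q → div i t ≡ q → (div i t ≡ᵇ a) ≡ true ⊎ (div i t ≡ᵇ a) ≡ false →
          ⟦ div i t ≡ᵇ a ⟧ ℚ.* (r (div i t) ℚ.* M i j) ≡ r a ℚ.* (⟦ div i t ≡ᵇ a ⟧ ℚ.* M i j)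
        go q _ (inj₁ h) = trans (swap*′ ⟦ div i t ≡ᵇ a ⟧ (r (div i t)) (M i j)) (cong (λ z → r z ℚ.* (⟦ div i t ≡ᵇ a ⟧ ℚ.* M i j)) (≡ᵇ-true _ _ h))
        go q _ (inj₂ h) = trans (cong (λ b → ⟦ b ⟧ ℚ.* (r (div i t) ℚ.* M i j)) h) (trans (ℚₚ.*-zeroˡ (r (div i t) ℚ.* M i j))
          (sym (trans (cong (λ b → r a ℚ.* (⟦ b ⟧ ℚ.* M i j)) h) (trans (cong (r a ℚ.*_) (ℚₚ.*-zeroˡ (M i j))) (ℚₚ.*-zeroʳ (r a))))))

partner : ℕ → ℕ
partner 0 = 1
partner 1 = 0
partner (suc (suc i)) = suc (suc (partner i))

block-partner : ∀ i j → block 1 i j ≡ (j ≡ᵇ partner i)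
block-partner 0 0 = refl
block-partner 0 1 = refl
block-partner 0 (suc (suc j)) = cong (0 ≡ᵇ_) (div-+ 2 j (s≤s z≤n))
block-partner 1 0 = refl
block-partner 1 1 = refl
block-partner 1 (suc (suc j)) = cong (0 ≡ᵇ_) (div-+ 2 j (s≤s z≤n))
block-partner (suc (suc i)) 0 = cong (_≡ᵇ 0) (div-+ 2 i (s≤s z≤n))
block-partner (suc (suc i)) 1 = cong (_≡ᵇ 0) (div-+ 2 i (s≤s z≤n))
block-partner (suc (suc i)) (suc (suc j)) = trans (cong₂ (λ a b → not (i ≡ᵇ j) ∧ (a ≡ᵇ b)) (div-+ 2 i (s≤s z≤n)) (div-+ 2 j (s≤s z≤n))) (block-partner i j)

partner-even : ∀ a → partner (a * 2) ≡ suc (a * 2)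
partner-even zero = refl
partner-even (suc a) = cong (λ x → suc (suc x)) (partner-even a)

partner-odd : ∀ a → partner (suc (a * 2)) ≡ a * 2
partner-odd zero = refl
partner-odd (suc a) = cong (λ x → suc (suc x)) (partner-odd a)

partner-< : ∀ k i → i < k * 2 → partner i < k * 2
partner-< (suc k) 0 _ = s≤s (s≤s z≤n)
partner-< (suc k) 1 _ = s≤s z≤n
partner-< (suc k) (suc (suc i)) (s≤s (s≤s l)) = s≤s (s≤s (partner-< k i l))

div-even : ∀ a → div (a * 2) 2 ≡ a
div-even a = trans (cong (λ z → div z 2) (sym (ℕₚ.+-identityʳ (a * 2)))) (div-block a 2 0 (s≤s z≤n))

div-odd : ∀ a → div (suc (a * 2)) 2 ≡ a
div-odd a = trans (cong (λ z → div z 2) (ℕₚ.+-comm 1 (a * 2))) (div-block a 2 1 (s≤s (s≤s z≤n)))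

data EvenOdd : ℕ → Set where
  even : ∀ a → EvenOdd (a * 2)
  odd  : ∀ a → EvenOdd (suc (a * 2))

evenOdd : ∀ i → EvenOdd i
evenOdd 0 = even 0
evenOdd 1 = odd 0
evenOdd (suc (suc i)) with evenOdd i
... | even a = even (suc a)
... | odd a = odd (suc a)

block-lift : ∀ {m g t} {τ : ℕ → ℕ} → Perm< m g → t ≡ 2 → (∀ i → i < m → div (g i) t ≡ τ (div i t)) → (∀ i j → i < m → j < m → τ (div i t) ≡ τ (div j t) → div i t ≡ div j t) →
  ∀ i j → i < m → j < m → block 1 (g i) (g j) ≡ block 1 i j
block-lift {m} {g} {_} {τ} P refl h τ-inj i j l l′ = cong₂ _∧_
  (cong not (bool-ext (λ q → subst (λ z → (i ≡ᵇ z) ≡ true) (injℕ P i j l l′ (≡ᵇ-true (g i) (g j) q)) (≡ᵇ-refl i))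
                      (λ q → subst (λ z → (g i ≡ᵇ g z) ≡ true) (≡ᵇ-true i j q) (≡ᵇ-refl (g i)))))
  (trans (cong₂ _≡ᵇ_ (h i l) (h j l′))
    (bool-ext (λ q → subst (λ z → (div i 2 ≡ᵇ z) ≡ true) (τ-inj i j l l′ (≡ᵇ-true (τ (div i 2)) (τ (div j 2)) q)) (≡ᵇ-refl (div i 2)))
              (λ q → subst (λ z → (τ (div i 2) ≡ᵇ τ z) ≡ true) (≡ᵇ-true (div i 2) (div j 2) q) (≡ᵇ-refl (τ (div i 2))))))

-- Commuting with the matching makes the sums over pairs well defined, so this is a lift with blocks
-- of size two.
matching-perm : ∀ {m k M} → m ≡ k * 2 → Stochasticℕ m M → (∀ i j → i < m → j < m → M (partner i) j ≡ M i (partner j)) →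
  ¬ ¬ (∃ λ g → SupportPerm m M g × ∀ i j → i < m → j < m → block 1 (g i) (g j) ≡ block 1 i j)
matching-perm {_} {k} {M} refl S comm ret = birkhoffℕ Z-stochastic λ (τ , Pτ , supp) →
  lift-perm {k = k} {t = 2} {Z = Z} refl S rowZ colZ (Pτ , supp) λ (g , (Pg , supp′) , h) →
    ret (g , (Pg , supp′) , block-lift {t = 2} {τ} Pg refl h λ i j l l′ → injℕ Pτ (div i 2) (div j 2) (div-< k 2 l) (div-< k 2 l′))
  where
  m = k * 2
  e< : ∀ {a} → a < k → a * 2 < m
  e< l = ℕₚ.*-monoˡ-< 2 l
  o< : ∀ {a} → a < k → suc (a * 2) < m
  o< l = ℕₚ.*-monoˡ-≤ 2 l
  Z : ℕ → ℕ → ℚ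
  Z a b = M (a * 2) (b * 2) ℚ.+ M (a * 2) (suc (b * 2))
  odd-even : ∀ a j → a < k → j < m → M (suc (a * 2)) j ≡ M (a * 2) (partner j)
  odd-even a j la lj = trans (cong (λ z → M z j) (sym (partner-even a))) (comm (a * 2) j (e< la) lj)
  rowPair : ∀ i b → i < m → b < k → M i (b * 2) ℚ.+ M i (suc (b * 2)) ≡ Z (div i 2) b
  rowPair i b l lb with evenOdd i
  ... | even a = cong (λ z → Z z b) (sym (div-even a))
  ... | odd a = trans (cong₂ ℚ._+_ (trans (odd-even a (b * 2) la (e< lb)) (cong (M (a * 2)) (partner-even b)))
                                   (trans (odd-even a (suc (b * 2)) la (o< lb)) (cong (M (a * 2)) (partner-odd b))))
      (trans (ℚₚ.+-comm (M (a * 2) (suc (b * 2))) _) (cong (λ z → Z z b) (sym (div-odd a))))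
    where la = subst (_< k) (div-odd a) (div-< k 2 l)
  colPair : ∀ a j → a < k → j < m → M (a * 2) j ℚ.+ M (suc (a * 2)) j ≡ Z a (div j 2)
  colPair a j la l with evenOdd j
  ... | even b = trans (cong (M (a * 2) (b * 2) ℚ.+_) (trans (odd-even a (b * 2) la l) (cong (M (a * 2)) (partner-even b)))) (cong (Z a) (sym (div-even b)))
  ... | odd b = trans (cong (M (a * 2) (suc (b * 2)) ℚ.+_) (trans (odd-even a (suc (b * 2)) la l) (cong (M (a * 2)) (partner-odd b))))
      (trans (ℚₚ.+-comm (M (a * 2) (suc (b * 2))) _) (cong (Z a) (sym (div-odd b))))
  rowZ : ∀ i b → i < m → b < k → Σℕ m (λ j → M i j ℚ.* ⟦ div j 2 ≡ᵇ b ⟧) ≡ Z (div i 2) b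
  rowZ i b l lb = trans (Σℕ-pairs k (λ j → M i j ℚ.* ⟦ div j 2 ≡ᵇ b ⟧)) (trans (Σℕ-cong k (λ a _ → trans (cong₂ (λ x y → M i (a * 2) ℚ.* ⟦ x ≡ᵇ b ⟧ ℚ.+ M i (suc (a * 2)) ℚ.* ⟦ y ≡ᵇ b ⟧) (div-even a) (div-odd a))
      (trans (sym (ℚₚ.*-distribʳ-+ ⟦ a ≡ᵇ b ⟧ (M i (a * 2)) (M i (suc (a * 2))))) (ℚₚ.*-comm (M i (a * 2) ℚ.+ M i (suc (a * 2))) ⟦ a ≡ᵇ b ⟧))))
    (trans (Σℕ-pick k (λ a → M i (a * 2) ℚ.+ M i (suc (a * 2))) b lb) (rowPair i b l lb)))
  colZ : ∀ a j → a < k → j < m → Σℕ m (λ i → ⟦ div i 2 ≡ᵇ a ⟧ ℚ.* M i j) ≡ Z a (div j 2)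
  colZ a j la l = trans (Σℕ-pairs k (λ i → ⟦ div i 2 ≡ᵇ a ⟧ ℚ.* M i j)) (trans (Σℕ-cong k (λ b _ → trans (cong₂ (λ x y → ⟦ x ≡ᵇ a ⟧ ℚ.* M (b * 2) j ℚ.+ ⟦ y ≡ᵇ a ⟧ ℚ.* M (suc (b * 2)) j) (div-even b) (div-odd b))
      (sym (ℚₚ.*-distribˡ-+ ⟦ b ≡ᵇ a ⟧ (M (b * 2) j) (M (suc (b * 2)) j)))))
    (trans (Σℕ-pick k (λ b → M (b * 2) j ℚ.+ M (suc (b * 2)) j) a la) (colPair a j la l)))
  +-nonneg : ∀ {x y} → 0ℚ ℚ.≤ x → 0ℚ ℚ.≤ y → 0ℚ ℚ.≤ x ℚ.+ y
  +-nonneg {x} {y} h h′ = subst (ℚ._≤ x ℚ.+ y) (ℚₚ.+-identityˡ 0ℚ) (ℚₚ.+-mono-≤ h h′)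
  Z-stochastic : Stochasticℕ k Z
  Z-stochastic = record
    { nonnegℕ = λ a b la lb → +-nonneg (nonnegℕ S _ _ (e< la) (e< lb)) (nonnegℕ S _ _ (e< la) (o< lb))
    ; rowsℕ = λ a la → trans (sym (Σℕ-pairs k (M (a * 2)))) (rowsℕ S _ (e< la))
    ; colsℕ = λ b lb → trans (Σℕ-cong k (λ a la → trans (cong (Z a) (sym (div-even b))) (sym (colPair a (b * 2) la (e< lb)))))
        (trans (sym (Σℕ-pairs k (λ i → M i (b * 2)))) (colsℕ S _ (e< lb))) }

-- A matrix commuting with the pentagon satisfies a discrete wave equation, so in the coordinates
-- s = i + j and d = i - j it has the form α s + β d; hence its support contains a reflection or a rotation.
module Pentagon {M : ℕ → ℕ → ℚ} (S : Stochasticℕ 5 M)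
  (comm : ∀ i j → i < 5 → j < 5 → Σℕ 5 (λ k → ⟦ pentagon i k ⟧ ℚ.* M k j) ≡ Σℕ 5 (λ k → M i k ℚ.* ⟦ pentagon k j ⟧)) where

  private
    next prev : ℕ → ℕ
    next i = mod (1 + i) 5
    prev i = mod (4 + i) 5

    m5 : ∀ x → mod x 5 < 5
    m5 x = mod-< x (s≤s z≤n)

    fin5 : ∀ {P : ℕ → ℕ → Set} → (∀ (a b : Fin 5) → P (toℕ a) (toℕ b)) → ∀ i j → i < 5 → j < 5 → P i j
    fin5 {P} h i j l l′ = subst₂ P (Fₚ.toℕ-fromℕ< l) (Fₚ.toℕ-fromℕ< l′) (h (fromℕ< l) (fromℕ< l′))

    neighbours : ∀ i k → i < 5 → k < 5 → ⟦ pentagon i k ⟧ ≡ ⟦ k ≡ᵇ next i ⟧ ℚ.+ ⟦ k ≡ᵇ prev i ⟧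
    neighbours = fin5 (from-yes (all? λ (a : Fin 5) → all? λ (b : Fin 5) →
      ⟦ pentagon (toℕ a) (toℕ b) ⟧ ℚₚ.≟ (⟦ toℕ b ≡ᵇ next (toℕ a) ⟧ ℚ.+ ⟦ toℕ b ≡ᵇ prev (toℕ a) ⟧)))

    pent-sum : ∀ (f : ℕ → ℚ) i → i < 5 → Σℕ 5 (λ k → ⟦ pentagon i k ⟧ ℚ.* f k) ≡ f (next i) ℚ.+ f (prev i)
    pent-sum f i l = trans (Σℕ-cong 5 {g = λ k → ⟦ k ≡ᵇ next i ⟧ ℚ.* f k ℚ.+ ⟦ k ≡ᵇ prev i ⟧ ℚ.* f k}
        (λ k lk → trans (cong (ℚ._* f k) (neighbours i k l lk)) (ℚₚ.*-distribʳ-+ (f k) ⟦ k ≡ᵇ next i ⟧ ⟦ k ≡ᵇ prev i ⟧)))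
      (trans (sum-+ {5} (λ a → ⟦ toℕ a ≡ᵇ next i ⟧ ℚ.* f (toℕ a)) (λ a → ⟦ toℕ a ≡ᵇ prev i ⟧ ℚ.* f (toℕ a)))
        (cong₂ ℚ._+_ (Σℕ-pick 5 f (next i) (m5 (1 + i))) (Σℕ-pick 5 f (prev i) (m5 (4 + i)))))

    wave : ∀ i j → i < 5 → j < 5 → M (next i) j ℚ.+ M (prev i) j ≡ M i (next j) ℚ.+ M i (prev j)
    wave i j l l′ = trans (sym (pent-sum (λ k → M k j) i l)) (trans (comm i j l l′)
      (trans (Σℕ-cong 5 (λ k _ → trans (ℚₚ.*-comm (M i k) ⟦ pentagon k j ⟧) (cong (λ b → ⟦ b ⟧ ℚ.* M i k) (block-sym 2 k j)))) (pent-sum (M i) j l′)))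

    -- 3 is the inverse of 2 modulo 5, so i = 3 (s + d) and j = 3 (s - d) = 3 s + 2 d.
    rowOf colOf : ℕ → ℕ → ℕ
    rowOf s d = mod (3 * s + 3 * d) 5
    colOf s d = mod (3 * s + 2 * d) 5

    N : ℕ → ℕ → ℚ
    N s d = M (rowOf s d) (colOf s d)

    index : ∀ s d → s < 5 → d < 5 →
      (next (rowOf s d) ≡ rowOf (next s) (next d) × colOf s d ≡ colOf (next s) (next d)) ×
      (prev (rowOf s d) ≡ rowOf (prev s) (prev d) × colOf s d ≡ colOf (prev s) (prev d)) ×
      (rowOf s d ≡ rowOf (next s) (prev d) × next (colOf s d) ≡ colOf (next s) (prev d)) ×
      (rowOf s d ≡ rowOf (prev s) (next d) × prev (colOf s d) ≡ colOf (prev s) (next d))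
    index = fin5 (from-yes (all? λ (a : Fin 5) → all? λ (b : Fin 5) → let s = toℕ a ; d = toℕ b in
      ((next (rowOf s d) ℕ.≟ rowOf (next s) (next d)) ×-dec (colOf s d ℕ.≟ colOf (next s) (next d))) ×-dec
      (((prev (rowOf s d) ℕ.≟ rowOf (prev s) (prev d)) ×-dec (colOf s d ℕ.≟ colOf (prev s) (prev d))) ×-dec
      (((rowOf s d ℕ.≟ rowOf (next s) (prev d)) ×-dec (next (colOf s d) ℕ.≟ colOf (next s) (prev d))) ×-dec
      ((rowOf s d ℕ.≟ rowOf (prev s) (next d)) ×-dec (prev (colOf s d) ℕ.≟ colOf (prev s) (next d)))))))

    square : ∀ s d → s < 5 → d < 5 → N (next s) (next d) ℚ.+ N (prev s) (prev d) ≡ N (next s) (prev d) ℚ.+ N (prev s) (next d)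
    square s d l l′ = let ((a , b) , (c , e) , (f , g) , (h , k)) = index s d l l′ in
      trans (sym (cong₂ ℚ._+_ (cong₂ M a b) (cong₂ M c e))) (trans (wave (rowOf s d) (colOf s d) (m5 (3 * s + 3 * d)) (m5 (3 * s + 2 * d)))
        (cong₂ ℚ._+_ (cong₂ M f g) (cong₂ M h k)))

    -- Steps of length two reach every residue modulo 5.
    constant : (f : ℕ → ℚ) → (∀ s → s < 5 → f (next s) ≡ f (prev s)) → ∀ s → s < 5 → f s ≡ f 0
    constant f h = λ { 0 _ → refl ; 1 _ → e1 ; 2 _ → e2 ; 3 _ → e3 ; 4 _ → e4
                     ; (suc (suc (suc (suc (suc s))))) (s≤s (s≤s (s≤s (s≤s (s≤s ()))))) }
      where
      e2 : f 2 ≡ f 0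
      e2 = h 1 (s≤s (s≤s z≤n))
      e4 : f 4 ≡ f 0
      e4 = trans (h 3 (s≤s (s≤s (s≤s (s≤s z≤n))))) e2
      e1 : f 1 ≡ f 0
      e1 = trans (h 0 (s≤s z≤n)) e4
      e3 : f 3 ≡ f 0
      e3 = trans (h 2 (s≤s (s≤s (s≤s z≤n)))) e1

    cross : ∀ a b c e → a ℚ.+ b ≡ c ℚ.+ e → a ℚ.- c ≡ e ℚ.- b
    cross a b c e h = begin
      a ℚ.- c ≡⟨ cong (ℚ._- c) (sym (trans (ℚₚ.+-assoc a b (ℚ.- b)) (trans (cong (a ℚ.+_) (ℚₚ.+-inverseʳ b)) (ℚₚ.+-identityʳ a)))) ⟩
      ((a ℚ.+ b) ℚ.- b) ℚ.- c ≡⟨ cong (λ z → (z ℚ.- b) ℚ.- c) (trans h (ℚₚ.+-comm c e)) ⟩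
      ((e ℚ.+ c) ℚ.- b) ℚ.- c ≡⟨ trans (ℚₚ.+-assoc (e ℚ.+ c) (ℚ.- b) (ℚ.- c)) (+-interchange e c (ℚ.- b) (ℚ.- c)) ⟩
      (e ℚ.- b) ℚ.+ (c ℚ.- c) ≡⟨ trans (cong ((e ℚ.- b) ℚ.+_) (ℚₚ.+-inverseʳ c)) (ℚₚ.+-identityʳ _) ⟩
      e ℚ.- b ∎
      where open ≡-Reasoning

    uncross : ∀ a b c e → a ℚ.- c ≡ e ℚ.- b → a ℚ.+ b ≡ e ℚ.+ c
    uncross a b c e h = begin
      a ℚ.+ b ≡⟨ cong (ℚ._+ b) (sym (trans (ℚₚ.+-assoc a (ℚ.- c) c) (trans (cong (a ℚ.+_) (ℚₚ.+-inverseˡ c)) (ℚₚ.+-identityʳ a)))) ⟩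
      ((a ℚ.- c) ℚ.+ c) ℚ.+ b ≡⟨ cong (λ z → (z ℚ.+ c) ℚ.+ b) h ⟩
      ((e ℚ.- b) ℚ.+ c) ℚ.+ b ≡⟨ trans (ℚₚ.+-assoc (e ℚ.- b) c b) (+-interchange e (ℚ.- b) c b) ⟩
      (e ℚ.+ c) ℚ.+ ((ℚ.- b) ℚ.+ b) ≡⟨ trans (cong ((e ℚ.+ c) ℚ.+_) (ℚₚ.+-inverseˡ b)) (ℚₚ.+-identityʳ _) ⟩
      e ℚ.+ c ∎
      where open ≡-Reasoning

    -- The vanishing of mixed differences, which expresses the form α s + β d without choosing α and
    -- β.
    rectangle : ∀ s d d₀ → s < 5 → d < 5 → d₀ < 5 → N s d ℚ.+ N 0 d₀ ≡ N s d₀ ℚ.+ N 0 d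
    rectangle s d d₀ ls ld l₀ = uncross (N s d) (N 0 d₀) (N 0 d) (N s d₀)
        (trans (constant T T-step d ld) (sym (constant T T-step d₀ l₀)))
      where
      T : ℕ → ℚ
      T d = N s d ℚ.- N 0 d
      T-step : ∀ d → d < 5 → T (next d) ≡ T (prev d)
      T-step d l = cross (N s (next d)) (N 0 (prev d)) (N 0 (next d)) (N s (prev d))
        (trans (uncross (N s (next d)) (N 0 (prev d)) (N s (prev d)) (N 0 (next d))
          (constant (λ s → N s (next d) ℚ.- N s (prev d)) (λ s l′ → cross (N (next s) (next d)) (N (prev s) (prev d)) (N (next s) (prev d)) (N (prev s) (next d)) (square s d l′ l)) s ls))
          refl)

  Good : (ℕ → ℕ) → Set
  Good g = ∀ i j → i < 5 → j < 5 → pentagon (g i) (g j) ≡ pentagon i j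

  reflect rotate : ℕ → ℕ → ℕ
  reflect s i = mod (s + 4 * i) 5
  rotate d i = mod (i + 4 * d) 5

  private
    symmetry : (g : ℕ → ℕ) → (∀ i → g i < 5) → (∀ (a b : Fin 5) → g (toℕ a) ≡ g (toℕ b) → a ≡ b) →
      (∀ (a b : Fin 5) → pentagon (g (toℕ a)) (g (toℕ b)) ≡ pentagon (toℕ a) (toℕ b)) →
      (∀ i → i < 5 → M i (g i) ≢ 0ℚ) → ∃ λ g → SupportPerm 5 M g × Good g
    symmetry g b i p h = g , (record { bound = λ i _ → b i ; injℕ = fin5 {λ i j → g i ≡ g j → i ≡ j} (λ x y e → cong toℕ (i x y e)) } , h) , fin5 p

    injective? : (g : ℕ → ℕ) → Dec (∀ (a b : Fin 5) → g (toℕ a) ≡ g (toℕ b) → a ≡ b)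
    injective? g = all? λ a → all? λ b → (g (toℕ a) ℕ.≟ g (toℕ b)) →-dec (a ≟ b)

    preserves? : (g : ℕ → ℕ) → Dec (∀ (a b : Fin 5) → pentagon (g (toℕ a)) (g (toℕ b)) ≡ pentagon (toℕ a) (toℕ b))
    preserves? g = all? λ a → all? λ b → pentagon (g (toℕ a)) (g (toℕ b)) 𝔹ₚ.≟ pentagon (toℕ a) (toℕ b)

    reflection : ∀ (s : Fin 5) → (∀ d → d < 5 → N (toℕ s) d ≢ 0ℚ) → ∃ λ g → SupportPerm 5 M g × Good g
    reflection s h = symmetry (reflect (toℕ s)) (λ i → m5 (toℕ s + 4 * i))
      (from-yes (all? λ (s : Fin 5) → injective? (reflect (toℕ s))) s) (from-yes (all? λ (s : Fin 5) → preserves? (reflect (toℕ s))) s)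
      -- On the reflection j = s - i, the second coordinate is d = i - j = 2 i - s.
      (λ i l e → h (mod (2 * i + 4 * toℕ s) 5) (m5 (2 * i + 4 * toℕ s)) (trans (cong₂ M (proj₁ (ix i l)) (proj₂ (ix i l))) e))
      where
      ix : ∀ i → i < 5 → rowOf (toℕ s) (mod (2 * i + 4 * toℕ s) 5) ≡ i × colOf (toℕ s) (mod (2 * i + 4 * toℕ s) 5) ≡ reflect (toℕ s) i
      ix i l = fin5 {λ s i → rowOf s (mod (2 * i + 4 * s) 5) ≡ i × colOf s (mod (2 * i + 4 * s) 5) ≡ reflect s i}
        (from-yes (all? λ (a : Fin 5) → all? λ (b : Fin 5) → let s = toℕ a ; i = toℕ b in
          (rowOf s (mod (2 * i + 4 * s) 5) ℕ.≟ i) ×-dec (colOf s (mod (2 * i + 4 * s) 5) ℕ.≟ reflect s i))) (toℕ s) i (Fₚ.toℕ<n s) l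

    rotation : ∀ (d : Fin 5) → (∀ s → s < 5 → N s (toℕ d) ≢ 0ℚ) → ∃ λ g → SupportPerm 5 M g × Good g
    rotation d h = symmetry (rotate (toℕ d)) (λ i → m5 (i + 4 * toℕ d))
      (from-yes (all? λ (d : Fin 5) → injective? (rotate (toℕ d))) d) (from-yes (all? λ (d : Fin 5) → preserves? (rotate (toℕ d))) d)
      (λ i l e → h (mod (2 * i + 4 * toℕ d) 5) (m5 (2 * i + 4 * toℕ d)) (trans (cong₂ M (proj₁ (ix i l)) (proj₂ (ix i l))) e))
      where
      ix : ∀ i → i < 5 → rowOf (mod (2 * i + 4 * toℕ d) 5) (toℕ d) ≡ i × colOf (mod (2 * i + 4 * toℕ d) 5) (toℕ d) ≡ rotate (toℕ d) i
      ix i l = fin5 {λ d i → rowOf (mod (2 * i + 4 * d) 5) d ≡ i × colOf (mod (2 * i + 4 * d) 5) d ≡ rotate d i}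
        (from-yes (all? λ (a : Fin 5) → all? λ (b : Fin 5) → let d = toℕ a ; i = toℕ b in
          (rowOf (mod (2 * i + 4 * d) 5) d ℕ.≟ i) ×-dec (colOf (mod (2 * i + 4 * d) 5) d ℕ.≟ rotate d i))) (toℕ d) i (Fₚ.toℕ<n d) l

    N-nonneg : ∀ s d → 0ℚ ℚ.≤ N s d
    N-nonneg s d = nonnegℕ S _ _ (m5 (3 * s + 3 * d)) (m5 (3 * s + 2 * d))

    sum-pos : ∀ {x y} → 0ℚ ℚ.≤ x → 0ℚ ℚ.≤ y → x ≢ 0ℚ → x ℚ.+ y ≢ 0ℚ
    sum-pos {x} {y} hx hy ne e = <⇒≱ℚ (≢0⇒pos hx ne) (subst₂ ℚ._≤_ (ℚₚ.+-identityʳ x) e (ℚₚ.+-monoʳ-≤ x hy))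

  -- If `N 0` has a zero at `d₀`, then `rectangle` gives N s d = N s d₀ + N 0 d with nonnegative
  -- terms. A nonzero first term makes row `s` positive and yields a reflection; a nonzero second
  -- term makes column `d` positive and yields a rotation. They cannot all vanish, since rows sum to
  -- 1.
  pentagon-perm : ∃ λ g → SupportPerm 5 M g × Good g
  pentagon-perm with any? (λ (d : Fin 5) → N 0 (toℕ d) ℚₚ.≟ 0ℚ)
  ... | no none = reflection zero λ d l e → none (fromℕ< l , trans (cong (N 0) (Fₚ.toℕ-fromℕ< l)) e)
  ... | yes (d₀ , z₀) with any? (λ (s : Fin 5) → ¬? (N (toℕ s) (toℕ d₀) ℚₚ.≟ 0ℚ)) | any? (λ (d : Fin 5) → ¬? (N 0 (toℕ d) ℚₚ.≟ 0ℚ))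
  ...   | yes (s , ne) | _ = reflection s λ d l e → sum-pos (N-nonneg (toℕ s) (toℕ d₀)) (N-nonneg 0 d) ne
            (trans (sym (split (toℕ s) d (Fₚ.toℕ<n s) l)) e)
    where
    split : ∀ s d → s < 5 → d < 5 → N s d ≡ N s (toℕ d₀) ℚ.+ N 0 d
    split s d ls ld = trans (sym (ℚₚ.+-identityʳ _)) (trans (cong (N s d ℚ.+_) (sym z₀)) (rectangle s d (toℕ d₀) ls ld (Fₚ.toℕ<n d₀)))
  ...   | no _ | yes (d , ne) = rotation d λ s l e → sum-pos (N-nonneg 0 (toℕ d)) (N-nonneg s (toℕ d₀)) ne
            (trans (ℚₚ.+-comm (N 0 (toℕ d)) _) (trans (sym (split s (toℕ d) l (Fₚ.toℕ<n d))) e))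
    where
    split : ∀ s d → s < 5 → d < 5 → N s d ≡ N s (toℕ d₀) ℚ.+ N 0 d
    split s d ls ld = trans (sym (ℚₚ.+-identityʳ _)) (trans (cong (N s d ℚ.+_) (sym z₀)) (rectangle s d (toℕ d₀) ls ld (Fₚ.toℕ<n d₀)))
  ...   | no a | no b = ⊥-elim (0≢1ℚ (trans (sym (sum-zero {5} zeros)) (rowsℕ S 0 (s≤s z≤n))))
    where
    zeroN : ∀ s d → s < 5 → d < 5 → N s d ≡ 0ℚ
    zeroN s d ls ld = trans (sym (ℚₚ.+-identityʳ _)) (trans (cong (N s d ℚ.+_) (sym z₀)) (trans (rectangle s d (toℕ d₀) ls ld (Fₚ.toℕ<n d₀))
      (trans (cong₂ ℚ._+_ (za s ls) (zb d ld)) (ℚₚ.+-identityˡ 0ℚ))))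
      where
      za : ∀ s → s < 5 → N s (toℕ d₀) ≡ 0ℚ
      za s l = dne (N s (toℕ d₀) ℚₚ.≟ 0ℚ) λ ne → a (fromℕ< l , λ e → ne (trans (cong (λ z → N z (toℕ d₀)) (sym (Fₚ.toℕ-fromℕ< l))) e))
      zb : ∀ d → d < 5 → N 0 d ≡ 0ℚ
      zb d l = dne (N 0 d ℚₚ.≟ 0ℚ) λ ne → b (fromℕ< l , λ e → ne (trans (cong (N 0) (sym (Fₚ.toℕ-fromℕ< l))) e))
    zeros : ∀ (j : Fin 5) → M 0 (toℕ j) ≡ 0ℚ
    zeros j = trans (sym (cong₂ M (proj₁ ix) (proj₂ ix))) (zeroN (toℕ j) (mod (4 * toℕ j) 5) (Fₚ.toℕ<n j) (m5 (4 * toℕ j)))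
      where
      ix : rowOf (toℕ j) (mod (4 * toℕ j) 5) ≡ 0 × colOf (toℕ j) (mod (4 * toℕ j) 5) ≡ toℕ j
      ix = from-yes (all? λ (a : Fin 5) → let j = toℕ a in (rowOf j (mod (4 * j) 5) ℕ.≟ 0) ×-dec (colOf j (mod (4 * j) 5) ℕ.≟ j)) j

Commutes : ∀ {n} → Adj n → (Fin n → Fin n → ℚ) → Set
Commutes {n} B X = ∀ u v → sumℚ n (λ w → ⟦ B u w ⟧ ℚ.* X w v) ≡ sumℚ n (λ w → X u w ℚ.* ⟦ B w v ⟧)

InSupport : ∀ {n} → (Fin n → Fin n → ℚ) → (Fin n → Fin n) → Set
InSupport X σ = ∀ v → X v (σ v) ≢ 0ℚ

-- Every matrix commuting with the canonical graph has an automorphism in its support: permutations of the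
-- index sets are chosen cell by cell in order of increasing size, equally on cells connected by identity links.
module SupportAut {n : ℕ} (p : Fin n → Fin n) (p-idem : ∀ v → p (p v) ≡ p v)
  {B : Adj n} (sB : Simple B) (eqB : Cells.Equit p B)
  (double : ∀ {c c′} → p c ≡ c → p c′ ≡ c′ → Cells.size p c * Cells.deg p B c c′ ≡ Cells.size p c′ * Cells.deg p B c′ c)
  (parity : ∀ {c} → p c ≡ c → Cells.deg p B c c ≡ 1 → ∃ λ k → Cells.size p c ≡ k * 2)
  (cell-type : ∀ {c} → p c ≡ c → Cells.deg p B c c ≤ 1 ⊎ (Cells.deg p B c c ≡ 2 × Cells.size p c ≡ 5))
  (pair-type : ∀ {c c′} → p c ≡ c → p c′ ≡ c′ → c ≢ c′ → Cells.deg p B c c′ ≤ 1 ⊎ Cells.deg p B c′ c ≤ 1)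
  (sparse : ∀ {c c′} → p c ≡ c → p c′ ≡ c′ → c ≢ c′ → 2 * Cells.deg p B c c′ ≤ Cells.size p c′)
  (sparse-cell : ∀ {c} → p c ≡ c → suc (2 * Cells.deg p B c c) ≤ Cells.size p c)
  (rg : Cells.Rigid p (Standard.G₀ p p-idem sB eqB double parity cell-type pair-type sparse sparse-cell)) {X : Fin n → Fin n → ℚ} (ds : DoublyStochastic n X)
  (X-cell : ∀ u v → X u v ≢ 0ℚ → p u ≡ p v) (comm : Commutes (Standard.G₀ p p-idem sB eqB double parity cell-type pair-type sparse sparse-cell) X) where
  open Cells p
  open Standard p p-idem sB eqB double parity cell-type pair-type sparse sparse-cell

  open DoublyStochastic ds

  M : Fin n → ℕ → ℕ → ℚ
  M c i j = X (at c i) (at c j)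

  cell-sum : ∀ {c} → p c ≡ c → (f : Fin n → ℚ) → (∀ v → f v ≢ 0ℚ → p v ≡ c) → sumℚ n f ≡ Σℕ (size c) (λ i → f (at c i))
  cell-sum {c} pc f h = sum-reindex (at c ∘ toℕ) rank f (λ j → Fₚ.toℕ-injective (trans (rank-≡ (at-cell (Fₚ.toℕ<n j))) (idx-at (Fₚ.toℕ<n j))))
      (λ v ne → trans (cong (at c) (rank-≡ (h v ne))) (trans (cong (λ z → at z (idx v)) (sym (h v ne))) (at-idx v)))
    where
    rank : Fin n → Fin (size c)
    rank v with idx v ℕ.<? size c
    ... | yes l = fromℕ< l
    ... | no _  = fromℕ< (size-pos pc)
    rank-≡ : ∀ {v} → p v ≡ c → toℕ (rank v) ≡ idx v
    rank-≡ {v} e with idx v ℕ.<? size c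
    ... | yes l = Fₚ.toℕ-fromℕ< l
    ... | no h = ⊥-elim (h (subst (λ z → idx v < size z) e (idx-< v)))

  *-≢0ʳ : ∀ {x y} → x ℚ.* y ≢ 0ℚ → y ≢ 0ℚ
  *-≢0ʳ {x} ne refl = ne (ℚₚ.*-zeroʳ x)

  *-≢0ˡ : ∀ {x y} → x ℚ.* y ≢ 0ℚ → x ≢ 0ℚ
  *-≢0ˡ {y = y} ne refl = ne (ℚₚ.*-zeroˡ y)

  M-stochastic : ∀ {c} → p c ≡ c → Stochasticℕ (size c) (M c)
  M-stochastic {c} pc = record
    { nonnegℕ = λ i j _ _ → nonneg _ _
    ; rowsℕ = λ i l → trans (sym (cell-sum pc (X (at c i)) (λ v ne → trans (sym (X-cell _ v ne)) (at-cell l)))) (rows (at c i))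
    ; colsℕ = λ j l → trans (sym (cell-sum pc (λ u → X u (at c j)) (λ u ne → trans (X-cell u _ ne) (at-cell l)))) (cols (at c j)) }

  -- `X` is block diagonal, so for one vertex in each of two cells both sides of the commutation
  -- equation collapse to a sum over a single cell.
  comm-cell : ∀ {c z i j} → p c ≡ c → p z ≡ z → i < size c → j < size z → (R R′ : ℕ → Bool) →
    (∀ w → p w ≡ z → G₀ (at c i) w ≡ R (idx w)) → (∀ w → p w ≡ c → G₀ w (at z j) ≡ R′ (idx w)) →
    Σℕ (size z) (λ k → ⟦ R k ⟧ ℚ.* M z k j) ≡ Σℕ (size c) (λ k → M c i k ℚ.* ⟦ R′ k ⟧)
  comm-cell {c} {z} {i} {j} pc pz li lj R R′ h h′ = trans (sym left) (trans (comm (at c i) (at z j)) right)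
    where
    left : sumℚ n (λ w → ⟦ G₀ (at c i) w ⟧ ℚ.* X w (at z j)) ≡ Σℕ (size z) (λ k → ⟦ R k ⟧ ℚ.* M z k j)
    left = trans (cell-sum pz (λ w → ⟦ G₀ (at c i) w ⟧ ℚ.* X w (at z j)) (λ w ne → trans (X-cell w _ (*-≢0ʳ {⟦ G₀ (at c i) w ⟧} ne)) (at-cell lj)))
      (Σℕ-cong (size z) (λ k l → cong (λ b → ⟦ b ⟧ ℚ.* M z k j) (trans (h (at z k) (at-cell l)) (cong R (idx-at l)))))
    right : sumℚ n (λ w → X (at c i) w ℚ.* ⟦ G₀ w (at z j) ⟧) ≡ Σℕ (size c) (λ k → M c i k ℚ.* ⟦ R′ k ⟧)
    right = trans (cell-sum pc (λ w → X (at c i) w ℚ.* ⟦ G₀ w (at z j) ⟧) (λ w ne → trans (sym (X-cell _ w (*-≢0ˡ {X (at c i) w} ne))) (at-cell li)))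
      (Σℕ-cong (size c) (λ k l → cong (λ b → M c i k ℚ.* ⟦ b ⟧) (trans (h′ (at c k) (at-cell l)) (cong R′ (idx-at l)))))

  pick-right : ∀ m (f : ℕ → ℚ) a → a < m → Σℕ m (λ k → f k ℚ.* ⟦ k ≡ᵇ a ⟧) ≡ f a
  pick-right m f a l = trans (Σℕ-cong m (λ k _ → ℚₚ.*-comm (f k) ⟦ k ≡ᵇ a ⟧)) (Σℕ-pick m f a l)

  M-eq : ∀ {c c′ i j} → Eq c c′ → i < size c → j < size c → M c i j ≡ M c′ i j
  M-eq {c} {c′} {i} {j} E@((pc , pc′ , _) , _) li lj =
    trans (sym (pick-right (size c) (M c i) j lj)) (trans (sym (comm-cell pc pc′ li lj′ (_≡ᵇ i) (_≡ᵇ j)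
        (λ w pw → trans (std-eq F₀ E (at-cell li) pw) (trans (cong (_≡ᵇ idx w) (idx-at li)) (≡ᵇ-sym i (idx w))))
        (λ w pw → trans (std-eq F₀ E pw (at-cell lj′)) (cong (idx w ≡ᵇ_) (idx-at lj′)))))
      (Σℕ-pick (size c′) (λ k → M c′ k j) i (subst (i <_) (eq-size E) li)))
    where
    lj′ : j < size c′
    lj′ = subst (j <_) (eq-size E) lj

  M-conn : ∀ {c c′ i j} → Conn c c′ → i < size c → j < size c → M c i j ≡ M c′ i j
  M-conn here _ _ = refl
  M-conn {i = i} {j} (step k E) li lj = trans (M-conn k li lj)
    (M-eq E (subst (i <_) (conn-size k) li) (subst (j <_) (conn-size k) lj))

  -- Together with `proper-cols` this says that the block of `z` is the quotient of the block of
  -- `c`, as `lift-perm` requires.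
  proper-rows : ∀ {c z} → Proper c z → ∀ i b → i < size c → b < size z →
    Σℕ (size c) (λ j → M c i j ℚ.* ⟦ div j (D z c) ≡ᵇ b ⟧) ≡ M z (div i (D z c)) b
  proper-rows {c} {z} P@((pc , pz , _) , _) i b li lb = trans (sym (comm-cell pc pz li lb (λ k → k ≡ᵇ div i (D z c)) (λ k → div k (D z c) ≡ᵇ b)
      (λ w pw → trans (std-proper F₀ P (at-cell li) pw) (trans (cong (λ q → div q (D z c) ≡ᵇ idx w) (idx-at li)) (≡ᵇ-sym _ (idx w))))
      (λ w pw → trans (std-proper F₀ P pw (at-cell lb)) (cong (div (idx w) (D z c) ≡ᵇ_) (idx-at lb)))))
    (Σℕ-pick (size z) (λ k → M z k b) (div i (D z c)) (Maps.map-< F₀-maps P i li))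

  proper-cols : ∀ {c z} → Proper c z → ∀ a j → a < size z → j < size c →
    Σℕ (size c) (λ i → ⟦ div i (D z c) ≡ᵇ a ⟧ ℚ.* M c i j) ≡ M z a (div j (D z c))
  proper-cols {c} {z} P@((pc , pz , _) , _) a j la lj = trans (comm-cell pz pc la lj (λ k → div k (D z c) ≡ᵇ a) (λ k → k ≡ᵇ div j (D z c))
      (λ w pw → trans (sy (std-simple F₀) (at z a) w) (trans (std-proper F₀ P pw (at-cell la)) (cong (div (idx w) (D z c) ≡ᵇ_) (idx-at la))))
      (λ w pw → trans (sy (std-simple F₀) w (at c j)) (trans (std-proper F₀ P (at-cell lj) pw) (trans (cong (λ q → div q (D z c) ≡ᵇ idx w) (idx-at lj)) (≡ᵇ-sym _ (idx w))))))
    (pick-right (size z) (M z a) (div j (D z c)) (Maps.map-< F₀-maps P j lj))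

  block-comm : ∀ {c} → p c ≡ c → ∀ i j → i < size c → j < size c →
    Σℕ (size c) (λ k → ⟦ block (D c c) i k ⟧ ℚ.* M c k j) ≡ Σℕ (size c) (λ k → M c i k ℚ.* ⟦ block (D c c) k j ⟧)
  block-comm {c} pc i j li lj = comm-cell pc pc li lj (block (D c c) i) (λ k → block (D c c) k j)
    (λ w pw → trans (std-same F₀ (at-cell li) pw) (cong (λ q → block (D c c) q (idx w)) (idx-at li)))
    (λ w pw → trans (std-same F₀ pw (at-cell lj)) (cong (block (D c c) (idx w)) (idx-at lj)))

  eq-sym : ∀ {c c′} → Eq c c′ → Eq c′ c
  eq-sym ((a , b , ne) , e , f) = (b , a , ne ∘ sym) , f , e

  conn-trans : ∀ {a b c} → Conn a b → Conn b c → Conn a c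
  conn-trans k here = k
  conn-trans k (step l E) = step (conn-trans k l) E

  conn-sym : ∀ {a b} → Conn a b → Conn b a
  conn-sym here = here
  conn-sym (step k E) = conn-trans (step here (eq-sym E)) (conn-sym k)

  conn-label : ∀ {a b} → p a ≡ a → Conn a b → p b ≡ b
  conn-label pa here = pa
  conn-label pa (step k ((_ , pb , _) , _)) = pb

  proper? : ∀ c z → Dec (Proper c z)
  proper? c z = ((p c ≟ c) ×-dec ((p z ≟ z) ×-dec ¬? (c ≟ z))) ×-dec ((D c z ℕ.≟ 1) ×-dec (2 ℕ.≤? D z c))

  Family : Set
  Family = Fin n → ℕ → ℕ

  KeepsBlock : Fin n → (ℕ → ℕ) → Set
  KeepsBlock c g = ∀ i j → i < size c → j < size c → block (D c c) (g i) (g j) ≡ block (D c c) i j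

  -- A partial solution on the cells of size below `K`. Induction on the size is possible because
  -- the target of a proper link is smaller than its source, by `proper-<`.
  record Compatible (K : ℕ) (s : Family) : Set where
    field
      perm      : ∀ {c} → p c ≡ c → size c < K → SupportPerm (size c) (M c) (s c)
      keep-eq   : ∀ {c c′} → Eq c c′ → size c < K → ∀ i → s c i ≡ s c′ i
      keep-map  : ∀ {c z} → Proper c z → size c < K → ∀ i → i < size c → div (s c i) (D z c) ≡ s z (div i (D z c))
      keep-cell : ∀ {c} → p c ≡ c → size c < K → KeepsBlock c (s c)

  -- Identity links force one permutation of indices on the whole class of `r`, so it has to respect
  -- the structure on every cell of the class at once.
  record Good (s : Family) (r : Fin n) (g : ℕ → ℕ) : Set where
    field
      g-perm : SupportPerm (size r) (M r) g
      g-map  : ∀ {c z} → Conn r c → Proper c z → ∀ i → i < size r → div (g i) (D z c) ≡ s z (div i (D z c))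
      g-cell : ∀ {c} → Conn r c → KeepsBlock c g

  proper-< : ∀ {c z} → Proper c z → size z < size c
  proper-< {c} {z} P@((pc , pz , _) , _ , t≥2) = subst (size z <_) (sym (proper-size P))
    (ℕₚ.≤-trans (ℕₚ.m<m+n (size z) (size-pos pz)) (ℕₚ.≤-trans (ℕₚ.≤-reflexive (trans (cong (size z +_) (sym (ℕₚ.+-identityʳ _))) (ℕₚ.*-comm 2 (size z)))) (ℕₚ.*-monoʳ-≤ (size z) t≥2)))

  keeps-zero : ∀ {c} g → D c c ≡ 0 → KeepsBlock c g
  keeps-zero g e i j _ _ = trans (cong (λ d → block d (g i) (g j)) e) (cong (λ d → block d i j) (sym e))

  module Extend {K : ℕ} {s : Family} (C : Compatible K s) (conn? : ∀ c c′ → Dec (Conn c c′)) where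
    open Compatible C

    -- Only one kind of constraint acts on a class. A proper link is unique and makes all cells of
    -- the class edgeless. Otherwise matchings and pentagons exclude each other by the parity of the
    -- size, and all matchings, or all pentagons, in the class are the same relation on indices.
    good : ∀ {r} → p r ≡ r → size r ≡ K → ¬ ¬ ∃ (Good s r)
    good {r} pr e ret with any? (λ c → any? (λ z → conn? r c ×-dec proper? c z))
    ... | yes (c , z , k , P@((pc , pz , c≢z) , _)) =
      lift-perm {size r} {size z} {D z c} {M r} {M z} {s z} (trans (conn-size k) (proper-size P)) (M-stochastic pr)
        (λ i b li lb → trans (Σℕ-cong (size r) (λ j lj → cong (ℚ._* ⟦ div j (D z c) ≡ᵇ b ⟧) (M-conn k li lj)))
           (trans (cong (λ q → Σℕ q (λ j → M c i j ℚ.* ⟦ div j (D z c) ≡ᵇ b ⟧)) (conn-size k)) (proper-rows P i b (subst (i <_) (conn-size k) li) lb)))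
        (λ a j la lj → trans (Σℕ-cong (size r) (λ i li → cong (⟦ div i (D z c) ≡ᵇ a ⟧ ℚ.*_) (M-conn k li lj)))
           (trans (cong (λ q → Σℕ q (λ i → ⟦ div i (D z c) ≡ᵇ a ⟧ ℚ.* M c i j)) (conn-size k)) (proper-cols P a j la (subst (j <_) (conn-size k) lj))))
        (perm pz (subst (size z <_) (trans (sym (conn-size k)) e) (proper-< P)))
        λ (g , Pg , h) → ret (g , record
          { g-perm = Pg
          ; g-map = λ {c′} {z′} k′ P′ i l → let (q₁ , q₂) = unique k′ P′ in subst₂ (λ x y → div (g i) (D y x) ≡ s y (div i (D y x))) (sym q₁) (sym q₂) (h i l)
          ; g-cell = λ {c′} k′ → keeps-zero g (cell-zero k′) })
      where
      unique : ∀ {c′ z′} → Conn r c′ → Proper c′ z′ → c′ ≡ c × z′ ≡ z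
      -- Of two competing links, the one with the larger fibres is twisted.
      unique {c′} {z′} k′ P′ with (c′ ≟ c) ×-dec (z′ ≟ z) | ℕₚ.≤-total (D z′ c′) (D z c)
      ... | yes q | _ = q
      ... | no ne | inj₁ le = ⊥-elim (Clash.proper-absurd rg P (conn-trans (conn-sym k′) k) P′ le ne)
      ... | no ne | inj₂ le = ⊥-elim (Clash.proper-absurd rg P′ (conn-trans (conn-sym k) k′) P le (λ (a , b) → ne (sym a , sym b)))
      cell-zero : ∀ {c′} → Conn r c′ → D c′ c′ ≡ 0
      cell-zero {c′} k′ with cell-type (conn-label pr k′)
      ... | inj₂ (_ , five) = ⊥-elim (Clash.pentagon-absurd rg P (conn-trans (conn-sym k′) k) five)
      ... | inj₁ le with ℕₚ.m≤n⇒m<n∨m≡n le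
      ...   | inj₁ (s≤s z) = ℕₚ.n≤0⇒n≡0 z
      ...   | inj₂ one = ⊥-elim (Clash.matching-absurd rg P (conn-trans (conn-sym k′) k) (conn-label pr k′) one)
    ... | no noProper with any? (λ c → conn? r c ×-dec (D c c ℕ.≟ 1))
    ...   | yes (c , k , one) with parity (conn-label pr k) one
    ...     | h , sz = matching-perm {size r} {h} {M r} (trans (conn-size k) sz) (M-stochastic pr) commP λ (g , Pg , kb) → ret (g , record
          { g-perm = Pg
          ; g-map = λ k′ P′ → ⊥-elim (noProper (_ , _ , k′ , P′))
          ; g-cell = λ {c′} k′ → cell g k′ kb })
      where
      lc : ∀ {i} → i < size r → i < size c
      lc = subst (_ <_) (conn-size k)
      commP : ∀ i j → i < size r → j < size r → M r (partner i) j ≡ M r i (partner j)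
      commP i j li lj = trans (M-conn k lpi lj) (trans (sym (Σℕ-pick (size c) (λ q → M c q j) (partner i) (lc lpi)))
          (trans (Σℕ-cong (size c) (λ q _ → cong (λ b → ⟦ b ⟧ ℚ.* M c q j) (trans (sym (block-partner i q)) (cong (λ d → block d i q) (sym one)))))
          (trans (block-comm (conn-label pr k) i j (lc li) (lc lj))
          (trans (Σℕ-cong (size c) (λ q _ → cong (λ b → M c i q ℚ.* ⟦ b ⟧) (trans (cong (λ d → block d q j) one) (trans (block-sym 1 q j) (block-partner j q)))))
          (trans (pick-right (size c) (M c i) (partner j) (lc lpj)) (sym (M-conn k li lpj)))))))
        where
        half : ∀ {i} → i < size r → partner i < size r
        half l = subst (_ <_) (sym (trans (conn-size k) sz)) (partner-< h _ (subst (_ <_) (trans (conn-size k) sz) l))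
        lpi = half li
        lpj = half lj
      cell : ∀ {c′} g → Conn r c′ → (∀ i j → i < size r → j < size r → block 1 (g i) (g j) ≡ block 1 i j) → KeepsBlock c′ g
      cell {c′} g k′ kb with cell-type (conn-label pr k′)
      ... | inj₂ (_ , five) = ⊥-elim (odd≢even h (trans (sym five) (trans (sym (conn-size k′)) (trans (conn-size k) sz))))
        where
        odd≢even : ∀ h → 5 ≢ h * 2
        odd≢even 0 ()
        odd≢even 1 ()
        odd≢even 2 ()
        odd≢even (suc (suc (suc h))) ()
      ... | inj₁ le with ℕₚ.m≤n⇒m<n∨m≡n le
      ...   | inj₁ (s≤s z) = keeps-zero g (ℕₚ.n≤0⇒n≡0 z)
      ...   | inj₂ o = λ i j li lj → trans (cong (λ d → block d (g i) (g j)) o) (trans (kb i j (subst (i <_) (sym (conn-size k′)) li) (subst (j <_) (sym (conn-size k′)) lj)) (cong (λ d → block d i j) (sym o)))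
    good {r} pr e ret | no noProper | no noMatching with any? (λ c → conn? r c ×-dec (D c c ℕ.≟ 2))
    ...   | yes (c , k , two) with cell-type (conn-label pr k)
    ...     | inj₁ le = ℕₚ.<⇒≱ (ℕₚ.n<1+n 1) (subst (_≤ 1) two le)
    ...     | inj₂ (_ , five) =
      let r5 : size r ≡ 5
          r5 = trans (conn-size k) five
          (g , Pg , kb) = Pentagon.pentagon-perm (subst (λ m → Stochasticℕ m (M c)) five (M-stochastic (conn-label pr k)))
            (λ i j li lj → subst (λ m → Σℕ m (λ q → ⟦ pentagon i q ⟧ ℚ.* M c q j) ≡ Σℕ m (λ q → M c i q ℚ.* ⟦ pentagon q j ⟧)) five
               (trans (Σℕ-cong (size c) (λ q _ → cong (λ d → ⟦ block d i q ⟧ ℚ.* M c q j) (sym two)))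
                 (trans (block-comm (conn-label pr k) i j (subst (i <_) (sym five) li) (subst (j <_) (sym five) lj))
                   (Σℕ-cong (size c) (λ q _ → cong (λ d → M c i q ℚ.* ⟦ block d q j ⟧) two)))))
      in ret (g , record
          { g-perm = subst (λ m → Perm< m g) (sym r5) (proj₁ Pg)
                   , λ i l q → proj₂ Pg i (subst (i <_) r5 l) (trans (sym (M-conn k l (subst (g i <_) (sym r5) (bound (proj₁ Pg) i (subst (i <_) r5 l))))) q)
          ; g-map = λ k′ P′ → ⊥-elim (noProper (_ , _ , k′ , P′))
          ; g-cell = λ {c′} k′ → cell g k′ r5 kb })
      where
      cell : ∀ {c′} g → Conn r c′ → size r ≡ 5 → (∀ i j → i < 5 → j < 5 → pentagon (g i) (g j) ≡ pentagon i j) → KeepsBlock c′ g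
      cell {c′} g k′ r5 kb with cell-type (conn-label pr k′)
      ... | inj₂ (t , _) = λ i j li lj → trans (cong (λ d → block d (g i) (g j)) t) (trans (kb i j (subst (i <_) (trans (sym (conn-size k′)) r5) li) (subst (j <_) (trans (sym (conn-size k′)) r5) lj)) (cong (λ d → block d i j) (sym t)))
      ... | inj₁ le with ℕₚ.m≤n⇒m<n∨m≡n le
      ...   | inj₁ (s≤s z) = keeps-zero g (ℕₚ.n≤0⇒n≡0 z)
      ...   | inj₂ o = ⊥-elim (noMatching (c′ , k′ , o))
    good {r} pr e ret | no noProper | no noMatching | no noPentagon = birkhoffℕ (M-stochastic pr) λ (g , Pg) → ret (g , record
          { g-perm = Pg
          ; g-map = λ k′ P′ → ⊥-elim (noProper (_ , _ , k′ , P′))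
          ; g-cell = λ {c′} k′ → keeps-zero g (cell-zero k′) })
      where
      cell-zero : ∀ {c′} → Conn r c′ → D c′ c′ ≡ 0
      cell-zero {c′} k′ with cell-type (conn-label pr k′)
      ... | inj₂ (t , _) = ⊥-elim (noPentagon (c′ , k′ , t))
      ... | inj₁ le with ℕₚ.m≤n⇒m<n∨m≡n le
      ...   | inj₁ (s≤s z) = ℕₚ.n≤0⇒n≡0 z
      ...   | inj₂ o = ⊥-elim (noMatching (c′ , k′ , o))

    R : Reps Conn
    R = reps (λ _ → here) conn-sym conn-trans conn?
    open Reps R

    extend : ¬ ¬ ∃ (Compatible (suc K))
    extend ret = ¬¬-Π {P = λ r → p r ≡ r → size r ≡ K → ∃ (Good s r)} pointwise λ goods → ret (family goods)
      where
      pointwise : ∀ r → ¬ ¬ (p r ≡ r → size r ≡ K → ∃ (Good s r))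
      pointwise r k with (p r ≟ r) ×-dec (size r ℕ.≟ K)
      ... | no h = k (λ a b → ⊥-elim (h (a , b)))
      ... | yes (a , b) = good a b (λ g → k (λ _ _ → g))
      family : (∀ r → p r ≡ r → size r ≡ K → ∃ (Good s r)) → ∃ (Compatible (suc K))
      family goods = s′ , record { perm = perm′ ; keep-eq = eq′ ; keep-map = map′′ ; keep-cell = cell′ }
        where
        new : Fin n → ℕ → ℕ
        new r with p r ≟ r | size r ℕ.≟ K
        ... | yes a | yes b = proj₁ (goods r a b)
        ... | _     | _     = s r
        new-good : ∀ {r} → p r ≡ r → size r ≡ K → Good s r (new r)
        new-good {r} a b with p r ≟ r | size r ℕ.≟ K
        ... | yes a′ | yes b′ = proj₂ (goods r a′ b′)
        ... | yes _ | no h = ⊥-elim (h b)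
        ... | no h | _ = ⊥-elim (h a)
        s′ : Family
        s′ c = if does (size c ℕ.≟ K) then new (rep c) else s c
        s′-new : ∀ {c} → size c ≡ K → s′ c ≡ new (rep c)
        s′-new {c} h rewrite dec-true (size c ℕ.≟ K) h = refl
        s′-old : ∀ {c} → size c < K → s′ c ≡ s c
        s′-old {c} h rewrite dec-false (size c ℕ.≟ K) (ℕₚ.<⇒≢ h) = refl
        old-or-new : ∀ {c} → size c < suc K → size c < K ⊎ size c ≡ K
        old-or-new (s≤s l) = ℕₚ.m≤n⇒m<n∨m≡n l
        module _ {c : Fin n} (pc : p c ≡ c) (e : size c ≡ K) where
          sr : size (rep c) ≡ size c
          sr = sym (conn-size (rep-rel c))
          G : Good s (rep c) (new (rep c))
          G = new-good (conn-label pc (rep-rel c)) (trans sr e)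
        perm′ : ∀ {c} → p c ≡ c → size c < suc K → SupportPerm (size c) (M c) (s′ c)
        perm′ {c} pc l with old-or-new l
        ... | inj₁ l′ = subst (SupportPerm (size c) (M c)) (sym (s′-old l′)) (perm pc l′)
        ... | inj₂ e = subst (SupportPerm (size c) (M c)) (sym (s′-new e))
            (subst (λ m → Perm< m (new (rep c))) (sr pc e) (proj₁ Pg)
            , λ i li q → proj₂ Pg i (subst (i <_) (sym (sr pc e)) li)
                (trans (sym (M-conn (rep-rel c) li (subst (new (rep c) i <_) (sr pc e) (bound (proj₁ Pg) i (subst (i <_) (sym (sr pc e)) li))))) q))
          where Pg = Good.g-perm (G pc e)
        eq′ : ∀ {c c′} → Eq c c′ → size c < suc K → ∀ i → s′ c i ≡ s′ c′ i
        eq′ {c} {c′} E l i with old-or-new l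
        ... | inj₁ l′ = trans (cong (λ f → f i) (s′-old l′)) (trans (keep-eq E l′ i) (cong (λ f → f i) (sym (s′-old (subst (_< K) (eq-size E) l′)))))
        ... | inj₂ e = trans (cong (λ f → f i) (s′-new e)) (trans (cong (λ r → new r i) (rep-cong (step here E))) (cong (λ f → f i) (sym (s′-new (trans (sym (eq-size E)) e)))))
        map′′ : ∀ {c z} → Proper c z → size c < suc K → ∀ i → i < size c → div (s′ c i) (D z c) ≡ s′ z (div i (D z c))
        map′′ {c} {z} P l i li with old-or-new l
        ... | inj₁ l′ = trans (cong (λ f → div (f i) (D z c)) (s′-old l′)) (trans (keep-map P l′ i li) (cong (λ f → f (div i (D z c))) (sym (s′-old (ℕₚ.<-trans (proper-< P) l′)))))
        ... | inj₂ e = trans (cong (λ f → div (f i) (D z c)) (s′-new e))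
            (trans (Good.g-map (G pc e) (conn-sym (rep-rel c)) P i (subst (i <_) (sym (sr pc e)) li)) (cong (λ f → f (div i (D z c))) (sym (s′-old (subst (size z <_) e (proper-< P))))))
          where pc = proj₁ (proj₁ P)
        cell′ : ∀ {c} → p c ≡ c → size c < suc K → KeepsBlock c (s′ c)
        cell′ {c} pc l with old-or-new l
        ... | inj₁ l′ = subst (KeepsBlock c) (sym (s′-old l′)) (keep-cell pc l′)
        ... | inj₂ e = subst (KeepsBlock c) (sym (s′-new e)) (Good.g-cell (G pc e) (conn-sym (rep-rel c)))

  compatible : (∀ c c′ → Dec (Conn c c′)) → ∀ K → ¬ ¬ ∃ (Compatible K)
  compatible conn? zero ret = ret ((λ _ i → i) , record { perm = λ _ () ; keep-eq = λ _ () ; keep-map = λ _ () ; keep-cell = λ _ () })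
  compatible conn? (suc K) ret = compatible conn? K λ (s , C) → Extend.extend C conn? ret

  size≤n : ∀ c → size c < suc n
  size≤n c = s≤s (subst (size c ≤_) (all n) (count-⊆ {P = inCell c} {Q = λ _ → true} (λ _ _ → refl)))
    where
    all : ∀ n → countFin n (λ _ → true) ≡ n
    all zero = refl
    all (suc n) = cong suc (all n)

  module Final {s : Family} (C : Compatible (suc n) s) where
    open Compatible C

    σ : Fin n → Fin n
    σ v = at (p v) (s (p v) (idx v))

    private
      P : ∀ v → SupportPerm (size (p v)) (M (p v)) (s (p v))
      P v = perm (p-idem v) (size≤n (p v))

      s< : ∀ v → s (p v) (idx v) < size (p v)
      s< v = bound (proj₁ (P v)) (idx v) (idx-< v)

    σ-cell : ∀ v → p (σ v) ≡ p v
    σ-cell v = at-cell (s< v)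

    σ-idx : ∀ v → idx (σ v) ≡ s (p v) (idx v)
    σ-idx v = idx-at (s< v)

    σ-support : InSupport X σ
    σ-support v e = proj₂ (P v) (idx v) (idx-< v) (trans (cong (λ z → X z (σ v)) (at-idx v)) e)

    σ-injective : ∀ {u v} → σ u ≡ σ v → u ≡ v
    σ-injective {u} {v} e = idx-inj pu (injℕ (proj₁ (P u)) (idx u) (idx v) (idx-< u) (subst (λ c → idx v < size c) (sym pu) (idx-< v))
        (trans (sym (σ-idx u)) (trans (cong idx e) (trans (σ-idx v) (cong (λ c → s c (idx v)) (sym pu))))))
      where
      pu : p u ≡ p v
      pu = trans (sym (σ-cell u)) (trans (cong p e) (σ-cell v))

    ≡ᵇ-cong : ∀ {a b c d} → (a ≡ b → c ≡ d) → (c ≡ d → a ≡ b) → (a ≡ᵇ b) ≡ (c ≡ᵇ d)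
    ≡ᵇ-cong {a} {b} {c} {d} f g = bool-ext (λ h → subst (λ z → (c ≡ᵇ z) ≡ true) (f (≡ᵇ-true a b h)) (≡ᵇ-refl c))
                                         (λ h → subst (λ z → (a ≡ᵇ z) ≡ true) (g (≡ᵇ-true c d h)) (≡ᵇ-refl a))

    σ-proper : ∀ {u v} → Proper (p u) (p v) → G₀ (σ u) (σ v) ≡ G₀ u v
    σ-proper {u} {v} Q = trans (std-proper F₀ Q (σ-cell u) (σ-cell v)) (trans (cong₂ (λ a b → div a t ≡ᵇ b) (σ-idx u) (σ-idx v))
        (trans (cong (_≡ᵇ s (p v) (idx v)) (keep-map Q (size≤n (p u)) (idx u) (idx-< u)))
        (trans (≡ᵇ-cong (injℕ (proj₁ (P v)) (div (idx u) t) (idx v) (Maps.map-< F₀-maps Q (idx u) (idx-< u)) (idx-< v)) (cong (s (p v)))) (sym (std-proper F₀ Q refl refl)))))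
      where t = D (p v) (p u)

    σ-adj : ∀ u v → G₀ (σ u) (σ v) ≡ G₀ u v
    σ-adj u v = go (p u ≟ p v)
      where
      go : Dec (p u ≡ p v) → G₀ (σ u) (σ v) ≡ G₀ u v
      go (yes e) = trans (std-same F₀ {c = p u} (σ-cell u) (trans (σ-cell v) (sym e))) (trans (cong₂ (block (D (p u) (p u))) (σ-idx u) (trans (σ-idx v) (cong (λ c → s c (idx v)) (sym e))))
          (trans (keep-cell (p-idem u) (size≤n (p u)) (idx u) (idx v) (idx-< u) (subst (λ c → idx v < size c) (sym e) (idx-< v))) (sym (std-same F₀ refl (sym e)))))
      go (no ne) with linkType (p-idem u) (p-idem v) ne
      ... | none e = trans (std-none F₀ (p-idem u) (p-idem v) ne e (σ-cell u) (σ-cell v)) (sym (std-none F₀ (p-idem u) (p-idem v) ne e refl refl))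
      ... | equal E = trans (std-eq F₀ E (σ-cell u) (σ-cell v)) (trans (cong₂ _≡ᵇ_ (σ-idx u) (trans (σ-idx v) (sym (keep-eq E (size≤n (p u)) (idx v)))))
          (trans (≡ᵇ-cong (injℕ (proj₁ (P u)) (idx u) (idx v) (idx-< u) (subst (idx v <_) (sym (eq-size E)) (idx-< v))) (cong (s (p u)))) (sym (std-eq F₀ E refl refl))))
      ... | proper Q = σ-proper Q
      ... | proper⁻¹ Q = trans (sy (std-simple F₀) (σ u) (σ v)) (trans (σ-proper Q) (sy (std-simple F₀) v u))

  support-automorphism : ¬ ¬ ∃ λ σ → CellIso G₀ G₀ σ × InSupport X σ
  support-automorphism ret = ¬¬-Π (λ c → ¬¬-Π (λ c′ → ¬¬-excluded-middle {A = Conn c c′})) λ conn? → compatible conn? (suc n) λ (s , C) →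
    let open Final C in ret (σ , (injective⇒bij σ-injective , σ-cell , σ-adj) , σ-support)

-- Double counting, and complementation inside and between cells

sumN : ∀ m → (Fin m → ℕ) → ℕ
sumN zero    f = 0
sumN (suc m) f = f zero + sumN m (f ∘ suc)

sumN-cong : ∀ {m} {f g : Fin m → ℕ} → (∀ i → f i ≡ g i) → sumN m f ≡ sumN m g
sumN-cong {zero}  h = refl
sumN-cong {suc m} h = cong₂ _+_ (h zero) (sumN-cong (h ∘ suc))

sumN-+ : ∀ {m} (f g : Fin m → ℕ) → sumN m (λ i → f i + g i) ≡ sumN m f + sumN m g
sumN-+ {zero}  f g = refl
sumN-+ {suc m} f g = trans (cong ((f zero + g zero) +_) (sumN-+ (f ∘ suc) (g ∘ suc)))
  (trans (ℕₚ.+-assoc (f zero) (g zero) _) (trans (cong (f zero +_) (trans (sym (ℕₚ.+-assoc (g zero) (sumN m (f ∘ suc)) _))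
    (trans (cong (_+ sumN m (g ∘ suc)) (ℕₚ.+-comm (g zero) _)) (ℕₚ.+-assoc (sumN m (f ∘ suc)) (g zero) _)))) (sym (ℕₚ.+-assoc (f zero) _ _))))

sumN-count : ∀ m (P : Fin m → Bool) → sumN m (λ i → if P i then 1 else 0) ≡ countFin m P
sumN-count zero P = refl
sumN-count (suc m) P = cong ((if P zero then 1 else 0) +_) (sumN-count m (P ∘ suc))

-- Deleting vertex 0 lowers the sum of the degrees by twice its degree.
handshake : ∀ {m} (A : Adj m) → (∀ u v → A u v ≡ A v u) → (∀ u → A u u ≡ false) → ∃ λ k → sumN m (λ u → countFin m (A u)) ≡ k * 2
handshake {zero} A _ _ = 0 , refl
handshake {suc m} A s i with handshake (λ u v → A (suc u) (suc v)) (λ u v → s (suc u) (suc v)) (λ u → i (suc u))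
... | k , e = c + k , (begin
    ((if A zero zero then 1 else 0) + c) + sumN m (λ u → (if A (suc u) zero then 1 else 0) + countFin m (A (suc u) ∘ suc))
      ≡⟨ cong₂ _+_ (cong (λ b → (if b then 1 else 0) + c) (i zero)) (sumN-+ (λ u → if A (suc u) zero then 1 else 0) (λ u → countFin m (A (suc u) ∘ suc))) ⟩
    c + (sumN m (λ u → if A (suc u) zero then 1 else 0) + sumN m (λ u → countFin m (A (suc u) ∘ suc)))
      ≡⟨ cong (c +_) (cong₂ _+_ (trans (sumN-count m (λ u → A (suc u) zero)) (count-cong (λ u → s (suc u) zero))) e) ⟩
    c + (c + k * 2) ≡⟨ sym (ℕₚ.+-assoc c c (k * 2)) ⟩
    (c + c) + k * 2 ≡⟨ cong (_+ k * 2) (trans (cong (c +_) (sym (ℕₚ.+-identityʳ c))) (ℕₚ.*-comm 2 c)) ⟩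
    c * 2 + k * 2 ≡⟨ sym (ℕₚ.*-distribʳ-+ 2 c k) ⟩
    (c + k) * 2 ∎)
  where
  open ≡-Reasoning
  c = countFin m (A zero ∘ suc)

ι-+ : ∀ a b → ι (a + b) ≡ ι a ℚ.+ ι b
ι-+ zero b = sym (ℚₚ.+-identityˡ _)
ι-+ (suc a) b = trans (cong (1ℚ ℚ.+_) (ι-+ a b)) (sym (ℚₚ.+-assoc 1ℚ (ι a) (ι b)))

ι-* : ∀ a b → ι (a * b) ≡ ι a ℚ.* ι b
ι-* zero b = sym (ℚₚ.*-zeroˡ (ι b))
ι-* (suc a) b = trans (ι-+ b (a * b)) (trans (cong₂ ℚ._+_ (sym (ℚₚ.*-identityˡ (ι b))) (ι-* a b)) (sym (ℚₚ.*-distribʳ-+ (ι b) 1ℚ (ι a))))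

⟦⟧-∧ : ∀ a b → ⟦ a ∧ b ⟧ ≡ ⟦ a ⟧ ℚ.* ⟦ b ⟧
⟦⟧-∧ true b = sym (ℚₚ.*-identityˡ ⟦ b ⟧)
⟦⟧-∧ false b = sym (ℚₚ.*-zeroˡ ⟦ b ⟧)

module CellCounts {n : ℕ} (p : Fin n → Fin n) {B : Adj n} (s : Simple B) (eq : Cells.Equit p B) where
  open Cells p

  edge-count : ∀ c c′ → p c ≡ c → sumℚ n (λ u → sumℚ n (λ v → ⟦ inCell c u ⟧ ℚ.* ⟦ nbr B u c′ v ⟧)) ≡ ι (size c * deg B c c′)
  edge-count c c′ pc = trans (sum-cong (λ u → trans (sum-*ˡ ⟦ inCell c u ⟧ (λ v → ⟦ nbr B u c′ v ⟧)) (trans (cong (⟦ inCell c u ⟧ ℚ.*_) (sum-count n (nbr B u c′))) (go u))))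
      (trans (sum-*ʳ (ι (deg B c c′)) (λ u → ⟦ inCell c u ⟧)) (trans (cong (ℚ._* ι (deg B c c′)) (sum-count n (inCell c))) (sym (ι-* (size c) _))))
    where
    go : ∀ u → ⟦ inCell c u ⟧ ℚ.* ι (deg B u c′) ≡ ⟦ inCell c u ⟧ ℚ.* ι (deg B c c′)
    go u with p u ≟ c
    ... | yes e = cong (λ d → 1ℚ ℚ.* ι d) (eq c′ (trans e (sym pc)))
    ... | no _ = trans (ℚₚ.*-zeroˡ (ι (deg B u c′))) (sym (ℚₚ.*-zeroˡ (ι (deg B c c′))))

  double : ∀ {c c′} → p c ≡ c → p c′ ≡ c′ → size c * deg B c c′ ≡ size c′ * deg B c′ c
  double {c} {c′} pc pc′ = ι-injective (trans (sym (edge-count c c′ pc)) (trans (sum-comm n n _) (trans (sum-cong (λ v → sum-cong (λ u → term u v))) (edge-count c′ c pc′))))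
    where
    term : ∀ u v → ⟦ inCell c u ⟧ ℚ.* ⟦ nbr B u c′ v ⟧ ≡ ⟦ inCell c′ v ⟧ ℚ.* ⟦ nbr B v c u ⟧
    term u v = trans (sym (⟦⟧-∧ (inCell c u) (nbr B u c′ v))) (trans (cong ⟦_⟧ (trans (cong (λ b → inCell c u ∧ (b ∧ inCell c′ v)) (sy s u v)) (rearrange (inCell c u) (B v u) (inCell c′ v)))) (⟦⟧-∧ (inCell c′ v) (nbr B v c u)))
      where
      rearrange : ∀ a b d → a ∧ (b ∧ d) ≡ d ∧ (b ∧ a)
      rearrange false b false = refl
      rearrange false b true = sym (𝔹ₚ.∧-zeroʳ b)
      rearrange true b false = 𝔹ₚ.∧-zeroʳ b
      rearrange true b true = refl

  parity : ∀ {c} → p c ≡ c → deg B c c ≡ 1 → ∃ λ k → size c ≡ k * 2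
  parity {c} pc one = let (k , e) = handshake A (λ u v → trans (cong (λ b → inCell c u ∧ (b ∧ inCell c v)) (sy s u v)) (rearrange (inCell c u) (B v u) (inCell c v)))
                                 (λ u → trans (cong (λ b → inCell c u ∧ (b ∧ inCell c u)) (ir s u)) (𝔹ₚ.∧-zeroʳ (inCell c u)))
                 in k , trans (trans (sym (sumN-count n (inCell c))) (sumN-cong row)) e
    where
    A : Adj n
    A u v = inCell c u ∧ nbr B u c v
    rearrange : ∀ a b d → a ∧ (b ∧ d) ≡ d ∧ (b ∧ a)
    rearrange false b false = refl
    rearrange false b true = sym (𝔹ₚ.∧-zeroʳ b)
    rearrange true b false = 𝔹ₚ.∧-zeroʳ b
    rearrange true b true = refl
    row : ∀ u → (if inCell c u then 1 else 0) ≡ countFin n (A u)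
    row u with p u ≟ c
    ... | yes e = sym (trans (eq c (trans e (sym pc))) one)
    ... | no _ = sym (count-false {n} {λ v → false ∧ nbr B u c v} (λ _ → refl))

module Toggle {n : ℕ} (p : Fin n → Fin n) (T : Fin n → Fin n → Bool) (T-sym : ∀ u v → T (p u) (p v) ≡ T (p v) (p u)) where
  open Cells p

  toggle : Adj n → Adj n
  toggle B u v = if does (u ≟ v) then false else (if T (p u) (p v) then not (B u v) else B u v)

  toggle-≢ : ∀ B {u v} → u ≢ v → toggle B u v ≡ (if T (p u) (p v) then not (B u v) else B u v)
  toggle-≢ B {u} {v} ne rewrite dec-false (u ≟ v) ne = refl

  toggle-irr : ∀ B u → toggle B u u ≡ false
  toggle-irr B u rewrite dec-true (u ≟ u) refl = refl

  toggle-simple : ∀ {B} → Simple B → Simple (toggle B)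
  toggle-simple {B} s = record { sy = λ u v → go u v (u ≟ v) ; ir = toggle-irr B }
    where
    go : ∀ u v → Dec (u ≡ v) → toggle B u v ≡ toggle B v u
    go u v (yes refl) = refl
    go u v (no ne) = trans (toggle-≢ B ne) (trans (cong₂ (λ t b → if t then not b else b) (T-sym u v) (sy s u v)) (sym (toggle-≢ B (ne ∘ sym))))

  toggle-invol : ∀ {B} → Simple B → ∀ u v → toggle (toggle B) u v ≡ B u v
  toggle-invol {B} s u v = go (u ≟ v)
    where
    twice : ∀ t b → (if t then not (if t then not b else b) else (if t then not b else b)) ≡ b
    twice true b = 𝔹ₚ.not-involutive b
    twice false b = refl
    go : Dec (u ≡ v) → toggle (toggle B) u v ≡ B u v
    go (yes refl) = trans (toggle-irr (toggle B) u) (sym (ir s u))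
    go (no ne) = trans (toggle-≢ (toggle B) ne) (trans (cong (λ x → if T (p u) (p v) then not x else x) (toggle-≢ B ne)) (twice (T (p u) (p v)) (B u v)))

  others : Fin n → Fin n → ℕ
  others u c = countFin n (λ v → inCell c v ∧ not (does (v ≟ u)))

  deg-toggled : ∀ {B} → Simple B → ∀ u c → T (p u) c ≡ true → deg (toggle B) u c + deg B u c ≡ others u c
  deg-toggled {B} s u c t = trans (ℕₚ.+-comm (deg (toggle B) u c) _) (sym (trans (count-split (λ v → inCell c v ∧ not (does (v ≟ u))) (B u))
      (cong₂ _+_ (count-cong in-B) (count-cong out-B))))
    where
    in-B : ∀ v → (inCell c v ∧ not (does (v ≟ u))) ∧ B u v ≡ nbr B u c v
    in-B v = bool-ext
      (λ h → let (h₁ , h₂) = ∧-true {inCell c v ∧ not (does (v ≟ u))} h in nbr-intro B h₂ (inCell-elim (proj₁ (∧-true h₁))))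
      (λ h → let (h₁ , h₂) = nbr-elim B h in ∧-intro (∧-intro (inCell-true h₂) (cong not (dec-false (v ≟ u) (adj≢ s h₁ ∘ sym)))) h₁)
    toggled : ∀ {v} → p v ≡ c → u ≢ v → toggle B u v ≡ not (B u v)
    toggled {v} h ne = trans (toggle-≢ B ne) (cong (λ b → if b then not (B u v) else B u v) (trans (cong (T (p u)) h) t))
    out-B : ∀ v → (inCell c v ∧ not (does (v ≟ u))) ∧ not (B u v) ≡ nbr (toggle B) u c v
    out-B v = bool-ext
      (λ h → let (h₁ , h₂) = ∧-true {inCell c v ∧ not (does (v ≟ u))} h ; (h₃ , h₄) = ∧-true {inCell c v} h₁ ; pv = inCell-elim h₃
             in nbr-intro (toggle B) {u} (trans (toggled pv (does-false (v ≟ u) (not-false h₄) ∘ sym)) h₂) pv)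
      (λ h → let (h₁ , h₂) = nbr-elim (toggle B) {u} h ; ne = adj≢ (toggle-simple s) {u} {v} h₁
             in ∧-intro (∧-intro (inCell-true h₂) (cong not (dec-false (v ≟ u) (ne ∘ sym)))) (trans (sym (toggled h₂ ne)) h₁))

  deg-same : ∀ {B} → Simple B → ∀ u c → T (p u) c ≡ false → deg (toggle B) u c ≡ deg B u c
  deg-same {B} s u c f = count-cong {P = nbr (toggle B) u c} {nbr B u c} λ v → bool-ext
      (λ h → let (h₁ , h₂) = nbr-elim (toggle B) {u} h in nbr-intro B (trans (sym (same h₂ (adj≢ (toggle-simple s) {u} {v} h₁))) h₁) h₂)
      (λ h → let (h₁ , h₂) = nbr-elim B h in nbr-intro (toggle B) {u} (trans (same h₂ (adj≢ s h₁)) h₁) h₂)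
    where
    same : ∀ {v} → p v ≡ c → u ≢ v → toggle B u v ≡ B u v
    same {v} h ne = trans (toggle-≢ B ne) (cong (λ b → if b then not (B u v) else B u v) (trans (cong (T (p u)) h) f))

  toggle-real : ∀ {B B₁} → Simple B → Simple B₁ → Real B B₁ → Real (toggle B) (toggle B₁)
  toggle-real {B} {B₁} s s₁ r u c with bool-cases (T (p u) c)
  ... | inj₁ t = ℕₚ.+-cancelʳ-≡ (deg B u c) _ _ (trans (cong (deg (toggle B₁) u c +_) (sym (r u c))) (trans (deg-toggled s₁ u c t) (sym (deg-toggled s u c t))))
  ... | inj₂ f = trans (deg-same s₁ u c f) (trans (r u c) (sym (deg-same s u c f)))

  toggle-iso : ∀ {B B₁ φ} → CellIso B B₁ φ → CellIso (toggle B) (toggle B₁) φ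
  toggle-iso {B} {B₁} {φ} (b , c , a) = b , c , λ u v → cong₂ (λ x y → if x then false else y)
    (does-cong (φ u ≟ φ v) (u ≟ v) (proj₁ b) (cong φ))
    (trans (cong₂ (λ x y → if T x y then not (B₁ (φ u) (φ v)) else B₁ (φ u) (φ v)) (c u) (c v)) (cong (λ x → if T (p u) (p v) then not x else x) (a u v)))

  iso-≗ : ∀ {B B₁ C C₁ φ} → (∀ u v → B u v ≡ C u v) → (∀ u v → B₁ u v ≡ C₁ u v) → CellIso B B₁ φ → CellIso C C₁ φ
  iso-≗ {φ = φ} h h₁ (b , c , a) = b , c , λ u v → trans (sym (h₁ (φ u) (φ v))) (trans (a u v) (h u v))

  toggle-rigid : ∀ {B} → Simple B → Rigid B → Rigid (toggle B)
  toggle-rigid {B} s rg B₁ s₁ r =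
    let (φ , i) = rg (toggle B₁) (toggle-simple s₁) λ u c → trans (toggle-real (toggle-simple s) s₁ r u c)
                     (count-cong λ v → cong (_∧ inCell c v) (toggle-invol s u v))
    in φ , iso-≗ (λ _ _ → refl) (toggle-invol s₁) (toggle-iso {B} {toggle B₁} i)

  -- `X` respects the cells, so for given `u` and `v` only one block of the adjacency matrix
  -- matters. If this block is toggled, the old and the new block and the identity add up to the
  -- all-ones block, on which both sides give 1 because rows and columns of `X` sum to 1.
  toggle-commutes : ∀ {B X} → Simple B → DoublyStochastic n X → (∀ u v → X u v ≢ 0ℚ → p u ≡ p v) → Commutes B X → Commutes (toggle B) X
  toggle-commutes {B} {X} s ds X-cell comm u v with bool-cases (T (p u) (p v))
  ... | inj₂ f = trans (sum-cong (λ w → left w (X w v ℚₚ.≟ 0ℚ))) (trans (comm u v) (sum-cong (λ w → right w (X u w ℚₚ.≟ 0ℚ))))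
    where
    same : ∀ {a b} → p a ≡ p u → p b ≡ p v → toggle B a b ≡ B a b
    same {a} {b} h h′ = go (a ≟ b)
      where
      go : Dec (a ≡ b) → toggle B a b ≡ B a b
      go (yes refl) = trans (toggle-irr B a) (sym (ir s a))
      go (no ne) = trans (toggle-≢ B ne) (cong (λ x → if x then not (B a b) else B a b) (trans (cong₂ T h h′) f))
    left : ∀ w → Dec (X w v ≡ 0ℚ) → ⟦ toggle B u w ⟧ ℚ.* X w v ≡ ⟦ B u w ⟧ ℚ.* X w v
    left w (yes e) = trans (cong (⟦ toggle B u w ⟧ ℚ.*_) e) (trans (ℚₚ.*-zeroʳ ⟦ toggle B u w ⟧) (sym (trans (cong (⟦ B u w ⟧ ℚ.*_) e) (ℚₚ.*-zeroʳ ⟦ B u w ⟧))))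
    left w (no ne) = cong (λ b → ⟦ b ⟧ ℚ.* X w v) (same refl (X-cell w v ne))
    right : ∀ w → Dec (X u w ≡ 0ℚ) → X u w ℚ.* ⟦ B w v ⟧ ≡ X u w ℚ.* ⟦ toggle B w v ⟧
    right w (yes e) = trans (cong (ℚ._* ⟦ B w v ⟧) e) (trans (ℚₚ.*-zeroˡ ⟦ B w v ⟧) (sym (trans (cong (ℚ._* ⟦ toggle B w v ⟧) e) (ℚₚ.*-zeroˡ ⟦ toggle B w v ⟧))))
    right w (no ne) = cong (λ b → X u w ℚ.* ⟦ b ⟧) (sym (same (sym (X-cell u w ne)) refl))
  ... | inj₁ t = ℚ-cancel (sumℚ n (λ w → ⟦ toggle B u w ⟧ ℚ.* X w v)) (sumℚ n (λ w → X u w ℚ.* ⟦ toggle B w v ⟧)) (L ℚ.+ X u v)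
      (trans left (trans (sym right) (cong (λ z → sumℚ n (λ w → X u w ℚ.* ⟦ toggle B w v ⟧) ℚ.+ (z ℚ.+ X u v)) (sym (comm u v)))))
    where
    open DoublyStochastic ds
    L = sumℚ n (λ w → ⟦ B u w ⟧ ℚ.* X w v)
    ℚ-cancel : ∀ x y z → x ℚ.+ z ≡ y ℚ.+ z → x ≡ y
    ℚ-cancel x y z e = trans (sym (undo x)) (trans (cong (ℚ._- z) e) (undo y))
      where
      undo : ∀ x → (x ℚ.+ z) ℚ.- z ≡ x
      undo x = trans (ℚₚ.+-assoc x z (ℚ.- z)) (trans (cong (x ℚ.+_) (ℚₚ.+-inverseʳ z)) (ℚₚ.+-identityʳ x))
    bits : ∀ {a b} → p a ≡ p u → p b ≡ p v → ⟦ toggle B a b ⟧ ℚ.+ (⟦ B a b ⟧ ℚ.+ ⟦ does (a ≟ b) ⟧) ≡ 1ℚ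
    bits {a} {b} h h′ = go (a ≟ b)
      where
      val : ∀ x → ⟦ not x ⟧ ℚ.+ (⟦ x ⟧ ℚ.+ 0ℚ) ≡ 1ℚ
      val true = refl
      val false = refl
      go : Dec (a ≡ b) → ⟦ toggle B a b ⟧ ℚ.+ (⟦ B a b ⟧ ℚ.+ ⟦ does (a ≟ b) ⟧) ≡ 1ℚ
      go (yes refl) = trans (cong₂ (λ x y → ⟦ x ⟧ ℚ.+ (⟦ y ⟧ ℚ.+ ⟦ does (a ≟ a) ⟧)) (toggle-irr B a) (ir s a)) (cong (λ x → 0ℚ ℚ.+ (0ℚ ℚ.+ ⟦ x ⟧)) (dec-true (a ≟ a) refl))
      go (no ne) = trans (cong₂ (λ x y → ⟦ x ⟧ ℚ.+ (⟦ B a b ⟧ ℚ.+ ⟦ y ⟧)) (trans (toggle-≢ B ne) (cong (λ x → if x then not (B a b) else B a b) (trans (cong₂ T h h′) t))) (dec-false (a ≟ b) ne)) (val (B a b))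
    distrib : ∀ a b c x → a ℚ.+ (b ℚ.+ c) ≡ 1ℚ → a ℚ.* x ℚ.+ (b ℚ.* x ℚ.+ c ℚ.* x) ≡ x
    distrib a b c x e = trans (cong (a ℚ.* x ℚ.+_) (sym (ℚₚ.*-distribʳ-+ x b c))) (trans (sym (ℚₚ.*-distribʳ-+ x a (b ℚ.+ c))) (trans (cong (ℚ._* x) e) (ℚₚ.*-identityˡ x)))
    zeros : ∀ a b c → a ℚ.* 0ℚ ℚ.+ (b ℚ.* 0ℚ ℚ.+ c ℚ.* 0ℚ) ≡ 0ℚ
    zeros a b c = cong₂ ℚ._+_ (ℚₚ.*-zeroʳ a) (cong₂ ℚ._+_ (ℚₚ.*-zeroʳ b) (ℚₚ.*-zeroʳ c))
    left : sumℚ n (λ w → ⟦ toggle B u w ⟧ ℚ.* X w v) ℚ.+ (L ℚ.+ X u v) ≡ 1ℚ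
    left = trans (cong (λ z → sumℚ n (λ w → ⟦ toggle B u w ⟧ ℚ.* X w v) ℚ.+ (L ℚ.+ z)) (sym (trans (sum-cong (λ w → cong (λ b → ⟦ b ⟧ ℚ.* X w v) (does-cong (u ≟ w) (w ≟ u) sym sym))) (sum-pick (λ w → X w v) u))))
      (trans (cong (sumℚ n (λ w → ⟦ toggle B u w ⟧ ℚ.* X w v) ℚ.+_) (sym (sum-+ (λ w → ⟦ B u w ⟧ ℚ.* X w v) (λ w → ⟦ does (u ≟ w) ⟧ ℚ.* X w v))))
      (trans (sym (sum-+ (λ w → ⟦ toggle B u w ⟧ ℚ.* X w v) (λ w → ⟦ B u w ⟧ ℚ.* X w v ℚ.+ ⟦ does (u ≟ w) ⟧ ℚ.* X w v))) (trans (sum-cong (λ w → term w (X w v ℚₚ.≟ 0ℚ))) (cols v))))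
      where
      term : ∀ w → Dec (X w v ≡ 0ℚ) → ⟦ toggle B u w ⟧ ℚ.* X w v ℚ.+ (⟦ B u w ⟧ ℚ.* X w v ℚ.+ ⟦ does (u ≟ w) ⟧ ℚ.* X w v) ≡ X w v
      term w (yes e) = trans (cong (λ z → ⟦ toggle B u w ⟧ ℚ.* z ℚ.+ (⟦ B u w ⟧ ℚ.* z ℚ.+ ⟦ does (u ≟ w) ⟧ ℚ.* z)) e) (trans (zeros ⟦ toggle B u w ⟧ ⟦ B u w ⟧ ⟦ does (u ≟ w) ⟧) (sym e))
      term w (no ne) = distrib ⟦ toggle B u w ⟧ ⟦ B u w ⟧ ⟦ does (u ≟ w) ⟧ (X w v) (bits refl (X-cell w v ne))
    right : sumℚ n (λ w → X u w ℚ.* ⟦ toggle B w v ⟧) ℚ.+ (sumℚ n (λ w → X u w ℚ.* ⟦ B w v ⟧) ℚ.+ X u v) ≡ 1ℚ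
    right = trans (cong₂ (λ y z → y ℚ.+ (z ℚ.+ X u v)) (sum-cong (λ w → ℚₚ.*-comm (X u w) ⟦ toggle B w v ⟧)) (sum-cong (λ w → ℚₚ.*-comm (X u w) ⟦ B w v ⟧)))
      (trans (cong (λ z → sumℚ n (λ w → ⟦ toggle B w v ⟧ ℚ.* X u w) ℚ.+ (sumℚ n (λ w → ⟦ B w v ⟧ ℚ.* X u w) ℚ.+ z)) (sym (sum-pick (X u) v)))
      (trans (cong (sumℚ n (λ w → ⟦ toggle B w v ⟧ ℚ.* X u w) ℚ.+_) (sym (sum-+ (λ w → ⟦ B w v ⟧ ℚ.* X u w) (λ w → ⟦ does (w ≟ v) ⟧ ℚ.* X u w))))
      (trans (sym (sum-+ (λ w → ⟦ toggle B w v ⟧ ℚ.* X u w) (λ w → ⟦ B w v ⟧ ℚ.* X u w ℚ.+ ⟦ does (w ≟ v) ⟧ ℚ.* X u w))) (trans (sum-cong (λ w → term w (X u w ℚₚ.≟ 0ℚ))) (rows u)))))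
      where
      term : ∀ w → Dec (X u w ≡ 0ℚ) → ⟦ toggle B w v ⟧ ℚ.* X u w ℚ.+ (⟦ B w v ⟧ ℚ.* X u w ℚ.+ ⟦ does (w ≟ v) ⟧ ℚ.* X u w) ≡ X u w
      term w (yes e) = trans (cong (λ z → ⟦ toggle B w v ⟧ ℚ.* z ℚ.+ (⟦ B w v ⟧ ℚ.* z ℚ.+ ⟦ does (w ≟ v) ⟧ ℚ.* z)) e) (trans (zeros ⟦ toggle B w v ⟧ ⟦ B w v ⟧ ⟦ does (w ≟ v) ⟧) (sym e))
      term w (no ne) = distrib ⟦ toggle B w v ⟧ ⟦ B w v ⟧ ⟦ does (w ≟ v) ⟧ (X u w) (bits (sym (X-cell u w ne)) refl)

module RigidSupport {n : ℕ} (p : Fin n → Fin n) (p-idem : ∀ v → p (p v) ≡ p v)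
  {B₀ : Adj n} (s₀ : Simple B₀) (eq₀ : Cells.Equit p B₀) (rg₀ : Cells.Rigid p B₀)
  {X : Fin n → Fin n → ℚ} (ds : DoublyStochastic n X) (X-cell : ∀ u v → X u v ≢ 0ℚ → p u ≡ p v) (comm₀ : Commutes B₀ X) where
  open Cells p

  private
    module C₀ = CellCounts p s₀ eq₀

    -- At least about half of the possible edges are present. Between two cells the numbers of edges
    -- are compared instead of degrees, which makes the condition symmetric by double counting.
    Dense : Fin n → Fin n → Set
    Dense c c′ = (c ≡ c′ × size c ≤ 2 * deg B₀ c c) ⊎ (c ≢ c′ × size c * size c′ ≤ 2 * (size c * deg B₀ c c′))

    dense? : ∀ c c′ → Dec (Dense c c′)
    dense? c c′ = ((c ≟ c′) ×-dec (size c ℕ.≤? 2 * deg B₀ c c)) ⊎-dec (¬? (c ≟ c′) ×-dec (size c * size c′ ℕ.≤? 2 * (size c * deg B₀ c c′)))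

    T : Fin n → Fin n → Bool
    T c c′ = does (dense? c c′)

    dense-sym : ∀ {c c′} → p c ≡ c → p c′ ≡ c′ → Dense c c′ → Dense c′ c
    dense-sym pc pc′ (inj₁ (refl , h)) = inj₁ (refl , h)
    dense-sym {c} {c′} pc pc′ (inj₂ (ne , h)) = inj₂ (ne ∘ sym , subst₂ _≤_ (ℕₚ.*-comm (size c) (size c′)) (cong (2 *_) (C₀.double pc pc′)) h)

    T-sym : ∀ u v → T (p u) (p v) ≡ T (p v) (p u)
    T-sym u v = does-cong (dense? (p u) (p v)) (dense? (p v) (p u)) (dense-sym (p-idem u) (p-idem v)) (dense-sym (p-idem v) (p-idem u))

    open Toggle p T T-sym

    B : Adj n
    B = toggle B₀

    s = toggle-simple s₀
    rg = toggle-rigid s₀ rg₀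

    count-others : ∀ u c → p u ≢ c → others u c ≡ size c
    count-others u c h = count-cong λ v → bool-ext (λ t → proj₁ (∧-true {inCell c v} t))
      (λ t → ∧-intro t (cong not (dec-false (v ≟ u) (λ e → h (trans (cong p (sym e)) (inCell-elim t))))))

    count-others-own : ∀ u → suc (others u (p u)) ≡ size (p u)
    count-others-own u = sym (trans (count-split (inCell (p u)) (λ v → does (v ≟ u))) (cong (_+ others u (p u)) (trans
      (count-cong λ v → bool-ext (λ t → proj₂ (∧-true {inCell (p u) v} t)) (λ t → ∧-intro (inCell-true (cong p (does-true (v ≟ u) t))) t)) (count-single u))))

    eq : Equit B
    eq {u} {v} c h with bool-cases (T (p u) c)
    ... | inj₂ f = trans (deg-same s₀ u c f) (trans (eq₀ c h) (sym (deg-same s₀ v c (trans (cong (λ z → T z c) (sym h)) f))))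
    ... | inj₁ t = ℕₚ.+-cancelʳ-≡ (deg B₀ u c) _ _ (trans (deg-toggled s₀ u c t) (trans (same (p u ≟ c))
            (trans (sym (deg-toggled s₀ v c (trans (cong (λ z → T z c) (sym h)) t))) (cong (deg B v c +_) (sym (eq₀ c h))))))
      where
      same : Dec (p u ≡ c) → others u c ≡ others v c
      same (no ne) = trans (count-others u c ne) (sym (count-others v c (λ e → ne (trans h e))))
      same (yes refl) = ℕₚ.suc-injective (trans (count-others-own u) (trans (cong size h) (trans (sym (count-others-own v)) (cong (λ z → suc (others v z)) (sym h)))))

    module C = CellCounts p s eq

    size-pos : ∀ {c} → p c ≡ c → 1 ≤ size c
    size-pos {c} h = count-pos c (inCell-true h)

    half : ∀ {d d′ m} → d′ + d ≡ m → m ≤ 2 * d → 2 * d′ ≤ m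
    half {d} {d′} refl h = subst (_≤ d′ + d) (cong (d′ +_) (sym (ℕₚ.+-identityʳ d′))) (ℕₚ.+-monoʳ-≤ d′
      (ℕₚ.+-cancelʳ-≤ d d′ d (subst (d′ + d ≤_) (cong (d +_) (ℕₚ.+-identityʳ d)) h)))

    sparse : ∀ {c c′} → p c ≡ c → p c′ ≡ c′ → c ≢ c′ → 2 * deg B c c′ ≤ size c′
    sparse {c} {c′} pc pc′ ne with dense? (p c) c′
    ... | yes (inj₁ (e , _)) = ⊥-elim (ne (trans (sym pc) e))
    ... | yes q@(inj₂ (_ , h)) = half {deg B₀ c c′} {deg B c c′} (trans (deg-toggled s₀ c c′ (dec-true (dense? (p c) c′) q)) (count-others c c′ (λ e → ne (trans (sym pc) e))))
          (ℕₚ.*-cancelˡ-≤ (size c) {{ℕ.>-nonZero (size-pos pc)}} (subst₂ _≤_ (cong (λ z → size z * size c′) pc)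
            (trans (cong (λ z → 2 * (size z * deg B₀ z c′)) pc) (trans (sym (ℕₚ.*-assoc 2 (size c) _)) (trans (cong (_* deg B₀ c c′) (ℕₚ.*-comm 2 (size c))) (ℕₚ.*-assoc (size c) 2 _)))) h))
    ... | no q = subst (λ d → 2 * d ≤ size c′) (sym (deg-same s₀ c c′ (dec-false (dense? (p c) c′) q)))
          (ℕₚ.*-cancelˡ-≤ (size c) {{ℕ.>-nonZero (size-pos pc)}} (ℕₚ.≤-trans (ℕₚ.≤-reflexive
             (trans (sym (ℕₚ.*-assoc (size c) 2 _)) (trans (cong (_* deg B₀ c c′) (ℕₚ.*-comm (size c) 2)) (ℕₚ.*-assoc 2 (size c) _))))
             (ℕₚ.<⇒≤ (ℕₚ.≰⇒> (λ h → q (inj₂ ((λ e → ne (trans (sym pc) e)) , subst (λ z → size z * size c′ ≤ 2 * (size z * deg B₀ z c′)) (sym pc) h)))))))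

    sparse-cell : ∀ {c} → p c ≡ c → suc (2 * deg B c c) ≤ size c
    sparse-cell {c} pc with dense? (p c) c
    ... | yes (inj₂ (ne , _)) = ⊥-elim (ne pc)
    ... | yes q@(inj₁ (_ , h)) = begin
          suc (2 * d′) ≡⟨ cong (λ z → suc (d′ + z)) (ℕₚ.+-identityʳ d′) ⟩
          suc d′ + d′ ≤⟨ ℕₚ.+-monoʳ-≤ (suc d′) d′≤d ⟩
          suc d′ + d ≡⟨ total ⟩
          size c ∎
      where
      open ℕₚ.≤-Reasoning
      d = deg B₀ c c
      d′ = deg B c c
      total : suc (d′ + d) ≡ size c
      total = trans (cong suc (deg-toggled s₀ c c (dec-true (dense? (p c) c) q))) (trans (cong (λ z → suc (others c z)) (sym pc)) (trans (count-others-own c) (cong size pc)))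
      d′≤d : d′ ≤ d
      d′≤d = ℕₚ.+-cancelʳ-≤ d d′ d (ℕₚ.≤-trans (ℕₚ.n≤1+n _) (ℕₚ.≤-trans (ℕₚ.≤-reflexive total) (subst₂ _≤_ (cong size pc) (trans (cong (λ z → 2 * deg B₀ z z) pc) (cong (d +_) (ℕₚ.+-identityʳ d))) h)))
    ... | no q = subst (λ d → suc (2 * d) ≤ size c) (sym (deg-same s₀ c c (dec-false (dense? (p c) c) q)))
          (ℕₚ.≰⇒> (λ h → q (inj₁ (pc , subst (λ z → size z ≤ 2 * deg B₀ z z) (sym pc) h))))

    pair-type : ∀ {c c′} → p c ≡ c → p c′ ≡ c′ → c ≢ c′ → deg B c c′ ≤ 1 ⊎ deg B c′ c ≤ 1
    pair-type {c} {c′} pc pc′ ne with deg B c c′ ℕ.≤? 1 | deg B c′ c ℕ.≤? 1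
    ... | yes h | _ = inj₁ h
    ... | _ | yes h = inj₂ h
    ... | no h | no h′ =
      let (v₀ , nv) = count-witness (nbr B c c′) (ℕₚ.≤-trans (s≤s z≤n) (ℕₚ.≰⇒> h))
          (cv , pv) = nbr-elim B {c} nv
          same = eq c (trans pv (sym pc′))
      in ⊥-elim (BiregularPair.biregular-absurd p s eq rg ne pc pv cv (ℕₚ.≰⇒> h)
           (subst (2 ≤_) (sym same) (ℕₚ.≰⇒> h′)) (sparse pc pc′ ne) (subst (λ d → 2 * d ≤ size c) (sym same) (sparse pc′ pc (ne ∘ sym))))

    cell-type : ∀ {c} → p c ≡ c → deg B c c ≤ 1 ⊎ (deg B c c ≡ 2 × size c ≡ 5)
    cell-type pc = RegularCell.sparse-cell p s eq rg pc (sparse-cell pc)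

    module St = Standard p p-idem s eq C.double C.parity cell-type pair-type sparse sparse-cell

    G₀-real : Real B St.G₀
    G₀-real = St.std-real St.F₀-maps

    G₀-simple : Simple St.G₀
    G₀-simple = St.std-simple St.F₀

    -- The canonical graph is only isomorphic to `B`, so `X` is conjugated by `φ` and the
    -- automorphism found is conjugated back.
    module Transport {φ} (iso : CellIso B St.G₀ φ) where
      b = proj₁ iso
      φ-cell = proj₁ (proj₂ iso)
      φ-adj = proj₂ (proj₂ iso)
      open DoublyStochastic ds

      X′ : Fin n → Fin n → ℚ
      X′ u v = X (inv b u) (inv b v)

      ds′ : DoublyStochastic n X′
      ds′ = record { nonneg = λ u v → nonneg _ _ ; rows = λ u → trans (sum-perm (inv-bij b) (X (inv b u))) (rows (inv b u))
                   ; cols = λ v → trans (sum-perm (inv-bij b) (λ u → X u (inv b v))) (cols (inv b v)) }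

      inv-cell : ∀ v → p (inv b v) ≡ p v
      inv-cell v = trans (sym (φ-cell _)) (cong p (f∘inv b v))

      inv-adj : ∀ u v → B (inv b u) (inv b v) ≡ St.G₀ u v
      inv-adj u v = trans (sym (φ-adj _ _)) (cong₂ St.G₀ (f∘inv b u) (f∘inv b v))

      comm′ : Commutes St.G₀ X′
      comm′ u v = trans (sum-cong (λ w → cong (λ x → ⟦ x ⟧ ℚ.* X′ w v) (sym (inv-adj u w))))
        (trans (sum-perm (inv-bij b) (λ w → ⟦ B (inv b u) w ⟧ ℚ.* X w (inv b v)))
        (trans (toggle-commutes s₀ ds X-cell comm₀ (inv b u) (inv b v))
        (trans (sym (sum-perm (inv-bij b) (λ w → X (inv b u) w ℚ.* ⟦ B w (inv b v) ⟧)))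
        (sum-cong (λ w → cong (λ x → X′ u w ℚ.* ⟦ x ⟧) (inv-adj w v))))))

      result : ¬ ¬ ∃ λ σ → CellIso B₀ B₀ σ × InSupport X σ
      result ret = SupportAut.support-automorphism p p-idem s eq C.double C.parity cell-type pair-type sparse sparse-cell
          (rigid-real rg G₀-simple G₀-real) ds′ (λ u v ne → trans (sym (inv-cell u)) (trans (X-cell _ _ ne) (inv-cell v))) comm′
          λ (σ , i , supp) → ret (inv b ∘ σ ∘ φ
            , iso-≗ (toggle-invol s₀) (toggle-invol s₀) (toggle-iso {B} {B} (cellIso-trans {B} {St.G₀} {B} (cellIso-trans {B} {St.G₀} {St.G₀} iso i) (cellIso-sym {B} {St.G₀} iso)))
            , λ v e → supp (φ v) (trans (cong (λ z → X z (inv b (σ (φ v)))) (inv∘f b v)) e))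

  support-automorphism : ¬ ¬ ∃ λ σ → CellIso B₀ B₀ σ × InSupport X σ
  support-automorphism = Transport.result (proj₂ (rg St.G₀ G₀-simple G₀-real))

-- Colour refinement

nbr-≡ : ∀ G {u} {x y : Nbr G u} → proj₁ x ≡ proj₁ y → x ≡ y
nbr-≡ G {u} = sub-≡ {P = adj G u}

cr-refl : ∀ i G u → CRSame i G u G u
cr-refl zero    G u = refl
cr-refl (suc i) G u = cr-refl i G u , id , id-bij , λ a → cr-refl i G (proj₁ a)

cr-sym : ∀ i G u H v → CRSame i G u H v → CRSame i H v G u
cr-sym zero    G u H v h = sym h
cr-sym (suc i) G u H v (h , f , b , k) = cr-sym i G u H v h , inv b , inv-bij b , λ a →
  cr-sym i G _ H _ (subst (λ z → CRSame i G (proj₁ (inv b a)) H (proj₁ z)) (f∘inv b a) (k (inv b a)))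

cr-trans : ∀ i G u H v K w → CRSame i G u H v → CRSame i H v K w → CRSame i G u K w
cr-trans zero    G u H v K w h k = trans h k
cr-trans (suc i) G u H v K w (h , f , b , q) (k , g , c , r) = cr-trans i G u H v K w h k , g ∘ f , ∘-bij c b , λ a →
  cr-trans i G _ H _ K _ (q a) (r (f a))

cr-mono : ∀ {i j} G u H v → i ≤ j → CRSame j G u H v → CRSame i G u H v
cr-mono {j = zero} G u H v z≤n h = h
cr-mono {i} {suc j} G u H v l h with ℕₚ.m≤n⇒m<n∨m≡n l
... | inj₁ (s≤s l′) = cr-mono G u H v l′ (proj₁ h)
... | inj₂ refl = h

cr-iso : ∀ {G H f} → IsIsoMap G H f → ∀ i u → CRSame i G u H (f u)
cr-iso (b , a , c) zero u = sym (c u)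
cr-iso {G} {H} {f} I@(b , a , c) (suc i) u = cr-iso I i u , F , mkBij F⁻¹ (λ x → nbr-≡ G (inv∘f b (proj₁ x))) (λ y → nbr-≡ H (f∘inv b (proj₁ y)))
    , λ x → cr-iso I i (proj₁ x)
  where
  F : Nbr G u → Nbr H (f u)
  F (x , h) = f x , trans (a u x) h
  F⁻¹ : Nbr H (f u) → Nbr G u
  F⁻¹ (y , h) = inv b y , trans (sym (a u (inv b y))) (trans (cong (adj H (f u)) (f∘inv b y)) h)

-- Equality of labels is a bisimulation: equal labels have matching neighbourhoods, whose partners
-- again have equal labels. So no round of refinement can separate them.
cr-label : ∀ G H (q : Fin (n G) → ℕ) (q′ : Fin (n H) → ℕ) →
  (∀ u v → q u ≡ q′ v → col G u ≡ col H v × (∀ y → nbrsIn G q u y ≡ nbrsIn H q′ v y)) →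
  ∀ i u v → q u ≡ q′ v → CRSame i G u H v
cr-label G H q q′ h zero    u v e = proj₁ (h u v e)
cr-label G H q q′ h (suc i) u v e =
  let (f , b , k) = labelled-bij q q′ (proj₂ (h u v e))
  in cr-label G H q q′ h i u v e , f , b , λ a → cr-label G H q q′ h i _ _ (sym (k a))

cr-coarsen : ∀ G (c₁ c₂ : Fin (n G) → ℕ) H (d₁ d₂ : Fin (n H) → ℕ) → (∀ u v → c₁ u ≡ d₁ v → c₂ u ≡ d₂ v) →
  ∀ i u v → CRSame i (record G { col = c₁ }) u (record H { col = d₁ }) v → CRSame i (record G { col = c₂ }) u (record H { col = d₂ }) v
cr-coarsen G c₁ c₂ H d₁ d₂ h zero    u v e = h u v e
cr-coarsen G c₁ c₂ H d₁ d₂ h (suc i) u v (e , f , b , k) =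
  cr-coarsen G c₁ c₂ H d₁ d₂ h i u v e , f , b , λ a → cr-coarsen G c₁ c₂ H d₁ d₂ h i _ _ (k a)

-- Maps between subsets are encoded as total maps, to be searched by `anyFun?`; outside `P` they
-- take the default value `d`.
subBij? : ∀ {m k} (P : Fin m → Bool) (Q : Fin k → Bool) (R : Fin m → Fin k → Set) → (∀ a b → Dec (R a b)) → Fin k →
  Dec (Σ (Sub P → Sub Q) λ f → IsBij f × (∀ x → R (proj₁ x) (proj₁ (f x))))
subBij? {m} {k} P Q R R? d = map′ to-bij from-bij (anyFun? resp′ ok?)
  where
  Ok : (Fin m → Fin k) → Set
  Ok F = (∀ a → P a ≡ true → Q (F a) ≡ true × R a (F a)) × (∀ a b → P a ≡ true → P b ≡ true → F a ≡ F b → a ≡ b)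
         × (∀ b → Q b ≡ true → ∃ λ a → P a ≡ true × F a ≡ b)
  ok? : ∀ F → Dec (Ok F)
  ok? F = all? (λ a → (P a 𝔹ₚ.≟ true) →-dec ((Q (F a) 𝔹ₚ.≟ true) ×-dec R? a (F a)))
    ×-dec (all? (λ a → all? λ b → (P a 𝔹ₚ.≟ true) →-dec ((P b 𝔹ₚ.≟ true) →-dec ((F a ≟ F b) →-dec (a ≟ b))))
    ×-dec all? (λ b → (Q b 𝔹ₚ.≟ true) →-dec any? λ a → (P a 𝔹ₚ.≟ true) ×-dec (F a ≟ b)))
  resp′ : ∀ {F G} → (∀ x → F x ≡ G x) → Ok F → Ok G
  resp′ h (x , y , z) = (λ a p → subst (λ w → Q w ≡ true × R a w) (h a) (x a p))
    , (λ a b p q e → y a b p q (trans (h a) (trans e (sym (h b)))))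
    , (λ b q → let (a , p , e) = z b q in a , p , trans (sym (h a)) e)
  to-bij : ∃ Ok → Σ (Sub P → Sub Q) λ f → IsBij f × (∀ x → R (proj₁ x) (proj₁ (f x)))
  to-bij (F , x , y , z) = (λ { (a , p) → F a , proj₁ (x a p) })
    , mkBij (λ { (b , q) → proj₁ (z b q) , proj₁ (proj₂ (z b q)) })
        (λ { (a , p) → let (a′ , p′ , e) = z (F a) (proj₁ (x a p)) in sub-≡ (y a′ a p′ p e) })
        (λ { (b , q) → sub-≡ (proj₂ (proj₂ (z b q))) })
    , λ { (a , p) → proj₂ (x a p) }
  from-bij : (Σ (Sub P → Sub Q) λ f → IsBij f × (∀ x → R (proj₁ x) (proj₁ (f x)))) → ∃ Ok
  from-bij (f , b , r) = F
      , (λ a p → subst (λ w → Q w ≡ true × R a w) (sym (F-≡ a p)) (proj₂ (f (a , p)) , r (a , p)))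
      , (λ a a′ p p′ e → cong proj₁ (proj₁ b {a , p} {a′ , p′} (sub-≡ (trans (sym (F-≡ a p)) (trans e (F-≡ a′ p′))))))
      , (λ c q → let (a , p) = inv b (c , q) in a , p , trans (F-≡ a p) (cong proj₁ (f∘inv b (c , q))))
    where
    F : Fin m → Fin k
    F a with P a 𝔹ₚ.≟ true
    ... | yes p = proj₁ (f (a , p))
    ... | no _  = d
    F-≡ : ∀ a p → F a ≡ proj₁ (f (a , p))
    F-≡ a p with P a 𝔹ₚ.≟ true
    ... | yes p′ = cong (proj₁ ∘ f) (sub-≡ refl)
    ... | no np = ⊥-elim (np p)

cr? : ∀ i G u H v → Dec (CRSame i G u H v)
cr? zero    G u H v = col G u ℕ.≟ col H v
cr? (suc i) G u H v = cr? i G u H v ×-dec subBij? (adj G u) (adj H v) (λ a b → CRSame i G a H b) (λ a b → cr? i G a H b) v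

stable-refl : ∀ G u → StableSame G u G u
stable-refl G u i = cr-refl i G u

stable-sym : ∀ {G u H v} → StableSame G u H v → StableSame H v G u
stable-sym {G} {u} {H} {v} h i = cr-sym i G u H v (h i)

stable-trans : ∀ {G u H v K w} → StableSame G u H v → StableSame H v K w → StableSame G u K w
stable-trans {G} {u} {H} {v} {K} {w} h k i = cr-trans i G u H v K w (h i) (k i)

upper-bound : ∀ {m} (f : Fin m → ℕ) → ∃ λ b → ∀ i → f i ≤ b
upper-bound {zero}  f = 0 , λ ()
upper-bound {suc m} f = let (b , h) = upper-bound (f ∘ suc) in
  f zero + b , λ { zero → ℕₚ.m≤m+n _ b ; (suc i) → ℕₚ.≤-trans (h i) (ℕₚ.m≤n+m b (f zero)) }

StableLevel : ℕ → Graph → Graph → Set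
StableLevel i G H = ∀ u v → CRSame i G u H v → StableSame G u H v

-- Each pair of vertices is either never separated or separated in some round, and the maximum of
-- finitely many rounds works for all pairs.
stable-level : ∀ G H → ¬ ¬ ∃ λ i → StableLevel i G H
stable-level G H ret = ¬¬-Π (λ u → ¬¬-Π (λ v → level u v)) λ L →
    let (b , h) = upper-bound (λ u → proj₁ (upper-bound (λ v → proj₁ (L u v))))
    in ret (b , λ u v c → proj₂ (L u v) (cr-mono G u H v (ℕₚ.≤-trans (proj₂ (upper-bound (λ v → proj₁ (L u v))) v) (h u)) c))
  where
  level : ∀ u v → ¬ ¬ ∃ λ i → CRSame i G u H v → StableSame G u H v
  level u v k = ¬¬-excluded-middle {A = StableSame G u H v} λ
    { (yes s) → k (0 , λ _ → s)
    ; (no ns) → ns (λ i → dne (cr? i G u H v) (λ nc → k (i , λ c → ⊥-elim (nc c)))) }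

stable-multiset : ∀ G H → (∀ i → SameMultiset i G H) →
  ¬ ¬ (Σ (Fin (n G) → Fin (n H)) λ f → IsBij f × (∀ u → StableSame G u H (f u)))
stable-multiset G H h ret = stable-level G H λ (i , L) → let (f , b , k) = h i in ret (f , b , λ u → L u (f u) (k u))

stable-nbrs : ∀ {G H i} → StableLevel i G H → ∀ {u v} → StableSame G u H v →
  Σ (Nbr G u → Nbr H v) λ f → IsBij f × (∀ a → StableSame G (proj₁ a) H (proj₁ (f a)))
stable-nbrs {G} {H} {i} L {u} {v} h = let (_ , f , b , k) = h (suc i) in f , b , λ a → L _ _ (k a)

stable-count : ∀ {G H i} → StableLevel i G H → (C : Fin (n G) → Bool) (C′ : Fin (n H) → Bool) →
  (∀ a b → StableSame G a H b → C a ≡ C′ b) → ∀ {u v} → StableSame G u H v →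
  countFin (n G) (λ a → adj G u a ∧ C a) ≡ countFin (n H) (λ a → adj H v a ∧ C′ a)
stable-count {G} {H} L C C′ h s = let (f , b , k) = stable-nbrs {G} {H} L s in count-label C C′ b (λ x → sym (h _ _ (k x)))

stable-dec : ∀ G → ¬ ¬ (∀ u v → Dec (StableSame G u G v))
stable-dec G = ¬¬-Π (λ u → ¬¬-Π (λ v → ¬¬-excluded-middle))

stable-reps : ∀ G → (∀ u v → Dec (StableSame G u G v)) → Reps (λ u v → StableSame G u G v)
stable-reps G = reps (stable-refl G) (λ {u} {v} → stable-sym {G} {u} {G} {v}) (λ {u} {v} {w} → stable-trans {G} {u} {G} {v} {G} {w})

aut-id : ∀ G → IsAut G id
aut-id G = id-bij , (λ _ _ → refl) , (λ _ → refl)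

iso-trans : ∀ {G H K f g} → IsIsoMap G H f → IsIsoMap H K g → IsIsoMap G K (g ∘ f)
iso-trans (b , a , c) (b′ , a′ , c′) = ∘-bij b′ b , (λ u v → trans (a′ _ _) (a u v)) , (λ u → trans (c′ _) (c u))

iso-sym : ∀ {G H f} → (I : IsIsoMap G H f) → IsIsoMap H G (inv (proj₁ I))
iso-sym {G} {H} (b , a , c) = inv-bij b , (λ u v → trans (sym (a _ _)) (cong₂ (adj H) (f∘inv b u) (f∘inv b v)))
  , (λ u → trans (sym (c _)) (cong (col H) (f∘inv b u)))

-- A neighbour `a` of `u` is matched with a neighbour of `f u` of the same stable colour. As the
-- colours of `G` are distinct, that neighbour can only be `f a`, so `f` carries neighbourhoods to
-- neighbourhoods.
discrete⊆amenable : Discrete ⊆ Amenable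
discrete⊆amenable G disc H same = dne (≅? G H) λ no-iso → stable-multiset G H same λ (f , b , k) → stable-level G H λ (i , L) →
  let nbrs : ∀ u → Σ (Nbr G u → Nbr H (f u)) λ g → IsBij g × (∀ a → f (proj₁ a) ≡ proj₁ (g a))
      nbrs u = let (g , gb , gk) = stable-nbrs {G} {H} L (k u) in g , gb , λ a →
        trans (cong f (disc _ _ (stable-trans {G} {_} {H} {_} {G} (gk a) (stable-sym {G} {_} {H} (subst (λ z → StableSame G (inv b (proj₁ (g a))) H z) (f∘inv b _) (k (inv b (proj₁ (g a)))))))))
              (f∘inv b (proj₁ (g a)))
  in no-iso (f , b , (λ u v → bool-ext
        (λ h → let (g , gb , e) = nbrs u ; (a , t) = inv gb (f v , h)
               in subst (λ z → adj G u z ≡ true) (proj₁ b (trans (e (a , t)) (cong proj₁ (f∘inv gb (f v , h))))) t)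
        (λ h → let (g , gb , e) = nbrs u in subst (λ z → adj H (f u) z ≡ true) (sym (e (v , h))) (proj₂ (g (v , h)))))
      , λ u → sym (k u 0))

-- The polytope of fractional automorphisms

module Polytope (G : Graph) where

  private
    m = n G
    A = adj G

  simple : Simple A
  simple = record { sy = symm G ; ir = loopless G }

  poly-ds : ∀ {X} → InPolytope G X → DoublyStochastic m X
  poly-ds (a , b , c , _) = record { nonneg = a ; rows = b ; cols = c }

  poly-comm : ∀ {X} → InPolytope G X → Commutes A X
  poly-comm (_ , _ , _ , d , _) = d

  square-zero : ∀ x → x ℚ.* x ≡ 0ℚ → x ≡ 0ℚ
  square-zero x e with x ℚₚ.≟ 0ℚ
  ... | yes h = h
  ... | no ne = ⊥-elim (ne (trans (sym (ℚₚ.*-identityʳ x)) (trans (cong (x ℚ.*_) (sym (*-recip ne)))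
        (trans (sym (ℚₚ.*-assoc x x (recip x))) (trans (cong (ℚ._* recip x) e) (ℚₚ.*-zeroˡ (recip x)))))))

  sub-zero : ∀ {x y} → x ℚ.- y ≡ 0ℚ → x ≡ y
  sub-zero {x} {y} e = trans (sym (ℚₚ.+-identityʳ x)) (trans (cong (x ℚ.+_) (sym (ℚₚ.+-inverseˡ y))) (trans (sym (ℚₚ.+-assoc x (ℚ.- y) y)) (trans (cong (ℚ._+ y) e) (ℚₚ.+-identityˡ y))))

  square-nonneg : ∀ x → 0ℚ ℚ.≤ x ℚ.* x
  square-nonneg x with ℚₚ.≤-total 0ℚ x
  ... | inj₁ h = *-nonneg h h
  ... | inj₂ h = subst (0ℚ ℚ.≤_) (neg-square x) (*-nonneg (ℚₚ.neg-antimono-≤ h) (ℚₚ.neg-antimono-≤ h))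
    where
    neg-square : ∀ x → (ℚ.- x) ℚ.* (ℚ.- x) ≡ x ℚ.* x
    neg-square = solve 1 (λ x → (:- x) :* (:- x) := x :* x) refl
      where open +-*-Solver

  -- Sum over u, v of X u v (f u - f v)² vanishes when X f = f, so f is constant along the support of X.
  harmonic : ∀ {X} → DoublyStochastic m X → (f : Fin m → ℚ) → (∀ u → sumℚ m (λ v → X u v ℚ.* f v) ≡ f u) →
    ∀ u v → X u v ≢ 0ℚ → f u ≡ f v
  harmonic {X} ds f h u v ne = sub-zero (square-zero _ (cancel (nonneg-sum-zero (term-nonneg u) (nonneg-sum-zero (λ u → sum-nonneg (term-nonneg u)) total u) v)))
    where
    open DoublyStochastic ds
    term : Fin m → Fin m → ℚ
    term u v = X u v ℚ.* ((f u ℚ.- f v) ℚ.* (f u ℚ.- f v))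
    term-nonneg : ∀ u v → 0ℚ ℚ.≤ term u v
    term-nonneg u v = *-nonneg (nonneg u v) (square-nonneg (f u ℚ.- f v))
    cancel : term u v ≡ 0ℚ → (f u ℚ.- f v) ℚ.* (f u ℚ.- f v) ≡ 0ℚ
    cancel e = trans (sym (ℚₚ.*-identityˡ s)) (trans (cong (ℚ._* s) (sym (trans (ℚₚ.*-comm (recip (X u v)) _) (*-recip ne))))
      (trans (ℚₚ.*-assoc (recip (X u v)) (X u v) s) (trans (cong (recip (X u v) ℚ.*_) e) (ℚₚ.*-zeroʳ (recip (X u v))))))
      where s = (f u ℚ.- f v) ℚ.* (f u ℚ.- f v)
    expand : ∀ x a b → x ℚ.* ((a ℚ.- b) ℚ.* (a ℚ.- b)) ≡ (x ℚ.* (a ℚ.* a) ℚ.+ x ℚ.* (b ℚ.* b)) ℚ.+ (ℚ.- (a ℚ.* (x ℚ.* b)) ℚ.+ ℚ.- (a ℚ.* (x ℚ.* b)))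
    expand = solve 3 (λ x a b → x :* ((a :- b) :* (a :- b)) := (x :* (a :* a) :+ x :* (b :* b)) :+ (:- (a :* (x :* b)) :+ :- (a :* (x :* b)))) refl
      where open +-*-Solver
    neg-sum : ∀ {k} (g : Fin k → ℚ) → sumℚ k (λ i → ℚ.- g i) ≡ ℚ.- sumℚ k g
    neg-sum {zero} g = refl
    neg-sum {suc k} g = trans (cong (ℚ.- g zero ℚ.+_) (neg-sum (g ∘ suc))) (sym (ℚₚ.neg-distrib-+ (g zero) _))
    row : ∀ u → sumℚ m (term u) ≡ (f u ℚ.* f u ℚ.+ sumℚ m (λ v → X u v ℚ.* (f v ℚ.* f v))) ℚ.+ (ℚ.- (f u ℚ.* f u) ℚ.+ ℚ.- (f u ℚ.* f u))
    row u = trans (sum-cong (λ v → expand (X u v) (f u) (f v)))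
      (trans (sum-+ (λ v → X u v ℚ.* (f u ℚ.* f u) ℚ.+ X u v ℚ.* (f v ℚ.* f v)) (λ v → ℚ.- (f u ℚ.* (X u v ℚ.* f v)) ℚ.+ ℚ.- (f u ℚ.* (X u v ℚ.* f v))))
      (cong₂ ℚ._+_ (trans (sum-+ (λ v → X u v ℚ.* (f u ℚ.* f u)) (λ v → X u v ℚ.* (f v ℚ.* f v)))
                     (cong (ℚ._+ sumℚ m (λ v → X u v ℚ.* (f v ℚ.* f v))) (trans (sum-*ʳ (f u ℚ.* f u) (X u)) (trans (cong (ℚ._* (f u ℚ.* f u)) (rows u)) (ℚₚ.*-identityˡ (f u ℚ.* f u))))))
                   (trans (sum-+ (λ v → ℚ.- (f u ℚ.* (X u v ℚ.* f v))) (λ v → ℚ.- (f u ℚ.* (X u v ℚ.* f v)))) (cong₂ ℚ._+_ cross cross))))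
      where
      cross : sumℚ m (λ v → ℚ.- (f u ℚ.* (X u v ℚ.* f v))) ≡ ℚ.- (f u ℚ.* f u)
      cross = trans (neg-sum (λ v → f u ℚ.* (X u v ℚ.* f v))) (cong ℚ.-_ (trans (sum-*ˡ (f u) (λ v → X u v ℚ.* f v)) (cong (f u ℚ.*_) (h u))))
    S = sumℚ m (λ u → f u ℚ.* f u)
    total : sumℚ m (λ u → sumℚ m (term u)) ≡ 0ℚ
    total = trans (sum-cong row) (trans (sum-+ (λ u → f u ℚ.* f u ℚ.+ sumℚ m (λ v → X u v ℚ.* (f v ℚ.* f v))) (λ u → ℚ.- (f u ℚ.* f u) ℚ.+ ℚ.- (f u ℚ.* f u)))
      (trans (cong₂ ℚ._+_ (trans (sum-+ (λ u → f u ℚ.* f u) (λ u → sumℚ m (λ v → X u v ℚ.* (f v ℚ.* f v)))) (cong (S ℚ.+_) columns))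
        (trans (sum-+ (λ u → ℚ.- (f u ℚ.* f u)) (λ u → ℚ.- (f u ℚ.* f u))) (cong₂ ℚ._+_ (neg-sum (λ u → f u ℚ.* f u)) (neg-sum (λ u → f u ℚ.* f u)))))
      (trans (+-interchange S S (ℚ.- S) (ℚ.- S)) (cong₂ ℚ._+_ (ℚₚ.+-inverseʳ S) (ℚₚ.+-inverseʳ S)))))
      where
      columns : sumℚ m (λ u → sumℚ m (λ v → X u v ℚ.* (f v ℚ.* f v))) ≡ S
      columns = trans (sum-comm m m (λ u v → X u v ℚ.* (f v ℚ.* f v))) (sum-cong (λ v → trans (sum-*ʳ (f v ℚ.* f v) (λ u → X u v)) (trans (cong (ℚ._* (f v ℚ.* f v)) (cols v)) (ℚₚ.*-identityˡ (f v ℚ.* f v)))))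

  -- By induction `X` fixes the indicator of every class of round `i`. Since `X` commutes with the
  -- adjacency matrix, it also fixes the function counting neighbours in such a class, which by
  -- `harmonic` is constant along the support of `X`.
  poly-cr : ∀ {X} → InPolytope G X → ∀ i → ∀ u v → X u v ≢ 0ℚ → CRSame i G u G v
  poly-cr P@(_ , _ , _ , _ , c) zero u v ne = dne (col G u ℕ.≟ col G v) (λ h → ne (c u v h))
  poly-cr {X} P (suc i) u v ne = poly-cr P i u v ne ,
      labelled-bij-cr (labelled-bij q q λ y → ι-injective (trans (sym (f≡ y u)) (trans (harmonic (poly-ds P) (f y) (Xf y) u v ne) (f≡ y v))))
    where
    open Reps (reps {R = λ a b → CRSame i G a G b} (cr-refl i G) (λ {a} {b} → cr-sym i G a G b) (λ {a} {b} {d} → cr-trans i G a G b G d) (λ a b → cr? i G a G b))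
    q : Fin m → ℕ
    q a = toℕ (rep a)
    labelled-bij-cr : (Σ (Nbr G u → Nbr G v) λ f → IsBij f × (∀ x → q (proj₁ (f x)) ≡ q (proj₁ x))) →
      Σ (Nbr G u → Nbr G v) λ f → IsBij f × (∀ a → CRSame i G (proj₁ a) G (proj₁ (f a)))
    labelled-bij-cr (f , b , k) = f , b , λ a → cr-trans i G _ G _ G _ (rep-rel (proj₁ a))
      (subst (λ z → CRSame i G z G (proj₁ (f a))) (Fₚ.toℕ-injective (k a)) (cr-sym i G _ G _ (rep-rel (proj₁ (f a)))))
    C : ℕ → Fin m → Bool
    C y a = q a ≡ᵇ y
    f : ℕ → Fin m → ℚ
    f y u = sumℚ m (λ w → ⟦ A u w ⟧ ℚ.* ⟦ C y w ⟧)
    f≡ : ∀ y u → f y u ≡ ι (countFin m (λ a → A u a ∧ C y a))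
    f≡ y u = trans (sum-cong (λ w → sym (⟦⟧-∧ (A u w) (C y w)))) (sum-count m (λ a → A u a ∧ C y a))
    open DoublyStochastic (poly-ds P)
    X1 : ∀ y u → sumℚ m (λ w → X u w ℚ.* ⟦ C y w ⟧) ≡ ⟦ C y u ⟧
    X1 y u = trans (sum-cong term) (trans (sum-*ʳ ⟦ C y u ⟧ (X u)) (trans (cong (ℚ._* ⟦ C y u ⟧) (rows u)) (ℚₚ.*-identityˡ ⟦ C y u ⟧)))
      where
      term : ∀ w → X u w ℚ.* ⟦ C y w ⟧ ≡ X u w ℚ.* ⟦ C y u ⟧
      term w with X u w ℚₚ.≟ 0ℚ
      ... | yes e = trans (cong (ℚ._* ⟦ C y w ⟧) e) (trans (ℚₚ.*-zeroˡ ⟦ C y w ⟧) (sym (trans (cong (ℚ._* ⟦ C y u ⟧) e) (ℚₚ.*-zeroˡ ⟦ C y u ⟧))))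
      ... | no h = cong (λ z → X u w ℚ.* ⟦ toℕ z ≡ᵇ y ⟧) (sym (rep-cong (poly-cr P i u w h)))
    Xf : ∀ y u → sumℚ m (λ v → X u v ℚ.* f y v) ≡ f y u
    Xf y u = trans (sum-cong (λ v → trans (sym (sum-*ˡ (X u v) (λ w → ⟦ A v w ⟧ ℚ.* ⟦ C y w ⟧))) (sum-cong (λ w → sym (ℚₚ.*-assoc (X u v) ⟦ A v w ⟧ ⟦ C y w ⟧)))))
      (trans (sum-comm m m (λ v w → (X u v ℚ.* ⟦ A v w ⟧) ℚ.* ⟦ C y w ⟧))
      (trans (sum-cong (λ w → trans (sum-*ʳ ⟦ C y w ⟧ (λ v → X u v ℚ.* ⟦ A v w ⟧)) (trans (cong (ℚ._* ⟦ C y w ⟧) (sym (poly-comm P u w))) (sym (sum-*ʳ ⟦ C y w ⟧ (λ v → ⟦ A u v ⟧ ℚ.* X v w))))))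
      (trans (sum-comm m m (λ w v → (⟦ A u v ⟧ ℚ.* X v w) ℚ.* ⟦ C y w ⟧))
      (sum-cong (λ v → trans (sum-cong (λ w → ℚₚ.*-assoc ⟦ A u v ⟧ (X v w) ⟦ C y w ⟧)) (trans (sum-*ˡ ⟦ A u v ⟧ (λ w → X v w ℚ.* ⟦ C y w ⟧)) (cong (⟦ A u v ⟧ ℚ.*_) (X1 y v))))))))

  poly-stable : ∀ {X} → InPolytope G X → ∀ u v → X u v ≢ 0ℚ → StableSame G u G v
  poly-stable P u v ne i = poly-cr P i u v ne

  module _ (s : ℚ) where
    lin : ℚ → ℚ → ℚ → ℚ
    lin x y z = x ℚ.+ s ℚ.* (y ℚ.- z)

    lin-same : ∀ x y → lin x y y ≡ x
    lin-same x y = trans (cong (λ w → x ℚ.+ s ℚ.* w) (ℚₚ.+-inverseʳ y)) (trans (cong (x ℚ.+_) (ℚₚ.*-zeroʳ s)) (ℚₚ.+-identityʳ x))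

    lin-sum : ∀ {k} (a b c : Fin k → ℚ) → sumℚ k (λ i → lin (a i) (b i) (c i)) ≡ lin (sumℚ k a) (sumℚ k b) (sumℚ k c)
    lin-sum {zero} a b c = sym (lin-same 0ℚ 0ℚ)
    lin-sum {suc k} a b c = trans (cong (lin (a zero) (b zero) (c zero) ℚ.+_) (lin-sum (a ∘ suc) (b ∘ suc) (c ∘ suc)))
        (join (a zero) (b zero) (c zero) (sumℚ k (a ∘ suc)) (sumℚ k (b ∘ suc)) (sumℚ k (c ∘ suc)) s)
      where
      join : ∀ a b c d e f s → (a ℚ.+ s ℚ.* (b ℚ.- c)) ℚ.+ (d ℚ.+ s ℚ.* (e ℚ.- f)) ≡ (a ℚ.+ d) ℚ.+ s ℚ.* ((b ℚ.+ e) ℚ.- (c ℚ.+ f))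
      join = solve 7 (λ a b c d e f s → (a :+ s :* (b :- c)) :+ (d :+ s :* (e :- f)) := (a :+ d) :+ s :* ((b :+ e) :- (c :+ f))) refl
        where open +-*-Solver

    lin-*ˡ : ∀ k x y z → k ℚ.* lin x y z ≡ lin (k ℚ.* x) (k ℚ.* y) (k ℚ.* z)
    lin-*ˡ k x y z = expand k x y z s
      where
      expand : ∀ k x y z s → k ℚ.* (x ℚ.+ s ℚ.* (y ℚ.- z)) ≡ (k ℚ.* x) ℚ.+ s ℚ.* ((k ℚ.* y) ℚ.- (k ℚ.* z))
      expand = solve 5 (λ k x y z s → k :* (x :+ s :* (y :- z)) := (k :* x) :+ s :* ((k :* y) :- (k :* z))) refl
        where open +-*-Solver

    lin-*ʳ : ∀ k x y z → lin x y z ℚ.* k ≡ lin (x ℚ.* k) (y ℚ.* k) (z ℚ.* k)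
    lin-*ʳ k x y z = trans (ℚₚ.*-comm (lin x y z) k) (trans (lin-*ˡ k x y z) (lin-cong (ℚₚ.*-comm k x) (ℚₚ.*-comm k y) (ℚₚ.*-comm k z)))
      where
      lin-cong : ∀ {x y z x′ y′ z′} → x ≡ x′ → y ≡ y′ → z ≡ z′ → lin x y z ≡ lin x′ y′ z′
      lin-cong refl refl refl = refl

    -- The equations of the polytope are affine, so they persist in the direction `Y - Z`; only
    -- nonnegativity has to be supplied.
    shift : ∀ {X Y Z} → InPolytope G X → InPolytope G Y → InPolytope G Z →
      (∀ u v → 0ℚ ℚ.≤ lin (X u v) (Y u v) (Z u v)) → InPolytope G (λ u v → lin (X u v) (Y u v) (Z u v))
    shift {X} {Y} {Z} (_ , rx , cx , ax , kx) (_ , ry , cy , ay , ky) (_ , rz , cz , az , kz) h = h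
      , (λ u → trans (lin-sum (X u) (Y u) (Z u)) (trans (three (rx u) (ry u) (rz u)) (lin-same 1ℚ 1ℚ)))
      , (λ v → trans (lin-sum (λ u → X u v) (λ u → Y u v) (λ u → Z u v)) (trans (three (cx v) (cy v) (cz v)) (lin-same 1ℚ 1ℚ)))
      , (λ u v → trans (sum-cong (λ w → lin-*ˡ ⟦ A u w ⟧ (X w v) (Y w v) (Z w v)))
          (trans (lin-sum (λ w → ⟦ A u w ⟧ ℚ.* X w v) (λ w → ⟦ A u w ⟧ ℚ.* Y w v) (λ w → ⟦ A u w ⟧ ℚ.* Z w v)) (trans (three (ax u v) (ay u v) (az u v))
          (trans (sym (lin-sum (λ w → X u w ℚ.* ⟦ A w v ⟧) (λ w → Y u w ℚ.* ⟦ A w v ⟧) (λ w → Z u w ℚ.* ⟦ A w v ⟧))) (sum-cong (λ w → sym (lin-*ʳ ⟦ A w v ⟧ (X u w) (Y u w) (Z u w))))))))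
      , (λ u v ne → trans (three (kx u v ne) (ky u v ne) (kz u v ne)) (lin-same 0ℚ 0ℚ))
      where
      three : ∀ {x y z x′ y′ z′} → x ≡ x′ → y ≡ y′ → z ≡ z′ → lin x y z ≡ lin x′ y′ z′
      three refl refl refl = refl

  permMatrix : (Fin m → Fin m) → Matrix m
  permMatrix σ u v = ⟦ does (σ u ≟ v) ⟧

  perm-row : ∀ (σ : Fin m → Fin m) u (f : Fin m → ℚ) → sumℚ m (λ v → permMatrix σ u v ℚ.* f v) ≡ f (σ u)
  perm-row σ u f = trans (sum-cong (λ v → cong (λ b → ⟦ b ⟧ ℚ.* f v) (does-cong (σ u ≟ v) (v ≟ σ u) sym sym))) (sum-pick f (σ u))

  perm-col : ∀ {σ : Fin m → Fin m} (b : IsBij σ) v (f : Fin m → ℚ) → sumℚ m (λ u → permMatrix σ u v ℚ.* f u) ≡ f (inv b v)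
  perm-col {σ} b v f = trans (sum-cong (λ u → cong (λ x → ⟦ x ⟧ ℚ.* f u) (does-cong (σ u ≟ v) (u ≟ inv b v)
    (λ e → trans (sym (inv∘f b u)) (cong (inv b) e)) (λ e → trans (cong σ e) (f∘inv b v))))) (sum-pick f (inv b v))

  perm-poly : ∀ {σ} → IsAut G σ → InPolytope G (permMatrix σ)
  perm-poly {σ} (b , a , c) = (λ u v → ⟦⟧-nonneg (does (σ u ≟ v)))
    , (λ u → trans (sum-cong (λ v → sym (ℚₚ.*-identityʳ (permMatrix σ u v)))) (perm-row σ u (λ _ → 1ℚ)))
    , (λ v → trans (sum-cong (λ u → sym (ℚₚ.*-identityʳ (permMatrix σ u v)))) (perm-col b v (λ _ → 1ℚ)))
    , (λ u v → trans (sum-cong (λ w → ℚₚ.*-comm ⟦ A u w ⟧ (permMatrix σ w v))) (trans (perm-col b v (λ w → ⟦ A u w ⟧))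
        (trans (cong ⟦_⟧ (trans (sym (a u (inv b v))) (cong (A (σ u)) (f∘inv b v)))) (sym (perm-row σ u (λ w → ⟦ A w v ⟧))))))
    , (λ u v ne → cong ⟦_⟧ (dec-false (σ u ≟ v) (λ e → ne (trans (sym (c u)) (cong (col G) e)))))

  small-positive : ∀ {k} (f : Fin k → ℚ) → (∀ i → 0ℚ ℚ.< f i) → ∃ λ t → 0ℚ ℚ.< t × t ℚ.< 1ℚ × (∀ i → t ℚ.≤ f i)
  -- Starting the minimum at ½ keeps `t` strictly below 1.
  small-positive {zero} f h = ℚ.½ , ℚₚ.positive⁻¹ ℚ.½ , ℚ.*<* (Data.Integer.+<+ (s≤s (s≤s z≤n))) , λ ()
  small-positive {suc k} f h with small-positive (f ∘ suc) (h ∘ suc)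
  ... | t , pos , lt , le with ℚₚ.≤-total t (f zero)
  ...   | inj₁ q = t , pos , lt , λ { zero → q ; (suc i) → le i }
  ...   | inj₂ q = f zero , h zero , ℚₚ.≤-<-trans q lt , λ { zero → ℚₚ.≤-refl ; (suc i) → ℚₚ.≤-trans q (le i) }

  sub-nonneg : ∀ {x y} → x ℚ.≤ y → 0ℚ ℚ.≤ y ℚ.- x
  sub-nonneg {x} {y} l = subst (ℚ._≤ y ℚ.- x) (ℚₚ.+-inverseʳ x) (ℚₚ.+-monoˡ-≤ (ℚ.- x) l)

  -- X is a proper convex combination of the automorphism and the point X + t/(1-t) (X - σ) beyond X.
  extreme-support : ∀ {X σ} → IsExtremePoint G X → IsAut G σ → InSupport X σ → ∀ u v → X u v ≡ permMatrix σ u v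
  extreme-support {X} {σ} (P , ext) aut supp
    with small-positive (λ u → X u (σ u)) (λ u → ≢0⇒pos (proj₁ P u (σ u)) (supp u))
  ... | t , t>0 , t<1 , le = λ u v → trans (combo u v) (trans (cong (λ z → t ℚ.* permMatrix σ u v ℚ.+ (1ℚ ℚ.- t) ℚ.* z) (sym (same u v))) (convex (permMatrix σ u v) t))
    where
    r = recip (1ℚ ℚ.- t)
    s = t ℚ.* r
    r-eq : (1ℚ ℚ.- t) ℚ.* r ≡ 1ℚ
    r-eq = *-recip (0<⇒≢0 (sub-pos t<1))
    Z : Matrix m
    Z u v = lin s (X u v) (X u v) (permMatrix σ u v)
    convex : ∀ x t → t ℚ.* x ℚ.+ (1ℚ ℚ.- t) ℚ.* x ≡ x
    convex = solve 2 (λ x t → t :* x :+ (con 1ℚ :- t) :* x := x) refl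
      where open +-*-Solver
    Z-eq : ∀ x y → lin s x x y ≡ r ℚ.* (x ℚ.- t ℚ.* y)
    Z-eq x y = begin
      x ℚ.+ (t ℚ.* r) ℚ.* (x ℚ.- y) ≡⟨ cong (ℚ._+ (t ℚ.* r) ℚ.* (x ℚ.- y)) (trans (sym (ℚₚ.*-identityʳ x)) (cong (x ℚ.*_) (sym r-eq))) ⟩
      x ℚ.* ((1ℚ ℚ.- t) ℚ.* r) ℚ.+ (t ℚ.* r) ℚ.* (x ℚ.- y) ≡⟨ ring x y t r ⟩
      r ℚ.* (x ℚ.- t ℚ.* y) ∎
      where
      open ≡-Reasoning
      ring : ∀ x y t r → x ℚ.* ((1ℚ ℚ.- t) ℚ.* r) ℚ.+ (t ℚ.* r) ℚ.* (x ℚ.- y) ≡ r ℚ.* (x ℚ.- t ℚ.* y)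
      ring = solve 4 (λ x y t r → x :* ((con 1ℚ :- t) :* r) :+ (t :* r) :* (x :- y) := r :* (x :- t :* y)) refl
        where open +-*-Solver
    above : ∀ u v → t ℚ.* permMatrix σ u v ℚ.≤ X u v
    above u v with σ u ≟ v
    ... | yes refl = ℚₚ.≤-trans (ℚₚ.≤-reflexive (ℚₚ.*-identityʳ t)) (le u)
    ... | no _ = ℚₚ.≤-trans (ℚₚ.≤-reflexive (ℚₚ.*-zeroʳ t)) (proj₁ P u v)
    Z-poly : InPolytope G Z
    Z-poly = shift s P P (perm-poly aut) λ u v → subst (0ℚ ℚ.≤_) (sym (Z-eq (X u v) (permMatrix σ u v)))
      (*-nonneg (recip-nonneg (ℚₚ.<⇒≤ (sub-pos t<1))) (sub-nonneg (above u v)))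
    combo : ∀ u v → X u v ≡ t ℚ.* permMatrix σ u v ℚ.+ (1ℚ ℚ.- t) ℚ.* Z u v
    combo u v = sym (trans (cong (λ z → t ℚ.* permMatrix σ u v ℚ.+ (1ℚ ℚ.- t) ℚ.* z) (Z-eq (X u v) (permMatrix σ u v)))
      (trans (cong (t ℚ.* permMatrix σ u v ℚ.+_) (trans (sym (ℚₚ.*-assoc (1ℚ ℚ.- t) r _)) (trans (cong (ℚ._* (X u v ℚ.- t ℚ.* permMatrix σ u v)) r-eq) (ℚₚ.*-identityˡ _))))
        (back (X u v) (t ℚ.* permMatrix σ u v))))
      where
      back : ∀ x y → y ℚ.+ (x ℚ.- y) ≡ x
      back = solve 2 (λ x y → y :+ (x :- y) := x) refl
        where open +-*-Solver
    same : ∀ u v → permMatrix σ u v ≡ Z u v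
    same = ext (permMatrix σ) Z t (perm-poly aut) Z-poly t>0 t<1 combo

  permutation? : ∀ X → Dec (IsPermutationMatrix m X)
  permutation? X = anyFun? (λ h (b , e) → bij-≗ h b , λ u v → trans (e u v) (cong (λ z → ⟦ does (z ≟ v) ⟧) (h u)))
    (λ π → bij? π ×-dec all? (λ u → all? λ v → X u v ℚₚ.≟ ⟦ does (π u ≟ v) ⟧))

compact-of-support : ∀ G → (∀ X → InPolytope G X → ¬ ¬ ∃ λ σ → IsAut G σ × InSupport X σ) → Compact G
compact-of-support G h X ext = dne (Polytope.permutation? G X) λ no-perm → h X (proj₁ ext) λ (σ , aut , supp) →
  no-perm (σ , proj₁ aut , Polytope.extreme-support G ext aut supp)

-- From amenability to rigidity of the stable partition

module AmenableCompact (G : Graph) (amen : Amenable G) (dec : ∀ u v → Dec (StableSame G u G v)) {i : ℕ} (L : StableLevel i G G) where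

  private
    p-reps = stable-reps G dec
  open Reps p-reps
  open Cells rep
  open Polytope G using (simple)

  rep-stable : ∀ {u v} → rep u ≡ rep v → StableSame G u G v
  rep-stable {u} {v} e = stable-trans {G} {u} {G} {rep v} {G} (subst (λ z → StableSame G u G z) e (rep-rel u)) (stable-sym {G} {v} {G} (rep-rel v))

  rep-idem : ∀ v → rep (rep v) ≡ rep v
  rep-idem v = sym (rep-cong (rep-rel v))

  equit : Equit (adj G)
  equit {u} {v} c h = stable-count {G} {G} L (inCell c) (inCell c)
    (λ a b s → does-cong (rep a ≟ c) (rep b ≟ c) (trans (sym (rep-cong s))) (trans (rep-cong s))) (rep-stable h)

  label-count : ∀ (E E′ : Fin (n G) → Bool) → (∀ c → countFin (n G) (λ a → E a ∧ inCell c a) ≡ countFin (n G) (λ a → E′ a ∧ inCell c a)) →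
    ∀ y → countFin (n G) (λ a → E a ∧ (toℕ (rep a) ≡ᵇ y)) ≡ countFin (n G) (λ a → E′ a ∧ (toℕ (rep a) ≡ᵇ y))
  label-count E E′ h y with y ℕ.<? n G
  ... | yes l = trans (count-cong (λ a → cong (E a ∧_) (same a))) (trans (h (fromℕ< l)) (count-cong (λ a → cong (E′ a ∧_) (sym (same a)))))
    where
    same : ∀ a → (toℕ (rep a) ≡ᵇ y) ≡ inCell (fromℕ< l) a
    same a = bool-ext (λ t → inCell-true {fromℕ< l} {a} (Fₚ.toℕ-injective (trans (≡ᵇ-true (toℕ (rep a)) y t) (sym (Fₚ.toℕ-fromℕ< l)))))
      (λ t → trans (cong (_≡ᵇ y) (trans (cong toℕ (inCell-elim {fromℕ< l} {a} t)) (Fₚ.toℕ-fromℕ< l))) (≡ᵇ-refl y))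
  ... | no g = trans (count-false (λ a → ∧-falseʳ (E a) (out a))) (sym (count-false (λ a → ∧-falseʳ (E′ a) (out a))))
    where
    out : ∀ a → (toℕ (rep a) ≡ᵇ y) ≡ false
    out a = ≡ᵇ-false _ y (λ e → g (subst (_< n G) e (Fₚ.toℕ<n (rep a))))

  -- A graph with the same degrees into the stable cells satisfies the hypotheses of `cr-label`
  -- against `G`, so amenability provides an isomorphism. It preserves the cells because refinement
  -- colours are invariant.
  rigid : Rigid (adj G)
  rigid B s r = let (φ , b , a , c) = amen H multiset in φ , b , cell φ (b , a , c) , a
    where
    H : Graph
    H = record G { adj = B ; symm = sy s ; loopless = ir s }
    same : ∀ i u v → rep u ≡ rep v → CRSame i G u H v
    same i u v e = cr-label G H (toℕ ∘ rep) (toℕ ∘ rep) (λ u v e → let h = Fₚ.toℕ-injective e in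
        rep-stable h 0 , label-count (adj G u) (B v) (λ c → trans (equit c h) (sym (r v c)))) i u v (cong toℕ e)
    multiset : ∀ i → SameMultiset i G H
    multiset i = id , id-bij , λ u → same i u u refl
    cell : ∀ φ → IsIsoMap G H φ → ∀ u → rep (φ u) ≡ rep u
    cell φ I u = sym (rep-cong {u} {φ u} λ i → cr-trans i G u H (φ u) G (φ u) (cr-iso I i u) (cr-sym i G (φ u) H (φ u) (same i (φ u) (φ u) refl)))

  support : ∀ X → InPolytope G X → ¬ ¬ ∃ λ σ → IsAut G σ × InSupport X σ
  support X P ret = RigidSupport.support-automorphism rep rep-idem simple equit rigid (Polytope.poly-ds G P)
    (λ u v ne → rep-cong (Polytope.poly-stable G P u v ne)) (Polytope.poly-comm G P)
    λ (σ , (b , c , a) , supp) → ret (σ , (b , a , λ u → rep-stable (c u) 0) , supp)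

amenable⊆compact : Amenable ⊆ Compact
amenable⊆compact G amen = compact-of-support G λ X P ret → stable-dec G λ dec → stable-level G G λ (i , L) →
  AmenableCompact.support G amen dec {i} L X P ret

-- Descent to extreme points, and equitable partitions of compact graphs

+-zeroˡ : ∀ {x y} → 0ℚ ℚ.≤ x → 0ℚ ℚ.≤ y → x ℚ.+ y ≡ 0ℚ → x ≡ 0ℚ
+-zeroˡ {x} {y} hx hy e = ℚₚ.≤-antisym (subst₂ ℚ._≤_ (ℚₚ.+-identityʳ x) e (ℚₚ.+-monoʳ-≤ x hy)) hx

*-zero-pos : ∀ {t x} → 0ℚ ℚ.< t → t ℚ.* x ≡ 0ℚ → x ≡ 0ℚ
*-zero-pos {t} {x} h e = trans (sym (ℚₚ.*-identityˡ x)) (trans (cong (ℚ._* x) (sym (trans (ℚₚ.*-comm (recip t) t) (*-recip (0<⇒≢0 h)))))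
  (trans (ℚₚ.*-assoc (recip t) t x) (trans (cong (recip t ℚ.*_) e) (ℚₚ.*-zeroʳ (recip t)))))

_⊑_ : ∀ {m} → Matrix m → Matrix m → Set
X ⊑ Y = ∀ a b → X a b ≢ 0ℚ → Y a b ≢ 0ℚ

convex-support : ∀ G {X Y Z t} → InPolytope G Y → InPolytope G Z → 0ℚ ℚ.< t → t ℚ.< 1ℚ →
  (∀ u v → X u v ≡ t ℚ.* Y u v ℚ.+ (1ℚ ℚ.- t) ℚ.* Z u v) → Y ⊑ X × Z ⊑ X
convex-support G {X} {Y} {Z} {t} PY PZ t>0 t<1 eq =
    (λ a b h e → h (*-zero-pos t>0 (+-zeroˡ (tY a b) (rZ a b) (trans (sym (eq a b)) e))))
  , (λ a b h e → h (*-zero-pos (sub-pos t<1) (+-zeroˡ (rZ a b) (tY a b) (trans (ℚₚ.+-comm ((1ℚ ℚ.- t) ℚ.* Z a b) (t ℚ.* Y a b)) (trans (sym (eq a b)) e)))))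
  where
  tY : ∀ a b → 0ℚ ℚ.≤ t ℚ.* Y a b
  tY a b = *-nonneg (ℚₚ.<⇒≤ t>0) (proj₁ PY a b)
  rZ : ∀ a b → 0ℚ ℚ.≤ (1ℚ ℚ.- t) ℚ.* Z a b
  rZ a b = *-nonneg (ℚₚ.<⇒≤ (sub-pos t<1)) (proj₁ PZ a b)

least-on : ∀ {N} (P : Fin N → Bool) (r : Fin N → ℚ) → ∃ (λ k → P k ≡ true) → ∃ λ k → P k ≡ true × (∀ i → P i ≡ true → r k ℚ.≤ r i)
least-on {suc N} P r (k , h) with any? (λ i → P (suc i) 𝔹ₚ.≟ true) | P zero in p₀
least-on {suc N} P r (zero , h) | no _ | false = ⊥-elim (true≢false h p₀)
least-on {suc N} P r (suc k , h) | no none | _ = ⊥-elim (none (k , h))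
least-on {suc N} P r (zero , h) | no none | true = zero , p₀ , λ { zero _ → ℚₚ.≤-refl ; (suc i) q → ⊥-elim (none (i , q)) }
... | yes w | b with least-on (P ∘ suc) (r ∘ suc) w
...   | j , pj , le with b | ℚₚ.≤-total (r zero) (r (suc j))
...     | false | _ = suc j , pj , λ { zero q → ⊥-elim (true≢false q p₀) ; (suc i) q → le i q }
...     | true | inj₁ l = zero , p₀ , λ { zero _ → ℚₚ.≤-refl ; (suc i) q → ℚₚ.≤-trans l (le i q) }
...     | true | inj₂ l = suc j , pj , λ { zero _ → l ; (suc i) q → le i q }

module Descend (G : Graph) where
  open Polytope G

  private
    m = n G

    nonzero : Matrix m → Fin (m * m) → Bool
    nonzero X k = not (does (X (proj₁ (remQuot {m} m k)) (proj₂ (remQuot {m} m k)) ℚₚ.≟ 0ℚ))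

    supportSize : Matrix m → ℕ
    supportSize X = countFin (m * m) (nonzero X)

    -- Every row of `Y - Z` sums to zero, so a nonzero row has a negative entry.
    negative-entry : ∀ {Y Z} → InPolytope G Y → InPolytope G Z → ∀ a b → Y a b ≢ Z a b → ∃₂ λ c d → Y c d ℚ.- Z c d ℚ.< 0ℚ
    negative-entry {Y} {Z} (_ , ry , _) (_ , rz , _) a b ne with any? (λ d → (Y a d ℚ.- Z a d) ℚₚ.<? 0ℚ)
    ... | yes (d , l) = a , d , l
    ... | no none = ⊥-elim (ne (sub-zero (nonneg-sum-zero (λ d → ℚₚ.≮⇒≥ (λ l → none (d , l)))
          (trans (sum-cong (λ d → sym (ℚ-one (Y a d) (Z a d)))) (trans (lin-sum 1ℚ (λ _ → 0ℚ) (Y a) (Z a))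
            (trans (cong₂ (λ x y → lin 1ℚ (sumℚ m (λ _ → 0ℚ)) x y) (ry a) (rz a)) (trans (lin-same 1ℚ (sumℚ m (λ _ → 0ℚ)) 1ℚ) (sum-zero {m} (λ _ → refl)))))) b)))
      where
      ℚ-one : ∀ x y → lin 1ℚ 0ℚ x y ≡ x ℚ.- y
      ℚ-one x y = trans (ℚₚ.+-identityˡ (1ℚ ℚ.* (x ℚ.- y))) (ℚₚ.*-identityˡ (x ℚ.- y))

    -- Moving from X in the direction Y - Z until an entry vanishes.
    improve-support : ∀ {X Y Z} → InPolytope G X → InPolytope G Y → InPolytope G Z → Y ⊑ X → Z ⊑ X →
      (∃₂ λ c d → Y c d ℚ.- Z c d ℚ.< 0ℚ) → ∀ u v → X u v ≢ 0ℚ → Z u v ℚ.≤ Y u v →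
      ∃ λ X₁ → InPolytope G X₁ × X₁ ⊑ X × X₁ u v ≢ 0ℚ × supportSize X₁ < supportSize X
    improve-support {X} {Y} {Z} PX PY PZ YX ZX (c , d , neg) u v ne le = X₁ , PX₁ , sub , ne₁ ,
        count-⊂ (λ k h → cong not (dec-false (_ ℚₚ.≟ 0ℚ) (sub _ _ (does-false (_ ℚₚ.≟ 0ℚ) (not-false h)))))
          k₀ (cong not (dec-false (_ ℚₚ.≟ 0ℚ) X-k₀)) (cong not (dec-true (_ ℚₚ.≟ 0ℚ) X₁-k₀))
      where
      row col′ : Fin (m * m) → Fin m
      row k = proj₁ (remQuot {m} m k)
      col′ k = proj₂ (remQuot {m} m k)
      Δ : Fin m → Fin m → ℚ
      Δ a b = Y a b ℚ.- Z a b
      P : Fin (m * m) → Bool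
      P k = does (Δ (row k) (col′ k) ℚₚ.<? 0ℚ)
      ratio : Fin m → Fin m → ℚ
      ratio a b = X a b ℚ.* recip (ℚ.- Δ a b)
      at-pair : ∀ {S : Fin m → Fin m → Set} a b → S a b → S (row (combine a b)) (col′ (combine a b))
      at-pair {S} a b h = subst (λ q → S (proj₁ q) (proj₂ q)) (sym (Fₚ.remQuot-combine {m} {m} a b)) h
      from-pair : ∀ {S : Fin m → Fin m → Set} a b → S (row (combine a b)) (col′ (combine a b)) → S a b
      from-pair {S} a b h = subst (λ q → S (proj₁ q) (proj₂ q)) (Fₚ.remQuot-combine {m} {m} a b) h
      -- The ratio test of linear programming: the smallest ratio is the largest step that keeps all
      -- entries nonnegative, and the entry attaining it becomes zero.
      minimum = least-on P (λ k → ratio (row k) (col′ k)) (combine c d , dec-true (_ ℚₚ.<? 0ℚ) (at-pair {λ a b → Δ a b ℚ.< 0ℚ} c d neg))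
      k₀ = proj₁ minimum
      neg₀ : Δ (row k₀) (col′ k₀) ℚ.< 0ℚ
      neg₀ = does-true (_ ℚₚ.<? 0ℚ) (proj₁ (proj₂ minimum))
      s = ratio (row k₀) (col′ k₀)
      minimal : ∀ a b → Δ a b ℚ.< 0ℚ → s ℚ.≤ ratio a b
      minimal a b l = from-pair {λ a b → s ℚ.≤ ratio a b} a b (proj₂ (proj₂ minimum) (combine a b) (dec-true (_ ℚₚ.<? 0ℚ) (at-pair {λ a b → Δ a b ℚ.< 0ℚ} a b l)))
      minus-pos : ∀ {x} → x ℚ.< 0ℚ → 0ℚ ℚ.< ℚ.- x
      minus-pos l = ℚₚ.neg-antimono-< l
      X≥0 = proj₁ PX
      s≥0 : 0ℚ ℚ.≤ s
      s≥0 = *-nonneg (X≥0 _ _) (recip-nonneg (ℚₚ.<⇒≤ (minus-pos neg₀)))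
      X₁ : Matrix m
      X₁ a b = lin s (X a b) (Y a b) (Z a b)
      cancel : ∀ a b → Δ a b ℚ.< 0ℚ → ratio a b ℚ.* (ℚ.- Δ a b) ≡ X a b
      cancel a b l = trans (ℚₚ.*-assoc (X a b) (recip (ℚ.- Δ a b)) (ℚ.- Δ a b)) (trans (cong (X a b ℚ.*_) (trans (ℚₚ.*-comm (recip (ℚ.- Δ a b)) (ℚ.- Δ a b)) (*-recip (0<⇒≢0 (minus-pos l))))) (ℚₚ.*-identityʳ (X a b)))
      flip : ∀ x s δ → x ℚ.- s ℚ.* (ℚ.- δ) ≡ x ℚ.+ s ℚ.* δ
      flip = solve 3 (λ x s δ → x :- s :* (:- δ) := x :+ s :* δ) refl
        where open +-*-Solver
      nonneg₁ : ∀ a b → 0ℚ ℚ.≤ X₁ a b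
      nonneg₁ a b with Δ a b ℚₚ.<? 0ℚ
      ... | no g = subst (ℚ._≤ X₁ a b) (ℚₚ.+-identityˡ 0ℚ) (ℚₚ.+-mono-≤ (X≥0 a b) (*-nonneg s≥0 (ℚₚ.≮⇒≥ g)))
      ... | yes l = subst (0ℚ ℚ.≤_) (flip (X a b) s (Δ a b)) (sub-nonneg (ℚₚ.≤-trans
              (ℚₚ.*-monoʳ-≤-nonNeg (ℚ.- Δ a b) {{ℚ.nonNegative (ℚₚ.<⇒≤ (minus-pos l))}} (minimal a b l)) (ℚₚ.≤-reflexive (cancel a b l))))
      PX₁ : InPolytope G X₁
      PX₁ = shift s PX PY PZ nonneg₁
      sub : X₁ ⊑ X
      sub a b h e = h (trans (cong₂ (λ y z → lin s (X a b) y z) (dne (Y a b ℚₚ.≟ 0ℚ) (λ q → YX a b q e)) (dne (Z a b ℚₚ.≟ 0ℚ) (λ q → ZX a b q e))) (trans (lin-same s (X a b) 0ℚ) e))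
      ne₁ : X₁ u v ≢ 0ℚ
      ne₁ e = ne (+-zeroˡ (X≥0 u v) (*-nonneg s≥0 (sub-nonneg le)) e)
      X-k₀ : X (row k₀) (col′ k₀) ≢ 0ℚ
      X-k₀ e = ℚₚ.<-irrefl (trans (cong₂ ℚ._-_ (dne (Y _ _ ℚₚ.≟ 0ℚ) (λ q → YX _ _ q e)) (dne (Z _ _ ℚₚ.≟ 0ℚ) (λ q → ZX _ _ q e))) refl) neg₀
      X₁-k₀ : X₁ (row k₀) (col′ k₀) ≡ 0ℚ
      X₁-k₀ = trans (sym (flip (X (row k₀) (col′ k₀)) s (Δ (row k₀) (col′ k₀)))) (trans (cong (λ z → X (row k₀) (col′ k₀) ℚ.- z) (cancel (row k₀) (col′ k₀) neg₀)) (ℚₚ.+-inverseʳ (X (row k₀) (col′ k₀))))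

  extreme-below : ∀ k X → InPolytope G X → supportSize X ≤ k → ∀ u v → X u v ≢ 0ℚ →
    ¬ ¬ ∃ λ E → IsExtremePoint G E × E ⊑ X × E u v ≢ 0ℚ
  extreme-below k X PX le u v ne ret = ¬¬-excluded-middle {A = IsExtremePoint G X} λ
    { (yes ext) → ret (X , ext , (λ _ _ h → h) , ne)
    ; (no next) → next (PX , λ Y Z t PY PZ t>0 t<1 eq a b → dne (Y a b ℚₚ.≟ Z a b) λ neq →
        let (YX , ZX) = convex-support G PY PZ t>0 t<1 eq
        -- The sign of the direction is chosen so that the entry at `(u , v)` does not decrease and
        -- hence stays nonzero.
        in case ℚₚ.≤-total (Z u v) (Y u v) of λ
           { (inj₁ l) → continue k le (improve-support PX PY PZ YX ZX (negative-entry PY PZ a b neq) u v ne l)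
           ; (inj₂ l) → continue k le (improve-support PX PZ PY ZX YX (negative-entry PZ PY a b (neq ∘ sym)) u v ne l) }) }
    where
    continue : ∀ k → supportSize X ≤ k → (∃ λ X₁ → InPolytope G X₁ × X₁ ⊑ X × X₁ u v ≢ 0ℚ × supportSize X₁ < supportSize X) → ⊥
    continue zero le (X₁ , P₁ , sub , ne₁ , lt) = ℕₚ.n≮0 (ℕₚ.<-≤-trans lt le)
    continue (suc k) le (X₁ , P₁ , sub , ne₁ , lt) = extreme-below k X₁ P₁ (ℕₚ.≤-pred (ℕₚ.<-≤-trans lt le)) u v ne₁
      λ (E , ext , sub′ , neE) → ret (E , ext , (λ a b h → sub a b (sub′ a b h)) , neE)

  extreme-in-support : ∀ {X} → InPolytope G X → ∀ u v → X u v ≢ 0ℚ → ¬ ¬ ∃ λ E → IsExtremePoint G E × E ⊑ X × E u v ≢ 0ℚ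
  extreme-in-support {X} PX = extreme-below (supportSize X) X PX ℕₚ.≤-refl

  ⟦⟧-injective : ∀ {a b} → ⟦ a ⟧ ≡ ⟦ b ⟧ → a ≡ b
  ⟦⟧-injective {false} {false} _ = refl
  ⟦⟧-injective {true}  {true}  _ = refl

  permutation-aut : ∀ {X} → InPolytope G X → (π : Fin m → Fin m) → IsBij π → (∀ u v → X u v ≡ permMatrix π u v) → IsAut G π
  permutation-aut {X} (_ , _ , _ , comm , c) π b e = b , preserves , λ u → sym (dne (col G u ℕ.≟ col G (π u)) (λ ne → 0≢1ℚ (trans (sym (c u (π u) ne)) (trans (e u (π u)) (cong ⟦_⟧ (dec-true (π u ≟ π u) refl))))))
    where
    preserves : ∀ u v → adj G (π u) (π v) ≡ adj G u v
    preserves u v = ⟦⟧-injective (trans (sym (perm-row π u (λ w → ⟦ adj G w (π v) ⟧)))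
      (trans (sum-cong (λ w → cong (ℚ._* ⟦ adj G w (π v) ⟧) (sym (e u w)))) (trans (sym (comm u (π v)))
      (trans (sum-cong (λ w → trans (cong (⟦ adj G u w ⟧ ℚ.*_) (e w (π v))) (ℚₚ.*-comm ⟦ adj G u w ⟧ (permMatrix π w (π v)))))
      (trans (perm-col b (π v) (λ w → ⟦ adj G u w ⟧)) (cong (λ z → ⟦ adj G u z ⟧) (inv∘f b v)))))))

module Averaging (G : Graph) (q : Fin (n G) → ℕ) (E : Equitable G q) where
  open Polytope G

  private
    m = n G
    A = adj G
    R = reps {R = λ u v → q u ≡ q v} (λ _ → refl) sym trans (λ u v → q u ℕ.≟ q v)
  open Reps R
  open Cells rep

  private
    rep-q : ∀ {u v} → rep u ≡ rep v → q u ≡ q v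
    rep-q {u} {v} e = trans (rep-rel u) (trans (cong q e) (sym (rep-rel v)))

    idem : ∀ v → rep (rep v) ≡ rep v
    idem v = sym (rep-cong (rep-rel v))

    equit : Equit A
    equit {u} {v} c h with rep c ≟ c
    ... | yes rc = trans (count-cong (λ a → cong (A u a ∧_) (same a))) (trans (proj₂ E u v (rep-q h) (q c)) (count-cong (λ a → cong (A v a ∧_) (sym (same a)))))
      where
      same : ∀ a → inCell c a ≡ (q a ≡ᵇ q c)
      same a = bool-ext (λ t → trans (cong (_≡ᵇ q c) (rep-q (trans (inCell-elim {c} {a} t) (sym rc)))) (≡ᵇ-refl (q c)))
        (λ t → inCell-true {c} {a} (trans (rep-cong (≡ᵇ-true (q a) (q c) t)) rc))
    ... | no nc = trans (empty u) (sym (empty v))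
      where
      empty : ∀ u → deg A u c ≡ 0
      empty u = count-false (λ a → ∧-falseʳ (A u a) (not-true (λ t → nc (trans (cong rep (sym (inCell-elim {c} {a} t))) (trans (idem a) (inCell-elim {c} {a} t))))))

    w : Fin m → ℚ
    w u = recip (ι (size (rep u)))

    ι≢0 : ∀ u → ι (size (rep u)) ≢ 0ℚ
    ι≢0 u e = ℕₚ.n≮0 (subst (1 ≤_) (ι-injective {size (rep u)} {0} e) (count-pos u (inCell-true {rep u} {u} refl)))

    ι-nonneg : ∀ k → 0ℚ ℚ.≤ ι k
    ι-nonneg zero = ℚₚ.≤-refl
    ι-nonneg (suc k) = ℚₚ.≤-trans (ι-nonneg k) (ℚₚ.<⇒≤ (ι-<-suc k))

  -- Constant on each diagonal block, with the reciprocal of the cell size as value. It commutes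
  -- with the adjacency matrix because the edges between two cells can be counted from either side.
  average : Matrix m
  average u v = ⟦ inCell (rep u) v ⟧ ℚ.* w u

  average-sym : ∀ u v → average u v ≡ average v u
  average-sym u v with rep v ≟ rep u | rep u ≟ rep v
  ... | yes e | yes _ = cong (λ z → 1ℚ ℚ.* recip (ι (size z))) (sym e)
  ... | yes e | no ne = ⊥-elim (ne (sym e))
  ... | no ne | yes e = ⊥-elim (ne (sym e))
  ... | no _ | no _ = trans (ℚₚ.*-zeroˡ (w u)) (sym (ℚₚ.*-zeroˡ (w v)))

  average-cell : ∀ u v → average u v ≢ 0ℚ → q u ≡ q v
  average-cell u v ne with rep v ≟ rep u
  ... | yes e = sym (rep-q e)
  ... | no _ = ⊥-elim (ne (ℚₚ.*-zeroˡ (w u)))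

  average-≢0 : ∀ u v → q u ≡ q v → average u v ≢ 0ℚ
  average-≢0 u v e z = 0≢1ℚ (trans (sym (ℚₚ.*-zeroʳ (ι (size (rep u))))) (trans (cong (ι (size (rep u)) ℚ.*_) (sym (trans (sym (ℚₚ.*-identityˡ (w u))) (trans (cong (λ b → ⟦ b ⟧ ℚ.* w u) (sym (inCell-true {rep u} {v} (rep-cong (sym e))))) z)))) (*-recip (ι≢0 u))))

  average-poly : InPolytope G average
  average-poly = (λ u v → *-nonneg (⟦⟧-nonneg (inCell (rep u) v)) (recip-nonneg (ι-nonneg (size (rep u)))))
    , rows , (λ v → trans (sum-cong (λ u → average-sym u v)) (rows v)) , comm
    , λ u v ne → dne (average u v ℚₚ.≟ 0ℚ) (λ h → ne (proj₁ E u v (average-cell u v h)))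
    where
    rows : ∀ u → sumℚ m (average u) ≡ 1ℚ
    rows u = trans (sum-*ʳ (w u) (λ v → ⟦ inCell (rep u) v ⟧)) (trans (cong (ℚ._* w u) (sum-count m (inCell (rep u)))) (*-recip (ι≢0 u)))
    weighted : ∀ u v → sumℚ m (λ x → ⟦ A u x ⟧ ℚ.* average v x) ≡ ι (deg A u (rep v)) ℚ.* w v
    weighted u v = trans (sum-cong (λ x → trans (sym (ℚₚ.*-assoc ⟦ A u x ⟧ ⟦ inCell (rep v) x ⟧ (w v))) (cong (ℚ._* w v) (sym (⟦⟧-∧ (A u x) (inCell (rep v) x))))))
      (trans (sum-*ʳ (w v) (λ x → ⟦ nbr A u (rep v) x ⟧)) (cong (ℚ._* w v) (sum-count m (nbr A u (rep v)))))
    ratio : ∀ {a b x y} → a ≢ 0ℚ → b ≢ 0ℚ → a ℚ.* x ≡ b ℚ.* y → x ℚ.* recip b ≡ y ℚ.* recip a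
    ratio {a} {b} {x} {y} ha hb e = begin
      x ℚ.* recip b ≡⟨ trans (sym (ℚₚ.*-identityˡ (x ℚ.* recip b))) (cong (ℚ._* (x ℚ.* recip b)) (sym (*-recip ha))) ⟩
      (a ℚ.* recip a) ℚ.* (x ℚ.* recip b) ≡⟨ swap a (recip a) x (recip b) ⟩
      (a ℚ.* x) ℚ.* (recip a ℚ.* recip b) ≡⟨ cong (ℚ._* (recip a ℚ.* recip b)) e ⟩
      (b ℚ.* y) ℚ.* (recip a ℚ.* recip b) ≡⟨ swap′ b y (recip a) (recip b) ⟩
      (b ℚ.* recip b) ℚ.* (y ℚ.* recip a) ≡⟨ trans (cong (ℚ._* (y ℚ.* recip a)) (*-recip hb)) (ℚₚ.*-identityˡ (y ℚ.* recip a)) ⟩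
      y ℚ.* recip a ∎
      where
      open ≡-Reasoning
      swap : ∀ a b c d → (a ℚ.* b) ℚ.* (c ℚ.* d) ≡ (a ℚ.* c) ℚ.* (b ℚ.* d)
      swap = solve 4 (λ a b c d → (a :* b) :* (c :* d) := (a :* c) :* (b :* d)) refl
        where open +-*-Solver
      swap′ : ∀ a b c d → (a ℚ.* b) ℚ.* (c ℚ.* d) ≡ (a ℚ.* d) ℚ.* (b ℚ.* c)
      swap′ = solve 4 (λ a b c d → (a :* b) :* (c :* d) := (a :* d) :* (b :* c)) refl
        where open +-*-Solver
    comm : ∀ u v → sumℚ m (λ x → ⟦ A u x ⟧ ℚ.* average x v) ≡ sumℚ m (λ x → average u x ℚ.* ⟦ A x v ⟧)
    comm u v = trans (sum-cong (λ x → cong (⟦ A u x ⟧ ℚ.*_) (average-sym x v))) (trans (weighted u v)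
      (trans (cong (λ d → ι d ℚ.* w v) (equit (rep v) (sym (idem u))))
      (trans (ratio (ι≢0 u) (ι≢0 v) (trans (sym (ι-* (size (rep u)) (deg A (rep u) (rep v)))) (trans (cong ι (CellCounts.double rep simple equit (idem u) (idem v))) (ι-* (size (rep v)) (deg A (rep v) (rep u))))))
      (trans (cong (λ d → ι d ℚ.* w u) (sym (equit (rep u) (sym (idem v)))))
      (trans (sym (weighted v u)) (sum-cong (λ x → trans (ℚₚ.*-comm ⟦ A v x ⟧ (average u x)) (cong (λ b → average u x ℚ.* ⟦ b ⟧) (symm G v x)))))))))

-- The group consists of all automorphisms preserving every cell, so only transitivity on the cells
-- has to be supplied.
orbit-partition : ∀ G (q : Fin (n G) → ℕ) → (∀ u v → q u ≡ q v → ∃ λ σ → (IsAut G σ × (∀ x → q (σ x) ≡ q x)) × σ u ≡ v) →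
  Σ ((Fin (n G) → Fin (n G)) → Set) λ Γ → IsAutSubgroup G Γ × IsOrbitPartitionOf G Γ q
orbit-partition G q h = (λ σ → IsAut G σ × (∀ x → q (σ x) ≡ q x))
  , ((λ _ → proj₁) , (aut-id G , λ _ → refl)
    , (λ σ τ (a , k) (b , l) → iso-trans {G} {G} {G} b a , λ x → trans (k (τ x)) (l x))
    , (λ σ (a , k) → inv (proj₁ a) , (iso-sym {G} {G} a , λ x → trans (sym (k _)) (cong q (f∘inv (proj₁ a) x))) , inv∘f (proj₁ a) , f∘inv (proj₁ a)))
  , λ u v → h u v , λ { (σ , (_ , k) , e) → trans (sym (k u)) (cong q e) }

cell-automorphism? : ∀ G (q : Fin (n G) → ℕ) u v → Dec (∃ λ σ → (IsAut G σ × (∀ x → q (σ x) ≡ q x)) × σ u ≡ v)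
cell-automorphism? G q u v = anyFun? (λ h ((a , k) , e) → (isIso-≗ G G h a , λ x → trans (cong q (sym (h x))) (k x)) , trans (sym (h u)) e)
  (λ σ → (isIso? G G σ ×-dec all? (λ x → q (σ x) ℕ.≟ q x)) ×-dec (σ u ≟ v))

-- The extreme point is a permutation matrix supported in `average`: it preserves the cells, and its
-- nonzero entry at `(u , v)` says that it moves `u` to `v`.
compact⊆godsil : Compact ⊆ Godsil
compact⊆godsil G comp q E = orbit-partition G q λ u v e → dne (cell-automorphism? G q u v) λ none →
  Descend.extreme-in-support G average-poly u v (average-≢0 u v e) λ (X , ext , sub , ne) →
    let (π , b , X≡) = comp X ext
        on : ∀ x → X x (π x) ≢ 0ℚ
        on x z = 0≢1ℚ (trans (sym z) (trans (X≡ x (π x)) (cong ⟦_⟧ (dec-true (π x ≟ π x) refl))))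
    in none (π , (Descend.permutation-aut G (proj₁ ext) π b X≡ , λ x → sym (average-cell x (π x) (sub x (π x) (on x))))
            , dne (π u ≟ v) (λ h → ne (trans (X≡ u v) (cong ⟦_⟧ (dec-false (π u ≟ v) h)))))
  where open Averaging G q E

-- Tinhofer's algorithm

encode : Maybe ℕ → ℕ → ℕ
encode i c = maybe (λ j → suc (2 * j)) (2 * c) i

encode-index : ∀ i i′ c c′ → encode i c ≡ encode i′ c′ → i ≡ i′
encode-index nothing  nothing  c c′ e = refl
encode-index nothing  (just j) c c′ e = ⊥-elim (ℕₚ.even≢odd c j e)
encode-index (just j) nothing  c c′ e = ⊥-elim (ℕₚ.even≢odd c′ j (sym e))
encode-index (just j) (just k) c c′ e = cong just (ℕₚ.*-cancelˡ-≡ j k 2 (ℕₚ.suc-injective e))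

encode-colour : ∀ c c′ → encode nothing c ≡ encode nothing c′ → c ≡ c′
encode-colour c c′ e = ℕₚ.*-cancelˡ-≡ c c′ 2 e

module _ {G H : Graph} where

  indexL-< : ∀ (s : Pairs G H) x {j} → indexL {G} {H} s x ≡ just j → j < length s
  indexL-< ((u , _) ∷ s) x e with u ≟ x
  ... | yes _ = subst (_< suc (length s)) (just-injective e) (ℕₚ.n<1+n _)
  ... | no _ = ℕₚ.m<n⇒m<1+n (indexL-< s x e)

  indexR-< : ∀ (s : Pairs G H) x {j} → indexR {G} {H} s x ≡ just j → j < length s
  indexR-< ((_ , v) ∷ s) x e with v ≟ x
  ... | yes _ = subst (_< suc (length s)) (just-injective e) (ℕₚ.n<1+n _)
  ... | no _ = ℕₚ.m<n⇒m<1+n (indexR-< s x e)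

  indexL-unique : ∀ (s : Pairs G H) x y {j} → indexL {G} {H} s x ≡ just j → indexL {G} {H} s y ≡ just j → x ≡ y
  indexL-unique ((u , _) ∷ s) x y e e′ with u ≟ x | u ≟ y
  ... | yes p | yes q = trans (sym p) q
  ... | yes _ | no _ = ⊥-elim (ℕₚ.<-irrefl refl (indexL-< s y (trans e′ (sym e))))
  ... | no _ | yes _ = ⊥-elim (ℕₚ.<-irrefl refl (indexL-< s x (trans e (sym e′))))
  ... | no _ | no _ = indexL-unique s x y e e′

recoloured-aut : ∀ G H (s : Pairs G H) {σ} → IsAut (leftG G H s) σ → IsAut G σ × (∀ x → indexL {G} {H} s (σ x) ≡ indexL {G} {H} s x)
recoloured-aut G H s {σ} (b , a , c) = (b , a , λ x → colour x (indexL {G} {H} s x) refl) , index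
  where
  index : ∀ x → indexL {G} {H} s (σ x) ≡ indexL {G} {H} s x
  index x = encode-index (indexL {G} {H} s (σ x)) (indexL {G} {H} s x) (col G (σ x)) (col G x) (c x)
  colour : ∀ x i → indexL {G} {H} s x ≡ i → col G (σ x) ≡ col G x
  colour x (just j) e = cong (col G) (indexL-unique {G} {H} s (σ x) x (trans (index x) e) e)
  colour x nothing e = encode-colour (col G (σ x)) (col G x)
    (subst₂ (λ i i′ → encode i (col G (σ x)) ≡ encode i′ (col G x)) (trans (index x) e) e (c x))

-- A sufficient condition for correctness of the algorithm: after any individualisation the stable
-- classes are orbits. It also covers `coupled`, which is not Godsil.
Homogeneous : Graph → Set
Homogeneous G = ∀ H (s : Pairs G H) u u′ → StableSame (leftG G H s) u (leftG G H s) u′ →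
  ¬ ¬ ∃ λ σ → IsAut (leftG G H s) σ × σ u ≡ u′

module _ (G : Graph) (hom : Homogeneous G) (H : Graph) where

  private
    Extends : Pairs G H → (Fin (n G) → Fin (n H)) → Set
    Extends s φ = IsIsoMap G H φ × (∀ x → indexR {G} {H} s (φ x) ≡ indexL {G} {H} s x)

    extends-iso : ∀ s {φ} → Extends s φ → IsIsoMap (leftG G H s) (rightG G H s) φ
    extends-iso s ((b , a , c) , k) = b , a , λ x → cong₂ encode (k x) (c x)

    -- The invariant is an isomorphism `φ` sending each individualised vertex to its partner. When
    -- `(u , v)` is added, homogeneity supplies an automorphism moving `u` to the preimage of `v`,
    -- and composing it with `φ` restores the invariant.
    never-wrong : ∀ s → TinhoferRun G H s nonIsomorphic → ∃ (Extends s) → ⊥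
    never-wrong s (differ h) (φ , X) = h λ i → φ , proj₁ (proj₁ X) , cr-iso (extends-iso s X) i
    never-wrong s (discreteNo _ _ dr f k bad) (φ , X) = bad (isIso-≗ G H (λ u → sym (dr (f u) (φ u)
      (stable-trans {rightG G H s} {f u} {leftG G H s} {u} {rightG G H s} {φ u} (stable-sym {leftG G H s} {u} {rightG G H s} {f u} (k u)) (λ i → cr-iso (extends-iso s X) i u)))) (proj₁ X))
    never-wrong s (individualise _ u v st _ _ run) (φ , X@((b , a , c) , k)) =
      hom H s u (inv b v) (stable-trans {leftG G H s} {u} {rightG G H s} {v} {leftG G H s} {inv b v} st
          (stable-sym {leftG G H s} {inv b v} {rightG G H s} {v} (subst (λ z → StableSame (leftG G H s) (inv b v) (rightG G H s) z) (f∘inv b v) (λ i → cr-iso (extends-iso s X) i (inv b v)))))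
        λ (σ , aut , e) → let (autG , index) = recoloured-aut G H s aut ; φu≡v = trans (cong φ e) (f∘inv b v) in
          never-wrong ((u , v) ∷ s) run (φ ∘ σ , iso-trans {G} {G} {H} autG (b , a , c) , extended σ (proj₁ autG) φu≡v index)
      where
      extended : ∀ σ → IsBij σ → φ (σ u) ≡ v → (∀ x → indexL {G} {H} s (σ x) ≡ indexL {G} {H} s x) →
        ∀ x → indexR {G} {H} ((u , v) ∷ s) (φ (σ x)) ≡ indexL {G} {H} ((u , v) ∷ s) x
      extended σ bσ e index x = cong₂ (λ t i → if t then just (length s) else i)
        (does-cong (v ≟ φ (σ x)) (u ≟ x) (λ h → proj₁ bσ (proj₁ b (trans e h))) (λ h → trans (sym e) (cong (φ ∘ σ) h)))
        (trans (k (σ x)) (index x))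

    sound : ∀ s → TinhoferRun G H s isomorphic → G ≅ H
    sound s (discreteYes _ _ _ f _ iso) = f , iso
    sound s (individualise _ u v _ _ _ run) = sound ((u , v) ∷ s) run

  homogeneous-run : ∀ a → TinhoferRun G H [] a → (a ≡ isomorphic → G ≅ H) × (G ≅ H → a ≡ isomorphic)
  homogeneous-run isomorphic    run = (λ _ → sound [] run) , λ _ → refl
  homogeneous-run nonIsomorphic run = (λ ()) , λ (φ , I) → ⊥-elim (never-wrong [] run (φ , I , λ _ → refl))

homogeneous⇒tinhofer : ∀ G → Homogeneous G → Tinhofer G
homogeneous⇒tinhofer G hom H a run = homogeneous-run G hom H a run

godsil⊆tinhofer : Godsil ⊆ Tinhofer
godsil⊆tinhofer G god = homogeneous⇒tinhofer G λ H s u u′ st ret →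
  let Gs = leftG G H s in stable-dec Gs λ dec → stable-level Gs Gs λ (i , L) →
  let open Reps (stable-reps Gs dec)
      q : Fin (n G) → ℕ
      q = toℕ ∘ rep
      q-stable : ∀ {x y} → q x ≡ q y → StableSame Gs x Gs y
      q-stable {x} {y} e = stable-trans {Gs} {x} {Gs} {rep y} {Gs} (subst (λ z → StableSame Gs x Gs z) (Fₚ.toℕ-injective e) (rep-rel x)) (stable-sym {Gs} {y} {Gs} (rep-rel y))
      q-cong : ∀ {x y} → StableSame Gs x Gs y → q x ≡ q y
      q-cong h = cong toℕ (rep-cong h)
      equitable : Equitable G q
      equitable = (λ x y e → original-colour H s x y (q-stable {x} {y} e 0) (indexL {G} {H} s x) refl)
        , λ x y e z → stable-count {Gs} {Gs} L (λ a → q a ≡ᵇ z) (λ a → q a ≡ᵇ z) (λ a b h → cong (_≡ᵇ z) (q-cong h)) (q-stable {x} {y} e)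
      (Γ , (auts , _) , orbits) = god q equitable
      (σ , σ∈Γ , e) = proj₁ (orbits u u′) (q-cong st)
      (b , a , _) = auts σ σ∈Γ
  in ret (σ , (b , a , λ x → sym (q-stable {x} {σ x} (proj₂ (orbits x (σ x)) (σ , σ∈Γ , refl)) 0)) , e)
  where
  -- Recolouring forgets the old colour of an individualised vertex, but such a vertex shares its
  -- new colour with no other.
  original-colour : ∀ H (s : Pairs G H) x y → encode (indexL {G} {H} s x) (col G x) ≡ encode (indexL {G} {H} s y) (col G y) →
    ∀ i → indexL {G} {H} s x ≡ i → col G x ≡ col G y
  original-colour H s x y e (just j) h = cong (col G) (indexL-unique {G} {H} s x y h (trans (sym (encode-index (indexL {G} {H} s x) (indexL {G} {H} s y) (col G x) (col G y) e)) h))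
  original-colour H s x y e nothing h = encode-colour (col G x) (col G y) (subst₂ (λ i i′ → encode i (col G x) ≡ encode i′ (col G y)) h
    (trans (sym (encode-index (indexL {G} {H} s x) (indexL {G} {H} s y) (col G x) (col G y) e)) h) e)

-- A positive answer is accompanied by an isomorphism respecting all choices made so far; `coarser`
-- carries this back through an individualisation.
Verified : ∀ {G H} → Pairs G H → Answer → Set
Verified {G} {H} s a = a ≡ isomorphic → ∃ λ f → IsIsoMap G H f × (∀ x → StableSame (leftG G H s) x (rightG G H s) (f x))

module _ {G H : Graph} where

  coarser : ∀ (s : Pairs G H) u v → StableSame (leftG G H s) u (rightG G H s) v →
    ∀ x y → StableSame (leftG G H ((u , v) ∷ s)) x (rightG G H ((u , v) ∷ s)) y → StableSame (leftG G H s) x (rightG G H s) y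
  coarser s u v st x y h i = cr-coarsen G (col (leftG G H ((u , v) ∷ s))) (col (leftG G H s)) H (col (rightG G H ((u , v) ∷ s))) (col (rightG G H s)) step i x y (h i)
    where
    step : ∀ x y → encode (indexL {G} {H} ((u , v) ∷ s) x) (col G x) ≡ encode (indexR {G} {H} ((u , v) ∷ s) y) (col H y) →
      encode (indexL {G} {H} s x) (col G x) ≡ encode (indexR {G} {H} s y) (col H y)
    step x y e with u ≟ x | v ≟ y
    ... | yes refl | yes refl = st 0
    ... | yes _ | no _ = ⊥-elim (ℕₚ.<-irrefl refl (indexR-< {G} {H} s y (sym (encode-index (just (length s)) (indexR {G} {H} s y) (col G x) (col H y) e))))
    ... | no _ | yes _ = ⊥-elim (ℕₚ.<-irrefl refl (indexL-< {G} {H} s x (encode-index (indexL {G} {H} s x) (just (length s)) (col G x) (col H y) e)))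
    ... | no _ | no _ = e

  private
    unindexed : Pairs G H → ℕ
    unindexed s = countFin (n G) (λ x → is-nothing (indexL {G} {H} s x))

    fewer : ∀ s u v → indexL {G} {H} s u ≡ nothing → unindexed ((u , v) ∷ s) < unindexed s
    fewer s u v e = count-⊂ sub u (cong is-nothing e) (cong (λ t → is-nothing (if t then just (length s) else indexL {G} {H} s u)) (dec-true (u ≟ u) refl))
      where
      sub : ∀ x → is-nothing (indexL {G} {H} ((u , v) ∷ s) x) ≡ true → is-nothing (indexL {G} {H} s x) ≡ true
      sub x h with u ≟ x
      ... | no _ = h

    twin-unindexed : ∀ s {u u′} → u ≢ u′ → StableSame (leftG G H s) u (leftG G H s) u′ → indexL {G} {H} s u ≡ nothing
    twin-unindexed s {u} {u′} ne h = go (indexL {G} {H} s u) refl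
      where
      go : ∀ i → indexL {G} {H} s u ≡ i → indexL {G} {H} s u ≡ nothing
      go nothing e = e
      go (just j) e = ⊥-elim (ne (indexL-unique {G} {H} s u u′ e (trans (sym (encode-index (indexL {G} {H} s u) (indexL {G} {H} s u′) (col G u) (col G u′) (h 0))) e)))

  complete-run : ∀ k (s : Pairs G H) → unindexed s ≤ k → ¬ ¬ ∃ λ a → TinhoferRun G H s a × Verified {G} {H} s a
  complete-run k s le ret = ¬¬-excluded-middle {A = ∀ i → SameMultiset i L R} λ
    { (no h) → ret (nonIsomorphic , differ h , λ ())
    ; (yes same) → stable-multiset L R same λ (f , b , st) → ¬¬-excluded-middle {A = ∃₂ λ u u′ → u ≢ u′ × StableSame L u L u′} λ
      { (no none) → let
            dl : ∀ u u′ → StableSame L u L u′ → u ≡ u′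
            dl u u′ h = dne (u ≟ u′) (λ ne → none (u , u′ , ne , h))
            back : ∀ v → StableSame R v L (inv b v)
            back v = stable-sym {L} {inv b v} {R} {v} (subst (λ z → StableSame L (inv b v) R z) (f∘inv b v) (st (inv b v)))
            dr : ∀ v v′ → StableSame R v R v′ → v ≡ v′
            dr v v′ h = proj₁ (inv-bij b) (dl (inv b v) (inv b v′) (stable-trans {L} {_} {R} {v} {L} (stable-sym {R} {v} {L} (back v)) (stable-trans {R} {v} {R} {v′} {L} h (back v′))))
          in case isIso? G H f of λ
            { (yes I) → ret (isomorphic , discreteYes same dl dr f st I , λ _ → f , I , st)
            ; (no nI) → ret (nonIsomorphic , discreteNo same dl dr f st nI , λ ()) }
      ; (yes (u , u′ , ne , h)) → next k le same u (f u) u′ (f u′) (ne ∘ sym) (λ e → ne (sym (proj₁ b e))) h (st u)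
          (stable-trans {R} {f u} {L} {u} {R} (stable-sym {L} {u} {R} (st u)) (stable-trans {L} {u} {L} {u′} {R} h (st u′))) } }
    where
    L = leftG G H s
    R = rightG G H s
    next : ∀ k → unindexed s ≤ k → (∀ i → SameMultiset i L R) → ∀ u v u′ v′ → u′ ≢ u → v′ ≢ v →
      StableSame L u L u′ → StableSame L u R v → StableSame R v R v′ → ⊥
    next zero le _ u v _ _ ne _ h _ _ = ℕₚ.n≮0 (ℕₚ.<-≤-trans (fewer s u v (twin-unindexed s (ne ∘ sym) h)) le)
    next (suc k) le same u v u′ v′ ne ne′ h hv hv′ = complete-run k ((u , v) ∷ s) (ℕₚ.≤-pred (ℕₚ.<-≤-trans (fewer s u v (twin-unindexed s (ne ∘ sym) h)) le))
      λ (a , run , ver) → ret (a , individualise same u v hv (u′ , ne , h) (v′ , ne′ , hv′) run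
        , λ e → let (f , I , st) = ver e in f , I , λ x → coarser s u v hv x (f x) (st x))

data Chosen (G : Graph) : Pairs G G → Set where
  start  : Chosen G []
  choose : ∀ {s u v} → Chosen G s → (∀ i → SameMultiset i (leftG G G s) (rightG G G s)) →
    StableSame (leftG G G s) u (rightG G G s) v →
    (∃ λ u′ → u′ ≢ u × StableSame (leftG G G s) u (leftG G G s) u′) →
    (∃ λ v′ → v′ ≢ v × StableSame (rightG G G s) v (rightG G G s) v′) → Chosen G ((u , v) ∷ s)

chosen-run : ∀ {G s a} → Chosen G s → TinhoferRun G G s a → TinhoferRun G G [] a
chosen-run start run = run
chosen-run (choose c same st tu tv) run = chosen-run c (individualise same _ _ st tu tv run)

-- On the input `(G , G)` the answer must be `isomorphic`, and a verified run then provides an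
-- automorphism compatible with the chosen pairs.
tinhofer-extends : ∀ G → Tinhofer G → ∀ {s} → Chosen G s →
  ¬ ¬ ∃ λ f → IsAut G f × (∀ x → StableSame (leftG G G s) x (rightG G G s) (f x))
tinhofer-extends G tin {s} c ret = complete-run _ s ℕₚ.≤-refl λ (a , run , ver) →
  ret (ver (proj₂ (tin G a (chosen-run c run)) (id , aut-id G)))

base-stable : ∀ G {u v} → StableSame G u G v → StableSame (leftG G G []) u (rightG G G []) v
base-stable G {u} {v} h i = cr-coarsen G (col G) (λ x → 2 * col G x) G (col G) (λ x → 2 * col G x) (λ _ _ → cong (2 *_)) i u v (h i)

choose-first : ∀ G {u v u′ v′} → StableSame G u G v → u′ ≢ u → StableSame G u G u′ → v′ ≢ v → StableSame G v G v′ → Chosen G ((u , v) ∷ [])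
choose-first G {u} {v} {u′} {v′} h nu hu nv hv = choose start (λ i → id , id-bij , λ x → cr-refl i (leftG G G []) x)
  (base-stable G h) (u′ , nu , base-stable G hu) (v′ , nv , base-stable G hv)

first-pair : ∀ G {u v : Fin (n G)} y → indexL {G} {G} ((u , v) ∷ []) u ≡ indexR {G} {G} ((u , v) ∷ []) y → y ≡ v
first-pair G {u} {v} y e with u ≟ u | v ≟ y
... | yes _ | yes h = sym h
... | yes _ | no _ = case e of λ ()
... | no h | _ = ⊥-elim (h refl)

sends? : ∀ G (u v : Fin (n G)) → Dec (∃ λ σ → IsAut G σ × σ u ≡ v)
sends? G u v = anyFun? (λ h (a , e) → isIso-≗ G G h a , trans (sym (h u)) e) (λ σ → isIso? G G σ ×-dec (σ u ≟ v))

tinhofer⊆refinable : Tinhofer ⊆ Refinable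
tinhofer⊆refinable G tin u v = (λ h → dne (sends? G u v) λ none → case u ≟ v of λ
    { (yes e) → none (id , aut-id G , e)
    ; (no ne) → tinhofer-extends G tin (choose-first G h (ne ∘ sym) h ne (stable-sym {G} {u} {G} h)) λ (f , I , st) →
        none (f , I , first-pair G {u} {v} (f u) (encode-index (indexL {G} {G} ((u , v) ∷ []) u) (indexR {G} {G} ((u , v) ∷ []) (f u)) (col G u) (col G (f u)) (st u 0))) })
  , λ { (σ , I , refl) i → cr-iso I i u }

-- Separating examples

bounded-labels : ∀ G H (q : Fin (n G) → ℕ) (q′ : Fin (n H) → ℕ) K → (∀ a → q a < K) → (∀ a → q′ a < K) → ∀ u v →
  (∀ (y : Fin K) → nbrsIn G q u (toℕ y) ≡ nbrsIn H q′ v (toℕ y)) → ∀ y → nbrsIn G q u y ≡ nbrsIn H q′ v y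
bounded-labels G H q q′ K b b′ u v h y with y ℕ.<? K
... | yes l = subst (λ z → nbrsIn G q u z ≡ nbrsIn H q′ v z) (Fₚ.toℕ-fromℕ< l) (h (fromℕ< l))
... | no g = trans (count-false (λ a → ∧-falseʳ (adj G u a) (≡ᵇ-false (q a) y (λ e → g (subst (_< K) e (b a))))))
             (sym (count-false (λ a → ∧-falseʳ (adj H v a) (≡ᵇ-false (q′ a) y (λ e → g (subst (_< K) e (b′ a)))))))

-- The hypotheses of `cr-label` made decidable by bounding the labels, so that concrete graphs are
-- treated by evaluation.
MatchedLabels : (G H : Graph) (q : Fin (n G) → ℕ) (q′ : Fin (n H) → ℕ) → ℕ → Set
MatchedLabels G H q q′ K = (∀ a → q a < K) × (∀ a → q′ a < K) × (∀ u v → q u ≡ q′ v → col G u ≡ col H v ×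
  (∀ (y : Fin K) → nbrsIn G q u (toℕ y) ≡ nbrsIn H q′ v (toℕ y)))

matchedLabels? : ∀ G H q q′ K → Dec (MatchedLabels G H q q′ K)
matchedLabels? G H q q′ K = all? (λ a → q a ℕ.<? K) ×-dec (all? (λ a → q′ a ℕ.<? K) ×-dec
  all? (λ u → all? λ v → (q u ℕ.≟ q′ v) →-dec ((col G u ℕ.≟ col H v) ×-dec all? (λ y → nbrsIn G q u (toℕ y) ℕ.≟ nbrsIn H q′ v (toℕ y)))))

matched-stable : ∀ G H {q q′ K} → MatchedLabels G H q q′ K → ∀ u v → q u ≡ q′ v → StableSame G u H v
matched-stable G H {q} {q′} {K} (b , b′ , h) u v e i = cr-label G H q q′
  (λ u v e → proj₁ (h u v e) , bounded-labels G H q q′ K b b′ u v (proj₂ (h u v e))) i u v e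

matched-equitable : ∀ G {q K} → MatchedLabels G G q q K → Equitable G q
matched-equitable G {q} {K} (b , _ , h) = (λ u v e → proj₁ (h u v e)) , λ u v e → bounded-labels G G q q K b b u v (proj₂ (h u v e))

mkGraph : (N : ℕ) (A : Adj N) (c : Fin N → ℕ) → (∀ u v → A u v ≡ A v u) → (∀ u → A u u ≡ false) → Graph
mkGraph N A c s i = record { n = N ; adj = A ; symm = s ; loopless = i ; col = c }

sum-two : ∀ {m} (f : Fin m → ℚ) a b → a ≢ b → (∀ i → i ≢ a → i ≢ b → f i ≡ 0ℚ) → sumℚ m f ≡ f a ℚ.+ f b
sum-two {m} f a b ne h = trans (sum-cong term) (trans (sum-+ (λ i → ⟦ does (i ≟ a) ⟧ ℚ.* f i) (λ i → ⟦ does (i ≟ b) ⟧ ℚ.* f i)) (cong₂ ℚ._+_ (sum-pick f a) (sum-pick f b)))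
  where
  term : ∀ i → f i ≡ ⟦ does (i ≟ a) ⟧ ℚ.* f i ℚ.+ ⟦ does (i ≟ b) ⟧ ℚ.* f i
  term i with i ≟ a | i ≟ b
  ... | yes e | yes e′ = ⊥-elim (ne (trans (sym e) e′))
  ... | yes _ | no _ = sym (trans (cong₂ ℚ._+_ (ℚₚ.*-identityˡ (f i)) (ℚₚ.*-zeroˡ (f i))) (ℚₚ.+-identityʳ (f i)))
  ... | no _ | yes _ = sym (trans (cong₂ ℚ._+_ (ℚₚ.*-zeroˡ (f i)) (ℚₚ.*-identityˡ (f i))) (ℚₚ.+-identityˡ (f i)))
  ... | no na | no nb = trans (h i na nb) (sym (cong₂ ℚ._+_ (ℚₚ.*-zeroˡ (f i)) (ℚₚ.*-zeroˡ (f i))))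

-- When the allowed support leaves one or two entries per equation, the equations of the polytope
-- become relations between single entries.
module Pattern (G : Graph) (E : Adj (n G)) {Y : Matrix (n G)} (PY : InPolytope G Y) (YE : ∀ u v → E u v ≡ false → Y u v ≡ 0ℚ) where

  OnlyTwo : (Fin (n G) → Bool) → Fin (n G) → Fin (n G) → Set
  OnlyTwo P a b = a ≢ b × (∀ i → i ≢ a → i ≢ b → P i ≡ false)

  onlyTwo? : ∀ P a b → Dec (OnlyTwo P a b)
  onlyTwo? P a b = ¬? (a ≟ b) ×-dec all? (λ i → ¬? (i ≟ a) →-dec (¬? (i ≟ b) →-dec (P i 𝔹ₚ.≟ false)))

  OnlyOne : (Fin (n G) → Bool) → Fin (n G) → Set
  OnlyOne P a = ∀ i → i ≢ a → P i ≡ false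

  onlyOne? : ∀ P a → Dec (OnlyOne P a)
  onlyOne? P a = all? (λ i → ¬? (i ≟ a) →-dec (P i 𝔹ₚ.≟ false))

  row-two : ∀ u a b → OnlyTwo (E u) a b → Y u a ℚ.+ Y u b ≡ 1ℚ
  row-two u a b (ne , h) = trans (sym (sum-two (Y u) a b ne (λ i na nb → YE u i (h i na nb)))) (proj₁ (proj₂ PY) u)

  col-two : ∀ v a b → OnlyTwo (λ u → E u v) a b → Y a v ℚ.+ Y b v ≡ 1ℚ
  col-two v a b (ne , h) = trans (sym (sum-two (λ u → Y u v) a b ne (λ i na nb → YE i v (h i na nb)))) (proj₁ (proj₂ (proj₂ PY)) v)

  comm-one : ∀ u v w z → OnlyOne (λ i → adj G u i ∧ E i v) w → OnlyOne (λ i → E u i ∧ adj G i v) z → adj G u w ≡ true → adj G z v ≡ true → Y w v ≡ Y u z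
  comm-one u v w z hw hz uw zv = trans (sym (trans (cong (λ b → ⟦ b ⟧ ℚ.* Y w v) uw) (ℚₚ.*-identityˡ (Y w v))))
    (trans (sym (sum-single (λ i → ⟦ adj G u i ⟧ ℚ.* Y i v) w (λ i ne → left i (hw i ne)))) (trans (proj₁ (proj₂ (proj₂ (proj₂ PY))) u v)
    (trans (sum-single (λ i → Y u i ℚ.* ⟦ adj G i v ⟧) z (λ i ne → right i (hz i ne))) (trans (cong (λ b → Y u z ℚ.* ⟦ b ⟧) zv) (ℚₚ.*-identityʳ (Y u z))))))
    where
    left : ∀ i → adj G u i ∧ E i v ≡ false → ⟦ adj G u i ⟧ ℚ.* Y i v ≡ 0ℚ
    left i h with adj G u i
    ... | false = ℚₚ.*-zeroˡ (Y i v)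
    ... | true = trans (ℚₚ.*-identityˡ (Y i v)) (YE i v h)
    right : ∀ i → E u i ∧ adj G i v ≡ false → Y u i ℚ.* ⟦ adj G i v ⟧ ≡ 0ℚ
    right i h with adj G i v
    ... | false = ℚₚ.*-zeroʳ (Y u i)
    ... | true = trans (ℚₚ.*-identityʳ (Y u i)) (YE u i (trans (sym (𝔹ₚ.∧-identityʳ (E u i))) h))

edgeless : Graph
edgeless = mkGraph 2 (λ _ _ → false) (λ _ → 0) (λ _ _ → refl) (λ _ → refl)

edgeless-amenable : Amenable edgeless
edgeless-amenable H same = let (f , b , k) = same 1 in f , b
  , (λ u v → not-true (λ h → let (_ , g , gb , _) = k u in case proj₂ (inv gb (f v , h)) of λ ()))
  , λ u → sym (proj₁ (k u))

edgeless-not-discrete : ¬ Discrete edgeless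
edgeless-not-discrete d with d zero (suc zero) (λ i → cr-iso {edgeless} {edgeless} {swp zero (suc zero)} (swp-bij zero (suc zero) , (λ _ _ → refl) , (λ _ → refl)) i zero)
... | ()

-- Two triangles with one vertex of each colour, and the 6-cycle with opposite vertices coloured alike.

hue : Fin 6 → ℕ
hue u = div (toℕ u) 2

bit : Fin 6 → ℕ
bit u = mod (toℕ u) 2

triangles hexagon : Graph
triangles = mkGraph 6 A hue (from-yes (all? λ u → all? λ v → A u v 𝔹ₚ.≟ A v u)) (from-yes (all? λ u → A u u 𝔹ₚ.≟ false))
  where
  A : Adj 6
  A u v = not (hue u ≡ᵇ hue v) ∧ (bit u ≡ᵇ bit v)
hexagon = mkGraph 6 A hue (from-yes (all? λ u → all? λ v → A u v 𝔹ₚ.≟ A v u)) (from-yes (all? λ u → A u u 𝔹ₚ.≟ false))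
  where
  A : Adj 6
  A u v = if hue u + hue v ≡ᵇ 1 then not (bit u ≡ᵇ bit v) else (not (hue u ≡ᵇ hue v) ∧ (bit u ≡ᵇ bit v))

-- The hexagon arises by crossing one of the three matchings between colour classes. Refinement sees
-- perfect matchings in both graphs, but only one of them contains a triangle.
triangles-not-amenable : ¬ Amenable triangles
triangles-not-amenable amen = no-triangle (φ 0F) (φ 2F) (φ 4F) (a 0F 2F) (a 2F 4F) (a 0F 4F)
  where
  same : ∀ u v → hue u ≡ hue v → StableSame triangles u hexagon v
  same = matched-stable triangles hexagon {hue} {hue} {3} (from-yes (matchedLabels? triangles hexagon hue hue 3))
  iso = amen hexagon (λ i → id , id-bij , λ u → same u u refl i)
  φ = proj₁ iso
  a = proj₁ (proj₂ (proj₂ iso))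
  no-triangle : ∀ x y z → adj hexagon x y ≡ true → adj hexagon y z ≡ true → adj hexagon x z ≡ true → ⊥
  no-triangle = from-yes (all? λ x → all? λ y → all? λ z → (adj hexagon x y 𝔹ₚ.≟ true) →-dec ((adj hexagon y z 𝔹ₚ.≟ true) →-dec ¬? (adj hexagon x z 𝔹ₚ.≟ true)))

-- The matchings copy the 2 by 2 block of one hue to the others, so the support contains the
-- identity or the simultaneous flip.
triangles-compact : Compact triangles
triangles-compact = compact-of-support triangles λ X P ret → ret (found X P)
  where
  E : Adj 6
  E u v = hue u ≡ᵇ hue v
  flip : Fin 6 → Fin 6
  flip 0F = 1F
  flip 1F = 0F
  flip 2F = 3F
  flip 3F = 2F
  flip 4F = 5F
  flip 5F = 4F
  module _ (X : Matrix 6) (P : InPolytope triangles X) where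
    open Pattern triangles E P (λ u v h → proj₂ (proj₂ (proj₂ (proj₂ P))) u v (λ e → true≢false (subst (λ z → (hue u ≡ᵇ z) ≡ true) e (≡ᵇ-refl (hue u))) h))
    row₀ : X 0F 0F ℚ.+ X 0F 1F ≡ 1ℚ
    row₀ = row-two 0F 0F 1F (from-yes (onlyTwo? (E 0F) 0F 1F))
    col₀ : X 0F 0F ℚ.+ X 1F 0F ≡ 1ℚ
    col₀ = col-two 0F 0F 1F (from-yes (onlyTwo? (λ u → E u 0F) 0F 1F))
    col₁ : X 0F 1F ℚ.+ X 1F 1F ≡ 1ℚ
    col₁ = col-two 1F 0F 1F (from-yes (onlyTwo? (λ u → E u 1F) 0F 1F))
    move : ∀ u v w z → Dec (OnlyOne (λ i → adj triangles u i ∧ E i v) w × OnlyOne (λ i → E u i ∧ adj triangles i v) z × adj triangles u w ≡ true × adj triangles z v ≡ true)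
    move u v w z = onlyOne? _ w ×-dec (onlyOne? _ z ×-dec ((adj triangles u w 𝔹ₚ.≟ true) ×-dec (adj triangles z v 𝔹ₚ.≟ true)))
    moved : ∀ {u v w z} → OnlyOne (λ i → adj triangles u i ∧ E i v) w × OnlyOne (λ i → E u i ∧ adj triangles i v) z × adj triangles u w ≡ true × adj triangles z v ≡ true → X u z ≢ 0ℚ → X w v ≢ 0ℚ
    moved {u} {v} {w} {z} (a , b , c , d) ne e = ne (trans (sym (comm-one u v w z a b c d)) e)
    found : ∃ λ σ → IsAut triangles σ × InSupport X σ
    found with X 0F 0F ℚₚ.≟ 0ℚ
    ... | no ne = id , aut-id triangles , λ
          { 0F → ne ; 1F → ne₁
          ; 2F → moved (from-yes (move 0F 2F 2F 0F)) ne ; 3F → moved (from-yes (move 1F 3F 3F 1F)) ne₁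
          ; 4F → moved (from-yes (move 0F 4F 4F 0F)) ne ; 5F → moved (from-yes (move 1F 5F 5F 1F)) ne₁ }
      where
      ne₁ : X 1F 1F ≢ 0ℚ
      ne₁ e = ne (trans (sym (ℚₚ.+-identityʳ (X 0F 0F))) (ℚ-cancelʳ (X 0F 1F) (trans (cong (ℚ._+ X 0F 1F) (ℚₚ.+-identityʳ (X 0F 0F))) (trans row₀ (trans (sym col₁) (trans (cong (X 0F 1F ℚ.+_) e) (ℚₚ.+-comm (X 0F 1F) 0ℚ)))))))
        where
        ℚ-cancelʳ : ∀ {x y} z → x ℚ.+ z ≡ y ℚ.+ z → x ≡ y
        ℚ-cancelʳ {x} {y} z e = trans (sym (undo x)) (trans (cong (ℚ._- z) e) (undo y))
          where
          undo : ∀ x → (x ℚ.+ z) ℚ.- z ≡ x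
          undo x = trans (ℚₚ.+-assoc x z (ℚ.- z)) (trans (cong (x ℚ.+_) (ℚₚ.+-inverseʳ z)) (ℚₚ.+-identityʳ x))
    ... | yes e = flip , from-yes (isIso? triangles triangles flip) , λ
          { 0F → h₀ ; 1F → h₁
          ; 2F → moved (from-yes (move 0F 3F 2F 1F)) h₀ ; 3F → moved (from-yes (move 1F 2F 3F 0F)) h₁
          ; 4F → moved (from-yes (move 0F 5F 4F 1F)) h₀ ; 5F → moved (from-yes (move 1F 4F 5F 0F)) h₁ }
      where
      h₀ : X 0F 1F ≢ 0ℚ
      h₀ z = 0≢1ℚ (trans (sym (ℚₚ.+-identityˡ 0ℚ)) (trans (sym (cong₂ ℚ._+_ e z)) row₀))
      h₁ : X 1F 0F ≢ 0ℚ
      h₁ z = 0≢1ℚ (trans (sym (ℚₚ.+-identityˡ 0ℚ)) (trans (sym (cong₂ ℚ._+_ e z)) col₀))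

-- Coordinates over the field with two elements. Kinds 0 and 1 consist of points (x , y), kind 2 records y
-- and kind 3 records x + y (kept in the field x).
record Point : Set where
  constructor point
  field
    kind : ℕ
    px py : Bool
open Point

xor : Bool → Bool → Bool
xor a b = if a then not b else b

eqb : Bool → Bool → Bool
eqb a b = not (xor a b)

related : Point → Point → Bool
related (point 0 x y) (point 1 x′ y′) = eqb x x′
related (point 1 x y) (point 0 x′ y′) = eqb x x′
related (point 0 x y) (point 2 x′ y′) = eqb y y′
related (point 2 x y) (point 0 x′ y′) = eqb y y′
related (point 1 x y) (point 2 x′ y′) = eqb y y′
related (point 2 x y) (point 1 x′ y′) = eqb y y′
related (point 0 x y) (point 3 x′ y′) = eqb (xor x y) x′
related (point 3 x y) (point 0 x′ y′) = eqb (xor x′ y′) x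
related _ _ = false

decode : ℕ → Point
decode 0 = point 0 false false
decode 1 = point 0 false true
decode 2 = point 0 true false
decode 3 = point 0 true true
decode 4 = point 1 false false
decode 5 = point 1 false true
decode 6 = point 1 true false
decode 7 = point 1 true true
decode 8 = point 2 false false
decode 9 = point 2 false true
decode 10 = point 3 false false
decode _ = point 3 true false

kindOf : ∀ {N} → Fin N → ℕ
kindOf u = kind (decode (toℕ u))

adjOf : ∀ {N} → Adj N
adjOf u v = related (decode (toℕ u)) (decode (toℕ v))

-- Adds the vector `(e , f)` to all coordinates; on kind 3, which records x + y, this means adding e
-- + f. The numbering is that of `decode`.
translate : Bool → Bool → ℕ → ℕ
translate e f i with decode i
... | point 0 x y = (if xor x e then 2 else 0) + (if xor y f then 1 else 0)
... | point 1 x y = 4 + ((if xor x e then 2 else 0) + (if xor y f then 1 else 0))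
... | point 2 x y = 8 + (if xor y f then 1 else 0)
... | point _ x y = 10 + (if xor x (xor e f) then 1 else 0)

coupled : Graph
coupled = mkGraph 10 adjOf kindOf (from-yes (all? λ (u : Fin 10) → all? λ (v : Fin 10) → adjOf u v 𝔹ₚ.≟ adjOf v u)) (from-yes (all? λ (u : Fin 10) → adjOf u u 𝔹ₚ.≟ false))

coupled⁺ : Graph
coupled⁺ = mkGraph 12 adjOf kindOf (from-yes (all? λ (u : Fin 12) → all? λ (v : Fin 12) → adjOf u v 𝔹ₚ.≟ adjOf v u)) (from-yes (all? λ (u : Fin 12) → adjOf u u 𝔹ₚ.≟ false))

allBool : {P : Bool → Set} → (∀ b → Dec (P b)) → Dec (∀ b → P b)
allBool P? = map′ (λ { (f , t) false → f ; (f , t) true → t }) (λ h → h false , h true) (P? false ×-dec P? true)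

shift₁₀ : Bool → Bool → Fin 10 → Fin 10
shift₁₀ e f u with translate e f (toℕ u) ℕ.<? 10
... | yes l = fromℕ< l
... | no _  = u

shift₁₂ : Bool → Bool → Fin 12 → Fin 12
shift₁₂ e f u with translate e f (toℕ u) ℕ.<? 12
... | yes l = fromℕ< l
... | no _  = u

shift₁₀-aut : ∀ e f → IsAut coupled (shift₁₀ e f)
shift₁₀-aut = from-yes (allBool λ e → allBool λ f → isIso? coupled coupled (shift₁₀ e f))

shift₁₂-aut : ∀ e f → IsAut coupled⁺ (shift₁₂ e f)
shift₁₂-aut = from-yes (allBool λ e → allBool λ f → isIso? coupled⁺ coupled⁺ (shift₁₂ e f))

nextTo : (G : Graph) → (Fin (n G) → Bool) → Fin (n G) → Bool
nextTo G P u = does (any? λ a → (adj G u a 𝔹ₚ.≟ true) ×-dec (P a 𝔹ₚ.≟ true))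

single : ∀ {N} → Fin N → Fin N → Bool
single w a = does (a ≟ w)

indexed? : (m : Maybe ℕ) → Dec (m ≢ nothing)
indexed? nothing  = no (λ h → h refl)
indexed? (just _) = yes (λ ())

unindexed : (m : Maybe ℕ) → ¬ (m ≢ nothing) → m ≡ nothing
unindexed nothing  h = refl
unindexed (just _) h = ⊥-elim (h λ ())

-- Predicates that are constant on stable classes. They are closed under passing to neighbours, so
-- lower bounds on what refinement separates are obtained without running it.
module Visible (G : Graph) (ind : Fin (n G) → Maybe ℕ) (ind-unique : ∀ a b {j} → ind a ≡ just j → ind b ≡ just j → a ≡ b)
  {i : ℕ} (L : StableLevel i (recolour G ind) (recolour G ind)) where

  private
    Gs : Graph
    Gs = recolour G ind

  Same : Fin (n G) → Fin (n G) → Set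
  Same a b = StableSame Gs a Gs b

  same-sym : ∀ a b → Same a b → Same b a
  same-sym a b = stable-sym {Gs} {a} {Gs} {b}

  Vis : (Fin (n G) → Bool) → Set
  Vis P = ∀ a b → Same a b → P a ≡ P b

  same-index : ∀ a b → Same a b → ind a ≡ ind b
  same-index a b h = encode-index (ind a) (ind b) (col G a) (col G b) (h 0)

  same-col : ∀ a b → Same a b → col G a ≡ col G b
  same-col a b h = go (ind a) refl
    where
    go : ∀ k → ind a ≡ k → col G a ≡ col G b
    go (just j) e = cong (col G) (ind-unique a b e (trans (sym (same-index a b h)) e))
    go nothing e = encode-colour (col G a) (col G b) (subst₂ (λ k l → encode k (col G a) ≡ encode l (col G b)) e (trans (sym (same-index a b h)) e) (h 0))

  vis-col : ∀ k → Vis (λ a → col G a ≡ᵇ k)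
  vis-col k a b h = cong (_≡ᵇ k) (same-col a b h)

  vis-not-col : ∀ k → Vis (λ a → not (col G a ≡ᵇ k))
  vis-not-col k a b h = cong (λ c → not (c ≡ᵇ k)) (same-col a b h)

  vis-single : ∀ w → ind w ≢ nothing → Vis (single w)
  vis-single w iw a b h = does-cong (a ≟ w) (b ≟ w) (λ e → trans (sym (back a b h e)) e) (λ e → trans (sym (back b a (same-sym a b h) e)) e)
    where
    back : ∀ a b → Same a b → a ≡ w → a ≡ b
    back a b h e = go (ind w) refl
      where
      go : ∀ k → ind w ≡ k → a ≡ b
      go (just j) q = ind-unique a b (trans (cong ind e) q) (trans (sym (same-index a b h)) (trans (cong ind e) q))
      go nothing q = ⊥-elim (iw q)

  vis-nextTo : ∀ P → Vis P → Vis (nextTo G P)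
  vis-nextTo P v a b h = does-cong (any? λ c → (adj G a c 𝔹ₚ.≟ true) ×-dec (P c 𝔹ₚ.≟ true)) (any? λ c → (adj G b c 𝔹ₚ.≟ true) ×-dec (P c 𝔹ₚ.≟ true))
      (go a b h) (go b a (same-sym a b h))
    where
    go : ∀ a b → Same a b → (∃ λ c → adj G a c ≡ true × P c ≡ true) → ∃ λ c → adj G b c ≡ true × P c ≡ true
    go a b h (c , e , p) = let (f , _ , k) = stable-nbrs {Gs} {Gs} L h ; (c′ , e′) = f (c , e) in c′ , e′ , trans (sym (v c c′ (k (c , e)))) p

  vis-∧ : ∀ P Q → Vis P → Vis Q → Vis (λ a → P a ∧ Q a)
  vis-∧ P Q v w a b h = cong₂ _∧_ (v a b h) (w a b h)

nextTo-single : (w : Fin 10) → Fin 10 → Bool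
nextTo-single w = nextTo coupled (single w)

-- From one point the refinement recovers y through kind 2 and x through the other kind of points.
near-y near-x : Fin 10 → Fin 10 → Bool
near-y w = nextTo coupled (λ a → nextTo-single w a ∧ (col coupled a ≡ᵇ 2))
near-x w = nextTo coupled (λ a → nextTo-single w a ∧ not (col coupled a ≡ᵇ 2))

near-separates : ∀ w → col coupled w < 2 → ∀ a b → col coupled a ≡ col coupled b → nextTo-single w a ≡ nextTo-single w b → near-y w a ≡ near-y w b → near-x w a ≡ near-x w b → a ≡ b
near-separates = from-yes (all? λ w → (col coupled w ℕ.<? 2) →-dec all? λ a → all? λ b → (col coupled a ℕ.≟ col coupled b) →-dec
  ((nextTo-single w a 𝔹ₚ.≟ nextTo-single w b) →-dec ((near-y w a 𝔹ₚ.≟ near-y w b) →-dec ((near-x w a 𝔹ₚ.≟ near-x w b) →-dec (a ≟ b)))))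

-- A vertex of kind 2 reveals y only; what remains undetermined is a translation in the direction of
-- x.
y-separates : ∀ w → col coupled w ≡ 2 → ∀ a b → col coupled a ≡ col coupled b → single w a ≡ single w b → nextTo-single w a ≡ nextTo-single w b → ∃ λ (e : Fin 2) → shift₁₀ (toℕ e ≡ᵇ 1) false a ≡ b
y-separates = from-yes (all? λ w → (col coupled w ℕ.≟ 2) →-dec all? λ a → all? λ b → (col coupled a ℕ.≟ col coupled b) →-dec
  ((single w a 𝔹ₚ.≟ single w b) →-dec ((nextTo-single w a 𝔹ₚ.≟ nextTo-single w b) →-dec any? λ (e : Fin 2) → shift₁₀ (toℕ e ≡ᵇ 1) false a ≟ b)))

shift₁₀-transitive : ∀ a b → col coupled a ≡ col coupled b → ∃ λ (e : Fin 2) → ∃ λ (f : Fin 2) → shift₁₀ (toℕ e ≡ᵇ 1) (toℕ f ≡ᵇ 1) a ≡ b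
shift₁₀-transitive = from-yes (all? λ a → all? λ b → (col coupled a ℕ.≟ col coupled b) →-dec any? λ (e : Fin 2) → any? λ (f : Fin 2) → shift₁₀ (toℕ e ≡ᵇ 1) (toℕ f ≡ᵇ 1) a ≟ b)

coupled-kinds : ∀ a → col coupled a < 2 ⊎ col coupled a ≡ 2
coupled-kinds = from-yes (all? λ a → (col coupled a ℕ.<? 2) ⊎-dec (col coupled a ℕ.≟ 2))

x-shift : ∀ e a → col coupled (shift₁₀ e false a) < 2 × col coupled a < 2 ⊎ shift₁₀ e false a ≡ a
x-shift = from-yes (allBool λ e → all? λ a → ((col coupled (shift₁₀ e false a) ℕ.<? 2) ×-dec (col coupled a ℕ.<? 2)) ⊎-dec (shift₁₀ e false a ≟ a))

module _ (ind : Fin 10 → Maybe ℕ) (ind-unique : ∀ a b {j} → ind a ≡ just j → ind b ≡ just j → a ≡ b)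
  {i : ℕ} (L : StableLevel i (recolour coupled ind) (recolour coupled ind)) (u u′ : Fin 10) where
  open Visible coupled ind ind-unique L

  private
    Moved : Set
    Moved = ∃ λ σ → IsAut (recolour coupled ind) σ × σ u ≡ u′

    moved-by : ∀ e f → (∀ x → ind (shift₁₀ e f x) ≡ ind x) → shift₁₀ e f u ≡ u′ → Moved
    moved-by e f h q = let (b , a , c) = shift₁₀-aut e f in shift₁₀ e f , (b , a , λ x → cong₂ encode (h x) (c x)) , q

    from-point : ∀ w → col coupled w < 2 → ind w ≢ nothing → Same u u′ → Moved
    from-point w k iw st = id , aut-id (recolour coupled ind) , near-separates w k u u′ (same-col u u′ st) (near u u′ st)
        (vis-nextTo (λ a → nextTo-single w a ∧ (col coupled a ≡ᵇ 2)) (vis-∧ (nextTo-single w) (λ a → col coupled a ≡ᵇ 2) near (vis-col 2)) u u′ st)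
        (vis-nextTo (λ a → nextTo-single w a ∧ not (col coupled a ≡ᵇ 2)) (vis-∧ (nextTo-single w) (λ a → not (col coupled a ≡ᵇ 2)) near (vis-not-col 2)) u u′ st)
      where
      near : Vis (nextTo-single w)
      near = vis-nextTo (single w) (vis-single w iw)

    from-y : ¬ (∃ λ w → col coupled w < 2 × ind w ≢ nothing) → ∀ w → col coupled w ≡ 2 → ind w ≢ nothing → Same u u′ → Moved
    from-y none w k iw st =
      let (e , q) = y-separates w k u u′ (same-col u u′ st) (vis-single w iw u u′ st) (vis-nextTo (single w) (vis-single w iw) u u′ st)
      in moved-by (toℕ e ≡ᵇ 1) false (λ x → fixed (toℕ e ≡ᵇ 1) x (x-shift (toℕ e ≡ᵇ 1) x)) q
      where
      fixed : ∀ e x → col coupled (shift₁₀ e false x) < 2 × col coupled x < 2 ⊎ shift₁₀ e false x ≡ x → ind (shift₁₀ e false x) ≡ ind x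
      fixed e x (inj₂ q) = cong ind q
      fixed e x (inj₁ (k , k′)) = trans (unindexed (ind (shift₁₀ e false x)) (λ h → none (shift₁₀ e false x , k , h))) (sym (unindexed (ind x) (λ h → none (x , k′ , h))))

    from-any : ¬ (∃ λ w → col coupled w < 2 × ind w ≢ nothing) → ∀ w → col coupled w < 2 ⊎ col coupled w ≡ 2 → ind w ≢ nothing → Same u u′ → Moved
    from-any none w (inj₁ k) iw st = ⊥-elim (none (w , k , iw))
    from-any none w (inj₂ k) iw st = from-y none w k iw st

    from-none : ¬ (∃ λ w → ind w ≢ nothing) → Same u u′ → Moved
    from-none none st =
      let (e , f , q) = shift₁₀-transitive u u′ (same-col u u′ st)
      in moved-by (toℕ e ≡ᵇ 1) (toℕ f ≡ᵇ 1) (λ x → trans (free (shift₁₀ (toℕ e ≡ᵇ 1) (toℕ f ≡ᵇ 1) x)) (sym (free x))) q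
      where
      free : ∀ x → ind x ≡ nothing
      free x = unindexed (ind x) (λ h → none (x , h))

    by-index : Dec (∃ λ w → col coupled w < 2 × ind w ≢ nothing) → Dec (∃ λ w → ind w ≢ nothing) → Same u u′ → Moved
    by-index (yes (w , k , iw)) _               st = from-point w k iw st
    by-index (no none)          (yes (w , iw))  st = from-any none w (coupled-kinds w) iw st
    by-index (no _)             (no none)       st = from-none none st

  -- An individualised vertex of kind 0 or 1 determines both coordinates, so stable classes are
  -- singletons. If only vertices of kind 2 are individualised, translations in x are still
  -- available, and with no individualised vertex all translations are.
  coupled-moved : Same u u′ → Moved
  coupled-moved = by-index (any? λ w → (col coupled w ℕ.<? 2) ×-dec indexed? (ind w)) (any? λ w → indexed? (ind w))

coupled-homogeneous : Homogeneous coupled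
coupled-homogeneous H s u u′ st ret = stable-level (leftG coupled H s) (leftG coupled H s) λ (i , L) →
  ret (coupled-moved (indexL {coupled} {H} s) (indexL-unique {coupled} {H} s) L u u′ st)

coupled-tinhofer : Tinhofer coupled
coupled-tinhofer = homogeneous⇒tinhofer coupled coupled-homogeneous

-- Splitting the points of kind 0 by x + y is equitable, but it rules out changing y alone on kind 1.
coupled-not-godsil : ¬ Godsil coupled
coupled-not-godsil god =
  let (Γ , (auts , _) , orbits) = god q (matched-equitable coupled {q} {4} (from-yes (matchedLabels? coupled coupled q q 4)))
      (σ , σ∈Γ , e) = proj₁ (orbits 4F 5F) refl
      (_ , a , c) = auts σ σ∈Γ
  in impossible (σ 0F) (σ 8F) (subst (λ z → adj coupled (σ 0F) z ≡ true) e (a 0F 4F)) (subst (λ z → adj coupled (σ 8F) z ≡ true) e (a 8F 4F))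
       (a 0F 8F) (c 8F) (sym (proj₂ (orbits 0F (σ 0F)) (σ , σ∈Γ , refl)))
  where
  q : Fin 10 → ℕ
  q u with decode (toℕ u)
  ... | point 0 x y = if xor x y then 3 else 0
  ... | point k x y = k
  five : Fin 10
  five = 5F
  impossible : ∀ (z w : Fin 10) → adjOf z five ≡ true → adjOf w five ≡ true → adjOf z w ≡ true → kindOf w ≡ 2 → q z ≡ 0 → ⊥
  impossible = from-yes (all? λ z → all? λ w → (adjOf z five 𝔹ₚ.≟ true) →-dec ((adjOf w five 𝔹ₚ.≟ true) →-dec ((adjOf z w 𝔹ₚ.≟ true) →-dec ((kindOf w ℕ.≟ 2) →-dec ¬? (q z ℕ.≟ 0)))))

coupled⁺-refinable : Refinable coupled⁺
coupled⁺-refinable u v = (λ h → let (e , f , q) = transitive u v (h 0) in shift₁₂ (toℕ e ≡ᵇ 1) (toℕ f ≡ᵇ 1) , shift₁₂-aut (toℕ e ≡ᵇ 1) (toℕ f ≡ᵇ 1) , q)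
  , λ { (σ , I , refl) i → cr-iso I i u }
  where
  transitive : ∀ (a b : Fin 12) → kindOf a ≡ kindOf b → ∃ λ (e : Fin 2) → ∃ λ (f : Fin 2) → shift₁₂ (toℕ e ≡ᵇ 1) (toℕ f ≡ᵇ 1) a ≡ b
  transitive = from-yes (all? λ (a : Fin 12) → all? λ (b : Fin 12) → (kindOf a ℕ.≟ kindOf b) →-dec any? λ (e : Fin 2) → any? λ (f : Fin 2) → shift₁₂ (toℕ e ≡ᵇ 1) (toℕ f ≡ᵇ 1) a ≟ b)

-- After individualising a vertex of kind 3, refinement splits kind 0 by x + y but leaves kind 1 whole.
coupled⁺-not-tinhofer : ¬ Tinhofer coupled⁺
coupled⁺-not-tinhofer tin = tinhofer-extends G tin second λ (f , (_ , a , c) , st) →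
    let fixed : f d ≡ d
        fixed = at-0 (f d) (sym (encode-index (indexL {G} {G} s₂ d) (indexR {G} {G} s₂ (f d)) (kindOf d) (kindOf (f d)) (st d 0)))
        moved : f 4F ≡ 5F
        moved = at-1 (f 4F) (sym (encode-index (indexL {G} {G} s₂ 4F) (indexR {G} {G} s₂ (f 4F)) 1 (kindOf (f 4F)) (st 4F 0)))
    in impossible (f 0F) (f 8F) (subst (λ z → adj G (f 0F) z ≡ true) moved (a 0F 4F)) (subst (λ z → adj G (f 8F) z ≡ true) moved (a 8F 4F))
         (a 0F 8F) (c 8F) (c 0F) (subst (λ z → adj G (f 0F) z ≡ true) fixed (a 0F d))
  where
  G = coupled⁺
  d d′ : Fin 12
  d = fromℕ< {10} (s≤s (s≤s (s≤s (s≤s (s≤s (s≤s (s≤s (s≤s (s≤s (s≤s (s≤s z≤n)))))))))))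
  d′ = fromℕ< {11} (s≤s (s≤s (s≤s (s≤s (s≤s (s≤s (s≤s (s≤s (s≤s (s≤s (s≤s (s≤s z≤n))))))))))))
  s₁ s₂ : Pairs G G
  s₁ = (d , d) ∷ []
  s₂ = (4F , 5F) ∷ s₁
  first-choice : Chosen G s₁
  first-choice = choose-first G (stable-refl G d) (λ ()) swap (λ ()) swap
    where
    swap : StableSame G d G d′
    swap i = cr-iso (shift₁₂-aut true false) i d
  -- An equitable labelling after `d` has been individualised with itself; `4F` and `5F` still share
  -- a label, so they may be chosen next.
  q : Fin 12 → ℕ
  q u with decode (toℕ u)
  ... | point 0 x y = if xor x y then 4 else 0
  ... | point 3 x y = if x then 5 else 3
  ... | point k x y = k
  split : ∀ u v → q u ≡ q v → StableSame (leftG G G s₁) u (rightG G G s₁) v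
  split = matched-stable (leftG G G s₁) (rightG G G s₁) {q} {q} {6} (from-yes (matchedLabels? (leftG G G s₁) (rightG G G s₁) q q 6))
  splitL : ∀ u v → q u ≡ q v → StableSame (leftG G G s₁) u (leftG G G s₁) v
  splitL = matched-stable (leftG G G s₁) (leftG G G s₁) {q} {q} {6} (from-yes (matchedLabels? (leftG G G s₁) (leftG G G s₁) q q 6))
  splitR : ∀ u v → q u ≡ q v → StableSame (rightG G G s₁) u (rightG G G s₁) v
  splitR = matched-stable (rightG G G s₁) (rightG G G s₁) {q} {q} {6} (from-yes (matchedLabels? (rightG G G s₁) (rightG G G s₁) q q 6))
  second : Chosen G s₂
  second = choose first-choice (λ i → id , id-bij , λ x → split x x refl i) (split 4F 5F refl)
    (5F , (λ ()) , splitL 4F 5F refl) (4F , (λ ()) , splitR 5F 4F refl)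
  at-0 : ∀ y → indexR {G} {G} s₂ y ≡ just 0 → y ≡ d
  at-0 = from-yes (all? λ y → ≡-dec ℕ._≟_ (indexR {G} {G} s₂ y) (just 0) →-dec (y ≟ d))
  at-1 : ∀ y → indexR {G} {G} s₂ y ≡ just 1 → y ≡ 5F
  at-1 = from-yes (all? λ y → ≡-dec ℕ._≟_ (indexR {G} {G} s₂ y) (just 1) →-dec (y ≟ 5F))
  five : Fin 12
  five = 5F
  impossible : ∀ (z w : Fin 12) → adjOf z five ≡ true → adjOf w five ≡ true → adjOf z w ≡ true → kindOf w ≡ 2 → kindOf z ≡ 0 → adjOf z d ≡ true → ⊥
  impossible = from-yes (all? λ z → all? λ w → (adjOf z five 𝔹ₚ.≟ true) →-dec ((adjOf w five 𝔹ₚ.≟ true) →-dec ((adjOf z w 𝔹ₚ.≟ true) →-dec ((kindOf w ℕ.≟ 2) →-dec ((kindOf z ℕ.≟ 0) →-dec ¬? (adjOf z d 𝔹ₚ.≟ true))))))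

-- The 8-cycle through points of kinds 0 and 1 alternately, with two further vertices recording the parity
-- of the position; its automorphism group is cyclic of order four.

kind₁₀ : Fin 10 → ℕ
kind₁₀ u = div (toℕ u) 4

octagonAdj : Adj 10
octagonAdj u v = edge (div (toℕ u) 4) (div (toℕ v) 4)
  where
  i = mod (toℕ u) 4
  j = mod (toℕ v) 4
  edge : ℕ → ℕ → Bool
  edge 0 1 = (i ≡ᵇ j) ∨ (mod (suc j) 4 ≡ᵇ i)
  edge 1 0 = (j ≡ᵇ i) ∨ (mod (suc i) 4 ≡ᵇ j)
  edge 0 2 = mod i 2 ≡ᵇ j
  edge 1 2 = mod i 2 ≡ᵇ j
  edge 2 0 = mod j 2 ≡ᵇ i
  edge 2 1 = mod j 2 ≡ᵇ i
  edge _ _ = false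

octagon : Graph
octagon = mkGraph 10 octagonAdj kind₁₀ (from-yes (all? λ u → all? λ v → octagonAdj u v 𝔹ₚ.≟ octagonAdj v u)) (from-yes (all? λ u → octagonAdj u u 𝔹ₚ.≟ false))

rotate₁ : Fin 10 → Fin 10
rotate₁ 0F = 1F
rotate₁ 1F = 2F
rotate₁ 2F = 3F
rotate₁ 3F = 0F
rotate₁ 4F = 5F
rotate₁ 5F = 6F
rotate₁ 6F = 7F
rotate₁ 7F = 4F
rotate₁ 8F = 9F
rotate₁ 9F = 8F

rotations : ∀ k → IsAut octagon (iter rotate₁ k)
rotations zero = aut-id octagon
rotations (suc k) = iso-trans {octagon} {octagon} {octagon} (rotations k) (from-yes (isIso? octagon octagon rotate₁))

allB : ∀ {N} → (Fin N → Bool) → Bool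
allB {zero}  P = true
allB {suc N} P = P zero ∧ allB (P ∘ suc)

allB-elim : ∀ {N} {P : Fin N → Bool} → allB P ≡ true → ∀ i → P i ≡ true
allB-elim h zero = proj₁ (∧-true h)
allB-elim {P = P} h (suc i) = allB-elim (proj₂ (∧-true {P zero} h)) i

allB-intro : ∀ {N} {P : Fin N → Bool} → (∀ i → P i ≡ true) → allB P ≡ true
allB-intro {zero}  h = refl
allB-intro {suc N} h = ∧-intro (h zero) (allB-intro (h ∘ suc))

-- The search is Boolean so that it can be evaluated, and it cuts a branch as soon as a value is not
-- allowed by `cand`.
allMaps : ∀ {N k} → (Fin N → Fin k → Bool) → ((Fin N → Fin k) → Bool) → Bool
allMaps {zero}  cand P = P (λ ())
allMaps {suc N} cand P = allB (λ c → if cand zero c then allMaps (cand ∘ suc) (λ g → P (consF c g)) else true)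

allMaps-elim : ∀ {N k} (cand : Fin N → Fin k → Bool) {P : (Fin N → Fin k) → Bool} → (∀ {f g} → (∀ x → f x ≡ g x) → P f ≡ P g) →
  allMaps cand P ≡ true → ∀ f → (∀ x → cand x (f x) ≡ true) → P f ≡ true
allMaps-elim {zero} cand resp′ h f c = trans (resp′ (λ ())) h
allMaps-elim {suc N} cand {P} resp′ h f c = trans (resp′ (λ { zero → refl ; (suc x) → refl }))
  (allMaps-elim (cand ∘ suc) {λ g → P (consF (f zero) g)} (λ e → resp′ (λ { zero → refl ; (suc x) → e x })) (choose-branch (allB-elim h (f zero))) (f ∘ suc) (c ∘ suc))
  where
  choose-branch : (if cand zero (f zero) then allMaps (cand ∘ suc) (λ g → P (consF (f zero) g)) else true) ≡ true →
    allMaps (cand ∘ suc) (λ g → P (consF (f zero) g)) ≡ true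
  choose-branch b rewrite c zero = b

implies : Bool → Bool → Bool
implies a b = if a then b else true

implies-elim : ∀ {a b} → implies a b ≡ true → a ≡ true → b ≡ true
implies-elim {true} h _ = h

implies-intro : ∀ {a b} → (a ≡ true → b ≡ true) → implies a b ≡ true
implies-intro {true}  h = h refl
implies-intro {false} h = refl

same : ∀ {N} → Fin N → Fin N → Bool
same u v = toℕ u ≡ᵇ toℕ v

same-elim : ∀ {N} {u v : Fin N} → same u v ≡ true → u ≡ v
same-elim {u = u} {v} h = Fₚ.toℕ-injective (≡ᵇ-true (toℕ u) (toℕ v) h)

same-refl : ∀ {N} {u v : Fin N} → u ≡ v → same u v ≡ true
same-refl {u = u} refl = ≡ᵇ-refl (toℕ u)

allB-cong : ∀ {N} {P Q : Fin N → Bool} → (∀ i → P i ≡ Q i) → allB P ≡ allB Q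
allB-cong {zero}  h = refl
allB-cong {suc N} h = cong₂ _∧_ (h zero) (allB-cong (h ∘ suc))

allB-witness : ∀ {N} (P : Fin N → Bool) → not (allB (λ k → not (P k))) ≡ true → ∃ λ k → P k ≡ true
allB-witness P h with any? (λ k → P k 𝔹ₚ.≟ true)
... | yes r = r
... | no none = ⊥-elim (true≢false (allB-intro {P = λ k → not (P k)} (λ k → cong not (not-true (λ e → none (k , e))))) (not-false h))

-- Partitions are encoded by maps ρ sending each vertex to a representative of its cell.
module PartitionTest {N : ℕ} (A : Adj N) (rot : Fin N → Fin N) where

  countIn : (Fin N → Fin N) → Fin N → Fin N → ℕ
  countIn ρ u y = countFin N (λ a → A u a ∧ same (ρ a) y)

  balanced rotatable : (Fin N → Fin N) → Bool
  balanced ρ = allB λ u → allB λ v → implies ((toℕ u ℕ.<ᵇ toℕ v) ∧ same (ρ u) (ρ v)) (allB λ y → countIn ρ u y ≡ᵇ countIn ρ v y)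
  rotatable ρ = allB λ u → allB λ v → implies (same (ρ u) (ρ v))
    (not (allB λ (k : Fin 4) → not (same (iter rot (toℕ k) u) v ∧ allB λ x → same (ρ (iter rot (toℕ k) x)) (ρ x))))

  test-cong : ∀ {ρ τ : Fin N → Fin N} → (∀ x → ρ x ≡ τ x) → implies (balanced ρ) (rotatable ρ) ≡ implies (balanced τ) (rotatable τ)
  test-cong {ρ} {τ} h = cong₂ implies
    (allB-cong λ u → allB-cong λ v → cong₂ (λ a b → implies ((toℕ u ℕ.<ᵇ toℕ v) ∧ a) b) (cong₂ same (h u) (h v))
      (allB-cong λ y → cong₂ _≡ᵇ_ (count-cong λ a → cong (λ w → A u a ∧ same w y) (h a)) (count-cong λ a → cong (λ w → A v a ∧ same w y) (h a))))
    (allB-cong λ u → allB-cong λ v → cong₂ (λ a b → implies a (not b)) (cong₂ same (h u) (h v))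
      (allB-cong λ (k : Fin 4) → cong (λ b → not (same (iter rot (toℕ k) u) v ∧ b)) (allB-cong λ x → cong₂ same (h (iter rot (toℕ k) x)) (h x))))

  balanced-intro : ∀ ρ → (∀ u v → ρ u ≡ ρ v → ∀ y → countIn ρ u y ≡ countIn ρ v y) → balanced ρ ≡ true
  balanced-intro ρ h = allB-intro λ u → allB-intro λ v → implies-intro λ t → allB-intro λ y →
    subst (λ z → (countIn ρ u y ≡ᵇ z) ≡ true) (h u v (same-elim (proj₂ (∧-true {toℕ u ℕ.<ᵇ toℕ v} t))) y) (≡ᵇ-refl (countIn ρ u y))

  rotatable-elim : ∀ ρ → rotatable ρ ≡ true → ∀ u v → ρ u ≡ ρ v → ∃ λ k → iter rot k u ≡ v × (∀ x → ρ (iter rot k x) ≡ ρ x)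
  rotatable-elim ρ h u v e =
    let (k , t) = allB-witness (λ (k : Fin 4) → same (iter rot (toℕ k) u) v ∧ allB λ x → same (ρ (iter rot (toℕ k) x)) (ρ x))
                    (implies-elim (allB-elim (allB-elim h u) v) (same-refl e))
        (t₁ , t₂) = ∧-true {same (iter rot (toℕ k) u) v} t
    in toℕ k , same-elim t₁ , λ x → same-elim (allB-elim t₂ x)

  tested : (cand : Fin N → Fin N → Bool) → allMaps cand (λ ρ → implies (balanced ρ) (rotatable ρ)) ≡ true →
    ∀ ρ → (∀ x → cand x (ρ x) ≡ true) → balanced ρ ≡ true → rotatable ρ ≡ true
  tested cand h ρ c = implies-elim (allMaps-elim cand {λ ρ → implies (balanced ρ) (rotatable ρ)} test-cong h ρ c)

open PartitionTest octagonAdj rotate₁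

-- The least member of a monochromatic cell is at most the given vertex and of the same kind, which
-- leaves 24 · 24 · 2 = 1152 maps to be tested.
candidate : Fin 10 → Fin 10 → Bool
candidate u w = (toℕ w ℕ.≤ᵇ toℕ u) ∧ (kind₁₀ w ≡ᵇ kind₁₀ u)

first-≤ : ∀ {N} (P : Fin N → Bool) d → toℕ (first P d) ≤ toℕ d
first-≤ P zero = z≤n
first-≤ P (suc d) with P zero
... | true  = z≤n
... | false = s≤s (first-≤ (P ∘ suc) d)

octagon-godsil : Godsil octagon
octagon-godsil q (mono , equit) = orbit-partition octagon q λ u v e →
  let (k , e₁ , e₂) = rotatable-elim ρ rotatable-ρ u v (ρ-cong e)
  in iter rotate₁ k , (rotations k , λ x → trans (sym (ρ-q (iter rotate₁ k x))) (trans (cong q (e₂ x)) (ρ-q x))) , e₁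
  where
  ρ : Fin 10 → Fin 10
  ρ u = first (λ v → q u ≡ᵇ q v) u
  ρ-q : ∀ u → q (ρ u) ≡ q u
  ρ-q u = sym (≡ᵇ-true (q u) (q (ρ u)) (first-true (λ v → q u ≡ᵇ q v) u (≡ᵇ-refl (q u))))
  ρ-cong : ∀ {u v} → q u ≡ q v → ρ u ≡ ρ v
  ρ-cong {u} {v} e = first-unique (λ a → q u ≡ᵇ q a) (λ a → q v ≡ᵇ q a) u v (λ a → cong (_≡ᵇ q a) e) (≡ᵇ-refl (q u)) (≡ᵇ-refl (q v))
  counts : ∀ u y → ρ y ≡ y → countIn ρ u y ≡ nbrsIn octagon q u (q y)
  counts u y e = count-cong λ a → cong (octagonAdj u a ∧_) (bool-ext
    (λ h → subst (λ z → (q a ≡ᵇ z) ≡ true) (trans (sym (ρ-q a)) (cong q (same-elim h))) (≡ᵇ-refl (q a)))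
    (λ h → same-refl (trans (ρ-cong (≡ᵇ-true (q a) (q y) h)) e)))
  none : ∀ u y → ρ y ≢ y → countIn ρ u y ≡ 0
  none u y ne = count-false λ a → ∧-falseʳ (octagonAdj u a) (not-true λ h → let e = same-elim {u = ρ a} {y} h in
    ne (trans (cong ρ (sym e)) (trans (ρ-cong (ρ-q a)) e)))
  balanced-ρ : balanced ρ ≡ true
  balanced-ρ = balanced-intro ρ λ u v h y → case ρ y ≟ y of λ
    { (yes r) → trans (counts u y r) (trans (equit u v (trans (sym (ρ-q u)) (trans (cong q h) (ρ-q v))) (q y)) (sym (counts v y r)))
    ; (no nr) → trans (none u y nr) (sym (none v y nr)) }
  rotatable-ρ : rotatable ρ ≡ true
  -- `refl` carries out the exhaustive test.
  rotatable-ρ = tested candidate refl ρ (λ u →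
    ∧-intro (dec-true (toℕ (ρ u) ℕ.≤? toℕ u) (first-≤ (λ v → q u ≡ᵇ q v) u))
            (subst (λ z → (z ≡ᵇ kind₁₀ u) ≡ true) (sym (mono (ρ u) u (ρ-q u))) (≡ᵇ-refl (kind₁₀ u)))) balanced-ρ

-- Two reflections of the 8-cycle, recombined: each of the two maps uses one reflection on kind 0
-- and the other on kind 1. Their average agrees on the cycle with the average of the reflections,
-- so it commutes with the cycle. Each map is also consistent on the parity vertices: `to₁`
-- preserves parity, `to₂` reverses it.
to₁ to₂ : Fin 10 → Fin 10
to₁ 0F = 0F
to₁ 1F = 3F
to₁ 2F = 2F
to₁ 3F = 1F
to₁ 4F = 6F
to₁ 5F = 5F
to₁ 6F = 4F
to₁ 7F = 7F
to₁ 8F = 8F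
to₁ 9F = 9F
to₂ 0F = 3F
to₂ 1F = 2F
to₂ 2F = 1F
to₂ 3F = 0F
to₂ 4F = 7F
to₂ 5F = 6F
to₂ 6F = 5F
to₂ 7F = 4F
to₂ 8F = 9F
to₂ 9F = 8F

halves : Adj 10
halves u v = same v (to₁ u) ∨ same v (to₂ u)

halfMatrix : Matrix 10
halfMatrix u v = ⟦ halves u v ⟧ ℚ.* ℚ.½

½-nonneg : 0ℚ ℚ.≤ ℚ.½
½-nonneg = ℚₚ.nonNegative⁻¹ ℚ.½

half-sum : ∀ (P : Fin 10 → Bool) → sumℚ 10 (λ i → ⟦ P i ⟧ ℚ.* ℚ.½) ≡ ι (countFin 10 P) ℚ.* ℚ.½
half-sum P = trans (sum-*ʳ ℚ.½ (λ i → ⟦ P i ⟧)) (cong (ℚ._* ℚ.½) (sum-count 10 P))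

halfMatrix-poly : InPolytope octagon halfMatrix
halfMatrix-poly = (λ u v → *-nonneg (⟦⟧-nonneg (halves u v)) ½-nonneg)
  , (λ u → trans (half-sum (halves u)) (cong (λ k → ι k ℚ.* ℚ.½) (from-yes (all? λ u → countFin 10 (halves u) ℕ.≟ 2) u)))
  , (λ v → trans (half-sum (λ u → halves u v)) (cong (λ k → ι k ℚ.* ℚ.½) (from-yes (all? λ v → countFin 10 (λ u → halves u v) ℕ.≟ 2) v)))
  , balance
  , λ u v ne → trans (cong (λ b → ⟦ b ⟧ ℚ.* ℚ.½) (not-true (λ h → ne (monochromatic u v h)))) (ℚₚ.*-zeroˡ ℚ.½)
  where
  commutes : ∀ u v → countFin 10 (λ w → octagonAdj u w ∧ halves w v) ≡ countFin 10 (λ w → halves u w ∧ octagonAdj w v)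
  commutes = from-yes (all? λ u → all? λ v → countFin 10 (λ w → octagonAdj u w ∧ halves w v) ℕ.≟ countFin 10 (λ w → halves u w ∧ octagonAdj w v))
  left : ∀ u v w → ⟦ octagonAdj u w ⟧ ℚ.* halfMatrix w v ≡ ⟦ octagonAdj u w ∧ halves w v ⟧ ℚ.* ℚ.½
  left u v w = trans (sym (ℚₚ.*-assoc ⟦ octagonAdj u w ⟧ ⟦ halves w v ⟧ ℚ.½)) (cong (ℚ._* ℚ.½) (sym (⟦⟧-∧ (octagonAdj u w) (halves w v))))
  right : ∀ u v w → ⟦ halves u w ∧ octagonAdj w v ⟧ ℚ.* ℚ.½ ≡ halfMatrix u w ℚ.* ⟦ octagonAdj w v ⟧
  right u v w = trans (cong (ℚ._* ℚ.½) (⟦⟧-∧ (halves u w) (octagonAdj w v))) (trans (ℚₚ.*-assoc ⟦ halves u w ⟧ ⟦ octagonAdj w v ⟧ ℚ.½)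
    (trans (cong (⟦ halves u w ⟧ ℚ.*_) (ℚₚ.*-comm ⟦ octagonAdj w v ⟧ ℚ.½)) (sym (ℚₚ.*-assoc ⟦ halves u w ⟧ ℚ.½ ⟦ octagonAdj w v ⟧))))
  balance : ∀ u v → sumℚ 10 (λ w → ⟦ octagonAdj u w ⟧ ℚ.* halfMatrix w v) ≡ sumℚ 10 (λ w → halfMatrix u w ℚ.* ⟦ octagonAdj w v ⟧)
  balance u v = trans (sum-cong (left u v)) (trans (half-sum (λ w → octagonAdj u w ∧ halves w v)) (trans (cong (λ k → ι k ℚ.* ℚ.½) (commutes u v))
    (trans (sym (half-sum (λ w → halves u w ∧ octagonAdj w v))) (sum-cong (right u v)))))
  monochromatic : ∀ u v → halves u v ≡ true → kind₁₀ u ≡ kind₁₀ v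
  monochromatic = from-yes (all? λ u → all? λ v → (halves u v 𝔹ₚ.≟ true) →-dec (kind₁₀ u ℕ.≟ kind₁₀ v))

-- A matrix of the polytope supported in `halves` is determined by its equations. Hence `halfMatrix`
-- is extreme, as both ends of any segment through it have their supports in `halves`.
module HalfUnique {Y : Matrix 10} (PY : InPolytope octagon Y) (YE : ∀ u v → halves u v ≡ false → Y u v ≡ 0ℚ) where
  open Pattern octagon halves PY YE

  other : ∀ {x y} → x ℚ.+ y ≡ 1ℚ → x ≡ ℚ.½ → y ≡ ℚ.½
  other {x} {y} e refl = trans (sym (undo y)) (cong (ℚ._- ℚ.½) e)
    where
    undo : ∀ y → (ℚ.½ ℚ.+ y) ℚ.- ℚ.½ ≡ y
    undo = solve 1 (λ y → (con ℚ.½ :+ y) :- con ℚ.½ := y) refl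
      where open +-*-Solver

  equal-others : ∀ {x y z} → x ℚ.+ y ≡ 1ℚ → z ℚ.+ y ≡ 1ℚ → x ≡ z
  equal-others {x} {y} {z} e f = trans (sym (undo x y)) (trans (cong (ℚ._- y) (trans e (sym f))) (undo z y))
    where
    undo : ∀ x y → (x ℚ.+ y) ℚ.- y ≡ x
    undo = solve 2 (λ x y → (x :+ y) :- y := x) refl
      where open +-*-Solver

  half-of : ∀ {x} → x ℚ.+ x ≡ 1ℚ → x ≡ ℚ.½
  half-of {x} e = trans (sym (undo x)) (cong (ℚ._* ℚ.½) e)
    where
    undo : ∀ x → (x ℚ.+ x) ℚ.* ℚ.½ ≡ x
    undo = solve 1 (λ x → (x :+ x) :* con ℚ.½ := x) refl
      where open +-*-Solver

  row : ∀ u → Y u (to₁ u) ℚ.+ Y u (to₂ u) ≡ 1ℚ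
  row u = row-two u (to₁ u) (to₂ u) (from-yes (all? λ u → onlyTwo? (halves u) (to₁ u) (to₂ u)) u)

  column : ∀ v a b → Dec (OnlyTwo (λ u → halves u v) a b)
  column v a b = onlyTwo? (λ u → halves u v) a b

  one : ∀ u v w z → Dec (OnlyOne (λ i → octagonAdj u i ∧ halves i v) w × OnlyOne (λ i → halves u i ∧ octagonAdj i v) z)
  one u v w z = onlyOne? (λ i → octagonAdj u i ∧ halves i v) w ×-dec onlyOne? (λ i → halves u i ∧ octagonAdj i v) z

  comm : ∀ u v w z → OnlyOne (λ i → octagonAdj u i ∧ halves i v) w × OnlyOne (λ i → halves u i ∧ octagonAdj i v) z → octagonAdj u w ≡ true → octagonAdj z v ≡ true → Y w v ≡ Y u z
  comm u v w z (a , b) = comm-one u v w z a b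

  y₈₈ : Y 8F 8F ≡ Y 0F 0F
  y₈₈ = comm 0F 8F 8F 0F (from-yes (one 0F 8F 8F 0F)) refl refl

  y₄₆ : Y 8F 8F ≡ Y 4F 6F
  y₄₆ = comm 4F 8F 8F 6F (from-yes (one 4F 8F 8F 6F)) refl refl

  y₇₄ : Y 7F 4F ≡ Y 0F 0F
  y₇₄ = comm 0F 4F 7F 0F (from-yes (one 0F 4F 7F 0F)) refl refl

  y₇₇ : Y 7F 7F ≡ Y 4F 6F
  y₇₇ = equal-others (trans (ℚₚ.+-comm (Y 7F 7F) (Y 4F 7F)) (col-two 7F 4F 7F (from-yes (column 7F 4F 7F)))) (row 4F)

  h₀₀ : Y 0F 0F ≡ ℚ.½
  -- The commutation equations lead from the entry at (0 , 0) to both entries of row 7, which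
  -- therefore are equal with sum 1.
  h₀₀ = half-of (trans (cong₂ ℚ._+_ (trans (sym y₈₈) (trans y₄₆ (sym y₇₇))) (sym y₇₄)) (row 7F))

  h₄₆ : Y 4F 6F ≡ ℚ.½
  h₄₆ = trans (sym y₄₆) (trans y₈₈ h₀₀)

  h₇₇ : Y 7F 7F ≡ ℚ.½
  h₇₇ = trans y₇₇ h₄₆

  h₆₄ : Y 6F 4F ≡ ℚ.½
  h₆₄ = other (col-two 4F 7F 6F (from-yes (column 4F 7F 6F))) (other (row 7F) h₇₇)

  h-to₁-1 : Y 1F (to₁ 1F) ≡ ℚ.½
  h-to₁-1 = other (col-two 3F 0F 1F (from-yes (column 3F 0F 1F))) (other (row 0F) h₀₀)

  h-to₁-2 : Y 2F (to₁ 2F) ≡ ℚ.½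
  h-to₁-2 = other (col-two 2F 1F 2F (from-yes (column 2F 1F 2F))) (other (row 1F) h-to₁-1)

  first-half : ∀ u → Y u (to₁ u) ≡ ℚ.½
  first-half 0F = h₀₀
  first-half 1F = h-to₁-1
  first-half 2F = h-to₁-2
  first-half 3F = other (col-two 1F 2F 3F (from-yes (column 1F 2F 3F))) (other (row 2F) h-to₁-2)
  first-half 4F = h₄₆
  first-half 5F = other (col-two 5F 6F 5F (from-yes (column 5F 6F 5F))) (other (row 6F) h₆₄)
  first-half 6F = h₆₄
  first-half 7F = h₇₇
  first-half 8F = trans y₈₈ h₀₀
  first-half 9F = other (col-two 9F 8F 9F (from-yes (column 9F 8F 9F))) (other (row 8F) (trans y₈₈ h₀₀))

  unique : ∀ u v → Y u v ≡ halfMatrix u v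
  unique u v with bool-cases (halves u v)
  ... | inj₂ f = trans (YE u v f) (sym (trans (cong (λ b → ⟦ b ⟧ ℚ.* ℚ.½) f) (ℚₚ.*-zeroˡ ℚ.½)))
  ... | inj₁ t = trans (entry (∨-true {same v (to₁ u)} t)) (sym (trans (cong (λ b → ⟦ b ⟧ ℚ.* ℚ.½) t) (ℚₚ.*-identityˡ ℚ.½)))
    where
    entry : same v (to₁ u) ≡ true ⊎ same v (to₂ u) ≡ true → Y u v ≡ ℚ.½
    entry (inj₁ h) = trans (cong (Y u) (same-elim h)) (first-half u)
    entry (inj₂ h) = trans (cong (Y u) (same-elim h)) (other (row u) (first-half u))

halfMatrix-extreme : IsExtremePoint octagon halfMatrix
halfMatrix-extreme = halfMatrix-poly , λ Y Z t PY PZ t>0 t<1 eq u v →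
  let (YX , ZX) = convex-support octagon {halfMatrix} PY PZ t>0 t<1 eq
  in trans (HalfUnique.unique PY (inside YX) u v) (sym (HalfUnique.unique PZ (inside ZX) u v))
  where
  inside : ∀ {Y} → Y ⊑ halfMatrix → ∀ u v → halves u v ≡ false → Y u v ≡ 0ℚ
  inside {Y} h u v f = dne (Y u v ℚₚ.≟ 0ℚ) λ ne → h u v ne (trans (cong (λ b → ⟦ b ⟧ ℚ.* ℚ.½) f) (ℚₚ.*-zeroˡ ℚ.½))

octagon-not-compact : ¬ Compact octagon
octagon-not-compact comp = let (π , _ , e) = comp halfMatrix halfMatrix-extreme in not-bit (does (π 0F ≟ 0F)) (e 0F 0F)
  where
  not-bit : ∀ b → halfMatrix 0F 0F ≢ ⟦ b ⟧
  not-bit true  ()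
  not-bit false ()

theorem3 : (Discrete ⊊ Amenable) × (Amenable ⊊ Compact) × (Compact ⊊ Godsil) × (Godsil ⊊ Tinhofer) × (Tinhofer ⊊ Refinable)
theorem3 = (discrete⊆amenable , edgeless , edgeless-amenable , edgeless-not-discrete)
         , (amenable⊆compact , triangles , triangles-compact , triangles-not-amenable)
         , (compact⊆godsil , octagon , octagon-godsil , octagon-not-compact)
         , (godsil⊆tinhofer , coupled , coupled-tinhofer , coupled-not-godsil)
         , (tinhofer⊆refinable , coupled⁺ , coupled⁺-refinable , coupled⁺-not-tinhofer)
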